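{- For each integer $n\geq 7$ there exists a finite connected tetravalent basic half-arc-transitive graph $\Gamma$ with $\mathrm{Aut}(\Gamma)\cong A_{2^n}\wr \mathbb{Z}_2$ and vertex-stabilizers isomorphic to $(D_8^2\times\mathbb{Z}_2^{n-6})^2$.
   Context: $D_8$ is the dihedral group of order 8, $A_k$ the alternating group of degree $k$, $\wr$ the wreath product. A graph $\Gamma$ is $G$-half-arc-transitive ($G\leq\mathrm{Aut}(\Gamma)$) if $G$ is transitive on vertices and edges but not on arcs; half-arc-transitive means $\mathrm{Aut}(\Gamma)$-half-arc-transitive. For $N\trianglelefteq G$ intransitive on $V(\Gamma)$, the normal quotient $\Gamma_N$ has as vertices the $N$-orbits, two distinct orbits adjacent iff some edge of $\Gamma$ joins them (if $N$ is transitive, $\Gamma_N$ is a single vertex, valency 0). A connected tetravalent $G$-half-arc-transitive graph is basic (for $G$) if $\Gamma_N$ has valency at most 2 for every non-trivial normal subgroup $N$ of $G$; a basic half-arc-transitive graph means basic for $G=\mathrm{Aut}(\Gamma)$. -}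

module Defs where

open import Level using (0ℓ)
open import Algebra.Bundles using (Group)
open import Algebra.Morphism.Structures using (module GroupMorphisms)
import Algebra.Construct.DirectProduct as DirectProduct
import Algebra.Construct.Pointwise as Pointwise
import Algebra.Properties.Group as GroupProperties
open import Data.Fin.Base using (Fin)
open import Data.Fin.Permutation as Perm using (Permutation′; transpose; _∘ₚ_; _⟨$⟩ʳ_)
open import Data.Fin.Permutation.Transposition.List using (TranspositionList; eval)
import Data.Integer.Base as ℤ
import Data.Integer.Properties as ℤₚ
open import Data.Integer.Divisibility.Signed as ℤ∣ using ()
open import Data.Integer.Tactic.RingSolver using (solve-∀)
open import Data.List.Base using ([]; _∷_; _++_; length)
open import Data.List.Properties using (length-++)
open import Data.List.Relation.Unary.All using (All; []; _∷_)
open import Data.List.Relation.Unary.All.Properties using (++⁺)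
open import Data.Nat.Base using (ℕ; suc)
open import Data.Nat.Properties using (+-comm)
open import Data.Nat.Divisibility using (_∣_; _∣0; ∣m∣n⇒∣m+n)
open import Data.Parity.Base using (0ℙ; 1ℙ)
import Data.Parity.Properties as Parity
open import Data.Product.Base using (Σ; ∃; ∃₂; _×_; _,_; proj₁; proj₂; swap)
open import Data.Sum.Base using (_⊎_)
open import Data.Unit.Base using (⊤; tt)
open import Function.Base using (_∘_)
open import Function.Bundles using (Inverse; Injection)
import Function.Construct.Composition as Composition
import Function.Construct.Identity as Identity
import Function.Construct.Symmetry as Symmetry
open import Relation.Binary.Bundles using (Setoid)
open import Relation.Binary.Core using (Rel)
import Relation.Binary.Construct.On as On
open import Relation.Binary.Construct.Closure.ReflexiveTransitive using (Star)
open import Relation.Binary.PropositionalEquality as ≡ using (_≡_; _≢_)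
import Relation.Binary.Reasoning.Setoid as SetoidReasoning
open import Relation.Nullary.Negation using (¬_)

Grp : Set₁
Grp = Group 0ℓ 0ℓ

infix 4 _≅_

_≅_ : Grp → Grp → Set
G ≅ H = ∃ IsGroupIsomorphism
  where open GroupMorphisms (Group.rawGroup G) (Group.rawGroup H)

record Subgroup (G : Grp) : Set₁ where
  open Group G
  infix 4 _∈
  field
    _∈        : Carrier → Set
    ∈-resp-≈  : ∀ {x y} → x ≈ y → x ∈ → y ∈
    ∙-closed  : ∀ {x y} → x ∈ → y ∈ → (x ∙ y) ∈
    ε-closed  : ε ∈
    ⁻¹-closed : ∀ {x} → x ∈ → (x ⁻¹) ∈

infix 4 _∈_

_∈_ : {G : Grp} → Group.Carrier G → Subgroup G → Set
x ∈ H = Subgroup._∈ H x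

⟦_⟧ : {G : Grp} → Subgroup G → Grp
⟦_⟧ {G} H = record
  { Carrier = Σ Carrier (_∈ H)
  ; _≈_     = λ x y → proj₁ x ≈ proj₁ y
  ; _∙_     = λ (x , p) (y , q) → x ∙ y , ∙-closed p q
  ; ε       = ε , ε-closed
  ; _⁻¹     = λ (x , p) → x ⁻¹ , ⁻¹-closed p
  ; isGroup = record
    { isMonoid = record
      { isSemigroup = record
        { isMagma = record
          { isEquivalence = On.isEquivalence proj₁ isEquivalence
          ; ∙-cong        = ∙-cong
          }
        ; assoc = λ x y z → assoc (proj₁ x) (proj₁ y) (proj₁ z)
        }
      ; identity = (identityˡ ∘ proj₁) , (identityʳ ∘ proj₁)
      }
    ; inverse = (inverseˡ ∘ proj₁) , (inverseʳ ∘ proj₁)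
    ; ⁻¹-cong = ⁻¹-cong
    }
  }
  where
  open Group G
  open Subgroup H using (∙-closed; ε-closed; ⁻¹-closed)

whole : (G : Grp) → Subgroup G
whole G = record
  { _∈        = λ _ → ⊤
  ; ∈-resp-≈  = λ _ _ → tt
  ; ∙-closed  = λ _ _ → tt
  ; ε-closed  = tt
  ; ⁻¹-closed = λ _ → tt
  }

infix 4 _⊴_

_⊴_ : {G : Grp} → Subgroup G → Subgroup G → Set
_⊴_ {G} N H = (∀ x → x ∈ N → x ∈ H)
            × (∀ h x → h ∈ H → x ∈ N → (h ∙ x ∙ h ⁻¹) ∈ N)
  where open Group G

Trivial : {G : Grp} → Subgroup G → Set
Trivial {G} N = ∀ x → x ∈ N → x ≈ ε
  where open Group G

infixr 6 _×ᴳ_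
infix 7 _^ᴳ_

_×ᴳ_ : Grp → Grp → Grp
_×ᴳ_ = DirectProduct.group

_^ᴳ_ : Grp → ℕ → Grp
G ^ᴳ k = Pointwise.group (Fin k) G

-- A homomorphism from H to the automorphism group of N, uncurried;
-- bijectivity of each `act h` follows from `act-∙` and `act-ε`.
record Action (H N : Grp) : Set where
  private
    module H = Group H
    module N = Group N
  field
    act      : H.Carrier → N.Carrier → N.Carrier
    act-cong : ∀ {h k x y} → h H.≈ k → x N.≈ y → act h x N.≈ act k y
    act-homo : ∀ h x y → act h (x N.∙ y) N.≈ act h x N.∙ act h y
    act-∙    : ∀ h k x → act (h H.∙ k) x N.≈ act h (act k x)
    act-ε    : ∀ x → act H.ε x N.≈ x

semidirect : (N H : Grp) → Action H N → Grp
semidirect N H φ = record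
  { Carrier = N.Carrier × H.Carrier
  ; _≈_     = λ (x , h) (y , k) → x N.≈ y × h H.≈ k
  ; _∙_     = λ (x , h) (y , k) → x N.∙ act h y , h H.∙ k
  ; ε       = N.ε , H.ε
  ; _⁻¹     = λ (x , h) → act (h H.⁻¹) (x N.⁻¹) , h H.⁻¹
  ; isGroup = record
    { isMonoid = record
      { isSemigroup = record
        { isMagma = record
          { isEquivalence = record
            { refl  = N.refl , H.refl
            ; sym   = λ (p , q) → N.sym p , H.sym q
            ; trans = λ (p , q) (r , s) → N.trans p r , H.trans q s
            }
          ; ∙-cong = λ (p , q) (r , s) → N.∙-cong p (act-cong q r) , H.∙-cong q s
          }
        ; assoc = λ (x , h) (y , k) (z , l) →
            (begin
              (x N.∙ act h y) N.∙ act (h H.∙ k) z   ≈⟨ N.∙-congˡ (act-∙ h k z) ⟩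
              (x N.∙ act h y) N.∙ act h (act k z)   ≈⟨ N.assoc _ _ _ ⟩
              x N.∙ (act h y N.∙ act h (act k z))   ≈⟨ N.∙-congˡ (act-homo h y (act k z)) ⟨
              x N.∙ act h (y N.∙ act k z)           ∎)
            , H.assoc h k l
        }
      ; identity
          = (λ (x , h) → N.trans (N.identityˡ _) (act-ε x) , H.identityˡ h)
          , (λ (x , h) → N.trans (N.∙-congˡ (act-1 h)) (N.identityʳ x) , H.identityʳ h)
      }
    ; inverse
        = (λ (x , h) →
            (begin
              act (h H.⁻¹) (x N.⁻¹) N.∙ act (h H.⁻¹) x  ≈⟨ act-homo _ _ _ ⟨
              act (h H.⁻¹) (x N.⁻¹ N.∙ x)               ≈⟨ act-cong H.refl (N.inverseˡ x) ⟩
              act (h H.⁻¹) N.ε                          ≈⟨ act-1 _ ⟩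
              N.ε                                       ∎)
            , H.inverseˡ h)
        , (λ (x , h) →
            (begin
              x N.∙ act h (act (h H.⁻¹) (x N.⁻¹))   ≈⟨ N.∙-congˡ (act-∙ _ _ _) ⟨
              x N.∙ act (h H.∙ h H.⁻¹) (x N.⁻¹)     ≈⟨ N.∙-congˡ (act-cong (H.inverseʳ h) N.refl) ⟩
              x N.∙ act H.ε (x N.⁻¹)                ≈⟨ N.∙-congˡ (act-ε _) ⟩
              x N.∙ x N.⁻¹                          ≈⟨ N.inverseʳ x ⟩
              N.ε                                   ∎)
            , H.inverseʳ h)
    ; ⁻¹-cong = λ (p , q) → act-cong (H.⁻¹-cong q) (N.⁻¹-cong p) , H.⁻¹-cong q
    }
  }
  where
  module N = Group N
  module H = Group H
  open Action φ
  open SetoidReasoning N.setoid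

  act-1 : ∀ h → act h N.ε N.≈ N.ε
  act-1 h = GroupProperties.identityˡ-unique N (act h N.ε) (act h N.ε)
    (N.trans (N.sym (act-homo h N.ε N.ε)) (act-cong H.refl (N.identityˡ N.ε)))

ℤ₂ : Grp
ℤ₂ = Parity.+-0-group

-- Integers modulo m, as the setoid quotient of ℤ by congruence.
ℤmod : ℕ → Grp
ℤmod m = record
  { Carrier = ℤ.ℤ
  ; _≈_     = _≈_
  ; _∙_     = ℤ._+_
  ; ε       = ℤ.0ℤ
  ; _⁻¹     = ℤ.-_
  ; isGroup = record
    { isMonoid = record
      { isSemigroup = record
        { isMagma = record
          { isEquivalence = record
            { refl  = λ {i} → reflexive {i} ≡.refl
            ; sym   = λ {i} {j} p →
                ≡.subst (ℤ.+ m ℤ∣.∣_) (neg i j) (ℤ∣.∣m⇒∣-m p)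
            ; trans = λ {i} {j} {k} p q →
                ≡.subst (ℤ.+ m ℤ∣.∣_) (tele i j k) (ℤ∣.∣m∣n⇒∣m+n p q)
            }
          ; ∙-cong = λ {i} {j} {k} {l} p q →
              ≡.subst (ℤ.+ m ℤ∣.∣_) (add i j k l) (ℤ∣.∣m∣n⇒∣m+n p q)
          }
        ; assoc = λ i j k → reflexive (ℤₚ.+-assoc i j k)
        }
      ; identity = (λ i → reflexive (ℤₚ.+-identityˡ i))
                 , (λ i → reflexive (ℤₚ.+-identityʳ i))
      }
    ; inverse = (λ i → reflexive (ℤₚ.+-inverseˡ i))
              , (λ i → reflexive (ℤₚ.+-inverseʳ i))
    ; ⁻¹-cong = λ {i} {j} p →
        ≡.subst (ℤ.+ m ℤ∣.∣_) (neg′ i j) (ℤ∣.∣m⇒∣-m p)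
    }
  }
  where
  _≈_ : Rel ℤ.ℤ 0ℓ
  i ≈ j = ℤ.+ m ℤ∣.∣ (i ℤ.- j)

  reflexive : ∀ {i j} → i ≡ j → i ≈ j
  reflexive {i} ≡.refl = ℤ∣.divides ℤ.0ℤ (ℤₚ.+-inverseʳ i)

  neg : ∀ i j → ℤ.- (i ℤ.- j) ≡ j ℤ.- i
  neg = solve-∀

  neg′ : ∀ i j → ℤ.- (i ℤ.- j) ≡ (ℤ.- i) ℤ.- (ℤ.- j)
  neg′ = solve-∀

  tele : ∀ i j k → (i ℤ.- j) ℤ.+ (j ℤ.- k) ≡ i ℤ.- k
  tele = solve-∀

  add : ∀ i j k l → (i ℤ.- j) ℤ.+ (k ℤ.- l) ≡ (i ℤ.+ k) ℤ.- (j ℤ.+ l)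
  add = solve-∀

inversion : ∀ m → Action ℤ₂ (ℤmod m)
inversion m = record
  { act      = act
  ; act-cong = λ { {0ℙ} ≡.refl p → p ; {1ℙ} {x = i} {j} ≡.refl p → ⁻¹-cong {i} {j} p }
  ; act-homo = λ { 0ℙ i j → refl {i ℤ.+ j}
                 ; 1ℙ i j → reflexive (ℤₚ.neg-distrib-+ i j) }
  ; act-∙    = λ { 0ℙ k i → refl {act k i}
                 ; 1ℙ 0ℙ i → refl {ℤ.- i}
                 ; 1ℙ 1ℙ i → reflexive (≡.sym (ℤₚ.neg-involutive i)) }
  ; act-ε    = λ i → refl {i}
  }
  where
  open Group (ℤmod m)
  act : Group.Carrier ℤ₂ → ℤ.ℤ → ℤ.ℤ
  act 0ℙ i = i
  act 1ℙ i = ℤ.- i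

-- The dihedral group of order 2m.
dihedral : ℕ → Grp
dihedral m = semidirect (ℤmod m) ℤ₂ (inversion m)

D₈ : Grp
D₈ = dihedral 4

swapping : (G : Grp) → Action ℤ₂ (G ×ᴳ G)
swapping G = record
  { act      = act
  ; act-cong = λ { {0ℙ} ≡.refl p → p ; {1ℙ} ≡.refl p → swap p }
  ; act-homo = λ { 0ℙ _ _ → refl ; 1ℙ _ _ → refl }
  ; act-∙    = λ { 0ℙ _ _ → refl ; 1ℙ 0ℙ _ → refl ; 1ℙ 1ℙ _ → refl }
  ; act-ε    = λ _ → refl
  }
  where
  open Group (G ×ᴳ G)
  act : Group.Carrier ℤ₂ → Carrier → Carrier
  act 0ℙ x = x
  act 1ℙ x = swap x

_≀ℤ₂ : Grp → Grp
G ≀ℤ₂ = semidirect (G ×ᴳ G) ℤ₂ (swapping G)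

Sym : Setoid 0ℓ 0ℓ → Grp
Sym S = record
  { Carrier = Inverse S S
  ; _≈_     = λ f g → ∀ x → to f x ≈ to g x
  ; _∙_     = λ f g → Composition.inverse g f
  ; ε       = Identity.inverse S
  ; _⁻¹     = Symmetry.inverse
  ; isGroup = record
    { isMonoid = record
      { isSemigroup = record
        { isMagma = record
          { isEquivalence = record
            { refl  = λ _ → refl
            ; sym   = λ p x → sym (p x)
            ; trans = λ p q x → trans (p x) (q x)
            }
          ; ∙-cong = λ {f} {_} {_} {k} p q x → trans (to-cong f (q x)) (p (to k x))
          }
        ; assoc = λ _ _ _ _ → refl
        }
      ; identity = (λ _ _ → refl) , (λ _ _ → refl)
      }
    ; inverse = (λ f _ → inverseʳ f refl) , (λ f _ → inverseˡ f refl)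
    ; ⁻¹-cong = λ {f} {g} p x →
        inverseʳ f (trans (sym (inverseˡ g refl)) (sym (p (from g x))))
    }
  }
  where
  open Setoid S
  open Inverse using (to; from; to-cong; inverseˡ; inverseʳ)

-- A product of an even number of transpositions. The condition i ≢ j is
-- needed because `transpose i i` is the identity.
Even : ∀ {k} → Permutation′ k → Set
Even {k} π = ∃ λ (ts : TranspositionList k) →
  All (λ (i , j) → i ≢ j) ts × 2 ∣ length ts × eval ts Perm.≈ π

eval-++ : ∀ {k} (ss ts : TranspositionList k) →
          eval (ss ++ ts) Perm.≈ eval ss ∘ₚ eval ts
eval-++ []             ts x = ≡.refl
eval-++ ((i , j) ∷ ss) ts x = eval-++ ss ts (transpose i j ⟨$⟩ʳ x)

inv : ∀ {k} → TranspositionList k → TranspositionList k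
inv []             = []
inv ((i , j) ∷ ts) = inv ts ++ (j , i) ∷ []

inv-distinct : ∀ {k} {ts : TranspositionList k} →
               All (λ (i , j) → i ≢ j) ts → All (λ (i , j) → i ≢ j) (inv ts)
inv-distinct []       = []
inv-distinct (p ∷ ps) = ++⁺ (inv-distinct ps) (p ∘ ≡.sym ∷ [])

inv-length : ∀ {k} (ts : TranspositionList k) → length ts ≡ length (inv ts)
inv-length []             = ≡.refl
inv-length ((i , j) ∷ ts) = ≡.trans (≡.cong suc (inv-length ts))
  (≡.trans (+-comm 1 (length (inv ts))) (≡.sym (length-++ (inv ts))))

eval-inv : ∀ {k} (ts : TranspositionList k) → eval (inv ts) Perm.≈ Perm.flip (eval ts)
eval-inv []             x = ≡.refl
eval-inv ((i , j) ∷ ts) x = ≡.trans (eval-++ (inv ts) ((j , i) ∷ []) x)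
  (≡.cong (transpose j i ⟨$⟩ʳ_) (eval-inv ts x))

Alternating : (k : ℕ) → Subgroup (Sym (≡.setoid (Fin k)))
Alternating k = record
  { _∈        = Even
  ; ∈-resp-≈  = λ π≈ρ (ts , d , e , p) → ts , d , e , λ x → ≡.trans (p x) (π≈ρ x)
  ; ∙-closed  = λ {π} {ρ} (ss , d , e , p) (ts , d′ , e′ , p′) →
      ts ++ ss , ++⁺ d′ d
      , ≡.subst (2 ∣_) (≡.sym (length-++ ts)) (∣m∣n⇒∣m+n e′ e)
      , λ x → ≡.trans (eval-++ ts ss x)
                (≡.trans (≡.cong (eval ss ⟨$⟩ʳ_) (p′ x)) (p (ρ ⟨$⟩ʳ x)))
  ; ε-closed  = [] , [] , (2 ∣0) , λ _ → ≡.refl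
  ; ⁻¹-closed = λ {π} (ts , d , e , p) →
      inv ts , inv-distinct d , ≡.subst (2 ∣_) (inv-length ts) e
      , λ x → ≡.trans (eval-inv ts x)
                (Group.⁻¹-cong (Sym (≡.setoid (Fin k))) {eval ts} {π} p x)
  }

Alt : ℕ → Grp
Alt k = ⟦ Alternating k ⟧

-- Vertices form a setoid, so that normal quotients are again graphs.
record Graph : Set₁ where
  infix 4 _~_
  field
    V : Setoid 0ℓ 0ℓ
  open Setoid V public using (_≈_)
    renaming (Carrier to Vertex; refl to ≈-refl; sym to ≈-sym; trans to ≈-trans)
  field
    _~_      : Rel Vertex 0ℓ
    ~-resp-≈ : ∀ {u u′ v v′} → u ≈ u′ → v ≈ v′ → u ~ v → u′ ~ v′
    ~-sym    : ∀ {u v} → u ~ v → v ~ u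
    ~-irrefl : ∀ {u v} → u ≈ v → ¬ u ~ v

  neighbours : Vertex → Setoid 0ℓ 0ℓ
  neighbours v = On.setoid {B = ∃ (v ~_)} V proj₁

Finite : Graph → Set
Finite Γ = ∃ λ m → Inverse (≡.setoid (Fin m)) (Graph.V Γ)

Connected : Graph → Set
Connected Γ = ∀ u v → Star (λ x y → x ≈ y ⊎ x ~ y) u v
  where open Graph Γ

HasValency : Graph → ℕ → Set
HasValency Γ k = ∀ v → Inverse (≡.setoid (Fin k)) (Graph.neighbours Γ v)

Tetravalent : Graph → Set
Tetravalent Γ = HasValency Γ 4

-- Phrased negatively because vertex equality in a normal quotient need
-- not be decidable.
ValencyAtMost : Graph → ℕ → Set
ValencyAtMost Γ k = ∀ v → ¬ Injection (≡.setoid (Fin (suc k))) (Graph.neighbours Γ v)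

Automorphisms : (Γ : Graph) → Subgroup (Sym (Graph.V Γ))
Automorphisms Γ = record
  { _∈        = λ f → ∀ u v → (u ~ v → to f u ~ to f v) × (to f u ~ to f v → u ~ v)
  ; ∈-resp-≈  = λ f≈g p u v →
        ~-resp-≈ (f≈g u) (f≈g v) ∘ proj₁ (p u v)
      , proj₂ (p u v) ∘ ~-resp-≈ (≈-sym (f≈g u)) (≈-sym (f≈g v))
  ; ∙-closed  = λ {f} {g} p q u v →
        proj₁ (p (to g u) (to g v)) ∘ proj₁ (q u v)
      , proj₂ (q u v) ∘ proj₂ (p (to g u) (to g v))
  ; ε-closed  = λ _ _ → (λ e → e) , (λ e → e)
  ; ⁻¹-closed = λ {f} p u v →
        proj₂ (p (from f u) (from f v))
          ∘ ~-resp-≈ (≈-sym (inverseˡ f ≈-refl)) (≈-sym (inverseˡ f ≈-refl))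
      , ~-resp-≈ (inverseˡ f ≈-refl) (inverseˡ f ≈-refl)
          ∘ proj₁ (p (from f u) (from f v))
  }
  where
  open Graph Γ
  open Inverse using (to; from; inverseˡ)

Aut : Graph → Grp
Aut Γ = ⟦ Automorphisms Γ ⟧

module _ (Γ : Graph) where
  open Graph Γ

  infixr 8 _·_

  _·_ : Group.Carrier (Aut Γ) → Vertex → Vertex
  g · v = Inverse.to (proj₁ g) v

  ·-cong : ∀ g {u v} → u ≈ v → g · u ≈ g · v
  ·-cong g = Inverse.to-cong (proj₁ g)

  ⁻¹-· : ∀ g {u v} → g · u ≈ v → Group._⁻¹ (Aut Γ) g · v ≈ u
  ⁻¹-· g p = Inverse.inverseʳ (proj₁ g) (≈-sym p)

  Stabilizer : Vertex → Subgroup (Aut Γ)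
  Stabilizer v = record
    { _∈        = λ g → g · v ≈ v
    ; ∈-resp-≈  = λ g≈h p → ≈-trans (≈-sym (g≈h v)) p
    ; ∙-closed  = λ {g} {h} p q → ≈-trans (·-cong g q) p
    ; ε-closed  = ≈-refl
    ; ⁻¹-closed = λ {g} → ⁻¹-· g
    }

  module _ (G : Subgroup (Aut Γ)) where

    VertexTransitive : Set
    VertexTransitive = ∀ u v → ∃ λ g → g ∈ G × g · u ≈ v

    EdgeTransitive : Set
    EdgeTransitive = ∀ {u v x y} → u ~ v → x ~ y →
      ∃ λ g → g ∈ G × ((g · u ≈ x × g · v ≈ y) ⊎ (g · u ≈ y × g · v ≈ x))

    ArcTransitive : Set
    ArcTransitive = ∀ {u v x y} → u ~ v → x ~ y →
      ∃ λ g → g ∈ G × (g · u ≈ x × g · v ≈ y)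

    HalfArcTransitiveFor : Set
    HalfArcTransitiveFor = VertexTransitive × EdgeTransitive × ¬ ArcTransitive

  orbits : Subgroup (Aut Γ) → Setoid 0ℓ 0ℓ
  orbits N = record
    { Carrier = Vertex
    ; _≈_     = λ u v → ∃ λ g → g ∈ N × g · u ≈ v
    ; isEquivalence = record
      { refl  = Group.ε (Aut Γ) , ε-closed , ≈-refl
      ; sym   = λ (g , g∈N , p) → Group._⁻¹ (Aut Γ) g , ⁻¹-closed g∈N , ⁻¹-· g p
      ; trans = λ (g , g∈N , p) (h , h∈N , q) →
          Group._∙_ (Aut Γ) h g , ∙-closed h∈N g∈N , ≈-trans (·-cong h p) q
      }
    }
    where open Subgroup N

  normalQuotient : Subgroup (Aut Γ) → Graph
  normalQuotient N = record
    { V        = orbits N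
    ; _~_      = λ u v → ¬ (u O.≈ v) × ∃₂ λ u′ v′ → u O.≈ u′ × v O.≈ v′ × u′ ~ v′
    ; ~-resp-≈ = λ p q (u≉v , u′ , v′ , r , s , e) →
          (λ t → u≉v (O.trans p (O.trans t (O.sym q))))
        , u′ , v′ , O.trans (O.sym p) r , O.trans (O.sym q) s , e
    ; ~-sym    = λ (u≉v , u′ , v′ , r , s , e) →
          (λ t → u≉v (O.sym t)) , v′ , u′ , s , r , ~-sym e
    ; ~-irrefl = λ p (u≉v , _) → u≉v p
    }
    where module O = Setoid (orbits N)

  -- If N is transitive the quotient has one vertex and no edges, so the
  -- valency condition then holds automatically.
  BasicFor : Subgroup (Aut Γ) → Set₁
  BasicFor G = ∀ (N : Subgroup (Aut Γ)) → N ⊴ G → ¬ Trivial N →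
    ValencyAtMost (normalQuotient N) 2

HalfArcTransitive : Graph → Set
HalfArcTransitive Γ = HalfArcTransitiveFor Γ (whole (Aut Γ))

Basic : Graph → Set₁
Basic Γ = BasicFor Γ (whole (Aut Γ))

{-# OPTIONS --safe #-}
-- Put m = n − 2 and Q = 2ⁿ.  The wreath product X = A_Q ≀ ℤ₂ acts on the 2Q positions of
-- two cycles of length Q, with the two parities of positions as colour classes.  Let x
-- advance both cycles by one step, let b be a certain product of eight transpositions, and
-- let bᵢ = xⁱ b x⁻ⁱ.  Among b₀, …, b_{2m+3} the only relations besides commutation and bᵢ² = 1
-- are [bᵢ , bᵢ₊₂ₘ] = bᵢ₊ₘ, so that they generate a group K ≅ (D₈² × ℤ₂ⁿ⁻⁶)².  The vertices of
-- Γ are the cosets uK, with arcs from uK to u x K and u b x K.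
--
-- * Suitable commutators [b₀ , bₗ] are 3-cycles; they show that b and x generate X.
-- * All 4-cycles of Γ are alternating, so an automorphism preserves or reverses all arcs.
-- * A product of bᵢ^eᵢ over a full period i < Q is trivial only for e = 0.  Therefore the
--   closed directed walks of length Q are the translates of (xⁱ K)ᵢ, one for each g ∈ X, and
--   an automorphism preserving arcs induces a map X → X that commutes with right
--   multiplication by b and x, that is, a left translation.
-- * Reversal of arcs would carry a relation of b and x that holds to one that fails.
-- * By the usual commutator trick a nontrivial normal subgroup of X contains a 3-cycle, hence
--   A_Q × A_Q, and has at most two orbits on vertices.
module Submission where

open import Defs
open import Algebra.Bundles using (Group)
open import Algebra.Morphism.Structures using (module GroupMorphisms)
import Algebra.Properties.Group as GroupProperties
open import Data.Bool.Base using (Bool; true; false; not; if_then_else_; _∧_; _∨_; T)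
open import Data.Bool.Properties using (T-∧)
open import Data.Empty using (⊥; ⊥-elim)
open import Data.Fin.Base using (Fin; zero; suc; toℕ; combine; remQuot; funToFin; finToFun)
open import Data.Fin.Patterns using (0F; 1F; 2F; 3F)
open import Data.Fin.Permutation using (_⟨$⟩ʳ_; Permutation′; permutation)
import Data.Fin.Permutation.Components as PC
open import Data.Fin.Permutation.Transposition.List using (TranspositionList; eval; decompose; eval-decompose)
import Data.Fin.Properties as Fin
import Data.Integer.Base as ℤ
import Data.Integer.DivMod as ℤ
open import Data.Integer.Divisibility.Signed as ℤ∣ using ()
import Data.Integer.Properties as ℤ
open import Data.List.Base using (List; []; _∷_; _++_; length; take; drop; map; concatMap)
open import Data.List.Membership.Propositional as List using ()
open import Data.List.Properties as List using (length-map; length-++)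
open import Data.List.Relation.Unary.All as All using (All; []; _∷_; all?)
import Data.List.Relation.Unary.All.Properties as All
open import Data.List.Relation.Unary.Any as Any using (here; there; index; Any)
import Data.List.Relation.Unary.Any.Properties as Any
open import Data.Maybe.Base using (Maybe; just; nothing; _>>=_)
open import Data.Nat.Base using (ℕ; suc; zero; _+_; _∸_; _≤_; _<_; z≤n; s≤s; _*_; _^_; _<ᵇ_; _≤ᵇ_; _≡ᵇ_; >-nonZero; parity; ⌊_/2⌋; NonZero; >-nonZero⁻¹; _≥_)
open import Data.Nat.DivMod using (_%_; _mod_; m%n<n; m<n⇒m%n≡m; %-distribˡ-+; m%n%n≡m%n; [m+n]%n≡m%n)
open import Data.Nat.Divisibility using (_∣_; ∣m+n∣m⇒∣n; ∣-refl; ∣1⇒≡1; divides)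
open import Data.Nat.Induction using (<-wellFounded)
import Data.Nat.Properties as ℕ
open import Data.Nat.Solver using (module +-*-Solver)
open import Data.Parity.Base as ℙ using (Parity; 0ℙ; 1ℙ)
import Data.Parity.Properties as ℙ
open import Data.Product.Base using (_×_; _,_; ∃; proj₁; proj₂)
import Data.Product.Properties as Product
open import Data.Sum.Base using (_⊎_; inj₁; inj₂; swap)
open import Data.Unit.Base using (tt; ⊤)
open import Data.Vec.Base using (Vec; lookup; []; _∷_)
open import Function.Base using (_∘_)
open import Function.Bundles using (Inverse; Injection; Equivalence)
open import Induction.WellFounded using (Acc; acc)
open import Level using (0ℓ)
open import Relation.Binary.Bundles using (Setoid)
open import Relation.Binary.Construct.Closure.ReflexiveTransitive using (Star; _◅_; _◅◅_) renaming (ε to ∎★)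
open import Relation.Binary.Definitions using (Decidable; tri<; tri≈; tri>; DecidableEquality)
open import Relation.Binary.PropositionalEquality as ≡ using (_≡_; refl; _≢_)
import Relation.Binary.Reasoning.Setoid as SetoidReasoning
open import Relation.Nullary.Decidable using (dec-true; dec-false; ¬?)
open import Relation.Nullary.Decidable.Core using (yes; no; Dec; from-yes; map′; _×-dec_; does; decidable-stable)
open import Relation.Nullary.Negation using (¬_)

-- Two cycles, because of parity: if x were one cycle of length 2Q, its square would be a Q-cycle on
-- each colour class and so odd; with two cycles it is a pair of cycles of length Q/2 there.
--
-- The first half of `table` alone yields the dihedral relation, but it is invariant under p ↦ 5m -
-- p on cycle 1 together with p ↦ m - p on cycle 0. This reflection inverts x, so arcs could be
-- reversed. The second half repeats the pattern with the roles of cycles 1 and 0 both played by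
-- cycle 1, translated by 8m + 1 and 16m + 3. This breaks the reflection. Since 8m + 1 = 5m + (3m +
-- 1) and 16m + 3 = (13m + 1) + (3m + 2), the supports of b₃ₘ₊₁ and b₃ₘ₊₂ each meet that of b₀ in
-- one point, which produces the 3-cycles. The blocks starting at 0, 8m + 1 and 16m + 3 are
-- separated by gaps of more than 3m, hence more than 2m + 4, so no further pairs fail to commute.
--
-- All positions are linear forms r + k m with bounded k and r, compared by evaluation; that this is
-- valid for every m rests only on 5 ≤ m and 25m + 3 ≤ Q.

open +-*-Solver using (_:+_; _:*_; con; _:=_)

-- Equations between group words, decided by free reduction.
module GroupSolver (G : Grp) where
  open Group G hiding (refl)
  open GroupProperties G
  open SetoidReasoning setoid

  infixl 7 _⊙_
  infix 8 ⊖_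
  data Expr (k : ℕ) : Set where
    var  : Fin k → Expr k
    one  : Expr k
    _⊙_  : Expr k → Expr k → Expr k
    ⊖_   : Expr k → Expr k

  Word : ℕ → Set
  Word k = List (Fin k × Bool)

  push : ∀ {k} → Fin k → Bool → Word k → Word k
  push i s [] = (i , s) ∷ []
  push i s ((j , t) ∷ w) with i Fin.≟ j
  push i true  ((j , true)  ∷ w) | yes _ = (i , true) ∷ (j , true) ∷ w
  push i true  ((j , false) ∷ w) | yes _ = w
  push i false ((j , true)  ∷ w) | yes _ = w
  push i false ((j , false) ∷ w) | yes _ = (i , false) ∷ (j , false) ∷ w
  ... | no _ = (i , s) ∷ (j , t) ∷ w

  -- The Bool is the sign of the expression and the last argument an accumulated reduced word, so
  -- inverting flips the sign and reverses a product.
  reduce : ∀ {k} → Expr k → Bool → Word k → Word k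
  reduce (var i) s     w = push i s w
  reduce one     s     w = w
  reduce (e ⊙ f) true  w = reduce e true (reduce f true w)
  reduce (e ⊙ f) false w = reduce f false (reduce e false w)
  reduce (⊖ e) s     w = reduce e (not s) w

  module _ {k} (ρ : Vec Carrier k) where

    ⟪_⟫ : Expr k → Carrier
    ⟪ var i ⟫ = lookup ρ i
    ⟪ one ⟫   = ε
    ⟪ e ⊙ f ⟫ = ⟪ e ⟫ ∙ ⟪ f ⟫
    ⟪ ⊖ e ⟫ = ⟪ e ⟫ ⁻¹

    signed : Bool → Carrier → Carrier
    signed true  u = u
    signed false u = u ⁻¹

    word : Word k → Carrier
    word []            = ε
    word ((i , s) ∷ w) = signed s (lookup ρ i) ∙ word w

    push-correct : ∀ i s w → word (push i s w) ≈ signed s (lookup ρ i) ∙ word w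
    push-correct i s [] = Group.refl G
    push-correct i s ((j , t) ∷ w) with i Fin.≟ j
    push-correct i true  ((j , true)  ∷ w) | yes _    = Group.refl G
    push-correct i true  ((i , false) ∷ w) | yes refl = sym (\\-leftDividesˡ _ _)
    push-correct i false ((i , true)  ∷ w) | yes refl = sym (\\-leftDividesʳ _ _)
    push-correct i false ((j , false) ∷ w) | yes _    = Group.refl G
    ... | no _ = Group.refl G

    reduce-correct : ∀ e s w → word (reduce e s w) ≈ signed s ⟪ e ⟫ ∙ word w
    reduce-correct (var i) s w = push-correct i s w
    reduce-correct one true  w = sym (identityˡ _)
    reduce-correct one false w = sym (trans (∙-congʳ ε⁻¹≈ε) (identityˡ _))
    reduce-correct (e ⊙ f) true w = begin
      word (reduce e true (reduce f true w))  ≈⟨ reduce-correct e true _ ⟩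
      ⟪ e ⟫ ∙ word (reduce f true w)          ≈⟨ ∙-congˡ (reduce-correct f true w) ⟩
      ⟪ e ⟫ ∙ (⟪ f ⟫ ∙ word w)                ≈⟨ assoc _ _ _ ⟨
      ⟪ e ⟫ ∙ ⟪ f ⟫ ∙ word w                  ∎
    reduce-correct (e ⊙ f) false w = begin
      word (reduce f false (reduce e false w))  ≈⟨ reduce-correct f false _ ⟩
      ⟪ f ⟫ ⁻¹ ∙ word (reduce e false w)        ≈⟨ ∙-congˡ (reduce-correct e false w) ⟩
      ⟪ f ⟫ ⁻¹ ∙ (⟪ e ⟫ ⁻¹ ∙ word w)            ≈⟨ assoc _ _ _ ⟨
      ⟪ f ⟫ ⁻¹ ∙ ⟪ e ⟫ ⁻¹ ∙ word w              ≈⟨ ∙-congʳ (⁻¹-anti-homo-∙ _ _) ⟨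
      (⟪ e ⟫ ∙ ⟪ f ⟫) ⁻¹ ∙ word w               ∎
    reduce-correct (⊖ e) true  w = reduce-correct e false w
    reduce-correct (⊖ e) false w =
      trans (reduce-correct e true w) (∙-congʳ (sym (⁻¹-involutive _)))

    solve : ∀ e f → reduce e true [] ≡ reduce f true [] → ⟪ e ⟫ ≈ ⟪ f ⟫
    solve e f eq = begin
      ⟪ e ⟫                    ≈⟨ identityʳ _ ⟨
      ⟪ e ⟫ ∙ ε                ≈⟨ reduce-correct e true [] ⟨
      word (reduce e true [])  ≡⟨ ≡cong eq ⟩
      word (reduce f true [])  ≈⟨ reduce-correct f true [] ⟩
      ⟪ f ⟫ ∙ ε                ≈⟨ identityʳ _ ⟩
      ⟪ f ⟫                    ∎
      where
      ≡cong : ∀ {v w} → v ≡ w → word v ≡ word w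
      ≡cong refl = refl

  p₀ : ∀ {k} → Expr (suc k)
  p₀ = var zero
  p₁ : ∀ {k} → Expr (suc (suc k))
  p₁ = var (suc zero)
  p₂ : ∀ {k} → Expr (suc (suc (suc k)))
  p₂ = var (suc (suc zero))
  p₃ : ∀ {k} → Expr (suc (suc (suc (suc k))))
  p₃ = var (suc (suc (suc zero)))
  p₄ : ∀ {k} → Expr (suc (suc (suc (suc (suc k)))))
  p₄ = var (suc (suc (suc (suc zero))))
  p₅ : ∀ {k} → Expr (suc (suc (suc (suc (suc (suc k))))))
  p₅ = var (suc (suc (suc (suc (suc zero)))))

-- Shifts of an involution

module Shifts (X : Grp) (b x : Group.Carrier X) where
  open Group X

  bi : ℕ → Carrier
  bi zero    = b
  bi (suc i) = x ∙ bi i ∙ x ⁻¹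

  xp : ℕ → Carrier
  xp zero    = ε
  xp (suc i) = x ∙ xp i

  sweep : (ℕ → Bool) → ℕ → ℕ → Carrier
  sweep e i zero    = ε
  sweep e i (suc k) = (if e i then bi i else ε) ∙ sweep e (suc i) k

  -- Only right multiplication by b and x occurs, which is a step along the coset graph: induction
  -- on this type is induction along walks. Inverses come from the finite orders of b and x.
  data Generated : Carrier → Set where
    gen-ε : Generated ε
    gen-b : ∀ {u} → Generated u → Generated (u ∙ b)
    gen-x : ∀ {u} → Generated u → Generated (u ∙ x)
    gen-≈ : ∀ {u v} → u ≈ v → Generated u → Generated v

-- The properties of the pair (b , x) from which everything about the coset
-- graph is derived; bᵢ stands for xⁱ b x⁻ⁱ.
record Config (X : Grp) : Set₁ where
  open Group X using (Carrier; _≈_; _∙_; ε; _⁻¹)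
  infixr 8 _▸_
  field
    Token      : Set
    _▸_    : Carrier → Token → Token
    ▸-cong : ∀ {u v} → u ≈ v → ∀ t → u ▸ t ≡ v ▸ t
    ▸-∙    : ∀ u v t → (u ∙ v) ▸ t ≡ u ▸ (v ▸ t)
    ▸-ε    : ∀ t → ε ▸ t ≡ t
    b x    : Carrier
    b²     : b ∙ b ≈ ε
    m      : ℕ
    5≤m    : 5 ≤ m
  open Shifts X b x public
  w : ℕ
  w = 4 + (m + m)
  field
    -- Distances up to w, although those within K are below w: windows of w + 1 shifts occur along
    -- 2-paths, and b_w has to commute with b.
    commute     : ∀ d → 1 ≤ d → d ≤ w → d ≢ m + m → b ∙ bi d ≈ bi d ∙ b
    dihedral-rel : b ∙ bi (m + m) ≈ bi m ∙ (bi (m + m) ∙ b)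
    -- A token met by b but by none of b₁, ..., b_{w+1}; it detects the first factor of an ordered
    -- product.
    lead        : Token
    lead-moved  : b ▸ lead ≢ lead
    lead-fixed  : ∀ j → bi (suc j) ▸ lead ≡ lead ⊎ w < j
    -- Tokens fixed by K and pushed along by x; they measure the net length of a short walk.
    far         : ℕ → Token
    far-x       : ∀ i → x ▸ far i ≡ far (suc i)
    far-fixed   : ∀ i j → i ≤ 8 → j < w → bi j ▸ far i ≡ far i
    far-inj     : ∀ i j → i ≤ 8 → j ≤ 8 → far i ≡ far j → i ≡ j
    Q           : ℕ
    w<Q         : w < Q
    x^Q         : xp Q ≈ ε
    sweep-inj   : ∀ e → sweep e 0 Q ≈ ε → ∀ i → i < Q → e i ≡ false
    generates   : ∀ u → Generated u
    -- The mirror image of the first relation fails; this is what rules out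
    -- orientation-reversing automorphisms.
    ℓ           : ℕ
    chiral      : bi 1 ∙ bi (suc ℓ) ∙ (bi 1 ∙ bi (suc ℓ)) ∙ b ≈ b ∙ (bi 1 ∙ bi (suc ℓ) ∙ (bi 1 ∙ bi (suc ℓ)))
    chiral-not  : ¬ (bi ℓ ∙ b ∙ (bi ℓ ∙ b) ∙ bi (suc ℓ) ≈ bi (suc ℓ) ∙ (bi ℓ ∙ b ∙ (bi ℓ ∙ b)))
    _≟_         : Decidable _≈_

-- Ordered products of consecutive shifts

module Windows {X : Grp} (C : Config X) where
  open Group X renaming (refl to ≈-refl; sym to ≈-sym; trans to ≈-trans) public
  open Config C public
  open GroupProperties X public
  open GroupSolver X public
  open SetoidReasoning setoid

  bi² : ∀ i → bi i ∙ bi i ≈ ε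
  bi² zero    = b²
  bi² (suc i) = begin
    x ∙ bi i ∙ x ⁻¹ ∙ (x ∙ bi i ∙ x ⁻¹)  ≈⟨ solve (x ∷ bi i ∷ []) (p₀ ⊙ p₁ ⊙ ⊖ p₀ ⊙ (p₀ ⊙ p₁ ⊙ ⊖ p₀)) (p₀ ⊙ (p₁ ⊙ p₁) ⊙ ⊖ p₀) refl ⟩
    x ∙ (bi i ∙ bi i) ∙ x ⁻¹             ≈⟨ ∙-congʳ (∙-congˡ (bi² i)) ⟩
    x ∙ ε ∙ x ⁻¹                         ≈⟨ solve (x ∷ []) (p₀ ⊙ one ⊙ ⊖ p₀) one refl ⟩
    ε                                    ∎

  bi-cancel : ∀ i u → bi i ∙ (bi i ∙ u) ≈ u
  bi-cancel i u = ≈-trans (≈-sym (assoc _ _ _)) (≈-trans (∙-congʳ (bi² i)) (identityˡ u))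

  bi⁻¹ : ∀ i → bi i ⁻¹ ≈ bi i
  bi⁻¹ i = ≈-sym (inverseˡ-unique _ _ (bi² i))

  conj : Carrier → Carrier → Carrier
  conj u v = u ∙ v ∙ u ⁻¹

  conj-cong : ∀ u {v v′} → v ≈ v′ → conj u v ≈ conj u v′
  conj-cong u p = ∙-congʳ (∙-congˡ p)

  conj-∙ : ∀ u v v′ → conj u (v ∙ v′) ≈ conj u v ∙ conj u v′
  conj-∙ u v v′ = solve (u ∷ v ∷ v′ ∷ []) (p₀ ⊙ (p₁ ⊙ p₂) ⊙ ⊖ p₀) (p₀ ⊙ p₁ ⊙ ⊖ p₀ ⊙ (p₀ ⊙ p₂ ⊙ ⊖ p₀)) refl

  conj-inj : ∀ u {v v′} → conj u v ≈ conj u v′ → v ≈ v′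
  conj-inj u {v} {v′} p = ∙-cancelˡ _ _ _ (∙-cancelʳ _ _ _ p)

  xp-+ : ∀ i j → xp (i + j) ≈ xp i ∙ xp j
  xp-+ zero    j = ≈-sym (identityˡ _)
  xp-+ (suc i) j = ≈-trans (∙-congˡ (xp-+ i j)) (≈-sym (assoc _ _ _))

  bi-xp : ∀ i j → bi (i + j) ≈ conj (xp i) (bi j)
  bi-xp zero    j = solve (bi j ∷ []) p₀ (one ⊙ p₀ ⊙ ⊖ one) refl
  bi-xp (suc i) j = begin
    x ∙ bi (i + j) ∙ x ⁻¹          ≈⟨ conj-cong x (bi-xp i j) ⟩
    conj x (conj (xp i) (bi j))    ≈⟨ solve (x ∷ xp i ∷ bi j ∷ []) (p₀ ⊙ (p₁ ⊙ p₂ ⊙ ⊖ p₁) ⊙ ⊖ p₀) (p₀ ⊙ p₁ ⊙ p₂ ⊙ ⊖ (p₀ ⊙ p₁)) refl ⟩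
    conj (x ∙ xp i) (bi j)         ∎

  bi-xp₀ : ∀ i → bi i ≈ conj (xp i) b
  bi-xp₀ i = ≈-trans (reflexive (≡.cong bi (≡.sym (ℕ.+-identityʳ i)))) (bi-xp i 0)

  commute-at : ∀ i d → 1 ≤ d → d ≤ w → d ≢ m + m → bi i ∙ bi (i + d) ≈ bi (i + d) ∙ bi i
  commute-at i d 1≤d d≤w d≢ = begin
    bi i ∙ bi (i + d)                        ≈⟨ ∙-cong (bi-xp₀ i) (bi-xp i d) ⟩
    conj (xp i) b ∙ conj (xp i) (bi d)       ≈⟨ conj-∙ (xp i) b (bi d) ⟨
    conj (xp i) (b ∙ bi d)                   ≈⟨ conj-cong (xp i) (commute d 1≤d d≤w d≢) ⟩
    conj (xp i) (bi d ∙ b)                   ≈⟨ conj-∙ (xp i) (bi d) b ⟩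
    conj (xp i) (bi d) ∙ conj (xp i) b       ≈⟨ ∙-cong (bi-xp i d) (bi-xp₀ i) ⟨
    bi (i + d) ∙ bi i                        ∎

  dihedral-at : ∀ i → bi i ∙ bi (i + (m + m)) ≈ bi (i + m) ∙ (bi (i + (m + m)) ∙ bi i)
  dihedral-at i = begin
    bi i ∙ bi (i + (m + m))                     ≈⟨ ∙-cong (bi-xp₀ i) (bi-xp i _) ⟩
    conj (xp i) b ∙ conj (xp i) (bi (m + m))    ≈⟨ conj-∙ (xp i) _ _ ⟨
    conj (xp i) (b ∙ bi (m + m))                ≈⟨ conj-cong (xp i) dihedral-rel ⟩
    conj (xp i) (bi m ∙ (bi (m + m) ∙ b))       ≈⟨ conj-∙ (xp i) _ _ ⟩
    conj (xp i) (bi m) ∙ conj (xp i) (bi (m + m) ∙ b)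
      ≈⟨ ∙-congˡ (conj-∙ (xp i) _ _) ⟩
    conj (xp i) (bi m) ∙ (conj (xp i) (bi (m + m)) ∙ conj (xp i) b)
      ≈⟨ ∙-cong (bi-xp i m) (∙-cong (bi-xp i _) (bi-xp₀ i)) ⟨
    bi (i + m) ∙ (bi (i + (m + m)) ∙ bi i)      ∎

  -- The products bᵢ^e₀ bᵢ₊₁^e₁ ⋯ of k factors; dividing by a factor and
  -- multiplying by it are the same since bᵢ is an involution.
  W : ℕ → ℕ → Carrier → Set
  W i zero    u = u ≈ ε
  W i (suc k) u = W (suc i) k u ⊎ W (suc i) k (bi i ∙ u)

  W-resp : ∀ i k {u v} → u ≈ v → W i k u → W i k v
  W-resp i zero    u≈v p = ≈-trans (≈-sym u≈v) p
  W-resp i (suc k) u≈v (inj₁ p) = inj₁ (W-resp (suc i) k u≈v p)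
  W-resp i (suc k) u≈v (inj₂ p) = inj₂ (W-resp (suc i) k (∙-congˡ u≈v) p)

  W-ε : ∀ i k → W i k ε
  W-ε i zero    = ≈-refl
  W-ε i (suc k) = inj₁ (W-ε (suc i) k)

  W? : ∀ i k u → Dec (W i k u)
  W? i zero    u = u ≟ ε
  W? i (suc k) u with W? (suc i) k u | W? (suc i) k (bi i ∙ u)
  ... | yes p | _     = yes (inj₁ p)
  ... | no _  | yes q = yes (inj₂ q)
  ... | no ¬p | no ¬q = no λ { (inj₁ p) → ¬p p ; (inj₂ q) → ¬q q }

  -- A factor bᵢ₊ⱼ is moved past a leading bᵢ. Either the two commute, or j = 2m and the dihedral
  -- relation leaves bᵢ₊ₘ bᵢ₊₂ₘ behind; both have indices above i, so induction on k applies. Hence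
  -- ordered products of at most w + 1 consecutive shifts form a group.
  W-bi∙ : ∀ i k j {u} → k ≤ suc w → j < k → W i k u → W i k (bi (i + j) ∙ u)
  W-bi∙ i (suc k) zero {u} k≤ _ p rewrite ℕ.+-identityʳ i with p
  ... | inj₁ q = inj₂ (W-resp (suc i) k (≈-sym (bi-cancel i u)) q)
  ... | inj₂ q = inj₁ q
  W-bi∙ i (suc k) (suc j) {u} (s≤s k≤) (s≤s j<k) (inj₁ p)
    rewrite ℕ.+-suc i j = inj₁ (W-bi∙ (suc i) k j (ℕ.m≤n⇒m≤1+n k≤) j<k p)
  W-bi∙ i (suc k) (suc j) {u} (s≤s k≤) (s≤s j<k) (inj₂ p) with suc j ℕ.≟ m + m
  ... | no d≢ = inj₂ (W-resp (suc i) k eq step)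
    where
    step : W (suc i) k (bi (suc i + j) ∙ (bi i ∙ u))
    step = W-bi∙ (suc i) k j (ℕ.m≤n⇒m≤1+n k≤) j<k p
    eq : bi (suc i + j) ∙ (bi i ∙ u) ≈ bi i ∙ (bi (i + suc j) ∙ u)
    eq = begin
      bi (suc i + j) ∙ (bi i ∙ u)   ≡⟨ ≡.cong (λ z → bi z ∙ (bi i ∙ u)) (≡.sym (ℕ.+-suc i j)) ⟩
      bi (i + suc j) ∙ (bi i ∙ u)   ≈⟨ assoc _ _ _ ⟨
      bi (i + suc j) ∙ bi i ∙ u     ≈⟨ ∙-congʳ (commute-at i (suc j) (s≤s z≤n) (ℕ.≤-trans j<k k≤) d≢) ⟨
      bi i ∙ bi (i + suc j) ∙ u     ≈⟨ assoc _ _ _ ⟩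
      bi i ∙ (bi (i + suc j) ∙ u)   ∎
  ... | yes d≡ = inj₂ (W-resp (suc i) k eq step)
    where
    m≤j : m ≤ suc j
    m≤j = ≡.subst (m ≤_) (≡.sym d≡) (ℕ.m≤m+n m m)
    m′ : ∃ λ m′ → m ≡ suc m′
    m′ with s≤s _ ← 5≤m = _ , refl
    m′<k : proj₁ m′ < k
    m′<k = ℕ.≤-trans (≡.subst (_≤ suc j) (proj₂ m′) m≤j) j<k
    step : W (suc i) k (bi (suc i + proj₁ m′) ∙ (bi (suc i + j) ∙ (bi i ∙ u)))
    step = W-bi∙ (suc i) k (proj₁ m′) (ℕ.m≤n⇒m≤1+n k≤) m′<k
             (W-bi∙ (suc i) k j (ℕ.m≤n⇒m≤1+n k≤) j<k p)
    eq : bi (suc i + proj₁ m′) ∙ (bi (suc i + j) ∙ (bi i ∙ u)) ≈ bi i ∙ (bi (i + suc j) ∙ u)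
    eq = begin
      bi (suc i + proj₁ m′) ∙ (bi (suc i + j) ∙ (bi i ∙ u))
        ≡⟨ ≡.cong₂ (λ y z → bi y ∙ (bi z ∙ (bi i ∙ u)))
             (≡.trans (≡.sym (ℕ.+-suc i _)) (≡.cong (i +_) (≡.sym (proj₂ m′))))
             (≡.trans (≡.sym (ℕ.+-suc i j)) (≡.cong (i +_) d≡)) ⟩
      bi (i + m) ∙ (bi (i + (m + m)) ∙ (bi i ∙ u))
        ≈⟨ solve (bi (i + m) ∷ bi (i + (m + m)) ∷ bi i ∷ u ∷ [])
             (p₀ ⊙ (p₁ ⊙ (p₂ ⊙ p₃))) (p₀ ⊙ (p₁ ⊙ p₂) ⊙ p₃) refl ⟩
      bi (i + m) ∙ (bi (i + (m + m)) ∙ bi i) ∙ u  ≈⟨ ∙-congʳ (dihedral-at i) ⟨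
      bi i ∙ bi (i + (m + m)) ∙ u                 ≈⟨ assoc _ _ _ ⟩
      bi i ∙ (bi (i + (m + m)) ∙ u)               ≡⟨ ≡.cong (λ z → bi i ∙ (bi (i + z) ∙ u)) d≡ ⟨
      bi i ∙ (bi (i + suc j) ∙ u)                 ∎

  W-bi : ∀ i k j → k ≤ suc w → j < k → W i k (bi (i + j))
  W-bi i k j k≤ j<k = W-resp i k (identityʳ _) (W-bi∙ i k j k≤ j<k (W-ε i k))

  -- The window of the left factor starts at offset o inside that of the right.
  W-∙ : ∀ i k o k′ {u v} → k ≤ suc w → o + k′ ≤ k →
        W (i + o) k′ u → W i k v → W i k (u ∙ v)
  W-∙ i k o zero k≤ _ p q = W-resp i k (≈-sym (≈-trans (∙-congʳ p) (identityˡ _))) q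
  W-∙ i k o (suc k′) {u} {v} k≤ o+k′≤ (inj₁ p) q =
    W-∙ i k (suc o) k′ k≤ (≡.subst (_≤ k) (ℕ.+-suc o k′) o+k′≤)
      (≡.subst (λ z → W z k′ u) (≡.sym (ℕ.+-suc i o)) p) q
  W-∙ i k o (suc k′) {u} {v} k≤ o+k′≤ (inj₂ p) q =
    W-resp i k (≈-trans (∙-congˡ (assoc _ _ _)) (bi-cancel (i + o) _))
      (W-bi∙ i k o k≤ (ℕ.≤-trans (ℕ.≤-trans (s≤s (ℕ.m≤m+n o k′)) (ℕ.≤-reflexive (≡.sym (ℕ.+-suc o k′)))) o+k′≤)
        (W-∙ i k (suc o) k′ k≤ (≡.subst (_≤ k) (ℕ.+-suc o k′) o+k′≤)
          (≡.subst (λ z → W z k′ (bi (i + o) ∙ u)) (≡.sym (ℕ.+-suc i o)) p) q))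

  W-mul : ∀ i k {u v} → k ≤ suc w → W i k u → W i k v → W i k (u ∙ v)
  W-mul i k {u} k≤ p = W-∙ i k 0 k k≤ ℕ.≤-refl (≡.subst (λ z → W z k u) (≡.sym (ℕ.+-identityʳ i)) p)

  W-inv : ∀ i k {u} → k ≤ suc w → W i k u → W i k (u ⁻¹)
  W-inv i zero    k≤ p = ≈-trans (⁻¹-cong p) ε⁻¹≈ε
  W-inv i (suc k) k≤ (inj₁ p) = inj₁ (W-inv (suc i) k (ℕ.≤-trans (ℕ.n≤1+n k) k≤) p)
  W-inv i (suc k) {u} k≤ (inj₂ p) =
    W-resp i (suc k) (solve (bi i ∷ u ∷ []) (⊖ (p₀ ⊙ p₁) ⊙ p₀) (⊖ p₁) refl)
      (W-mul i (suc k) k≤ (inj₁ (W-inv (suc i) k (ℕ.≤-trans (ℕ.n≤1+n k) k≤) p))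
        (≡.subst (λ z → W i (suc k) (bi z)) (ℕ.+-identityʳ i) (W-bi i (suc k) 0 k≤ (s≤s z≤n))))

  W-mono : ∀ i k k′ {u} → k ≤ k′ → W i k u → W i k′ u
  W-mono i zero k′ _ p = W-resp i k′ (≈-sym p) (W-ε i k′)
  W-mono i (suc k) (suc k′) (s≤s k≤) (inj₁ p) = inj₁ (W-mono (suc i) k k′ k≤ p)
  W-mono i (suc k) (suc k′) (s≤s k≤) (inj₂ p) = inj₂ (W-mono (suc i) k k′ k≤ p)

  -- `W` peels factors off on the left; in-neighbours need the last factor.
  W-last : ∀ i k {u} → W i (suc k) u → ∃ λ v → W i k v × (u ≈ v ⊎ u ≈ v ∙ bi (i + k))
  W-last i zero {u} (inj₁ p) = ε , ≈-refl , inj₁ p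
  W-last i zero {u} (inj₂ p) = ε , ≈-refl , inj₂ (begin
    u               ≈⟨ bi-cancel i u ⟨
    bi i ∙ (bi i ∙ u) ≈⟨ ∙-congˡ p ⟩
    bi i ∙ ε        ≈⟨ solve (bi i ∷ []) (p₀ ⊙ one) (one ⊙ p₀) refl ⟩
    ε ∙ bi i        ≡⟨ ≡.cong (λ z → ε ∙ bi z) (ℕ.+-identityʳ i) ⟨
    ε ∙ bi (i + 0)  ∎)
  W-last i (suc k) {u} (inj₁ p) with W-last (suc i) k p
  ... | v , q , eq = v , inj₁ q , ≡.subst (λ z → u ≈ v ⊎ u ≈ v ∙ bi z) (≡.sym (ℕ.+-suc i k)) eq
  W-last i (suc k) {u} (inj₂ p) with W-last (suc i) k p
  ... | v , q , eq = bi i ∙ v , inj₂ (W-resp (suc i) k (≈-sym (bi-cancel i v)) q)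
                   , ≡.subst (λ z → u ≈ bi i ∙ v ⊎ u ≈ bi i ∙ v ∙ bi z) (≡.sym (ℕ.+-suc i k)) (eq′ eq)
    where
    eq′ : bi i ∙ u ≈ v ⊎ bi i ∙ u ≈ v ∙ bi (suc i + k) → u ≈ bi i ∙ v ⊎ u ≈ bi i ∙ v ∙ bi (suc i + k)
    eq′ (inj₁ r) = inj₁ (≈-trans (≈-sym (bi-cancel i u)) (∙-congˡ r))
    eq′ (inj₂ r) = inj₂ (≈-trans (≈-sym (bi-cancel i u)) (≈-trans (∙-congˡ r) (≈-sym (assoc _ _ _))))

  W-up : ∀ i k {u} → W i k u → W (suc i) k (conj x u)
  W-up i zero {u} p = ≈-trans (conj-cong x p) (solve (x ∷ []) (p₀ ⊙ one ⊙ ⊖ p₀) one refl)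
  W-up i (suc k) (inj₁ p) = inj₁ (W-up (suc i) k p)
  W-up i (suc k) (inj₂ p) = inj₂ (W-resp (suc (suc i)) k (conj-∙ x _ _) (W-up (suc i) k p))

  W-down : ∀ i k {u} → W (suc i) k (conj x u) → W i k u
  W-down i zero {u} p = conj-inj x (≈-trans p (solve (x ∷ []) one (p₀ ⊙ one ⊙ ⊖ p₀) refl))
  W-down i (suc k) (inj₁ p) = inj₁ (W-down (suc i) k p)
  W-down i (suc k) (inj₂ p) =
    inj₂ (W-down (suc i) k (W-resp (suc (suc i)) k (≈-sym (conj-∙ x _ _)) p))

  W-up* : ∀ j i k {u} → W i k u → W (j + i) k (conj (xp j) u)
  W-up* zero    i k {u} p = W-resp i k (solve (u ∷ []) p₀ (one ⊙ p₀ ⊙ ⊖ one) refl) p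
  W-up* (suc j) i k {u} p = W-resp (suc j + i) k
    (solve (x ∷ xp j ∷ u ∷ []) (p₀ ⊙ (p₁ ⊙ p₂ ⊙ ⊖ p₁) ⊙ ⊖ p₀) (p₀ ⊙ p₁ ⊙ p₂ ⊙ ⊖ (p₀ ⊙ p₁)) refl)
    (W-up (j + i) k (W-up* j i k p))

  -- The indices of the window run from i + j + 1 to i + j + k, hence at most to i + w + 1, and xⁱ
  -- carries the lead of b to that of bᵢ.
  W-fixes : ∀ i k j → k + j ≤ suc w → ∀ {u} →
            W (suc (i + j)) k u → u ▸ (xp i ▸ lead) ≡ xp i ▸ lead
  W-fixes i zero j _ p = ≡.trans (▸-cong p _) (▸-ε _)
  W-fixes i (suc k) j k+j≤ {u} p = ≡.trans (eq p) bi-fixes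
    where
    j≤w : j ≤ w
    j≤w = ℕ.≤-pred (ℕ.≤-trans (s≤s (ℕ.m≤n+m j k)) k+j≤)
    bi-lead : bi (suc j) ▸ lead ≡ lead
    bi-lead with lead-fixed j
    ... | inj₁ q = q
    ... | inj₂ w<j = ⊥-elim (ℕ.<⇒≱ w<j j≤w)
    bi-fixes : bi (suc (i + j)) ▸ (xp i ▸ lead) ≡ xp i ▸ lead
    bi-fixes = ≡.trans (▸-cong (≈-trans (reflexive (≡.cong bi (≡.sym (ℕ.+-suc i j)))) (bi-xp i (suc j))) _)
      (≡.trans (≡.sym (▸-∙ _ _ _))
      (≡.trans (▸-cong (solve (xp i ∷ bi (suc j) ∷ []) (p₀ ⊙ p₁ ⊙ ⊖ p₀ ⊙ p₀) (p₀ ⊙ p₁) refl) _)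
      (≡.trans (▸-∙ _ _ _) (≡.cong (xp i ▸_) bi-lead))))
    rec : ∀ {v} → W (suc (suc (i + j))) k v → v ▸ (xp i ▸ lead) ≡ xp i ▸ lead
    rec {v} q = W-fixes i k (suc j) (≡.subst (_≤ suc w) (≡.sym (ℕ.+-suc k j)) k+j≤)
                  (≡.subst (λ z → W (suc z) k v) (≡.sym (ℕ.+-suc i j)) q)
    eq : W (suc (i + j)) (suc k) u → u ▸ (xp i ▸ lead) ≡ bi (suc (i + j)) ▸ (xp i ▸ lead)
    eq (inj₁ q) = ≡.trans (rec q) (≡.sym bi-fixes)
    eq (inj₂ q) = ≡.trans (▸-cong (≈-sym (bi-cancel (suc (i + j)) u)) _)
                     (≡.trans (▸-∙ _ _ _) (≡.cong (bi (suc (i + j)) ▸_) (rec q)))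

  bi∉W : ∀ i k → k ≤ suc w → ¬ W (suc i) k (bi i)
  bi∉W i k k≤ p = lead-moved (≡.trans (≡.sym (▸-ε _)) (≡.trans (▸-cong (≈-sym (inverseˡ (xp i))) _)
    (≡.trans (▸-∙ _ _ _) (≡.trans (≡.cong ((xp i) ⁻¹ ▸_) eq)
    (≡.trans (≡.sym (▸-∙ _ _ _)) (≡.trans (▸-cong (inverseˡ (xp i)) _) (▸-ε _)))))))
    where
    eq : xp i ▸ (b ▸ lead) ≡ xp i ▸ lead
    eq = ≡.trans (≡.sym (▸-∙ _ _ _))
      (≡.trans (▸-cong (≈-trans (solve (xp i ∷ b ∷ []) (p₀ ⊙ p₁) (p₀ ⊙ p₁ ⊙ ⊖ p₀ ⊙ p₀) refl) (∙-congʳ (≈-sym (bi-xp₀ i)))) _)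
      (≡.trans (▸-∙ _ _ _) (W-fixes i k 0 (≡.subst (_≤ suc w) (≡.sym (ℕ.+-identityʳ k)) k≤)
        (≡.subst (λ z → W (suc z) k (bi i)) (≡.sym (ℕ.+-identityʳ i)) p))))

  -- If bᵢ occurred in the ordered product, solving for it would express bᵢ by later shifts, against
  -- `bi∉W`.
  W-inter : ∀ i k k′ {u} → k ≤ k′ → k′ ≤ suc w → W i (suc k) u → W (suc i) k′ u → W (suc i) k u
  W-inter i k k′ k≤ k′≤ (inj₁ p) q = p
  W-inter i k k′ {u} k≤ k′≤ (inj₂ p) q = ⊥-elim (bi∉W i k′ k′≤
    (W-resp (suc i) k′ (solve (bi i ∷ u ∷ []) (p₀ ⊙ p₁ ⊙ ⊖ p₁) p₀ refl)
      (W-mul (suc i) k′ k′≤ (W-mono (suc i) k k′ k≤ p) (W-inv (suc i) k′ k′≤ q))))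

  -- Each further conjugate of K cuts off the lowest remaining generator; after w of them nothing is
  -- left.
  W-inter* : ∀ {u} r → r ≤ w → (∀ i → i ≤ r → W i w u) → W r (w ∸ r) u
  W-inter* zero    _   h = h 0 z≤n
  W-inter* {u} (suc r) r<w h = W-inter r (w ∸ suc r) w (ℕ.m∸n≤m w (suc r)) (ℕ.n≤1+n w)
    (≡.subst (λ z → W r z u) (ℕ.+-∸-assoc 1 r<w) (W-inter* r (ℕ.<⇒≤ r<w) (λ i i≤r → h i (ℕ.m≤n⇒m≤1+n i≤r))))
    (h (suc r) ℕ.≤-refl)

  trivial-inter : ∀ {u} → (∀ i → i ≤ w → W i w u) → u ≈ ε
  trivial-inter {u} h = ≡.subst (λ z → W w z u) (ℕ.n∸n≡0 w) (W-inter* w ℕ.≤-refl h)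

-- The coset graph

module CosetGraph {X : Grp} (C : Config X) where
  open Windows C public
  open SetoidReasoning setoid

  w′ : ℕ
  w′ = 3 + (m + m)

  w≤1+w : w ≤ suc w
  w≤1+w = ℕ.n≤1+n w

  K : Carrier → Set
  K = W 0 w

  K-resp : ∀ {u v} → u ≈ v → K u → K v
  K-resp = W-resp 0 w

  K-∙ : ∀ {u v} → K u → K v → K (u ∙ v)
  K-∙ = W-mul 0 w w≤1+w

  K-⁻¹ : ∀ {u} → K u → K (u ⁻¹)
  K-⁻¹ = W-inv 0 w w≤1+w

  K-bi : ∀ i → i < w → K (bi i)
  K-bi i = W-bi 0 w i w≤1+w

  infix 4 _≈ᵥ_
  _≈ᵥ_ : Carrier → Carrier → Set
  u ≈ᵥ v = K (u ⁻¹ ∙ v)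

  ≈ᵥ-reflexive : ∀ {u v} → u ≈ v → u ≈ᵥ v
  ≈ᵥ-reflexive {u} {v} p = K-resp (≈-trans (≈-sym (inverseˡ u)) (∙-congˡ p)) (W-ε 0 w)

  ≈ᵥ-refl : ∀ {u} → u ≈ᵥ u
  ≈ᵥ-refl = ≈ᵥ-reflexive ≈-refl

  ≈ᵥ-sym : ∀ {u v} → u ≈ᵥ v → v ≈ᵥ u
  ≈ᵥ-sym {u} {v} p = K-resp (solve (u ∷ v ∷ []) (⊖ (⊖ p₀ ⊙ p₁)) (⊖ p₁ ⊙ p₀) refl) (K-⁻¹ p)

  ≈ᵥ-trans : ∀ {u v t} → u ≈ᵥ v → v ≈ᵥ t → u ≈ᵥ t
  ≈ᵥ-trans {u} {v} {t} p q =
    K-resp (solve (u ∷ v ∷ t ∷ []) (⊖ p₀ ⊙ p₁ ⊙ (⊖ p₁ ⊙ p₂)) (⊖ p₀ ⊙ p₂) refl) (K-∙ p q)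

  ≈ᵥ-∙K : ∀ u {k} → K k → u ≈ᵥ u ∙ k
  ≈ᵥ-∙K u {k} p = K-resp (solve (u ∷ k ∷ []) p₁ (⊖ p₀ ⊙ (p₀ ⊙ p₁)) refl) p

  ≈ᵥ-left : ∀ g {u v} → u ≈ᵥ v → g ∙ u ≈ᵥ g ∙ v
  ≈ᵥ-left g {u} {v} = K-resp (solve (g ∷ u ∷ v ∷ []) (⊖ p₁ ⊙ p₂) (⊖ (p₀ ⊙ p₁) ⊙ (p₀ ⊙ p₂)) refl)

  cosets : Setoid 0ℓ 0ℓ
  cosets = record
    { Carrier = Carrier
    ; _≈_ = _≈ᵥ_
    ; isEquivalence = record { refl = ≈ᵥ-refl ; sym = ≈ᵥ-sym ; trans = ≈ᵥ-trans }
    }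

  pw : Bool → Carrier → Carrier
  pw e u = if e then u else ε

  out : Carrier → Bool → Carrier
  out u e = u ∙ pw e b ∙ x

  -- Conjugation by x⁻¹ keeps all generators of K but b₀ inside K, conjugation by x all but b_{w′}.
  -- So b_{w′} separates the two in-neighbours as b separates the two out-neighbours.
  inn : Carrier → Bool → Carrier
  inn u e = u ∙ pw e (bi w′) ∙ x ⁻¹

  Arc : Carrier → Carrier → Set
  Arc u v = ∃ λ e → out u e ≈ᵥ v

  K-pw : ∀ e i → i < w → K (pw e (bi i))
  K-pw true  i i<w = K-bi i i<w
  K-pw false i i<w = W-ε 0 w

  pw² : ∀ e i → pw e (bi i) ∙ pw e (bi i) ≈ ε
  pw² true  i = bi² i
  pw² false i = identityˡ ε

  pw⁻¹ : ∀ e i → pw e (bi i) ⁻¹ ≈ pw e (bi i)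
  pw⁻¹ e i = ≈-sym (inverseˡ-unique _ _ (pw² e i))

  K-split : ∀ {k} → K k → ∃ λ e → W 1 w′ (pw e b ∙ k)
  K-split (inj₁ p) = false , W-resp 1 w′ (≈-sym (identityˡ _)) p
  K-split (inj₂ p) = true , p

  W₁⇒K : ∀ {u} → W 1 w′ u → K (x ⁻¹ ∙ u ∙ x)
  W₁⇒K {u} p = W-mono 0 w′ w (ℕ.n≤1+n w′) (W-down 0 w′ (W-resp 1 w′
    (solve (x ∷ u ∷ []) p₁ (p₀ ⊙ (⊖ p₀ ⊙ p₁ ⊙ p₀) ⊙ ⊖ p₀) refl) p))

  -- An element of K is a power of b times an element of `W 1 w′`, and x⁻¹ conjugates the latter
  -- into K; only the power of b matters for the arc.
  arc-respˡ : ∀ {u u′ v} → u ≈ᵥ u′ → Arc u v → Arc u′ v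
  arc-respˡ {u} {u′} {v} u≈u′ (e , p)
    with e′ , q ← K-split (K-∙ (≈ᵥ-sym u≈u′) (K-pw e 0 (s≤s z≤n)))
    = e′ , ≈ᵥ-trans (K-resp eq (W₁⇒K q)) p
    where
    eq : x ⁻¹ ∙ (pw e′ b ∙ (u′ ⁻¹ ∙ u ∙ pw e b)) ∙ x ≈ out u′ e′ ⁻¹ ∙ out u e
    eq = begin
      x ⁻¹ ∙ (pw e′ b ∙ (u′ ⁻¹ ∙ u ∙ pw e b)) ∙ x     ≈⟨ ∙-congʳ (∙-congˡ (∙-congʳ (pw⁻¹ e′ 0))) ⟨
      x ⁻¹ ∙ (pw e′ b ⁻¹ ∙ (u′ ⁻¹ ∙ u ∙ pw e b)) ∙ x  ≈⟨ solve (x ∷ pw e′ b ∷ u′ ∷ u ∷ pw e b ∷ []) (⊖ p₀ ⊙ (⊖ p₁ ⊙ (⊖ p₂ ⊙ p₃ ⊙ p₄)) ⊙ p₀) (⊖ (p₂ ⊙ p₁ ⊙ p₀) ⊙ (p₃ ⊙ p₄ ⊙ p₀)) refl ⟩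
      out u′ e′ ⁻¹ ∙ out u e                          ∎

  arc-respʳ : ∀ {u v v′} → v ≈ᵥ v′ → Arc u v → Arc u v′
  arc-respʳ v≈v′ (e , p) = e , ≈ᵥ-trans p v≈v′

  arc-left : ∀ g {u v} → Arc u v → Arc (g ∙ u) (g ∙ v)
  arc-left g {u} {v} (e , p) = e , ≈ᵥ-trans
    (≈ᵥ-reflexive (solve (g ∷ u ∷ pw e b ∷ x ∷ []) (p₀ ⊙ p₁ ⊙ p₂ ⊙ p₃) (p₀ ⊙ (p₁ ⊙ p₂ ⊙ p₃)) refl))
    (≈ᵥ-left g p)

  arc-x : ∀ u → Arc u (u ∙ x)
  arc-x u = false , ≈ᵥ-reflexive (∙-congʳ (identityʳ u))

  arc-bx : ∀ u → Arc u (u ∙ b ∙ x)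
  arc-bx u = true , ≈ᵥ-refl

  arc-inn : ∀ u e → Arc (inn u e) u
  arc-inn u e = arc-respʳ (≈ᵥ-sym (≈ᵥ-trans (≈ᵥ-∙K u (K-pw e w′ ℕ.≤-refl)) (≈ᵥ-reflexive
    (solve (u ∷ pw e (bi w′) ∷ x ∷ []) (p₀ ⊙ p₁) (p₀ ⊙ p₁ ⊙ ⊖ p₂ ⊙ p₂) refl)))) (arc-x _)

  arc⇒inn : ∀ {u v} → Arc v u → ∃ λ e → inn u e ≈ᵥ v
  arc⇒inn {u} {v} (e₀ , p) with W-last 0 w′ p
  ... | k , q , inj₁ eq = false , K-resp (begin
      conj x (k ⁻¹) ∙ pw e₀ b                  ≈⟨ ∙-congʳ (conj-cong x (⁻¹-cong eq)) ⟨
      conj x ((out v e₀ ⁻¹ ∙ u) ⁻¹) ∙ pw e₀ b  ≈⟨ ∙-congˡ (pw⁻¹ e₀ 0) ⟨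
      conj x ((out v e₀ ⁻¹ ∙ u) ⁻¹) ∙ pw e₀ b ⁻¹
        ≈⟨ solve (u ∷ v ∷ pw e₀ b ∷ x ∷ []) (p₃ ⊙ ⊖ (⊖ (p₁ ⊙ p₂ ⊙ p₃) ⊙ p₀) ⊙ ⊖ p₃ ⊙ ⊖ p₂) (⊖ (p₀ ⊙ one ⊙ ⊖ p₃) ⊙ p₁) refl ⟩
      inn u false ⁻¹ ∙ v                       ∎)
      (K-∙ (inj₁ (W-up 0 w′ (W-inv 0 w′ (ℕ.≤-trans (ℕ.n≤1+n w′) w≤1+w) q))) (K-pw e₀ 0 (s≤s z≤n)))
  ... | k , q , inj₂ eq = true , K-resp (begin
      conj x (k ⁻¹) ∙ pw e₀ b                  ≈⟨ ∙-congʳ (conj-cong x (solve (k ∷ bi w′ ∷ []) (⊖ p₀) (p₁ ⊙ ⊖ (p₀ ⊙ p₁)) refl)) ⟩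
      conj x (bi w′ ∙ (k ∙ bi w′) ⁻¹) ∙ pw e₀ b  ≈⟨ ∙-congʳ (conj-cong x (∙-congˡ (⁻¹-cong eq))) ⟨
      conj x (bi w′ ∙ (out v e₀ ⁻¹ ∙ u) ⁻¹) ∙ pw e₀ b  ≈⟨ ∙-cong (conj-cong x (∙-congʳ (bi⁻¹ w′))) (pw⁻¹ e₀ 0) ⟨
      conj x (bi w′ ⁻¹ ∙ (out v e₀ ⁻¹ ∙ u) ⁻¹) ∙ pw e₀ b ⁻¹
        ≈⟨ solve (u ∷ v ∷ pw e₀ b ∷ x ∷ bi w′ ∷ []) (p₃ ⊙ (⊖ p₄ ⊙ ⊖ (⊖ (p₁ ⊙ p₂ ⊙ p₃) ⊙ p₀)) ⊙ ⊖ p₃ ⊙ ⊖ p₂) (⊖ (p₀ ⊙ p₄ ⊙ ⊖ p₃) ⊙ p₁) refl ⟩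
      inn u true ⁻¹ ∙ v                       ∎)
      (K-∙ (inj₁ (W-up 0 w′ (W-inv 0 w′ (ℕ.≤-trans (ℕ.n≤1+n w′) w≤1+w) q))) (K-pw e₀ 0 (s≤s z≤n)))

  -- u moves the far tokens as a walk with net length j − i does.
  Sh : ℕ → ℕ → Carrier → Set
  Sh i j u = u ▸ far i ≡ far j

  W-far : ∀ i → i ≤ 8 → ∀ j k {u} → j + k ≤ w → W j k u → Sh i i u
  W-far i i≤8 j zero    j+k≤ p = ≡.trans (▸-cong p _) (▸-ε _)
  W-far i i≤8 j (suc k) j+k≤ (inj₁ p) =
    W-far i i≤8 (suc j) k (≡.subst (_≤ w) (ℕ.+-suc j k) j+k≤) p
  W-far i i≤8 j (suc k) {u} j+k≤ (inj₂ p) = ≡.trans (▸-cong (≈-sym (bi-cancel j u)) _)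
    (≡.trans (▸-∙ _ _ _) (≡.trans (≡.cong (bi j ▸_)
      (W-far i i≤8 (suc j) k (≡.subst (_≤ w) (ℕ.+-suc j k) j+k≤) p))
      (far-fixed i j i≤8 (ℕ.≤-trans (ℕ.≤-trans (s≤s (ℕ.m≤m+n j k)) (ℕ.≤-reflexive (≡.sym (ℕ.+-suc j k)))) j+k≤))))

  K-far : ∀ i → i ≤ 8 → ∀ {u} → K u → Sh i i u
  K-far i i≤8 = W-far i i≤8 0 w ℕ.≤-refl

  arc-far : ∀ i → i ≤ 7 → ∀ {u v} → Arc u v → Sh i (suc i) (u ⁻¹ ∙ v)
  arc-far i i≤7 {u} {v} (e , p) = ≡.trans
    (▸-cong (solve (u ∷ v ∷ pw e b ∷ x ∷ []) (⊖ p₀ ⊙ p₁) (p₂ ⊙ (p₃ ⊙ (⊖ (p₀ ⊙ p₂ ⊙ p₃) ⊙ p₁))) refl) _)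
    (≡.trans (▸-∙ _ _ _) (≡.trans (≡.cong (pw e b ▸_) (≡.trans (▸-∙ _ _ _) (≡.trans
      (≡.cong (x ▸_) (K-far i (ℕ.m≤n⇒m≤1+n i≤7) p)) (far-x i)))) (K-far (suc i) (s≤s i≤7) (K-pw e 0 (s≤s z≤n)))))

  Sh-trans : ∀ {i j k u v t} → Sh j k (u ⁻¹ ∙ v) → Sh i j (v ⁻¹ ∙ t) → Sh i k (u ⁻¹ ∙ t)
  Sh-trans {u = u} {v} {t} p q = ≡.trans
    (▸-cong (solve (u ∷ v ∷ t ∷ []) (⊖ p₀ ⊙ p₂) (⊖ p₀ ⊙ p₁ ⊙ (⊖ p₁ ⊙ p₂)) refl) _)
    (≡.trans (▸-∙ _ _ _) (≡.trans (≡.cong (_ ▸_) q) p))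

  Sh-unique : ∀ {i j k u} → j ≤ 8 → k ≤ 8 → Sh i j u → Sh i k u → j ≡ k
  Sh-unique {j = j} {k} j≤ k≤ p q = far-inj j k j≤ k≤ (≡.trans (≡.sym p) q)

  0≤7 : 0 ≤ 7
  0≤7 = z≤n
  1≤7 : 1 ≤ 7
  1≤7 = s≤s z≤n
  2≤7 : 2 ≤ 7
  2≤7 = ℕ.m≤m+n 2 5
  3≤7 : 3 ≤ 7
  3≤7 = ℕ.m≤m+n 3 4

  no-loop : ∀ {u v} → u ≈ᵥ v → ¬ Arc u v
  no-loop u≈v a with Sh-unique {0} z≤n (ℕ.m≤n⇒m≤1+n 1≤7) (K-far 0 z≤n u≈v) (arc-far 0 0≤7 a)
  ... | ()

  no-2-cycle : ∀ {u v} → Arc u v → ¬ Arc v u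
  no-2-cycle {u} {v} a a′ with Sh-unique {0} z≤n (ℕ.m≤n⇒m≤1+n 2≤7) (K-far 0 z≤n (≈ᵥ-refl {u}))
    (Sh-trans {u = u} {v} {u} (arc-far 1 1≤7 a) (arc-far 0 0≤7 a′))
  ... | ()

  -- The far tokens would show the net lengths 3 and 1 at the same time.
  no-triangle : ∀ {u v s t} → Arc u v → Arc v s → Arc s t → ¬ Arc u t
  no-triangle {u} {v} {s} {t} a₁ a₂ a₃ a with Sh-unique {0} (ℕ.m≤n⇒m≤1+n 1≤7) (ℕ.m≤n⇒m≤1+n 3≤7) (arc-far 0 0≤7 a)
    (Sh-trans {u = u} {v} {t} (arc-far 2 2≤7 a₁) (Sh-trans {u = v} {s} {t} (arc-far 1 1≤7 a₂) (arc-far 0 0≤7 a₃)))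
  ... | ()

  no-4-cycle : ∀ {u v s t} → Arc u v → Arc v s → Arc s t → ¬ Arc t u
  no-4-cycle {u} {v} {s} {t} a₁ a₂ a₃ a with Sh-unique {0} z≤n (s≤s 3≤7) (K-far 0 z≤n (≈ᵥ-refl {u}))
    (Sh-trans {u = u} {v} {u} (arc-far 3 3≤7 a₁) (Sh-trans {u = v} {s} {u} (arc-far 2 2≤7 a₂)
      (Sh-trans {u = s} {t} {u} (arc-far 1 1≤7 a₃) (arc-far 0 0≤7 a))))
  ... | ()

  -- All three factors, conjugated by x or x², lie in the window b₁, ..., b_{w+1}, which is one
  -- longer than K and does not contain b.
  K-2-path : ∀ {p q r} → K p → K q → K r → ¬ (x ∙ p ∙ x ∙ q ∙ x ⁻¹ ∙ r ∙ x ⁻¹ ≈ b)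
  K-2-path {p} {q} {r} Kp Kq Kr eq = bi∉W 0 (suc w) ℕ.≤-refl (W-resp 1 (suc w) (begin
    conj x p ∙ (conj (xp 2) q ∙ conj x r)
      ≈⟨ solve (x ∷ p ∷ q ∷ r ∷ []) (p₀ ⊙ p₁ ⊙ ⊖ p₀ ⊙ ((p₀ ⊙ (p₀ ⊙ one)) ⊙ p₂ ⊙ ⊖ (p₀ ⊙ (p₀ ⊙ one)) ⊙ (p₀ ⊙ p₃ ⊙ ⊖ p₀)))
           (p₀ ⊙ p₁ ⊙ p₀ ⊙ p₂ ⊙ ⊖ p₀ ⊙ p₃ ⊙ ⊖ p₀) refl ⟩
    x ∙ p ∙ x ∙ q ∙ x ⁻¹ ∙ r ∙ x ⁻¹        ≈⟨ eq ⟩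
    b                                      ∎)
    (W-mul 1 (suc w) ℕ.≤-refl (up Kp) (W-mul 1 (suc w) ℕ.≤-refl (inj₁ (W-up* 2 0 w Kq)) (up Kr))))
    where
    up : ∀ {u} → K u → W 1 (suc w) (conj x u)
    up Ku = W-mono 1 w (suc w) w≤1+w (W-up 0 w Ku)

  -- If the paths left u with different exponents of b, going out along one and back along the other
  -- would write b as in `K-2-path`.
  unique-2-path : ∀ {u v v′ t} → Arc u v → Arc v t → Arc u v′ → Arc v′ t → v ≈ᵥ v′
  unique-2-path {u} {v} {v′} {t} (e , p) (f , q) (e′ , p′) (f′ , q′) =
    go e e′ p p′ (K-∙ p (K-pw f 0 (s≤s z≤n))) (K-∙ q (K-⁻¹ q′)) (K-∙ (K-⁻¹ (K-pw f′ 0 (s≤s z≤n))) (K-⁻¹ p′)) key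
    where
    key : x ∙ ((out u e ⁻¹ ∙ v) ∙ pw f b) ∙ x ∙ ((out v f ⁻¹ ∙ t) ∙ (out v′ f′ ⁻¹ ∙ t) ⁻¹) ∙ x ⁻¹
            ∙ (pw f′ b ⁻¹ ∙ (out u e′ ⁻¹ ∙ v′) ⁻¹) ∙ x ⁻¹ ≈ pw e b ⁻¹ ∙ pw e′ b
    key = ≈-trans (solve (u ∷ pw e b ∷ x ∷ v ∷ pw f b ∷ t ∷ [])
            (p₂ ⊙ (⊖ (p₀ ⊙ p₁ ⊙ p₂) ⊙ p₃ ⊙ p₄) ⊙ p₂ ⊙ (⊖ (p₃ ⊙ p₄ ⊙ p₂) ⊙ p₅)) (⊖ p₁ ⊙ ⊖ p₀ ⊙ p₅) refl ⟨∙⟩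
          solve (v′ ∷ pw f′ b ∷ x ∷ t ∷ u ∷ pw e′ b ∷ [])
            (⊖ (⊖ (p₀ ⊙ p₁ ⊙ p₂) ⊙ p₃) ⊙ ⊖ p₂ ⊙ (⊖ p₁ ⊙ ⊖ (⊖ (p₄ ⊙ p₅ ⊙ p₂) ⊙ p₀)) ⊙ ⊖ p₂) (⊖ p₃ ⊙ p₄ ⊙ p₅) refl)
          (solve (u ∷ pw e b ∷ t ∷ pw e′ b ∷ []) (⊖ p₁ ⊙ ⊖ p₀ ⊙ p₂ ⊙ (⊖ p₂ ⊙ p₀ ⊙ p₃)) (⊖ p₁ ⊙ p₃) refl)
      where
      _⟨∙⟩_ : ∀ {A B A′ B′ C D E : Carrier} → A ∙ B ≈ A′ → C ∙ D ∙ E ∙ D ≈ B′ → A ∙ (B ∙ C) ∙ D ∙ E ∙ D ≈ A′ ∙ B′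
      _⟨∙⟩_ {A} {B} {A′} {B′} {C} {D} {E} α β = ≈-trans
        (solve (A ∷ B ∷ C ∷ D ∷ E ∷ []) (p₀ ⊙ (p₁ ⊙ p₂) ⊙ p₃ ⊙ p₄ ⊙ p₃) (p₀ ⊙ p₁ ⊙ (p₂ ⊙ p₃ ⊙ p₄ ⊙ p₃)) refl)
        (∙-cong α β)
    go : ∀ e e′ → out u e ≈ᵥ v → out u e′ ≈ᵥ v′ → ∀ {p q r} → K p → K q → K r →
         x ∙ p ∙ x ∙ q ∙ x ⁻¹ ∙ r ∙ x ⁻¹ ≈ pw e b ⁻¹ ∙ pw e′ b → v ≈ᵥ v′
    go true  true  p p′ _ _ _ _ = ≈ᵥ-trans (≈ᵥ-sym p) p′
    go false false p p′ _ _ _ _ = ≈ᵥ-trans (≈ᵥ-sym p) p′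
    go true  false _ _ Kp Kq Kr k = ⊥-elim (K-2-path Kp Kq Kr (≈-trans k (≈-trans (identityʳ _) (bi⁻¹ 0))))
    go false true  _ _ Kp Kq Kr k = ⊥-elim (K-2-path Kp Kq Kr (≈-trans k (≈-trans (∙-congʳ ε⁻¹≈ε) (identityˡ _))))

  bi≉ε : ∀ i → ¬ bi i ≈ ε
  bi≉ε i p = bi∉W i 0 z≤n p

  -- The windows starting at 1, ..., w all contain b_w. If the one starting at 0 did too, b_w would
  -- lie in their intersection, which is trivial.
  biw∉K : ¬ K (bi w)
  biw∉K p = bi≉ε w (trivial-inter h)
    where
    h : ∀ i → i ≤ w → W i w (bi w)
    h zero    _   = p
    h (suc i) i<w = ≡.subst (λ z → W (suc i) w (bi z)) (ℕ.m+[n∸m]≡n i<w)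
      (W-bi (suc i) w (w ∸ suc i) w≤1+w (ℕ.∸-monoʳ-< (s≤s z≤n) i<w))

  b₋₁∉K : ¬ K (x ⁻¹ ∙ b ∙ x)
  b₋₁∉K p = bi∉W 0 w w≤1+w (W-resp 1 w (solve (x ∷ b ∷ []) (p₀ ⊙ (⊖ p₀ ⊙ p₁ ⊙ p₀) ⊙ ⊖ p₀) p₁ refl) (W-up 0 w p))

  biw-x : bi w ∙ x ≈ x ∙ bi w′
  biw-x = solve (x ∷ bi w′ ∷ []) (p₀ ⊙ p₁ ⊙ ⊖ p₀ ⊙ p₀) (p₀ ⊙ p₁) refl

  m+m<w : m + m < w
  m+m<w = s≤s (ℕ.m≤n+m (m + m) 3)

  w-comm : ∀ e → bi w ∙ pw e b ≈ pw e b ∙ bi w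
  w-comm true  = ≈-sym (commute w (s≤s z≤n) ℕ.≤-refl (λ p → ℕ.<⇒≢ m+m<w (≡.sym p)))
  w-comm false = ≈-trans (identityʳ _) (≈-sym (identityˡ _))

  -- b_w is outside K, commutes with b, and becomes b_{w′} ∈ K when moved past x: out-arcs cannot
  -- see it. The twin turns two arcs leaving v into an alternating 4-cycle.
  out-twin : ∀ v → ∃ λ v′ → ¬ v ≈ᵥ v′ × (∀ {a} → Arc v a → Arc v′ a)
  out-twin v = v ∙ bi w , (λ p → biw∉K (K-resp (solve (v ∷ bi w ∷ []) (⊖ p₀ ⊙ (p₀ ⊙ p₁)) p₁ refl) p))
             , λ { {a} (e , p) → e , ≈ᵥ-trans (≈ᵥ-sym (≈ᵥ-trans (≈ᵥ-∙K _ (K-bi w′ ℕ.≤-refl)) (≈ᵥ-reflexive (eq e)))) p }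
    where
    eq : ∀ e → out v e ∙ bi w′ ≈ out (v ∙ bi w) e
    eq e = begin
      v ∙ pw e b ∙ x ∙ bi w′     ≈⟨ assoc _ _ _ ⟩
      v ∙ pw e b ∙ (x ∙ bi w′)   ≈⟨ ∙-congˡ biw-x ⟨
      v ∙ pw e b ∙ (bi w ∙ x)    ≈⟨ solve (v ∷ pw e b ∷ bi w ∷ x ∷ []) (p₀ ⊙ p₁ ⊙ (p₂ ⊙ p₃)) (p₀ ⊙ (p₁ ⊙ p₂) ⊙ p₃) refl ⟩
      v ∙ (pw e b ∙ bi w) ∙ x    ≈⟨ ∙-congʳ (∙-congˡ (w-comm e)) ⟨
      v ∙ (bi w ∙ pw e b) ∙ x    ≈⟨ ∙-congʳ (assoc _ _ _) ⟨
      v ∙ bi w ∙ pw e b ∙ x      ∎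

  -- The twin is obtained from the shift of index -1. For the in-neighbour with b_{w′} the
  -- commutation of b with b_w is used once more.
  in-twin : ∀ v → ∃ λ v′ → ¬ v ≈ᵥ v′ × (∀ {c} → Arc c v → Arc c v′)
  in-twin v = v ∙ (x ⁻¹ ∙ b ∙ x)
            , (λ p → b₋₁∉K (K-resp (solve (v ∷ x ⁻¹ ∙ b ∙ x ∷ []) (⊖ p₀ ⊙ (p₀ ⊙ p₁)) p₁ refl) p))
            , λ a → let e , p = arc⇒inn a in arc-respˡ p (arcs e)
    where
    arcs : ∀ e → Arc (inn v e) (v ∙ (x ⁻¹ ∙ b ∙ x))
    arcs false = true , ≈ᵥ-reflexive (solve (v ∷ x ∷ b ∷ []) (p₀ ⊙ one ⊙ ⊖ p₁ ⊙ p₂ ⊙ p₁) (p₀ ⊙ (⊖ p₁ ⊙ p₂ ⊙ p₁)) refl)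
    arcs true  = true , ≈ᵥ-sym (≈ᵥ-trans (≈ᵥ-∙K _ (K-bi w′ ℕ.≤-refl)) (≈ᵥ-reflexive (begin
      v ∙ (x ⁻¹ ∙ b ∙ x) ∙ bi w′         ≈⟨ solve (v ∷ x ∷ b ∷ bi w′ ∷ []) (p₀ ⊙ (⊖ p₁ ⊙ p₂ ⊙ p₁) ⊙ p₃) (p₀ ⊙ ⊖ p₁ ⊙ (p₂ ⊙ (p₁ ⊙ p₃ ⊙ ⊖ p₁)) ⊙ p₁) refl ⟩
      v ∙ x ⁻¹ ∙ (b ∙ bi w) ∙ x          ≈⟨ ∙-congʳ (∙-congˡ (w-comm true)) ⟨
      v ∙ x ⁻¹ ∙ (bi w ∙ b) ∙ x          ≈⟨ solve (v ∷ x ∷ b ∷ bi w′ ∷ []) (p₀ ⊙ ⊖ p₁ ⊙ (p₁ ⊙ p₃ ⊙ ⊖ p₁ ⊙ p₂) ⊙ p₁) (p₀ ⊙ p₃ ⊙ ⊖ p₁ ⊙ p₂ ⊙ p₁) refl ⟩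
      v ∙ bi w′ ∙ x ⁻¹ ∙ b ∙ x           ∎)))

  -- Of the four orientations of v′ one is settled by uniqueness of 2-paths, the others by net
  -- length. So directed corners have no second common neighbour, in contrast to the corners at
  -- which two arcs leave or two arcs enter, which have twins.
  mixed-unique : ∀ {c v a v′} → Arc c v → Arc v a →
                 Arc v′ a ⊎ Arc a v′ → Arc c v′ ⊎ Arc v′ c → v ≈ᵥ v′
  mixed-unique cv va (inj₁ v′a) (inj₁ cv′) = unique-2-path cv va cv′ v′a
  mixed-unique cv va (inj₁ v′a) (inj₂ v′c) = ⊥-elim (no-triangle v′c cv va v′a)
  mixed-unique cv va (inj₂ av′) (inj₁ cv′) = ⊥-elim (no-triangle cv va av′ cv′)
  mixed-unique cv va (inj₂ av′) (inj₂ v′c) = ⊥-elim (no-4-cycle cv va av′ v′c)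

  Γ : Graph
  Γ = record
    { V = cosets
    ; _~_ = λ u v → Arc u v ⊎ Arc v u
    ; ~-resp-≈ = λ { p q (inj₁ a) → inj₁ (arc-respˡ p (arc-respʳ q a))
                   ; p q (inj₂ a) → inj₂ (arc-respˡ q (arc-respʳ p a)) }
    ; ~-sym = swap
    ; ~-irrefl = λ { p (inj₁ a) → no-loop p a ; p (inj₂ a) → no-loop (≈ᵥ-sym p) a }
    }

-- Automorphisms of the coset graph

module AutGraph {X : Grp} (C : Config X) where
  open CosetGraph C public
  open SetoidReasoning setoid

  xp-suc : ∀ i → xp (suc i) ≈ xp i ∙ x
  xp-suc i = ≈-trans (reflexive (≡.cong xp (≡.sym (ℕ.+-comm i 1)))) (≈-trans (xp-+ i 1) (∙-congˡ (identityʳ x)))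

  K⇒W : ∀ i {d} → K (xp i ⁻¹ ∙ d ∙ xp i) → W i w d
  K⇒W i {d} p = W-resp i w (solve (xp i ∷ d ∷ []) (p₀ ⊙ (⊖ p₀ ⊙ p₁ ⊙ p₀) ⊙ ⊖ p₀) p₁ refl)
    (≡.subst (λ z → W z w (conj (xp i) (xp i ⁻¹ ∙ d ∙ xp i))) (ℕ.+-identityʳ i) (W-up* i 0 w p))

  ≈ᵥ⇒W : ∀ i {g h} → g ∙ xp i ≈ᵥ h ∙ xp i → W i w (g ⁻¹ ∙ h)
  ≈ᵥ⇒W i {g} {h} p = K⇒W i (K-resp
    (solve (g ∷ h ∷ xp i ∷ []) (⊖ (p₀ ⊙ p₂) ⊙ (p₁ ⊙ p₂)) (⊖ p₂ ⊙ (⊖ p₀ ⊙ p₁) ⊙ p₂) refl) p)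

  ⁻¹∙≈ε⇒≈ : ∀ {g h} → g ⁻¹ ∙ h ≈ ε → g ≈ h
  ⁻¹∙≈ε⇒≈ {g} {h} p = ≈-sym (≈-trans (solve (g ∷ h ∷ []) p₁ (p₀ ⊙ (⊖ p₀ ⊙ p₁)) refl) (≈-trans (∙-congˡ p) (identityʳ g)))

  walk-unique : ∀ {g h} → (∀ i → i ≤ w → g ∙ xp i ≈ᵥ h ∙ xp i) → g ≈ h
  walk-unique p = ⁻¹∙≈ε⇒≈ (trivial-inter (λ i i≤w → ≈ᵥ⇒W i (p i i≤w)))

  sweep-shift : ∀ e j i k → sweep e (j + i) k ≈ conj (xp j) (sweep (λ z → e (j + z)) i k)
  sweep-shift e j i zero    = solve (xp j ∷ []) one (p₀ ⊙ one ⊙ ⊖ p₀) refl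
  sweep-shift e j i (suc k) = begin
    pw (e (j + i)) (bi (j + i)) ∙ sweep e (suc (j + i)) k
      ≈⟨ ∙-cong (head (e (j + i))) (≈-trans (reflexive (≡.cong (λ z → sweep e z k) (≡.sym (ℕ.+-suc j i)))) (sweep-shift e j (suc i) k)) ⟩
    conj (xp j) (pw (e (j + i)) (bi i)) ∙ conj (xp j) (sweep (λ z → e (j + z)) (suc i) k)
      ≈⟨ conj-∙ (xp j) _ _ ⟨
    conj (xp j) (pw (e (j + i)) (bi i) ∙ sweep (λ z → e (j + z)) (suc i) k) ∎
    where
    head : ∀ f → pw f (bi (j + i)) ≈ conj (xp j) (pw f (bi i))
    head true  = bi-xp j i
    head false = solve (xp j ∷ []) one (p₀ ⊙ one ⊙ ⊖ p₀) refl

  module ClosedWalk (v : ℕ → Carrier) (arc : ∀ i → Arc (v i) (v (suc i)))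
                    (periodic : ∀ i → v (Q + i) ≈ᵥ v i) where

    -- g xⁱ represents the i-th vertex for all i in the window [j ∸ w , j].
    Follows : ℕ → Carrier → Set
    Follows j g = ∀ i → i ≤ j → j ≤ i + w → g ∙ xp i ≈ᵥ v i

    -- As bⱼ xⁱ = xⁱ bⱼ₋ᵢ and bⱼ₋ᵢ ∈ K for 0 ≤ j - i < w, the correction by bⱼ needed for the new
    -- vertex does not disturb the vertices kept in the window.
    step : ∀ j {g} → Follows j g → ∃ λ e → Follows (suc j) (g ∙ pw e (bi j))
    step j {g} F = let e , p = arc-respˡ (≈ᵥ-sym (F j ℕ.≤-refl (ℕ.m≤m+n j w))) (arc j) in e , F′ e p
      where
      slide : ∀ e i k → i + k ≡ j → pw e (bi j) ∙ xp i ≈ xp i ∙ pw e (bi k)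
      slide false i k eq = ≈-trans (identityˡ _) (≈-sym (identityʳ _))
      slide true  i k refl = ≈-trans (∙-congʳ (bi-xp i k)) (solve (xp i ∷ bi k ∷ []) (p₀ ⊙ p₁ ⊙ ⊖ p₀ ⊙ p₀) (p₀ ⊙ p₁) refl)
      F′ : ∀ e → out (g ∙ xp j) e ≈ᵥ v (suc j) → Follows (suc j) (g ∙ pw e (bi j))
      F′ e p i i≤1+j 1+j≤ with ℕ.m≤n⇒m<n∨m≡n i≤1+j
      ... | inj₁ (s≤s i≤j) = ≈ᵥ-trans (≈ᵥ-sym (≈ᵥ-trans (≈ᵥ-∙K (g ∙ xp i) (K-pw e (j ∸ i)
              (ℕ.≤-trans (ℕ.≤-reflexive (≡.sym (ℕ.+-∸-assoc 1 i≤j))) (ℕ.≤-trans (ℕ.∸-monoˡ-≤ i 1+j≤) (ℕ.≤-reflexive (ℕ.m+n∸m≡n i w))))))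
              (≈ᵥ-reflexive (begin
                g ∙ xp i ∙ pw e (bi (j ∸ i))    ≈⟨ assoc _ _ _ ⟩
                g ∙ (xp i ∙ pw e (bi (j ∸ i)))  ≈⟨ ∙-congˡ (slide e i (j ∸ i) (ℕ.m+[n∸m]≡n i≤j)) ⟨
                g ∙ (pw e (bi j) ∙ xp i)        ≈⟨ assoc _ _ _ ⟨
                g ∙ pw e (bi j) ∙ xp i          ∎))))
              (F i i≤j (ℕ.≤-trans (ℕ.n≤1+n j) 1+j≤))
      ... | inj₂ refl = ≈ᵥ-trans (≈ᵥ-reflexive (begin
                g ∙ pw e (bi j) ∙ xp (suc j)      ≈⟨ ∙-congˡ (xp-suc j) ⟩
                g ∙ pw e (bi j) ∙ (xp j ∙ x)      ≈⟨ solve (g ∷ pw e (bi j) ∷ xp j ∷ x ∷ []) (p₀ ⊙ p₁ ⊙ (p₂ ⊙ p₃)) (p₀ ⊙ (p₁ ⊙ p₂) ⊙ p₃) refl ⟩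
                g ∙ (pw e (bi j) ∙ xp j) ∙ x      ≈⟨ ∙-congʳ (∙-congˡ (slide e j 0 (ℕ.+-identityʳ j))) ⟩
                g ∙ (xp j ∙ pw e b) ∙ x           ≈⟨ ∙-congʳ (assoc _ _ _) ⟨
                g ∙ xp j ∙ pw e b ∙ x             ∎)) p

    -- Sealed, since w is a successor and unfolding lift at w is expensive.
    abstract
      lift : ∀ j → ∃ (Follows j)
      lift zero    = v 0 , λ { zero _ _ → ≈ᵥ-reflexive (identityʳ _) }
      lift (suc j) = let g , F = lift j ; e , F′ = step j F in g ∙ pw e (bi j) , F′

      turn : ℕ → Bool
      turn j = proj₁ (step j (proj₂ (lift j)))

      lift-suc : ∀ j → proj₁ (lift (suc j)) ≡ proj₁ (lift j) ∙ pw (turn j) (bi j)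
      lift-suc j = refl

    g : ℕ → Carrier
    g j = proj₁ (lift j)

    g-sweep : ∀ i k → g (i + k) ≈ g i ∙ sweep turn i k
    g-sweep i zero    = ≈-trans (reflexive (≡.cong g (ℕ.+-identityʳ i))) (≈-sym (identityʳ _))
    g-sweep i (suc k) = begin
      g (i + suc k)                                          ≡⟨ ≡.cong g (ℕ.+-suc i k) ⟩
      g (suc i + k)                                          ≈⟨ g-sweep (suc i) k ⟩
      g (suc i) ∙ sweep turn (suc i) k                       ≡⟨ ≡.cong (_∙ sweep turn (suc i) k) (lift-suc i) ⟩
      g i ∙ pw (turn i) (bi i) ∙ sweep turn (suc i) k        ≈⟨ assoc _ _ _ ⟩
      g i ∙ (pw (turn i) (bi i) ∙ sweep turn (suc i) k)      ∎

    -- At times w and w + Q the last w + 1 vertices are the same, and x^Q = 1; by `walk-unique`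
    -- these vertices determine the representative.
    returns : g w ≈ g (w + Q)
    returns = walk-unique λ i i≤w → ≈ᵥ-trans (proj₂ (lift w) i i≤w (ℕ.m≤n+m w i)) (≈ᵥ-trans (≈ᵥ-sym (periodic i))
      (≈ᵥ-trans (≈ᵥ-sym (proj₂ (lift (w + Q)) (Q + i)
        (≡.subst (Q + i ≤_) (ℕ.+-comm Q w) (ℕ.+-monoʳ-≤ Q i≤w))
        (≡.subst (_≤ Q + i + w) (ℕ.+-comm Q w) (ℕ.+-monoˡ-≤ w (ℕ.m≤m+n Q i)))))
        (≈ᵥ-reflexive (∙-congˡ (≈-trans (xp-+ Q i) (≈-trans (∙-congʳ x^Q) (identityˡ _)))))))

    no-turn : ∀ j → j < Q → turn (w + j) ≡ false
    no-turn = sweep-inj (λ z → turn (w + z)) (conj-inj (xp w) (begin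
      conj (xp w) (sweep (λ z → turn (w + z)) 0 Q)  ≈⟨ sweep-shift turn w 0 Q ⟨
      sweep turn (w + 0) Q                          ≡⟨ ≡.cong (λ z → sweep turn z Q) (ℕ.+-identityʳ w) ⟩
      sweep turn w Q                                ≈⟨ solve (g w ∷ sweep turn w Q ∷ []) p₁ (⊖ p₀ ⊙ (p₀ ⊙ p₁)) refl ⟩
      g w ⁻¹ ∙ (g w ∙ sweep turn w Q)               ≈⟨ ∙-congˡ (≈-trans returns (g-sweep w Q)) ⟨
      g w ⁻¹ ∙ g w                                  ≈⟨ solve (g w ∷ xp w ∷ []) (⊖ p₀ ⊙ p₀) (p₁ ⊙ one ⊙ ⊖ p₁) refl ⟩
      conj (xp w) ε                                 ∎))

    g-const : ∀ j → j ≤ Q → g (w + j) ≈ g w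
    g-const zero    _   = reflexive (≡.cong g (ℕ.+-identityʳ w))
    g-const (suc j) j<Q = begin
      g (w + suc j)                                     ≡⟨ ≡.cong g (ℕ.+-suc w j) ⟩
      g (suc (w + j))                                   ≡⟨ lift-suc (w + j) ⟩
      g (w + j) ∙ pw (turn (w + j)) (bi (w + j))        ≡⟨ ≡.cong (λ e → g (w + j) ∙ pw e (bi (w + j))) (no-turn j j<Q) ⟩
      g (w + j) ∙ ε                                     ≈⟨ identityʳ _ ⟩
      g (w + j)                                         ≈⟨ g-const j (ℕ.<⇒≤ j<Q) ⟩
      g w                                               ∎

    straight : ∀ i → i ≤ Q → g w ∙ xp i ≈ᵥ v i
    straight i i≤Q = ≈ᵥ-trans (≈ᵥ-reflexive (∙-congʳ (≈-sym (g-const i i≤Q))))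
      (proj₂ (lift (w + i)) i (ℕ.m≤n+m i w) (ℕ.≤-reflexive (ℕ.+-comm w i)))

  xp-Q∸ : ∀ j → j ≤ Q → xp (Q ∸ j) ≈ xp j ⁻¹
  xp-Q∸ j j≤Q = inverseˡ-unique _ _ (≈-trans (≈-sym (xp-+ (Q ∸ j) j)) (≈-trans (reflexive (≡.cong xp (ℕ.m∸n+n≡m j≤Q))) x^Q))

  W-one : ∀ {d} → W w′ (w ∸ w′) d → d ≈ ε ⊎ bi w′ ∙ d ≈ ε
  W-one {d} p with ≡.subst (λ z → W w′ z d) (ℕ.m+n∸n≡m 1 w′) p
  ... | inj₁ q = inj₁ q
  ... | inj₂ q = inj₂ q

  bi-unique : ∀ i {d} → bi i ∙ d ≈ ε → d ≈ bi i
  bi-unique i p = ≈-trans (inverseʳ-unique _ _ p) (bi⁻¹ i)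

  module _ (φ : Group.Carrier (Aut Γ)) where
    private
      module φ = Inverse (proj₁ φ)
      f = φ.to
      adj = proj₂ φ

    f-inj : ∀ {u v} → f u ≈ᵥ f v → u ≈ᵥ v
    f-inj p = ≈ᵥ-trans (≈ᵥ-sym (φ.inverseʳ (≈ᵥ-sym p))) (φ.inverseʳ ≈ᵥ-refl)

    f-sur : ∀ u → f (φ.from u) ≈ᵥ u
    f-sur u = φ.inverseˡ ≈ᵥ-refl

    -- Otherwise the out-twin of f v, pulled back along f, would be a second common neighbour of c
    -- and a, against `mixed-unique`.
    straight-out : ∀ {c v a} → Arc c v → Arc v a → Arc (f v) (f c) → ¬ Arc (f v) (f a)
    straight-out {c} {v} {a} cv va vc va′ = let t , v≉t , arcs = out-twin (f v) in
      v≉t (≈ᵥ-trans (φ.to-cong (mixed-unique cv va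
        (proj₂ (adj (φ.from t) a) (inj₁ (arc-respˡ (≈ᵥ-sym (f-sur t)) (arcs va′))))
        (swap (proj₂ (adj (φ.from t) c) (inj₁ (arc-respˡ (≈ᵥ-sym (f-sur t)) (arcs vc))))))) (f-sur t))

    straight-in : ∀ {c v a} → Arc c v → Arc v a → Arc (f c) (f v) → ¬ Arc (f a) (f v)
    straight-in {c} {v} {a} cv va cv′ av = let t , v≉t , arcs = in-twin (f v) in
      v≉t (≈ᵥ-trans (φ.to-cong (mixed-unique cv va
        (swap (proj₂ (adj a (φ.from t)) (inj₁ (arc-respʳ (≈ᵥ-sym (f-sur t)) (arcs av)))))
        (proj₂ (adj c (φ.from t)) (inj₁ (arc-respʳ (≈ᵥ-sym (f-sur t)) (arcs cv′)))))) (f-sur t))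

    Preserves Reverses : Set
    Preserves = ∀ {u v} → Arc u v → Arc (f u) (f v)
    Reverses  = ∀ {u v} → Arc u v → Arc (f v) (f u)

    module Orient (P : Carrier → Carrier → Set)
      (P-resp : ∀ {u u′ v v′} → u ≈ᵥ u′ → v ≈ᵥ v′ → P u v → P u′ v′)
      (ahead : ∀ {c v a} → Arc c v → Arc v a → P c v → P v a)
      (behind : ∀ {c v a} → Arc c v → Arc v a → P v a → P c v)
      (base : P ε x) where

      along : ∀ {u} → Generated u → P u (u ∙ x)
      along gen-ε = P-resp ≈ᵥ-refl (≈ᵥ-reflexive (≈-sym (identityˡ x))) base
      along (gen-x {u} p) = ahead (arc-x u) (arc-x _) (along p)
      -- From the arc u → u x one goes back along an in-arc of u and forward again to reach the
      -- other out-arc u → u b x; u and u b are the same vertex.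
      along (gen-b {u} p) = P-resp (≈ᵥ-∙K u (K-bi 0 (s≤s z≤n))) ≈ᵥ-refl
        (ahead (arc-inn u false) (arc-bx u) (behind (arc-inn u false) (arc-x u) (along p)))
      along (gen-≈ p q) = P-resp (≈ᵥ-reflexive p) (≈ᵥ-reflexive (∙-congʳ p)) (along q)

      everywhere : ∀ {u v} → Arc u v → P u v
      everywhere {u} (false , p) = P-resp ≈ᵥ-refl (≈ᵥ-trans (≈ᵥ-reflexive (∙-congʳ (≈-sym (identityʳ u)))) p) (along (generates u))
      everywhere {u} (true , p)  = P-resp (≈ᵥ-sym (≈ᵥ-∙K u (K-bi 0 (s≤s z≤n)))) p (along (generates (u ∙ b)))

    orientation : Preserves ⊎ Reverses
    orientation = decide (proj₁ (adj ε x) (inj₁ (arc-respʳ (≈ᵥ-reflexive (identityˡ x)) (arc-x ε))))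
      where
      one-way : ∀ {A B : Set} → A ⊎ B → ¬ B → A
      one-way (inj₁ p) _ = p
      one-way (inj₂ p) q = ⊥-elim (q p)

      decide : Arc (f ε) (f x) ⊎ Arc (f x) (f ε) → Preserves ⊎ Reverses
      decide (inj₁ a) = inj₁ (Orient.everywhere (λ u v → Arc (f u) (f v))
        (λ p q r → arc-respˡ (φ.to-cong p) (arc-respʳ (φ.to-cong q) r))
        (λ {c} {v} {a} cv va p → one-way (proj₁ (adj v a) (inj₁ va)) (straight-in cv va p))
        (λ {c} {v} {a} cv va p → one-way (proj₁ (adj c v) (inj₁ cv)) (λ q → straight-out cv va q p)) a)
      decide (inj₂ a) = inj₂ (Orient.everywhere (λ u v → Arc (f v) (f u))
        (λ p q r → arc-respˡ (φ.to-cong q) (arc-respʳ (φ.to-cong p) r))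
        (λ {c} {v} {a} cv va p → one-way (swap (proj₁ (adj v a) (inj₁ va))) (straight-out cv va p))
        (λ {c} {v} {a} cv va p → one-way (swap (proj₁ (adj c v) (inj₁ cv))) (λ q → straight-in cv va q p)) a)

    private
      f-cong : ∀ {u v} → u ≈ v → f u ≈ᵥ f v
      f-cong p = φ.to-cong (≈ᵥ-reflexive p)

    module Preserving (pres : Preserves) where

      abstract
        walk : ∀ g → ∃ λ h → ∀ i → i ≤ Q → h ∙ xp i ≈ᵥ f (g ∙ xp i)
        walk g = ClosedWalk.g v arc periodic w , ClosedWalk.straight v arc periodic
          where
          v : ℕ → Carrier
          v i = f (g ∙ xp i)
          arc : ∀ i → Arc (v i) (v (suc i))
          arc i = pres (arc-respʳ (≈ᵥ-reflexive (≈-trans (assoc _ _ _) (∙-congˡ (≈-sym (xp-suc i))))) (arc-x _))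
          periodic : ∀ i → v (Q + i) ≈ᵥ v i
          periodic i = f-cong (∙-congˡ (≈-trans (xp-+ Q i) (≈-trans (∙-congʳ x^Q) (identityˡ _))))

      ψ : Carrier → Carrier
      ψ g = proj₁ (walk g)

      ψ-spec : ∀ g i → i ≤ Q → ψ g ∙ xp i ≈ᵥ f (g ∙ xp i)
      ψ-spec g = proj₂ (walk g)

      ψ-cong : ∀ {g h} → g ≈ h → ψ g ≈ ψ h
      ψ-cong {g} {h} p = walk-unique λ i i≤w → ≈ᵥ-trans (ψ-spec g i (ℕ.≤-trans i≤w (ℕ.<⇒≤ w<Q)))
        (≈ᵥ-trans (f-cong (∙-congʳ p)) (≈ᵥ-sym (ψ-spec h i (ℕ.≤-trans i≤w (ℕ.<⇒≤ w<Q)))))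

      ψ-x : ∀ g → ψ (g ∙ x) ≈ ψ g ∙ x
      ψ-x g = walk-unique λ i i≤w → ≈ᵥ-trans (ψ-spec (g ∙ x) i (ℕ.≤-trans i≤w (ℕ.<⇒≤ w<Q)))
        (≈ᵥ-trans (f-cong (assoc _ _ _)) (≈ᵥ-trans (≈ᵥ-sym (ψ-spec g (suc i) (ℕ.≤-trans (s≤s i≤w) w<Q)))
        (≈ᵥ-reflexive (≈-sym (assoc _ _ _)))))

      -- As b x⁻ʲ = x⁻ʲ bⱼ, the walks of g and g b agree at the times -j with 0 ≤ j ≤ w′. So d lies
      -- in w conjugates of K, which intersect in {1 , b}, and d = 1 would make f identify the
      -- distinct vertices g x K and g b x K. The times -j are written Q ∸ j.
      ψ-b : ∀ g → ψ (g ∙ b) ≈ ψ g ∙ b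
      ψ-b g = cases (W-one (W-inter* w′ (ℕ.n≤1+n w′) shifted))
        where
        d = ψ g ⁻¹ ∙ ψ (g ∙ b)
        shared : ∀ j → j ≤ w′ → K (conj (xp j) d)
        shared j j≤ = K-resp (≈-trans (∙-cong (⁻¹-cong (∙-congˡ (xp-Q∸ j j≤Q))) (∙-congˡ (xp-Q∸ j j≤Q)))
            (solve (ψ g ∷ ψ (g ∙ b) ∷ xp j ∷ []) (⊖ (p₀ ⊙ ⊖ p₂) ⊙ (p₁ ⊙ ⊖ p₂)) (p₂ ⊙ (⊖ p₀ ⊙ p₁) ⊙ ⊖ p₂) refl))
          (≈ᵥ-trans (ψ-spec g (Q ∸ j) (ℕ.m∸n≤m Q j)) (≈ᵥ-trans
            (φ.to-cong (≈ᵥ-trans (≈ᵥ-∙K _ (K-bi j (s≤s j≤))) (≈ᵥ-reflexive eq)))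
            (≈ᵥ-sym (ψ-spec (g ∙ b) (Q ∸ j) (ℕ.m∸n≤m Q j)))))
          where
          j≤Q : j ≤ Q
          j≤Q = ℕ.≤-trans (ℕ.≤-trans j≤ (ℕ.n≤1+n w′)) (ℕ.<⇒≤ w<Q)
          eq : g ∙ xp (Q ∸ j) ∙ bi j ≈ g ∙ b ∙ xp (Q ∸ j)
          eq = begin
            g ∙ xp (Q ∸ j) ∙ bi j               ≈⟨ ∙-cong (∙-congˡ (xp-Q∸ j j≤Q)) (bi-xp₀ j) ⟩
            g ∙ xp j ⁻¹ ∙ conj (xp j) b         ≈⟨ solve (g ∷ xp j ∷ b ∷ []) (p₀ ⊙ ⊖ p₁ ⊙ (p₁ ⊙ p₂ ⊙ ⊖ p₁)) (p₀ ⊙ p₂ ⊙ ⊖ p₁) refl ⟩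
            g ∙ b ∙ xp j ⁻¹                     ≈⟨ ∙-congˡ (xp-Q∸ j j≤Q) ⟨
            g ∙ b ∙ xp (Q ∸ j)                  ∎
        shifted : ∀ i → i ≤ w′ → W i w (conj (xp w′) d)
        shifted i i≤ = W-resp i w eq (≡.subst (λ z → W z w (conj (xp i) (conj (xp (w′ ∸ i)) d))) (ℕ.+-identityʳ i)
            (W-up* i 0 w (shared (w′ ∸ i) (ℕ.m∸n≤m w′ i))))
          where
          eq : conj (xp i) (conj (xp (w′ ∸ i)) d) ≈ conj (xp w′) d
          eq = begin
            conj (xp i) (conj (xp (w′ ∸ i)) d)  ≈⟨ solve (xp i ∷ xp (w′ ∸ i) ∷ d ∷ []) (p₀ ⊙ (p₁ ⊙ p₂ ⊙ ⊖ p₁) ⊙ ⊖ p₀) (p₀ ⊙ p₁ ⊙ p₂ ⊙ ⊖ (p₀ ⊙ p₁)) refl ⟩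
            conj (xp i ∙ xp (w′ ∸ i)) d         ≈⟨ ∙-cong (∙-congʳ eq′) (⁻¹-cong eq′) ⟩
            conj (xp w′) d                      ∎
            where
            eq′ : xp i ∙ xp (w′ ∸ i) ≈ xp w′
            eq′ = ≈-trans (≈-sym (xp-+ i (w′ ∸ i))) (reflexive (≡.cong xp (ℕ.m+[n∸m]≡n i≤)))
        cases : conj (xp w′) d ≈ ε ⊎ bi w′ ∙ conj (xp w′) d ≈ ε → ψ (g ∙ b) ≈ ψ g ∙ b
        cases (inj₁ p) = ⊥-elim (b₋₁∉K (K-resp
            (solve (g ∷ b ∷ x ∷ []) (⊖ (p₀ ⊙ (p₂ ⊙ one)) ⊙ (p₀ ⊙ p₁ ⊙ (p₂ ⊙ one))) (⊖ p₂ ⊙ p₁ ⊙ p₂) refl)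
            (f-inj (≈ᵥ-trans (≈ᵥ-sym (ψ-spec g 1 1≤Q)) (≈ᵥ-trans
              (≈ᵥ-reflexive (∙-congʳ (⁻¹∙≈ε⇒≈ (conj-inj (xp w′) (≈-trans p (solve (xp w′ ∷ []) one (p₀ ⊙ one ⊙ ⊖ p₀) refl))))))
              (ψ-spec (g ∙ b) 1 1≤Q))))))
          where
          1≤Q : 1 ≤ Q
          1≤Q = ℕ.≤-trans (s≤s z≤n) w<Q
        cases (inj₂ p) = begin
          ψ (g ∙ b)          ≈⟨ solve (ψ g ∷ ψ (g ∙ b) ∷ []) p₁ (p₀ ⊙ (⊖ p₀ ⊙ p₁)) refl ⟩
          ψ g ∙ d            ≈⟨ ∙-congˡ (conj-inj (xp w′) (≈-trans (bi-unique w′ p) (bi-xp₀ w′))) ⟩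
          ψ g ∙ b            ∎

      ψ-left : ∀ {g} → Generated g → ψ g ≈ ψ ε ∙ g
      ψ-left gen-ε = ≈-sym (identityʳ _)
      ψ-left (gen-b {u} p) = ≈-trans (ψ-b u) (≈-trans (∙-congʳ (ψ-left p)) (assoc _ _ _))
      ψ-left (gen-x {u} p) = ≈-trans (ψ-x u) (≈-trans (∙-congʳ (ψ-left p)) (assoc _ _ _))
      ψ-left (gen-≈ p q) = ≈-trans (ψ-cong (≈-sym p)) (≈-trans (ψ-left q) (∙-congˡ p))

      is-left : ∀ g → f g ≈ᵥ ψ ε ∙ g
      is-left g = ≈ᵥ-trans (f-cong (≈-sym (identityʳ g))) (≈ᵥ-trans (≈ᵥ-sym (ψ-spec g 0 z≤n))
        (≈ᵥ-reflexive (≈-trans (identityʳ _) (ψ-left (generates g)))))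

    module Reversing (rev : Reverses) where

      abstract
        walk : ∀ g → ∃ λ h → ∀ i → i ≤ Q → h ∙ xp i ≈ᵥ f (g ∙ xp i ⁻¹)
        walk g = ClosedWalk.g v arc periodic w , ClosedWalk.straight v arc periodic
          where
          v : ℕ → Carrier
          v i = f (g ∙ xp i ⁻¹)
          arc : ∀ i → Arc (v i) (v (suc i))
          arc i = rev (arc-respʳ (≈ᵥ-reflexive (solve (g ∷ x ∷ xp i ∷ []) (p₀ ⊙ ⊖ (p₁ ⊙ p₂) ⊙ p₁) (p₀ ⊙ ⊖ p₂) refl)) (arc-x _))
          periodic : ∀ i → v (Q + i) ≈ᵥ v i
          periodic i = f-cong (∙-congˡ (⁻¹-cong (≈-trans (xp-+ Q i) (≈-trans (∙-congʳ x^Q) (identityˡ _)))))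

      ψ : Carrier → Carrier
      ψ g = proj₁ (walk g)

      ψ-spec : ∀ g i → i ≤ Q → ψ g ∙ xp i ≈ᵥ f (g ∙ xp i ⁻¹)
      ψ-spec g = proj₂ (walk g)

      ψ-cong : ∀ {g h} → g ≈ h → ψ g ≈ ψ h
      ψ-cong {g} {h} p = walk-unique λ i i≤w → ≈ᵥ-trans (ψ-spec g i (ℕ.≤-trans i≤w (ℕ.<⇒≤ w<Q)))
        (≈ᵥ-trans (f-cong (∙-congʳ p)) (≈ᵥ-sym (ψ-spec h i (ℕ.≤-trans i≤w (ℕ.<⇒≤ w<Q)))))

      ψ-x⁻¹ : ∀ g → ψ (g ∙ x ⁻¹) ≈ ψ g ∙ x
      ψ-x⁻¹ g = walk-unique λ i i≤w → ≈ᵥ-trans (ψ-spec (g ∙ x ⁻¹) i (ℕ.≤-trans i≤w (ℕ.<⇒≤ w<Q)))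
        (≈ᵥ-trans (f-cong (≈-trans (solve (g ∷ x ∷ xp i ∷ []) (p₀ ⊙ ⊖ p₁ ⊙ ⊖ p₂) (p₀ ⊙ ⊖ (p₂ ⊙ p₁)) refl) (∙-congˡ (⁻¹-cong (≈-sym (xp-suc i))))))
        (≈ᵥ-trans (≈ᵥ-sym (ψ-spec g (suc i) (ℕ.≤-trans (s≤s i≤w) w<Q)))
        (≈ᵥ-reflexive (≈-sym (assoc _ _ _)))))

      ψ-x : ∀ g → ψ (g ∙ x) ≈ ψ g ∙ x ⁻¹
      ψ-x g = begin
        ψ (g ∙ x)                   ≈⟨ solve (ψ (g ∙ x) ∷ x ∷ []) p₀ (p₀ ⊙ p₁ ⊙ ⊖ p₁) refl ⟩
        ψ (g ∙ x) ∙ x ∙ x ⁻¹        ≈⟨ ∙-congʳ (ψ-x⁻¹ (g ∙ x)) ⟨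
        ψ (g ∙ x ∙ x ⁻¹) ∙ x ⁻¹     ≈⟨ ∙-congʳ (ψ-cong (solve (g ∷ x ∷ []) (p₀ ⊙ p₁ ⊙ ⊖ p₁) p₀ refl)) ⟩
        ψ g ∙ x ⁻¹                  ∎

      -- After reversal the common stretch of the two walks runs forward from 0 to w′, so the
      -- conjugates of K now intersect in {1 , b_{w′}}.
      ψ-b : ∀ g → ψ (g ∙ b) ≈ ψ g ∙ bi w′
      ψ-b g = cases (W-one (W-inter* w′ (ℕ.n≤1+n w′) shared))
        where
        d = ψ g ⁻¹ ∙ ψ (g ∙ b)
        shared : ∀ i → i ≤ w′ → W i w d
        shared i i≤ = ≈ᵥ⇒W i (≈ᵥ-trans (ψ-spec g i i≤Q) (≈ᵥ-trans
            (φ.to-cong (≈ᵥ-trans (≈ᵥ-∙K _ (K-bi i (s≤s i≤))) (≈ᵥ-reflexive (≈-trans (∙-congˡ (bi-xp₀ i))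
              (solve (g ∷ xp i ∷ b ∷ []) (p₀ ⊙ ⊖ p₁ ⊙ (p₁ ⊙ p₂ ⊙ ⊖ p₁)) (p₀ ⊙ p₂ ⊙ ⊖ p₁) refl)))))
            (≈ᵥ-sym (ψ-spec (g ∙ b) i i≤Q))))
          where
          i≤Q : i ≤ Q
          i≤Q = ℕ.≤-trans (ℕ.≤-trans i≤ (ℕ.n≤1+n w′)) (ℕ.<⇒≤ w<Q)
        cases : d ≈ ε ⊎ bi w′ ∙ d ≈ ε → ψ (g ∙ b) ≈ ψ g ∙ bi w′
        cases (inj₁ p) = ⊥-elim (biw∉K (K-resp (≈-trans
            (solve (g ∷ b ∷ xp w ∷ []) (⊖ (p₀ ⊙ ⊖ p₂) ⊙ (p₀ ⊙ p₁ ⊙ ⊖ p₂)) (p₂ ⊙ p₁ ⊙ ⊖ p₂) refl) (≈-sym (bi-xp₀ w)))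
            (f-inj (≈ᵥ-trans (≈ᵥ-sym (ψ-spec g w (ℕ.<⇒≤ w<Q))) (≈ᵥ-trans
              (≈ᵥ-reflexive (∙-congʳ (⁻¹∙≈ε⇒≈ p)))
              (ψ-spec (g ∙ b) w (ℕ.<⇒≤ w<Q)))))))
        cases (inj₂ p) = ≈-trans (solve (ψ g ∷ ψ (g ∙ b) ∷ []) p₁ (p₀ ⊙ (⊖ p₀ ⊙ p₁)) refl) (∙-congˡ (bi-unique w′ p))

      -- This is b_{w′-i}, also when w′ - i is negative.
      mirror : ℕ → Carrier
      mirror zero    = bi w′
      mirror (suc i) = x ⁻¹ ∙ mirror i ∙ x

      ψ-bi : ∀ i g → ψ (g ∙ bi i) ≈ ψ g ∙ mirror i
      ψ-bi zero    g = ψ-b g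
      ψ-bi (suc i) g = begin
        ψ (g ∙ (x ∙ bi i ∙ x ⁻¹))           ≈⟨ ψ-cong (solve (g ∷ x ∷ bi i ∷ []) (p₀ ⊙ (p₁ ⊙ p₂ ⊙ ⊖ p₁)) (p₀ ⊙ p₁ ⊙ p₂ ⊙ ⊖ p₁) refl) ⟩
        ψ (g ∙ x ∙ bi i ∙ x ⁻¹)             ≈⟨ ψ-x⁻¹ _ ⟩
        ψ (g ∙ x ∙ bi i) ∙ x                ≈⟨ ∙-congʳ (ψ-bi i (g ∙ x)) ⟩
        ψ (g ∙ x) ∙ mirror i ∙ x            ≈⟨ ∙-congʳ (∙-congʳ (ψ-x g)) ⟩
        ψ g ∙ x ⁻¹ ∙ mirror i ∙ x           ≈⟨ solve (ψ g ∷ x ∷ mirror i ∷ []) (p₀ ⊙ ⊖ p₁ ⊙ p₂ ⊙ p₁) (p₀ ⊙ (⊖ p₁ ⊙ p₂ ⊙ p₁)) refl ⟩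
        ψ g ∙ (x ⁻¹ ∙ mirror i ∙ x)         ∎

      -- The identification of `mirror i` with b_{w′-i}, conjugated far enough for all exponents to
      -- be natural numbers.
      mirror-bi : ∀ i j → conj (xp (i + j)) (mirror i) ≈ conj (xp w′) (bi j)
      mirror-bi zero j = begin
        conj (xp j) (bi w′)     ≈⟨ bi-xp j w′ ⟨
        bi (j + w′)             ≡⟨ ≡.cong bi (ℕ.+-comm j w′) ⟩
        bi (w′ + j)             ≈⟨ bi-xp w′ j ⟩
        conj (xp w′) (bi j)     ∎
      mirror-bi (suc i) j = begin
        conj (xp (suc (i + j))) (x ⁻¹ ∙ mirror i ∙ x)      ≈⟨ ∙-cong (∙-congʳ (xp-suc (i + j))) (⁻¹-cong (xp-suc (i + j))) ⟩
        conj (xp (i + j) ∙ x) (x ⁻¹ ∙ mirror i ∙ x)        ≈⟨ solve (xp (i + j) ∷ x ∷ mirror i ∷ []) (p₀ ⊙ p₁ ⊙ (⊖ p₁ ⊙ p₂ ⊙ p₁) ⊙ ⊖ (p₀ ⊙ p₁)) (p₀ ⊙ p₂ ⊙ ⊖ p₀) refl ⟩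
        conj (xp (i + j)) (mirror i)                       ≈⟨ mirror-bi i j ⟩
        conj (xp w′) (bi j)                                ∎

      -- ψ turns the indices 0, 1, ℓ + 1 of `chiral` into w′, w′ - 1, w′ - ℓ - 1. Up to conjugation
      -- by a power of x these are ℓ + 1, ℓ, 0, the indices of `chiral-not`.
      impossible : ⊥
      impossible = chiral-not (conj-inj (xp w′) (begin
        conj (xp w′) (bi ℓ ∙ b ∙ (bi ℓ ∙ b) ∙ bi (suc ℓ))     ≈⟨ comm-word (xp w′) (bi ℓ) b (bi (suc ℓ)) ⟩
        c₁ ∙ c₂ ∙ (c₁ ∙ c₂) ∙ c₃                              ≈⟨ ∙-cong (∙-cong (∙-cong m₁ m₂) (∙-cong m₁ m₂)) m₀ ⟨
        y₁ ∙ y₂ ∙ (y₁ ∙ y₂) ∙ y₀                              ≈⟨ comm-word (xp (suc ℓ)) _ _ _ ⟨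
        conj (xp (suc ℓ)) (mirror 1 ∙ mirror (suc ℓ) ∙ (mirror 1 ∙ mirror (suc ℓ)) ∙ mirror 0)  ≈⟨ conj-cong (xp (suc ℓ)) mirrored ⟩
        conj (xp (suc ℓ)) (mirror 0 ∙ (mirror 1 ∙ mirror (suc ℓ) ∙ (mirror 1 ∙ mirror (suc ℓ))))  ≈⟨ comm-word′ (xp (suc ℓ)) _ _ _ ⟩
        y₀ ∙ (y₁ ∙ y₂ ∙ (y₁ ∙ y₂))                            ≈⟨ ∙-cong m₀ (∙-cong (∙-cong m₁ m₂) (∙-cong m₁ m₂)) ⟩
        c₃ ∙ (c₁ ∙ c₂ ∙ (c₁ ∙ c₂))                            ≈⟨ comm-word′ (xp w′) (bi ℓ) b (bi (suc ℓ)) ⟨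
        conj (xp w′) (bi (suc ℓ) ∙ (bi ℓ ∙ b ∙ (bi ℓ ∙ b)))   ∎))
        where
        c₁ = conj (xp w′) (bi ℓ)
        c₂ = conj (xp w′) b
        c₃ = conj (xp w′) (bi (suc ℓ))
        y₀ = conj (xp (suc ℓ)) (mirror 0)
        y₁ = conj (xp (suc ℓ)) (mirror 1)
        y₂ = conj (xp (suc ℓ)) (mirror (suc ℓ))
        m₀ : y₀ ≈ c₃
        m₀ = mirror-bi 0 (suc ℓ)
        m₁ : y₁ ≈ c₁
        m₁ = mirror-bi 1 ℓ
        m₂ : y₂ ≈ c₂
        m₂ = ≈-trans (reflexive (≡.cong (λ z → conj (xp z) (mirror (suc ℓ))) (≡.sym (ℕ.+-identityʳ (suc ℓ))))) (mirror-bi (suc ℓ) 0)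
        comm-word : ∀ g r s t → conj g (r ∙ s ∙ (r ∙ s) ∙ t) ≈ conj g r ∙ conj g s ∙ (conj g r ∙ conj g s) ∙ conj g t
        comm-word g r s t = solve (g ∷ r ∷ s ∷ t ∷ []) (p₀ ⊙ (p₁ ⊙ p₂ ⊙ (p₁ ⊙ p₂) ⊙ p₃) ⊙ ⊖ p₀)
          ((p₀ ⊙ p₁ ⊙ ⊖ p₀) ⊙ (p₀ ⊙ p₂ ⊙ ⊖ p₀) ⊙ ((p₀ ⊙ p₁ ⊙ ⊖ p₀) ⊙ (p₀ ⊙ p₂ ⊙ ⊖ p₀)) ⊙ (p₀ ⊙ p₃ ⊙ ⊖ p₀)) refl
        comm-word′ : ∀ g r s t → conj g (t ∙ (r ∙ s ∙ (r ∙ s))) ≈ conj g t ∙ (conj g r ∙ conj g s ∙ (conj g r ∙ conj g s))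
        comm-word′ g r s t = solve (g ∷ r ∷ s ∷ t ∷ []) (p₀ ⊙ (p₃ ⊙ (p₁ ⊙ p₂ ⊙ (p₁ ⊙ p₂))) ⊙ ⊖ p₀)
          ((p₀ ⊙ p₃ ⊙ ⊖ p₀) ⊙ ((p₀ ⊙ p₁ ⊙ ⊖ p₀) ⊙ (p₀ ⊙ p₂ ⊙ ⊖ p₀) ⊙ ((p₀ ⊙ p₁ ⊙ ⊖ p₀) ⊙ (p₀ ⊙ p₂ ⊙ ⊖ p₀)))) refl
        ψ-5 : ∀ i j k l r → ψ (ε ∙ bi i ∙ bi j ∙ bi k ∙ bi l ∙ bi r) ≈ ψ ε ∙ mirror i ∙ mirror j ∙ mirror k ∙ mirror l ∙ mirror r
        ψ-5 i j k l r = ≈-trans (ψ-bi r _) (∙-congʳ (≈-trans (ψ-bi l _) (∙-congʳ (≈-trans (ψ-bi k _) (∙-congʳ (≈-trans (ψ-bi j _) (∙-congʳ (ψ-bi i _))))))))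
        B = bi (suc ℓ)
        M = mirror (suc ℓ)
        mirrored : mirror 1 ∙ M ∙ (mirror 1 ∙ M) ∙ mirror 0 ≈ mirror 0 ∙ (mirror 1 ∙ M ∙ (mirror 1 ∙ M))
        mirrored = ∙-cancelˡ (ψ ε) _ _ (begin
          ψ ε ∙ (mirror 1 ∙ M ∙ (mirror 1 ∙ M) ∙ mirror 0)
            ≈⟨ solve (ψ ε ∷ mirror 1 ∷ M ∷ mirror 0 ∷ []) (p₀ ⊙ (p₁ ⊙ p₂ ⊙ (p₁ ⊙ p₂) ⊙ p₃)) (p₀ ⊙ p₁ ⊙ p₂ ⊙ p₁ ⊙ p₂ ⊙ p₃) refl ⟩
          ψ ε ∙ mirror 1 ∙ M ∙ mirror 1 ∙ M ∙ mirror 0   ≈⟨ ψ-5 1 (suc ℓ) 1 (suc ℓ) 0 ⟨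
          ψ (ε ∙ bi 1 ∙ B ∙ bi 1 ∙ B ∙ b)                ≈⟨ ψ-cong (solve (bi 1 ∷ B ∷ b ∷ []) (one ⊙ p₀ ⊙ p₁ ⊙ p₀ ⊙ p₁ ⊙ p₂) (p₀ ⊙ p₁ ⊙ (p₀ ⊙ p₁) ⊙ p₂) refl) ⟩
          ψ (bi 1 ∙ B ∙ (bi 1 ∙ B) ∙ b)                  ≈⟨ ψ-cong chiral ⟩
          ψ (b ∙ (bi 1 ∙ B ∙ (bi 1 ∙ B)))                ≈⟨ ψ-cong (solve (bi 1 ∷ B ∷ b ∷ []) (p₂ ⊙ (p₀ ⊙ p₁ ⊙ (p₀ ⊙ p₁))) (one ⊙ p₂ ⊙ p₀ ⊙ p₁ ⊙ p₀ ⊙ p₁) refl) ⟩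
          ψ (ε ∙ b ∙ bi 1 ∙ B ∙ bi 1 ∙ B)                ≈⟨ ψ-5 0 1 (suc ℓ) 1 (suc ℓ) ⟩
          ψ ε ∙ mirror 0 ∙ mirror 1 ∙ M ∙ mirror 1 ∙ M
            ≈⟨ solve (ψ ε ∷ mirror 1 ∷ M ∷ mirror 0 ∷ []) (p₀ ⊙ p₃ ⊙ p₁ ⊙ p₂ ⊙ p₁ ⊙ p₂) (p₀ ⊙ (p₃ ⊙ (p₁ ⊙ p₂ ⊙ (p₁ ⊙ p₂)))) refl ⟩
          ψ ε ∙ (mirror 0 ∙ (mirror 1 ∙ M ∙ (mirror 1 ∙ M)))  ∎)

    abstract
      aut-is-left : ∃ λ u → ∀ g → f g ≈ᵥ u ∙ g
      aut-is-left = decide orientation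
        where
        decide : Preserves ⊎ Reverses → ∃ λ u → ∀ g → f g ≈ᵥ u ∙ g
        decide (inj₁ pres) = Preserving.ψ pres ε , Preserving.is-left pres
        decide (inj₂ rev)  = ⊥-elim (Reversing.impossible rev)

-- Finiteness

module _ (S : Setoid 0ℓ 0ℓ) (_≟_ : Decidable (Setoid._≈_ S)) where
  open Setoid S hiding (refl)

  distinct-values : ∀ k (s : Fin k → Carrier) → ∃ λ m → ∃ λ (t : Fin m → Carrier) →
    (∀ i j → t i ≈ t j → i ≡ j) × (∀ i → ∃ λ j → t j ≈ s i)
  distinct-values zero    s = 0 , (λ ()) , (λ ()) , (λ ())
  distinct-values (suc k) s with distinct-values k (λ i → s (suc i))
  ... | m , t , t-inj , t-sur with Fin.any? (λ j → t j ≟ s zero)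
  ...   | yes p = m , t , t-inj , λ { zero → p ; (suc i) → t-sur i }
  ...   | no ¬p = suc m , t′ , t′-inj , t′-sur
    where
    t′ : Fin (suc m) → Carrier
    t′ zero    = s zero
    t′ (suc i) = t i
    t′-inj : ∀ i j → t′ i ≈ t′ j → i ≡ j
    t′-inj zero    zero    _ = refl
    t′-inj zero    (suc j) p = ⊥-elim (¬p (j , sym p))
    t′-inj (suc i) zero    p = ⊥-elim (¬p (i , p))
    t′-inj (suc i) (suc j) p = ≡.cong suc (t-inj i j p)
    t′-sur : ∀ i → ∃ λ j → t′ j ≈ s i
    t′-sur zero    = zero , Setoid.refl S
    t′-sur (suc i) = let j , p = t-sur i in suc j , p

  surjection⇒finite : ∀ k (s : Fin k → Carrier) → (∀ y → ∃ λ i → s i ≈ y) →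
                      ∃ λ m → Inverse (≡.setoid (Fin m)) S
  surjection⇒finite k s s-sur with distinct-values k s
  ... | m , t , t-inj , t-sur = m , record
    { to        = t
    ; from      = λ y → proj₁ (pre y)
    ; to-cong   = λ { refl → Setoid.refl S }
    ; from-cong = λ {y} {z} p → t-inj _ _ (trans (proj₂ (pre y)) (trans p (sym (proj₂ (pre z)))))
    ; inverse   = (λ { {y} refl → proj₂ (pre y) }) , (λ {i} {y} p → t-inj _ _ (trans (proj₂ (pre y)) p))
    }
    where
    pre : ∀ y → ∃ λ j → t j ≈ y
    pre y = let i , p = s-sur y ; j , q = t-sur i in j , trans q p

module BoundedWords (X : Grp) (letter : Bool → Group.Carrier X) {F : ℕ} (code : Group.Carrier X → Fin F)
  (code-inj : ∀ {u v : Group.Carrier X} → code u ≡ code v → Group._≈_ X u v) where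
  open Group X hiding (refl)

  ev : List Bool → Carrier
  ev []       = ε
  ev (c ∷ cs) = letter c ∙ ev cs

  ev-++ : ∀ cs ds → ev (cs ++ ds) ≈ ev cs ∙ ev ds
  ev-++ []       ds = sym (identityˡ _)
  ev-++ (c ∷ cs) ds = trans (∙-congˡ (ev-++ cs ds)) (sym (assoc _ _ _))

  -- A word longer than F has two suffixes with the same code, hence the same value; the letters
  -- between their starting points can be cut out.
  shorten : ∀ cs → Acc _<_ (length cs) → ∃ λ ds → length ds ≤ F × ev ds ≈ ev cs
  shorten cs (acc rec) with length cs ℕ.≤? F
  ... | yes p = cs , p , Group.refl X
  ... | no ¬p with Fin.pigeonhole (ℕ.n<1+n F) (λ i → code (ev (drop (toℕ i) cs)))
  ...   | i , j , i<j , eq = let ds , q , r = shorten cs′ (rec shorter) in ds , q , trans r same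
    where
    cs′ = take (toℕ i) cs ++ drop (toℕ j) cs
    j≤ : toℕ j ≤ length cs
    j≤ = ℕ.≤-trans (ℕ.≤-pred (Fin.toℕ<n j)) (ℕ.<⇒≤ (ℕ.≰⇒> ¬p))
    i≤ : toℕ i ≤ length cs
    i≤ = ℕ.≤-trans (ℕ.<⇒≤ i<j) j≤
    shorter : length cs′ < length cs
    shorter = ℕ.≤-trans (ℕ.≤-reflexive (≡.cong suc (≡.trans (List.length-++ (take (toℕ i) cs))
      (≡.cong₂ _+_ (≡.trans (List.length-take (toℕ i) cs) (ℕ.m≤n⇒m⊓n≡m i≤)) (List.length-drop (toℕ j) cs)))))
      (ℕ.≤-trans (ℕ.+-monoˡ-≤ _ i<j) (ℕ.≤-reflexive (ℕ.m+[n∸m]≡n j≤)))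
    same : ev cs′ ≈ ev cs
    same = trans (ev-++ (take (toℕ i) cs) _) (trans (∙-congˡ (sym (code-inj eq)))
      (trans (sym (ev-++ (take (toℕ i) cs) _)) (reflexive (≡.cong ev (List.take++drop≡id (toℕ i) cs)))))

  -- The digit for `ε` pads shorter words, so k digits enumerate all words of length at most k.
  pick : Fin 3 → Carrier
  pick 0F = ε
  pick 1F = letter false
  pick 2F = letter true

  enumerate : ∀ k → Fin (3 ^ k) → Carrier
  enumerate zero    _ = ε
  enumerate (suc k) i = let c , j = remQuot {3} (3 ^ k) i in pick c ∙ enumerate k j

  enumerate-combine : ∀ k c j → enumerate (suc k) (combine {3} c j) ≈ pick c ∙ enumerate k j
  enumerate-combine k c j = reflexive (≡.cong (λ (c , j) → pick c ∙ enumerate k j) (Fin.remQuot-combine {3} c j))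

  enumerate-sur : ∀ k cs → length cs ≤ k → ∃ λ i → enumerate k i ≈ ev cs
  enumerate-sur zero    []       _ = zero , Group.refl X
  enumerate-sur (suc k) []       _ with enumerate-sur k [] z≤n
  ... | i , p = combine {3} 0F i , trans (enumerate-combine k 0F i) (trans (identityˡ _) p)
  enumerate-sur (suc k) (c ∷ cs) (s≤s l) with enumerate-sur k cs l
  enumerate-sur (suc k) (false ∷ cs) (s≤s l) | i , p = combine {3} 1F i , trans (enumerate-combine k 1F i) (∙-congˡ p)
  enumerate-sur (suc k) (true ∷ cs)  (s≤s l) | i , p = combine {3} 2F i , trans (enumerate-combine k 2F i) (∙-congˡ p)

  words-sur : (∀ u → ∃ λ cs → ev cs ≈ u) → ∀ u → ∃ λ i → enumerate F i ≈ u
  words-sur h u = let cs , p = h u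
                      ds , q , r = shorten cs (<-wellFounded _)
                      i , s = enumerate-sur F ds q
                  in i , trans s (trans r p)

module _ {G H : Grp} where
  private
    module G = Group G
    module H = Group H
  open GroupMorphisms G.rawGroup H.rawGroup

  mk≅ : (f : G.Carrier → H.Carrier) → (∀ {u v} → u G.≈ v → f u H.≈ f v) →
        (∀ u v → f (u G.∙ v) H.≈ f u H.∙ f v) → (∀ {u v} → f u H.≈ f v → u G.≈ v) →
        (∀ y → ∃ λ u → f u H.≈ y) → G ≅ H
  mk≅ f f-cong f-∙ f-inj f-sur = f , record
    { isGroupMonomorphism = record
      { isGroupHomomorphism = record
        { isMonoidHomomorphism = record
          { isMagmaHomomorphism = record
            { isRelHomomorphism = record { cong = f-cong }
            ; homo = f-∙
            }
          ; ε-homo = f-ε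
          }
        ; ⁻¹-homo = λ u → inverseˡ-unique _ _ (H.trans (H.sym (f-∙ (u G.⁻¹) u)) (H.trans (f-cong (G.inverseˡ u)) f-ε))
        }
      ; injective = f-inj
      }
    ; surjective = λ y → let u , p = f-sur y in u , λ q → H.trans (f-cong q) p
    }
    where
    open GroupProperties H
    f-ε : f G.ε H.≈ H.ε
    f-ε = identityˡ-unique _ _ (H.trans (H.sym (f-∙ G.ε G.ε)) (f-cong (G.identityˡ G.ε)))

-- Transitivity, valency and normal quotients

three-parities : ∀ (p q r : Parity) → p ≡ q ⊎ p ≡ r ⊎ q ≡ r
three-parities 0ℙ 0ℙ _  = inj₁ refl
three-parities 1ℙ 1ℙ _  = inj₁ refl
three-parities 0ℙ 1ℙ 0ℙ = inj₂ (inj₁ refl)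
three-parities 1ℙ 0ℙ 1ℙ = inj₂ (inj₁ refl)
three-parities 0ℙ 1ℙ 1ℙ = inj₂ (inj₂ refl)
three-parities 1ℙ 0ℙ 0ℙ = inj₂ (inj₂ refl)

module GraphProps {X : Grp} (C : Config X) where
  open AutGraph C public
  open SetoidReasoning setoid

  left : Carrier → Group.Carrier (Aut Γ)
  left u = record
    { to        = u ∙_
    ; from      = u ⁻¹ ∙_
    ; to-cong   = ≈ᵥ-left u
    ; from-cong = ≈ᵥ-left (u ⁻¹)
    ; inverse   = (λ {y} p → ≈ᵥ-trans (≈ᵥ-left u p) (≈ᵥ-reflexive (\\-leftDividesˡ u y)))
                , (λ {y} p → ≈ᵥ-trans (≈ᵥ-left (u ⁻¹) p) (≈ᵥ-reflexive (\\-leftDividesʳ u y)))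
    }
    , λ v t → (λ { (inj₁ a) → inj₁ (arc-left u a) ; (inj₂ a) → inj₂ (arc-left u a) })
            , (λ { (inj₁ a) → inj₁ (arc-unleft v t a) ; (inj₂ a) → inj₂ (arc-unleft t v a) })
    where
    arc-unleft : ∀ v t → Arc (u ∙ v) (u ∙ t) → Arc v t
    arc-unleft v t a = arc-respˡ (≈ᵥ-reflexive (\\-leftDividesʳ u v))
      (arc-respʳ (≈ᵥ-reflexive (\\-leftDividesʳ u t)) (arc-left (u ⁻¹) a))

  connected : Connected Γ
  connected u v = go (generates (u ⁻¹ ∙ v)) ◅◅ (inj₁ (≈ᵥ-reflexive (\\-leftDividesˡ u v)) ◅ ∎★)
    where
    go : ∀ {g} → Generated g → Star (λ y z → y ≈ᵥ z ⊎ Graph._~_ Γ y z) u (u ∙ g)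
    go gen-ε         = inj₁ (≈ᵥ-reflexive (≈-sym (identityʳ u))) ◅ ∎★
    go (gen-b {g} p) = go p ◅◅ (inj₁ (≈ᵥ-trans (≈ᵥ-∙K _ (K-bi 0 (s≤s z≤n))) (≈ᵥ-reflexive (assoc _ _ _))) ◅ ∎★)
    go (gen-x {g} p) = go p ◅◅ (inj₂ (inj₁ (arc-respʳ (≈ᵥ-reflexive (assoc _ _ _)) (arc-x (u ∙ g)))) ◅ ∎★)
    go (gen-≈ p q)   = go q ◅◅ (inj₁ (≈ᵥ-reflexive (∙-congˡ p)) ◅ ∎★)

  out-distinct : ∀ v → ¬ out v true ≈ᵥ out v false
  out-distinct v p = b₋₁∉K (K-resp (≈-trans
    (solve (v ∷ b ∷ x ∷ []) (⊖ (p₀ ⊙ p₁ ⊙ p₂) ⊙ (p₀ ⊙ one ⊙ p₂)) (⊖ p₂ ⊙ ⊖ p₁ ⊙ p₂) refl)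
    (∙-congʳ (∙-congˡ (bi⁻¹ 0)))) p)

  inn-distinct : ∀ v → ¬ inn v true ≈ᵥ inn v false
  inn-distinct v p = biw∉K (K-resp (≈-trans
    (solve (v ∷ bi w′ ∷ x ∷ []) (⊖ (p₀ ⊙ p₁ ⊙ ⊖ p₂) ⊙ (p₀ ⊙ one ⊙ ⊖ p₂)) (p₂ ⊙ ⊖ p₁ ⊙ ⊖ p₂) refl)
    (∙-congʳ (∙-congˡ (bi⁻¹ w′)))) p)

  out≉inn : ∀ v e e′ → ¬ out v e ≈ᵥ inn v e′
  out≉inn v e e′ p = no-2-cycle (e , p) (arc-inn v e′)

  module _ (v : Carrier) where

    nb : Fin 4 → Carrier
    nb 0F = out v false
    nb 1F = out v true
    nb 2F = inn v false
    nb 3F = inn v true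

    nb-adj : ∀ i → Graph._~_ Γ v (nb i)
    nb-adj 0F = inj₁ (false , ≈ᵥ-refl)
    nb-adj 1F = inj₁ (true , ≈ᵥ-refl)
    nb-adj 2F = inj₂ (arc-inn v false)
    nb-adj 3F = inj₂ (arc-inn v true)

    nb-inj : ∀ i j → nb i ≈ᵥ nb j → i ≡ j
    nb-inj 0F 0F _ = refl
    nb-inj 0F 1F p = ⊥-elim (out-distinct v (≈ᵥ-sym p))
    nb-inj 0F 2F p = ⊥-elim (out≉inn v false false p)
    nb-inj 0F 3F p = ⊥-elim (out≉inn v false true p)
    nb-inj 1F 0F p = ⊥-elim (out-distinct v p)
    nb-inj 1F 1F _ = refl
    nb-inj 1F 2F p = ⊥-elim (out≉inn v true false p)
    nb-inj 1F 3F p = ⊥-elim (out≉inn v true true p)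
    nb-inj 2F 0F p = ⊥-elim (out≉inn v false false (≈ᵥ-sym p))
    nb-inj 2F 1F p = ⊥-elim (out≉inn v true false (≈ᵥ-sym p))
    nb-inj 2F 2F _ = refl
    nb-inj 2F 3F p = ⊥-elim (inn-distinct v (≈ᵥ-sym p))
    nb-inj 3F 0F p = ⊥-elim (out≉inn v false true (≈ᵥ-sym p))
    nb-inj 3F 1F p = ⊥-elim (out≉inn v true true (≈ᵥ-sym p))
    nb-inj 3F 2F p = ⊥-elim (inn-distinct v p)
    nb-inj 3F 3F _ = refl

    nb-sur : ∀ {u} → Graph._~_ Γ v u → ∃ λ i → nb i ≈ᵥ u
    nb-sur (inj₁ (false , p)) = 0F , p
    nb-sur (inj₁ (true  , p)) = 1F , p
    nb-sur (inj₂ a) = pick (arc⇒inn a)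
      where
      pick : ∀ {u} → (∃ λ e → inn v e ≈ᵥ u) → ∃ λ i → nb i ≈ᵥ u
      pick (false , p) = 2F , p
      pick (true  , p) = 3F , p

  tetravalent : Tetravalent Γ
  tetravalent v = record
    { to        = λ i → nb v i , nb-adj v i
    ; from      = λ (_ , a) → proj₁ (nb-sur v a)
    ; to-cong   = λ { refl → ≈ᵥ-refl }
    ; from-cong = λ { {_ , a} {_ , a′} p → nb-inj v _ _ (≈ᵥ-trans (proj₂ (nb-sur v a)) (≈ᵥ-trans p (≈ᵥ-sym (proj₂ (nb-sur v a′))))) }
    ; inverse   = (λ { {_ , a} refl → proj₂ (nb-sur v a) })
                , (λ { {i} {_ , a} p → nb-inj v _ _ (≈ᵥ-trans (proj₂ (nb-sur v a)) p) })
    }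

  elt : Group.Carrier (Aut Γ) → Carrier
  elt φ = proj₁ (aut-is-left φ)

  elt-spec : ∀ φ g → Inverse.to (proj₁ φ) g ≈ᵥ elt φ ∙ g
  elt-spec φ = proj₂ (aut-is-left φ)

  elt-unique : ∀ {u v} → (∀ g → u ∙ g ≈ᵥ v ∙ g) → u ≈ v
  elt-unique p = walk-unique (λ i _ → p (xp i))

  Aut≅X : Aut Γ ≅ X
  Aut≅X = mk≅ {Aut Γ} {X} elt
    (λ {φ} {χ} p → elt-unique λ g → ≈ᵥ-trans (≈ᵥ-sym (elt-spec φ g)) (≈ᵥ-trans (p g) (elt-spec χ g)))
    (λ φ χ → elt-unique λ g → ≈ᵥ-trans (≈ᵥ-sym (elt-spec (Group._∙_ (Aut Γ) φ χ) g))
      (≈ᵥ-trans (elt-spec φ _) (≈ᵥ-trans (≈ᵥ-left (elt φ) (elt-spec χ g)) (≈ᵥ-reflexive (≈-sym (assoc _ _ _))))))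
    (λ {φ} {χ} p g → ≈ᵥ-trans (elt-spec φ g) (≈ᵥ-trans (≈ᵥ-reflexive (∙-congʳ p)) (≈ᵥ-sym (elt-spec χ g))))
    (λ u → left u , elt-unique λ g → ≈ᵥ-sym (elt-spec (left u) g))

  -- Absorbing the power of b into the representative brings every arc into the shape h K → h x K,
  -- and left translations permute these transitively.
  arc-rep : ∀ {u v} → Arc u v → ∃ λ h → h ≈ᵥ u × h ∙ x ≈ᵥ v
  arc-rep {u} (e , p) = u ∙ pw e b , ≈ᵥ-sym (≈ᵥ-∙K u (K-pw e 0 (s≤s z≤n))) , p

  arc-transport : ∀ {u v y z} → Arc u v → Arc y z → ∃ λ g → g ∙ u ≈ᵥ y × g ∙ v ≈ᵥ z
  arc-transport a a′ =
    let h , p , q = arc-rep a ; h′ , p′ , q′ = arc-rep a′ in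
    h′ ∙ h ⁻¹
    , ≈ᵥ-trans (≈ᵥ-left _ (≈ᵥ-sym p)) (≈ᵥ-trans (≈ᵥ-reflexive (solve (h ∷ h′ ∷ []) (p₁ ⊙ ⊖ p₀ ⊙ p₀) p₁ refl)) p′)
    , ≈ᵥ-trans (≈ᵥ-left _ (≈ᵥ-sym q)) (≈ᵥ-trans (≈ᵥ-reflexive (solve (h ∷ h′ ∷ x ∷ []) (p₁ ⊙ ⊖ p₀ ⊙ (p₀ ⊙ p₂)) (p₁ ⊙ p₂) refl)) q′)

  half-arc-transitive : HalfArcTransitive Γ
  half-arc-transitive = vertex , edge , not-arc
    where
    vertex : VertexTransitive Γ (whole (Aut Γ))
    vertex u v = left (v ∙ u ⁻¹) , tt , ≈ᵥ-reflexive (//-rightDividesˡ u v)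
    edge : EdgeTransitive Γ (whole (Aut Γ))
    edge (inj₁ a) (inj₁ a′) = let g , p , q = arc-transport a a′ in left g , tt , inj₁ (p , q)
    edge (inj₁ a) (inj₂ a′) = let g , p , q = arc-transport a a′ in left g , tt , inj₂ (p , q)
    edge (inj₂ a) (inj₁ a′) = let g , p , q = arc-transport a a′ in left g , tt , inj₂ (q , p)
    edge (inj₂ a) (inj₂ a′) = let g , p , q = arc-transport a a′ in left g , tt , inj₁ (q , p)
    εx : Arc ε x
    εx = arc-respʳ (≈ᵥ-reflexive (identityˡ x)) (arc-x ε)
    -- An automorphism that reverses an arc would be a left translation, and those respect
    -- directions.
    not-arc : ¬ ArcTransitive Γ (whole (Aut Γ))
    not-arc t = let φ , _ , p , q = t {ε} {x} {x} {ε} (inj₁ εx) (inj₂ εx) in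
      no-2-cycle εx (arc-respˡ (≈ᵥ-trans (≈ᵥ-sym (elt-spec φ ε)) p)
        (arc-respʳ (≈ᵥ-trans (≈ᵥ-sym (elt-spec φ x)) q) (arc-left (elt φ) εx)))

  -- The stabilizer of v consists of the left translations by v K v⁻¹, so an isomorphism θ from H
  -- onto K is all that is needed.
  stabilizer : ∀ {H : Grp} (θ : Group.Carrier H → Carrier) →
    (∀ {f g} → Group._≈_ H f g → θ f ≈ θ g) →
    (∀ f g → θ (Group._∙_ H f g) ≈ θ f ∙ θ g) →
    (∀ {f g} → θ f ≈ θ g → Group._≈_ H f g) →
    (∀ f → K (θ f)) → (∀ {k} → K k → ∃ λ f → θ f ≈ k) →
    ∀ v → ⟦ Stabilizer Γ v ⟧ ≅ H
  stabilizer {H} θ θ-cong θ-∙ θ-inj θ-K K-θ v = mk≅ {⟦ Stabilizer Γ v ⟧} {H} (λ φ → proj₁ (pre φ))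
    (λ {φ} {χ} p → θ-inj (≈-trans (proj₂ (pre φ)) (≈-trans (∙-congʳ (∙-congˡ (elt-cong φ χ p))) (≈-sym (proj₂ (pre χ))))))
    (λ φ χ → θ-inj (begin
      θ (proj₁ (pre (φ ·ₛ χ)))                       ≈⟨ proj₂ (pre (φ ·ₛ χ)) ⟩
      v ⁻¹ ∙ elt (proj₁ (φ ·ₛ χ)) ∙ v                ≈⟨ ∙-congʳ (∙-congˡ (elt-homo φ χ)) ⟩
      v ⁻¹ ∙ (elt (proj₁ φ) ∙ elt (proj₁ χ)) ∙ v     ≈⟨ solve (v ∷ elt (proj₁ φ) ∷ elt (proj₁ χ) ∷ []) (⊖ p₀ ⊙ (p₁ ⊙ p₂) ⊙ p₀) (⊖ p₀ ⊙ p₁ ⊙ p₀ ⊙ (⊖ p₀ ⊙ p₂ ⊙ p₀)) refl ⟩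
      v ⁻¹ ∙ elt (proj₁ φ) ∙ v ∙ (v ⁻¹ ∙ elt (proj₁ χ) ∙ v)  ≈⟨ ∙-cong (proj₂ (pre φ)) (proj₂ (pre χ)) ⟨
      θ (proj₁ (pre φ)) ∙ θ (proj₁ (pre χ))          ≈⟨ θ-∙ _ _ ⟨
      θ (Group._∙_ H (proj₁ (pre φ)) (proj₁ (pre χ))) ∎))
    (λ {φ} {χ} p g → ≈ᵥ-trans (elt-spec (proj₁ φ) g) (≈ᵥ-trans (≈ᵥ-reflexive (∙-congʳ
      (∙-cancelˡ _ _ _ (∙-cancelʳ _ _ _ (≈-trans (≈-sym (proj₂ (pre φ))) (≈-trans (θ-cong p) (proj₂ (pre χ))))))))
      (≈ᵥ-sym (elt-spec (proj₁ χ) g))))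
    (λ f → lift f , θ-inj (begin
      θ (proj₁ (pre (lift f)))           ≈⟨ proj₂ (pre (lift f)) ⟩
      v ⁻¹ ∙ elt (proj₁ (lift f)) ∙ v    ≈⟨ ∙-congʳ (∙-congˡ (elt-unique λ g → ≈ᵥ-sym (elt-spec (proj₁ (lift f)) g))) ⟩
      v ⁻¹ ∙ (v ∙ θ f ∙ v ⁻¹) ∙ v        ≈⟨ solve (v ∷ θ f ∷ []) (⊖ p₀ ⊙ (p₀ ⊙ p₁ ⊙ ⊖ p₀) ⊙ p₀) p₁ refl ⟩
      θ f                                ∎))
    where
    Stab = ⟦ Stabilizer Γ v ⟧
    _·ₛ_ = Group._∙_ Stab
    pre : ∀ (φ : Group.Carrier Stab) → ∃ λ f → θ f ≈ v ⁻¹ ∙ elt (proj₁ φ) ∙ v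
    pre (φ , p) = K-θ (K-resp (solve (v ∷ elt φ ∷ []) (⊖ (⊖ (p₁ ⊙ p₀) ⊙ p₀)) (⊖ p₀ ⊙ p₁ ⊙ p₀) refl)
      (K-⁻¹ (≈ᵥ-trans (≈ᵥ-sym (elt-spec φ v)) p)))
    elt-cong : ∀ (φ χ : Group.Carrier Stab) → Group._≈_ Stab φ χ → elt (proj₁ φ) ≈ elt (proj₁ χ)
    elt-cong (φ , _) (χ , _) p = elt-unique λ g → ≈ᵥ-trans (≈ᵥ-sym (elt-spec φ g)) (≈ᵥ-trans (p g) (elt-spec χ g))
    elt-homo : ∀ (φ χ : Group.Carrier Stab) → elt (proj₁ (φ ·ₛ χ)) ≈ elt (proj₁ φ) ∙ elt (proj₁ χ)
    elt-homo (φ , _) (χ , _) = elt-unique λ g → ≈ᵥ-trans (≈ᵥ-sym (elt-spec (Group._∙_ (Aut Γ) φ χ) g))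
      (≈ᵥ-trans (elt-spec φ _) (≈ᵥ-trans (≈ᵥ-left (elt φ) (elt-spec χ g)) (≈ᵥ-reflexive (≈-sym (assoc _ _ _)))))
    lift : Group.Carrier H → Group.Carrier Stab
    lift f = left (v ∙ θ f ∙ v ⁻¹) , ≈ᵥ-sym (≈ᵥ-trans (≈ᵥ-∙K v (θ-K f))
      (≈ᵥ-reflexive (solve (v ∷ θ f ∷ []) (p₀ ⊙ p₁) (p₀ ⊙ p₁ ⊙ ⊖ p₀ ⊙ p₀) refl)))

  -- par stands for the component in the quotient of order two; P ranges over
  -- normal subgroups.
  basic : (par : Carrier → Parity) →
    ((P : Carrier → Set) → (∀ {u v} → u ≈ v → P u → P v) → (∀ {u v} → P u → P v → P (u ∙ v)) →
      (∀ {u} → P u → P (u ⁻¹)) → (∀ g {u} → P u → P (g ∙ u ∙ g ⁻¹)) →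
      ∀ {u} → P u → ¬ u ≈ ε → ∀ g h → par g ≡ par h → P (h ∙ g ⁻¹)) →
    Basic Γ
  basic par simple N (_ , normal) nontrivial v ι = nontrivial λ φ φ∈N →
    decide φ φ∈N (elt φ ≟ ε)
    where
    open Subgroup N renaming (_∈ to _∈N)
    P : Carrier → Set
    P u = left u ∈N
    module ι = Injection ι
    y : Fin 3 → Carrier
    y i = proj₁ (ι.to i)
    fuse : ∀ {u} → P u → ¬ u ≈ ε → ∀ i j → par (y i) ≡ par (y j) → i ≡ j
    fuse Pu u≉ε i j eq = ι.injective (left (y j ∙ y i ⁻¹)
      , simple P (λ p → ∈-resp-≈ (λ g → ≈ᵥ-reflexive (∙-congʳ p)))
          (λ p q → ∈-resp-≈ (λ g → ≈ᵥ-reflexive (≈-sym (assoc _ _ _))) (∙-closed p q))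
          (λ p → ∈-resp-≈ (λ g → ≈ᵥ-refl) (⁻¹-closed p))
          (λ g {u} p → ∈-resp-≈ (λ h → ≈ᵥ-reflexive (solve (g ∷ u ∷ h ∷ []) (p₀ ⊙ (p₁ ⊙ (⊖ p₀ ⊙ p₂))) (p₀ ⊙ p₁ ⊙ ⊖ p₀ ⊙ p₂) refl)) (normal (left g) (left u) tt p))
          Pu u≉ε (y i) (y j) eq
      , ≈ᵥ-reflexive (//-rightDividesˡ (y i) (y j)))
    clash : (∀ i j → par (y i) ≡ par (y j) → i ≡ j) → ⊥
    clash h = cases (three-parities (par (y 0F)) (par (y 1F)) (par (y 2F)))
      where
      cases : par (y 0F) ≡ par (y 1F) ⊎ par (y 0F) ≡ par (y 2F) ⊎ par (y 1F) ≡ par (y 2F) → ⊥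
      cases (inj₁ p) with () ← h 0F 1F p
      cases (inj₂ (inj₁ p)) with () ← h 0F 2F p
      cases (inj₂ (inj₂ p)) with () ← h 1F 2F p
    -- N is shown to be trivial under the absurd assumption ι: an element of N other than the
    -- identity would leave at most two orbits for the three vertices.
    decide : ∀ φ → φ ∈N → Dec (elt φ ≈ ε) → Group._≈_ (Aut Γ) φ (Group.ε (Aut Γ))
    decide φ φ∈N (yes p) g = ≈ᵥ-trans (elt-spec φ g) (≈ᵥ-reflexive (≈-trans (∙-congʳ p) (identityˡ g)))
    decide φ φ∈N (no ¬p) = ⊥-elim (clash (fuse (∈-resp-≈ (elt-spec φ) φ∈N) ¬p))

  finite : ∀ {F} (code : Carrier → Fin F) → (∀ {u v} → code u ≡ code v → u ≈ v) → Finite Γ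
  finite {F} code code-inj = surjection⇒finite cosets (λ u v → W? 0 w (u ⁻¹ ∙ v)) _ (enumerate F)
    (λ u → let i , p = words-sur (λ u → word-of (generates u)) u in i , ≈ᵥ-reflexive p)
    where
    open BoundedWords X (λ c → if c then x else b) code code-inj
    word-of : ∀ {u} → Generated u → ∃ λ cs → ev cs ≈ u
    word-of gen-ε       = [] , ≈-refl
    word-of (gen-b p)   = let cs , q = word-of p in cs ++ false ∷ [] , ≈-trans (ev-++ cs _) (∙-cong q (identityʳ b))
    word-of (gen-x p)   = let cs , q = word-of p in cs ++ true ∷ [] , ≈-trans (ev-++ cs _) (∙-cong q (identityʳ x))
    word-of (gen-≈ p q) = let cs , r = word-of q in cs , ≈-trans r p

-- The vertex stabilizer

module IntegerPowers (X : Grp) (r : Group.Carrier X) where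
  open Group X hiding (refl)
  open GroupSolver X
  open SetoidReasoning setoid
  open GroupProperties X

  pow : ℕ → Carrier
  pow zero    = ε
  pow (suc k) = r ∙ pow k

  zp : ℤ.ℤ → Carrier
  zp (ℤ.+ k)      = pow k
  zp (ℤ.-[1+ k ]) = pow (suc k) ⁻¹

  pow-+ : ∀ i j → pow (i + j) ≈ pow i ∙ pow j
  pow-+ zero    j = sym (identityˡ _)
  pow-+ (suc i) j = trans (∙-congˡ (pow-+ i j)) (sym (assoc _ _ _))

  pow-sucʳ : ∀ i → pow (suc i) ≈ pow i ∙ r
  pow-sucʳ i = trans (reflexive (≡.cong pow (ℕ.+-comm 1 i))) (trans (pow-+ i 1) (∙-congˡ (identityʳ r)))

  zp-⊖ : ∀ i j → zp (i ℤ.⊖ j) ≈ pow i ∙ pow j ⁻¹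
  zp-⊖ i zero = trans (reflexive (≡.cong zp (ℤ.⊖-≥ {i} z≤n))) (solve (pow i ∷ []) p₀ (p₀ ⊙ ⊖ one) refl)
  zp-⊖ zero (suc j) = sym (identityˡ _)
  zp-⊖ (suc i) (suc j) = begin
    zp (suc i ℤ.⊖ suc j)               ≡⟨ ≡.cong zp (ℤ.[1+m]⊖[1+n]≡m⊖n i j) ⟩
    zp (i ℤ.⊖ j)                       ≈⟨ zp-⊖ i j ⟩
    pow i ∙ pow j ⁻¹                   ≈⟨ solve (pow i ∷ r ∷ pow j ∷ []) (p₀ ⊙ ⊖ p₂) (p₀ ⊙ p₁ ⊙ ⊖ (p₂ ⊙ p₁)) refl ⟩
    pow i ∙ r ∙ (pow j ∙ r) ⁻¹         ≈⟨ ∙-cong (pow-sucʳ i) (⁻¹-cong (pow-sucʳ j)) ⟨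
    pow (suc i) ∙ pow (suc j) ⁻¹       ∎

  pow-comm : ∀ i j → pow i ∙ pow j ≈ pow j ∙ pow i
  pow-comm i j = trans (sym (pow-+ i j)) (trans (reflexive (≡.cong pow (ℕ.+-comm i j))) (pow-+ j i))

  zp-+ : ∀ i j → zp (i ℤ.+ j) ≈ zp i ∙ zp j
  zp-+ (ℤ.+ i)      (ℤ.+ j)      = pow-+ i j
  zp-+ (ℤ.+ i)      (ℤ.-[1+ j ]) = zp-⊖ i (suc j)
  zp-+ (ℤ.-[1+ i ]) (ℤ.+ j)      = begin
    zp (j ℤ.⊖ suc i)             ≈⟨ zp-⊖ j (suc i) ⟩
    pow j ∙ pow (suc i) ⁻¹       ≈⟨ solve (pow j ∷ pow (suc i) ∷ []) (p₀ ⊙ ⊖ p₁) (⊖ p₁ ⊙ (p₁ ⊙ p₀) ⊙ ⊖ p₁) refl ⟩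
    pow (suc i) ⁻¹ ∙ (pow (suc i) ∙ pow j) ∙ pow (suc i) ⁻¹  ≈⟨ ∙-congʳ (∙-congˡ (pow-comm (suc i) j)) ⟩
    pow (suc i) ⁻¹ ∙ (pow j ∙ pow (suc i)) ∙ pow (suc i) ⁻¹  ≈⟨ solve (pow j ∷ pow (suc i) ∷ []) (⊖ p₁ ⊙ (p₀ ⊙ p₁) ⊙ ⊖ p₁) (⊖ p₁ ⊙ p₀) refl ⟩
    pow (suc i) ⁻¹ ∙ pow j       ∎
  zp-+ (ℤ.-[1+ i ]) (ℤ.-[1+ j ]) = begin
    pow (suc (suc (i + j))) ⁻¹         ≡⟨ ≡.cong (λ k → pow k ⁻¹) (≡.trans (≡.cong suc (≡.sym (ℕ.+-suc i j))) (ℕ.+-comm (suc i) (suc j))) ⟩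
    pow (suc j + suc i) ⁻¹             ≈⟨ ⁻¹-cong (pow-+ (suc j) (suc i)) ⟩
    (pow (suc j) ∙ pow (suc i)) ⁻¹     ≈⟨ ⁻¹-anti-homo-∙ _ _ ⟩
    pow (suc i) ⁻¹ ∙ pow (suc j) ⁻¹    ∎

  zp-neg : ∀ i → zp (ℤ.- i) ≈ zp i ⁻¹
  zp-neg i = inverseˡ-unique _ _ (trans (sym (zp-+ (ℤ.- i) i)) (reflexive (≡.cong zp (ℤ.+-inverseˡ i))))

  module _ (k : ℕ) (order : pow k ≈ ε) where

    pow-* : ∀ q → pow (q * k) ≈ ε
    pow-* zero    = Group.refl X
    pow-* (suc q) = trans (pow-+ k (q * k)) (trans (∙-cong order (pow-* q)) (identityˡ ε))

    zp-* : ∀ q → zp (q ℤ.* ℤ.+ k) ≈ ε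
    zp-* (ℤ.+ q)      = trans (reflexive (≡.cong zp (≡.sym (ℤ.pos-* q k)))) (pow-* q)
    zp-* (ℤ.-[1+ q ]) = begin
      zp (ℤ.-[1+ q ] ℤ.* ℤ.+ k)         ≡⟨ ≡.cong zp (≡.trans (≡.sym (ℤ.neg-distribˡ-* (ℤ.+ suc q) (ℤ.+ k))) (≡.cong ℤ.-_ (≡.sym (ℤ.pos-* (suc q) k)))) ⟩
      zp (ℤ.- (ℤ.+ (suc q * k)))        ≈⟨ zp-neg (ℤ.+ (suc q * k)) ⟩
      pow (suc q * k) ⁻¹                ≈⟨ ⁻¹-cong (pow-* (suc q)) ⟩
      ε ⁻¹                              ≈⟨ ε⁻¹≈ε ⟩
      ε                                 ∎

    zp-cong : ∀ i j → ℤ.+ k ℤ∣.∣ (i ℤ.- j) → zp i ≈ zp j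
    zp-cong i j (ℤ∣.divides q eq) = begin
      zp i                     ≡⟨ ≡.cong zp (≡.trans (≡.sym (ℤ.+-identityʳ i)) (≡.trans (≡.cong (ℤ._+_ i) (≡.sym (ℤ.+-inverseˡ j))) (≡.sym (ℤ.+-assoc i (ℤ.- j) j)))) ⟩
      zp ((i ℤ.- j) ℤ.+ j)     ≈⟨ zp-+ (i ℤ.- j) j ⟩
      zp (i ℤ.- j) ∙ zp j      ≈⟨ ∙-congʳ (trans (reflexive (≡.cong zp eq)) (zp-* q)) ⟩
      ε ∙ zp j                 ≈⟨ identityˡ _ ⟩
      zp j                     ∎

-- Among the indices 0, ..., 2m + 3 only i and i + 2m with i < 4 give non-commuting shifts. Each
-- such pair generates a dihedral group of order 8 with central element bᵢ₊ₘ; the indices 4, ..., m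
-- - 1 and m + 4, ..., 2m - 1 contribute 2 (m - 4) central involutions.
module StabGroup {X : Grp} (C : Config X) where
  open CosetGraph C
  open SetoidReasoning setoid

  Comm : Carrier → Carrier → Set
  Comm u v = u ∙ v ≈ v ∙ u

  comm-sym : ∀ {u v} → Comm u v → Comm v u
  comm-sym = ≈-sym

  comm-ε : ∀ {u} → Comm u ε
  comm-ε = ≈-trans (identityʳ _) (≈-sym (identityˡ _))

  comm-∙ : ∀ {u v t} → Comm u v → Comm u t → Comm u (v ∙ t)
  comm-∙ {u} {v} {t} p q = begin
    u ∙ (v ∙ t)   ≈⟨ assoc _ _ _ ⟨
    u ∙ v ∙ t     ≈⟨ ∙-congʳ p ⟩
    v ∙ u ∙ t     ≈⟨ assoc _ _ _ ⟩
    v ∙ (u ∙ t)   ≈⟨ ∙-congˡ q ⟩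
    v ∙ (t ∙ u)   ≈⟨ assoc _ _ _ ⟨
    v ∙ t ∙ u     ∎

  comm-⁻¹ : ∀ {u v} → Comm u v → Comm u (v ⁻¹)
  comm-⁻¹ {u} {v} p = begin
    u ∙ v ⁻¹                 ≈⟨ solve (u ∷ v ∷ []) (p₀ ⊙ ⊖ p₁) (⊖ p₁ ⊙ (p₁ ⊙ p₀) ⊙ ⊖ p₁) refl ⟩
    v ⁻¹ ∙ (v ∙ u) ∙ v ⁻¹    ≈⟨ ∙-congʳ (∙-congˡ p) ⟨
    v ⁻¹ ∙ (u ∙ v) ∙ v ⁻¹    ≈⟨ solve (u ∷ v ∷ []) (⊖ p₁ ⊙ (p₀ ⊙ p₁) ⊙ ⊖ p₁) (⊖ p₁ ⊙ p₀) refl ⟩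
    v ⁻¹ ∙ u                 ∎

  interchange : ∀ {a a′ c c′} → Comm a′ c → (a ∙ a′) ∙ (c ∙ c′) ≈ (a ∙ c) ∙ (a′ ∙ c′)
  interchange {a} {a′} {c} {c′} p = begin
    (a ∙ a′) ∙ (c ∙ c′)   ≈⟨ solve (a ∷ a′ ∷ c ∷ c′ ∷ []) (p₀ ⊙ p₁ ⊙ (p₂ ⊙ p₃)) (p₀ ⊙ (p₁ ⊙ p₂) ⊙ p₃) refl ⟩
    a ∙ (a′ ∙ c) ∙ c′     ≈⟨ ∙-congʳ (∙-congˡ p) ⟩
    a ∙ (c ∙ a′) ∙ c′     ≈⟨ solve (a ∷ a′ ∷ c ∷ c′ ∷ []) (p₀ ⊙ (p₂ ⊙ p₁) ⊙ p₃) (p₀ ⊙ p₂ ⊙ (p₁ ⊙ p₃)) refl ⟩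
    (a ∙ c) ∙ (a′ ∙ c′)   ∎

  bi-comm : ∀ i j → i < w → j < w → j ≢ i + (m + m) → i ≢ j + (m + m) → Comm (bi i) (bi j)
  bi-comm i j i<w j<w j≢ i≢ with ℕ.<-cmp i j
  ... | tri≈ _ refl _ = ≈-refl
  ... | tri< i<j _ _ = ≡.subst (λ z → Comm (bi i) (bi z)) (ℕ.m+[n∸m]≡n (ℕ.<⇒≤ i<j))
        (commute-at i (j ∸ i) (ℕ.m<n⇒0<n∸m i<j) (ℕ.≤-trans (ℕ.m∸n≤m j i) (ℕ.<⇒≤ j<w))
          (λ e → j≢ (≡.trans (≡.sym (ℕ.m+[n∸m]≡n (ℕ.<⇒≤ i<j))) (≡.cong (i +_) e))))
  ... | tri> _ _ j<i = ≈-sym (≡.subst (λ z → Comm (bi j) (bi z)) (ℕ.m+[n∸m]≡n (ℕ.<⇒≤ j<i))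
        (commute-at j (i ∸ j) (ℕ.m<n⇒0<n∸m j<i) (ℕ.≤-trans (ℕ.m∸n≤m i j) (ℕ.<⇒≤ i<w))
          (λ e → i≢ (≡.trans (≡.sym (ℕ.m+[n∸m]≡n (ℕ.<⇒≤ j<i))) (≡.cong (j +_) e)))))

  bi-central : ∀ i j → 4 ≤ i → i < m + m → j < w → Comm (bi i) (bi j)
  bi-central i j 4≤i i<2m j<w = bi-comm i j (ℕ.≤-trans i<2m (ℕ.m≤n+m (m + m) 4)) j<w
    (λ e → ℕ.<⇒≱ j<w (≡.subst (w ≤_) (≡.sym e) (ℕ.+-monoˡ-≤ (m + m) 4≤i)))
    (λ e → ℕ.<⇒≱ i<2m (≡.subst (m + m ≤_) (≡.sym e) (ℕ.m≤n+m (m + m) j)))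

  m+m<w+ : ∀ i → i < 4 → i + (m + m) < w
  m+m<w+ i i<4 = ℕ.+-monoˡ-< (m + m) i<4

  i<w : ∀ i → i < 4 → i < w
  i<w i i<4 = ℕ.≤-trans i<4 (ℕ.m≤m+n 4 (m + m))

  4≤m : 4 ≤ m
  4≤m = ℕ.≤-trans (ℕ.n≤1+n 4) 5≤m

  i<m : ∀ i → i < 4 → i < m
  i<m i i<4 = ℕ.≤-trans i<4 4≤m

  module D₈ᵢ (i : ℕ) (i<4 : i < 4) where
    j = i + (m + m)
    c = bi (i + m)
    r = bi i ∙ bi j
    open IntegerPowers X r public

    c-comm : ∀ k → k < w → Comm c (bi k)
    c-comm k = bi-central (i + m) k (ℕ.≤-trans 4≤m (ℕ.m≤n+m m i)) (ℕ.+-monoˡ-< m (i<m i i<4))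

    cji : bi i ∙ bi j ≈ c ∙ (bi j ∙ bi i)
    cji = dihedral-at i

    r² : r ∙ r ≈ c
    r² = begin
      bi i ∙ bi j ∙ (bi i ∙ bi j)             ≈⟨ ∙-congʳ cji ⟩
      c ∙ (bi j ∙ bi i) ∙ (bi i ∙ bi j)       ≈⟨ solve (c ∷ bi j ∷ bi i ∷ []) (p₀ ⊙ (p₁ ⊙ p₂) ⊙ (p₂ ⊙ p₁)) (p₀ ⊙ (p₁ ⊙ (p₂ ⊙ (p₂ ⊙ p₁)))) refl ⟩
      c ∙ (bi j ∙ (bi i ∙ (bi i ∙ bi j)))     ≈⟨ ∙-congˡ (∙-congˡ (bi-cancel i _)) ⟩
      c ∙ (bi j ∙ bi j)                       ≈⟨ ∙-congˡ (bi² j) ⟩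
      c ∙ ε                                   ≈⟨ identityʳ c ⟩
      c                                       ∎

    pow2 : pow 2 ≈ c
    pow2 = ≈-trans (∙-congˡ (identityʳ r)) r²

    pow4 : pow 4 ≈ ε
    pow4 = ≈-trans (pow-+ 2 2) (≈-trans (∙-cong pow2 pow2) (bi² (i + m)))

    flip : Parity → Carrier
    flip 0ℙ = ε
    flip 1ℙ = bi i

    δ : ℤ.ℤ × Parity → Carrier
    δ (ρ , p) = zp ρ ∙ flip p

    δ-cong : ∀ d d′ → Group._≈_ D₈ d d′ → δ d ≈ δ d′
    δ-cong (ρ , p) (ρ′ , p) (q , refl) = ∙-congʳ (zp-cong 4 pow4 ρ ρ′ q)

    r⁻¹ : r ⁻¹ ≈ bi j ∙ bi i
    r⁻¹ = ≈-trans (⁻¹-anti-homo-∙ _ _) (∙-cong (bi⁻¹ j) (bi⁻¹ i))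

    flip-r : bi i ∙ r ≈ r ⁻¹ ∙ bi i
    flip-r = begin
      bi i ∙ (bi i ∙ bi j)      ≈⟨ bi-cancel i _ ⟩
      bi j                      ≈⟨ identityʳ _ ⟨
      bi j ∙ ε                  ≈⟨ ∙-congˡ (bi² i) ⟨
      bi j ∙ (bi i ∙ bi i)      ≈⟨ assoc _ _ _ ⟨
      bi j ∙ bi i ∙ bi i        ≈⟨ ∙-congʳ r⁻¹ ⟨
      r ⁻¹ ∙ bi i               ∎

    flip-pow : ∀ k → bi i ∙ pow k ≈ pow k ⁻¹ ∙ bi i
    flip-pow zero    = solve (bi i ∷ []) (p₀ ⊙ one) (⊖ one ⊙ p₀) refl
    flip-pow (suc k) = begin
      bi i ∙ (r ∙ pow k)               ≈⟨ assoc _ _ _ ⟨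
      bi i ∙ r ∙ pow k                 ≈⟨ ∙-congʳ flip-r ⟩
      r ⁻¹ ∙ bi i ∙ pow k              ≈⟨ assoc _ _ _ ⟩
      r ⁻¹ ∙ (bi i ∙ pow k)            ≈⟨ ∙-congˡ (flip-pow k) ⟩
      r ⁻¹ ∙ (pow k ⁻¹ ∙ bi i)         ≈⟨ solve (r ∷ pow k ∷ bi i ∷ []) (⊖ p₀ ⊙ (⊖ p₁ ⊙ p₂)) (⊖ (p₁ ⊙ p₀) ⊙ p₂) refl ⟩
      (pow k ∙ r) ⁻¹ ∙ bi i            ≈⟨ ∙-congʳ (⁻¹-cong (pow-sucʳ k)) ⟨
      (r ∙ pow k) ⁻¹ ∙ bi i            ∎

    flip-zp : ∀ ρ → bi i ∙ zp ρ ≈ zp (ℤ.- ρ) ∙ bi i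
    flip-zp (ℤ.+ k)      = ≈-trans (flip-pow k) (∙-congʳ (≈-sym (zp-neg (ℤ.+ k))))
    flip-zp (ℤ.-[1+ k ]) = begin
      bi i ∙ P ⁻¹                        ≈⟨ solve (bi i ∷ P ∷ []) (p₀ ⊙ ⊖ p₁) (p₁ ⊙ (⊖ p₁ ⊙ p₀) ⊙ ⊖ p₁) refl ⟩
      P ∙ (P ⁻¹ ∙ bi i) ∙ P ⁻¹           ≈⟨ ∙-congʳ (∙-congˡ (flip-pow (suc k))) ⟨
      P ∙ (bi i ∙ P) ∙ P ⁻¹              ≈⟨ solve (bi i ∷ P ∷ []) (p₁ ⊙ (p₀ ⊙ p₁) ⊙ ⊖ p₁) (p₁ ⊙ p₀) refl ⟩
      P ∙ bi i                           ∎
      where P = pow (suc k)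

    δ-∙ : ∀ d d′ → δ (Group._∙_ D₈ d d′) ≈ δ d ∙ δ d′
    δ-∙ (ρ , 0ℙ) (ρ′ , p′) = begin
      zp (ρ ℤ.+ ρ′) ∙ flip p′          ≈⟨ ∙-congʳ (zp-+ ρ ρ′) ⟩
      zp ρ ∙ zp ρ′ ∙ flip p′           ≈⟨ solve (zp ρ ∷ zp ρ′ ∷ flip p′ ∷ []) (p₀ ⊙ p₁ ⊙ p₂) (p₀ ⊙ one ⊙ (p₁ ⊙ p₂)) refl ⟩
      zp ρ ∙ ε ∙ (zp ρ′ ∙ flip p′)     ∎
    δ-∙ (ρ , 1ℙ) (ρ′ , p′) = begin
      zp (ρ ℤ.+ ℤ.- ρ′) ∙ flip (p′ ℙ.⁻¹)            ≈⟨ ∙-cong (zp-+ ρ (ℤ.- ρ′)) (flip-⁻¹ p′) ⟩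
      zp ρ ∙ zp (ℤ.- ρ′) ∙ (bi i ∙ flip p′)         ≈⟨ solve (zp ρ ∷ zp (ℤ.- ρ′) ∷ bi i ∷ flip p′ ∷ []) (p₀ ⊙ p₁ ⊙ (p₂ ⊙ p₃)) (p₀ ⊙ (p₁ ⊙ p₂) ⊙ p₃) refl ⟩
      zp ρ ∙ (zp (ℤ.- ρ′) ∙ bi i) ∙ flip p′         ≈⟨ ∙-congʳ (∙-congˡ (flip-zp ρ′)) ⟨
      zp ρ ∙ (bi i ∙ zp ρ′) ∙ flip p′               ≈⟨ solve (zp ρ ∷ zp ρ′ ∷ bi i ∷ flip p′ ∷ []) (p₀ ⊙ (p₂ ⊙ p₁) ⊙ p₃) (p₀ ⊙ p₂ ⊙ (p₁ ⊙ p₃)) refl ⟩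
      zp ρ ∙ bi i ∙ (zp ρ′ ∙ flip p′)               ∎
      where
      flip-⁻¹ : ∀ p → flip (p ℙ.⁻¹) ≈ bi i ∙ flip p
      flip-⁻¹ 0ℙ = ≈-sym (identityʳ _)
      flip-⁻¹ 1ℙ = ≈-sym (bi² i)

    δ-comm : ∀ {u} → Comm u (bi i) → Comm u (bi j) → ∀ d → Comm u (δ d)
    δ-comm {u} ui uj (ρ , p) = comm-∙ (zp-comm ρ) (flip-comm p)
      where
      pow-comm′ : ∀ k → Comm u (pow k)
      pow-comm′ zero    = comm-ε
      pow-comm′ (suc k) = comm-∙ (comm-∙ ui uj) (pow-comm′ k)
      zp-comm : ∀ ρ → Comm u (zp ρ)
      zp-comm (ℤ.+ k)      = pow-comm′ k
      zp-comm (ℤ.-[1+ k ]) = comm-⁻¹ (pow-comm′ (suc k))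
      flip-comm : ∀ p → Comm u (flip p)
      flip-comm 0ℙ = comm-ε
      flip-comm 1ℙ = ui

    K-δ : ∀ d → K (δ d)
    K-δ (ρ , p) = K-∙ (K-zp ρ) (K-flip p)
      where
      K-pow : ∀ k → K (pow k)
      K-pow zero    = W-ε 0 w
      K-pow (suc k) = K-∙ (K-∙ (K-bi i (i<w i i<4)) (K-bi j (m+m<w+ i i<4))) (K-pow k)
      K-zp : ∀ ρ → K (zp ρ)
      K-zp (ℤ.+ k)      = K-pow k
      K-zp (ℤ.-[1+ k ]) = K-⁻¹ (K-pow (suc k))
      K-flip : ∀ p → K (flip p)
      K-flip 0ℙ = W-ε 0 w
      K-flip 1ℙ = K-bi i (i<w i i<4)

    -- Normal form of the element with rotation t mod 4 and reflection p.
    bits : ℕ → Parity → Bool × Bool × Bool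
    bits 0 0ℙ = false , false , false
    bits 0 1ℙ = true  , false , false
    bits 1 0ℙ = true  , false , true
    bits 1 1ℙ = false , true  , true
    bits 2 0ℙ = false , true  , false
    bits 2 1ℙ = true  , true  , false
    bits _ 0ℙ = true  , true  , true
    bits _ 1ℙ = false , false , true

    form : Bool × Bool × Bool → Carrier
    form (α , β , γ) = pw α (bi i) ∙ (pw β c ∙ pw γ (bi j))

    ri : r ∙ bi i ≈ c ∙ bi j
    ri = begin
      bi i ∙ bi j ∙ bi i               ≈⟨ ∙-congʳ cji ⟩
      c ∙ (bi j ∙ bi i) ∙ bi i         ≈⟨ solve (c ∷ bi j ∷ bi i ∷ []) (p₀ ⊙ (p₁ ⊙ p₂) ⊙ p₂) (p₀ ⊙ p₁ ⊙ (p₂ ⊙ p₂)) refl ⟩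
      c ∙ bi j ∙ (bi i ∙ bi i)         ≈⟨ ∙-congˡ (bi² i) ⟩
      c ∙ bi j ∙ ε                     ≈⟨ identityʳ _ ⟩
      c ∙ bi j                         ∎

    ci : c ∙ bi i ≈ bi i ∙ c
    ci = c-comm i (i<w i i<4)

    pow3 : pow 3 ≈ c ∙ r
    pow3 = ≈-trans (∙-congˡ pow2) (comm-sym (comm-∙ ci (c-comm j (m+m<w+ i i<4))))

    form-correct : ∀ t p → t < 4 → pow t ∙ flip p ≈ form (bits t p)
    form-correct 0 0ℙ _ = solve [] (one ⊙ one) (one ⊙ (one ⊙ one)) refl
    form-correct 0 1ℙ _ = solve (bi i ∷ []) (one ⊙ p₀) (p₀ ⊙ (one ⊙ one)) refl
    form-correct 1 0ℙ _ = solve (bi i ∷ bi j ∷ []) (p₀ ⊙ p₁ ⊙ one ⊙ one) (p₀ ⊙ (one ⊙ p₁)) refl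
    form-correct 1 1ℙ _ = ≈-trans (∙-congʳ (identityʳ r)) (≈-trans ri (≈-sym (identityˡ _)))
    form-correct 2 0ℙ _ = ≈-trans (∙-congʳ pow2) (solve (c ∷ []) (p₀ ⊙ one) (one ⊙ (p₀ ⊙ one)) refl)
    form-correct 2 1ℙ _ = ≈-trans (∙-congʳ pow2) (≈-trans ci (∙-congˡ (≈-sym (identityʳ c))))
    form-correct 3 0ℙ _ = begin
      pow 3 ∙ ε                  ≈⟨ identityʳ _ ⟩
      pow 3                      ≈⟨ pow3 ⟩
      c ∙ (bi i ∙ bi j)          ≈⟨ assoc _ _ _ ⟨
      c ∙ bi i ∙ bi j            ≈⟨ ∙-congʳ ci ⟩
      bi i ∙ c ∙ bi j            ≈⟨ assoc _ _ _ ⟩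
      bi i ∙ (c ∙ bi j)          ∎
    form-correct 3 1ℙ _ = begin
      pow 3 ∙ bi i               ≈⟨ ∙-congʳ pow3 ⟩
      c ∙ r ∙ bi i               ≈⟨ assoc _ _ _ ⟩
      c ∙ (r ∙ bi i)             ≈⟨ ∙-congˡ ri ⟩
      c ∙ (c ∙ bi j)             ≈⟨ bi-cancel (i + m) _ ⟩
      bi j                       ≈⟨ solve (bi j ∷ []) p₀ (one ⊙ (one ⊙ p₀)) refl ⟩
      ε ∙ (ε ∙ bi j)             ∎
    form-correct (suc (suc (suc (suc _)))) _ (s≤s (s≤s (s≤s (s≤s ()))))

    bits-inj : ∀ t p → t < 4 → bits t p ≡ (false , false , false) → t ≡ 0 × p ≡ 0ℙ
    bits-inj 0 0ℙ _ _ = refl , refl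
    bits-inj 0 1ℙ _ ()
    bits-inj 1 0ℙ _ ()
    bits-inj 1 1ℙ _ ()
    bits-inj 2 0ℙ _ ()
    bits-inj 2 1ℙ _ ()
    bits-inj 3 0ℙ _ ()
    bits-inj 3 1ℙ _ ()
    bits-inj (suc (suc (suc (suc _)))) _ (s≤s (s≤s (s≤s (s≤s ())))) _

    -- The exponents are ordered by the indices i < i + m < i + 2m, so that the argument with
    -- windows can read them off.
    δ-form : ∀ d → ∃ λ αβγ → δ d ≈ form αβγ × (αβγ ≡ (false , false , false) → Group._≈_ D₈ d (Group.ε D₈))
    δ-form (ρ , p) = bits t p , ≈-trans (∙-congʳ (zp-cong 4 pow4 ρ (ℤ.+ t) 4∣)) (form-correct t p t<4)
                   , λ e → let t≡0 , p≡0 = bits-inj t p t<4 e in ≡.subst (λ z → ℤ.+ 4 ℤ∣.∣ (ρ ℤ.- ℤ.+ z)) t≡0 4∣ , p≡0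
      where
      t = ρ ℤ.%ℕ 4
      t<4 : t < 4
      t<4 = ℤ.n%ℕd<d ρ 4
      4∣ : ℤ.+ 4 ℤ∣.∣ (ρ ℤ.- ℤ.+ t)
      4∣ = ℤ∣.divides q (≡.trans (≡.cong (ℤ._- (ℤ.+ t)) (≡.trans (ℤ.a≡a%ℕn+[a/ℕn]*n ρ 4) (ℤ.+-comm (ℤ.+ t) (q ℤ.* ℤ.+ 4))))
        (≡.trans (ℤ.+-assoc (q ℤ.* ℤ.+ 4) (ℤ.+ t) (ℤ.- (ℤ.+ t))) (≡.trans (≡.cong (ℤ._+_ (q ℤ.* ℤ.+ 4)) (ℤ.+-inverseʳ (ℤ.+ t))) (ℤ.+-identityʳ _))))
        where q = ρ ℤ./ℕ 4

  bit : Parity → Bool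
  bit 0ℙ = false
  bit 1ℙ = true

  ζ : ∀ k → ℕ → (Fin k → Parity) → Carrier
  ζ zero    s g = ε
  ζ (suc k) s g = pw (bit (g zero)) (bi s) ∙ ζ k (suc s) (λ t → g (suc t))

  ζ-cong : ∀ k s {g g′} → (∀ t → g t ≡ g′ t) → ζ k s g ≈ ζ k s g′
  ζ-cong zero    s p = ≈-refl
  ζ-cong (suc k) s p = ∙-cong (reflexive (≡.cong (λ q → pw (bit q) (bi s)) (p zero))) (ζ-cong k (suc s) (λ t → p (suc t)))

  ζ-ε : ∀ k s → ζ k s (λ _ → 0ℙ) ≈ ε
  ζ-ε zero    s = ≈-refl
  ζ-ε (suc k) s = ≈-trans (identityˡ _) (ζ-ε k (suc s))

  ζ-unit : ∀ k s t → t < k → ∃ λ g → ζ k s g ≈ bi (s + t)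
  ζ-unit (suc k) s zero    _ = (λ { zero → 1ℙ ; (suc _) → 0ℙ })
    , ≈-trans (∙-congˡ (ζ-ε k (suc s))) (≈-trans (identityʳ _) (reflexive (≡.cong bi (≡.sym (ℕ.+-identityʳ s)))))
  ζ-unit (suc k) s (suc t) (s≤s t<k) with g , p ← ζ-unit k (suc s) t t<k =
    (λ { zero → 0ℙ ; (suc t) → g t }) , ≈-trans (identityˡ _) (≈-trans p (reflexive (≡.cong bi (≡.sym (ℕ.+-suc s t)))))

  pw-comm : ∀ e {u v} → Comm u v → Comm u (pw e v)
  pw-comm true  p = p
  pw-comm false p = comm-ε

  ζ-comm : ∀ k s {u} → (∀ i → s ≤ i → i < s + k → Comm u (bi i)) → ∀ g → Comm u (ζ k s g)
  ζ-comm zero    s h g = comm-ε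
  ζ-comm (suc k) s h g = comm-∙ (pw-comm (bit (g zero)) (h s ℕ.≤-refl (ℕ.m<m+n s (s≤s z≤n))))
    (ζ-comm k (suc s) (λ i s<i i< → h i (ℕ.<⇒≤ s<i) (≡.subst (i <_) (≡.sym (ℕ.+-suc s k)) i<)) (λ t → g (suc t)))

  ζ-central : ∀ k s g → 4 ≤ s → s + k ≤ m + m → ∀ j → j < w → Comm (bi j) (ζ k s g)
  ζ-central k s g 4≤s s+k≤ j j<w = ζ-comm k s
    (λ i s≤i i< → comm-sym (bi-central i j (ℕ.≤-trans 4≤s s≤i) (ℕ.≤-trans i< s+k≤) j<w)) g

  ζ-∙ : ∀ k s g g′ → 4 ≤ s → s + k ≤ m + m → ζ k s (λ t → g t ℙ.+ g′ t) ≈ ζ k s g ∙ ζ k s g′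
  ζ-∙ zero    s g g′ _ _ = ≈-sym (identityˡ ε)
  ζ-∙ (suc k) s g g′ 4≤s s+k≤ = ≈-trans (∙-cong (bit-+ (g zero) (g′ zero)) (ζ-∙ k (suc s) _ _ (ℕ.m≤n⇒m≤1+n 4≤s) 1+s+k≤))
      (interchange (pw-comm₂ (bit (g′ zero))))
    where
    1+s+k≤ : suc s + k ≤ m + m
    1+s+k≤ = ≡.subst (_≤ m + m) (ℕ.+-suc s k) s+k≤
    bit-+ : ∀ p q → pw (bit (p ℙ.+ q)) (bi s) ≈ pw (bit p) (bi s) ∙ pw (bit q) (bi s)
    bit-+ 0ℙ q  = ≈-sym (identityˡ _)
    bit-+ 1ℙ 0ℙ = ≈-sym (identityʳ _)
    bit-+ 1ℙ 1ℙ = ≈-sym (bi² s)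
    rest = λ t → g (suc t)
    pw-comm₂ : ∀ e → Comm (pw e (bi s)) (ζ k (suc s) rest)
    pw-comm₂ false = comm-sym comm-ε
    pw-comm₂ true  = ζ-central k (suc s) rest (ℕ.m≤n⇒m≤1+n 4≤s) 1+s+k≤ s
      (ℕ.≤-trans (ℕ.m≤m+n (suc s) k) (ℕ.≤-trans 1+s+k≤ (ℕ.m≤n+m (m + m) 4)))

  private
    z : ℕ
    z = m ∸ 4

    4+z : 4 + z ≡ m
    4+z = ℕ.m+[n∸m]≡n 4≤m

    4≤4+m : 4 ≤ 4 + m
    4≤4+m = ℕ.m≤m+n 4 m

    4+m+z : (4 + m) + z ≡ m + m
    4+m+z = ≡.trans (≡.cong (_+ z) (ℕ.+-comm 4 m)) (≡.trans (ℕ.+-assoc m 4 z) (≡.cong (m +_) 4+z))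

    4+z≤ : 4 + z ≤ m + m
    4+z≤ = ≡.subst (_≤ m + m) (≡.sym 4+z) (ℕ.m≤m+n m m)

  H : Grp
  H = (D₈ ^ᴳ 2 ×ᴳ ℤ₂ ^ᴳ (m ∸ 4)) ^ᴳ 2

  private module H = Group H

  private
    0<4 : 0 < 4
    0<4 = s≤s z≤n
    1<4 : 1 < 4
    1<4 = s≤s (s≤s z≤n)
    2<4 : 2 < 4
    2<4 = s≤s (s≤s (s≤s z≤n))
    3<4 : 3 < 4
    3<4 = s≤s (s≤s (s≤s (s≤s z≤n)))

  module δ₀ = D₈ᵢ 0 0<4
  module δ₁ = D₈ᵢ 1 1<4
  module δ₂ = D₈ᵢ 2 2<4
  module δ₃ = D₈ᵢ 3 3<4

  δδ-comm : ∀ i k (i<4 : i < 4) (k<4 : k < 4) → i ≢ k → ∀ d d′ →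
            Comm (D₈ᵢ.δ i i<4 d) (D₈ᵢ.δ k k<4 d′)
  δδ-comm i k i<4 k<4 i≢k d = D₈ᵢ.δ-comm k k<4
    (comm-sym (D₈ᵢ.δ-comm i i<4
      (bi-comm k i (i<w k k<4) (i<w i i<4) (small i k i<4) (small k i k<4))
      (bi-comm k (i + (m + m)) (i<w k k<4) (m+m<w+ i i<4)
        (λ e → i≢k (ℕ.+-cancelʳ-≡ (m + m) i k e)) (small k (i + (m + m)) k<4)) d))
    (comm-sym (D₈ᵢ.δ-comm i i<4
      (bi-comm (k + (m + m)) i (m+m<w+ k k<4) (i<w i i<4)
        (small i (k + (m + m)) i<4) (λ e → i≢k (≡.sym (ℕ.+-cancelʳ-≡ (m + m) k i e))))
      (bi-comm (k + (m + m)) (i + (m + m)) (m+m<w+ k k<4) (m+m<w+ i i<4)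
        (λ e → small i k i<4 (ℕ.+-cancelʳ-≡ (m + m) i (k + (m + m)) e))
        (λ e → small k i k<4 (ℕ.+-cancelʳ-≡ (m + m) k (i + (m + m)) e))) d))
    where
    small : ∀ p q → p < 4 → p ≢ q + (m + m)
    small p q p<4 e = ℕ.<⇒≱ p<4 (≡.subst (4 ≤_) (≡.sym e)
      (ℕ.≤-trans 4≤m (ℕ.≤-trans (ℕ.m≤m+n m m) (ℕ.m≤n+m (m + m) q))))

  δζ-comm : ∀ i (i<4 : i < 4) d s g → 4 ≤ s → s + z ≤ m + m → Comm (D₈ᵢ.δ i i<4 d) (ζ z s g)
  δζ-comm i i<4 d s g 4≤s s+z≤ = comm-sym (D₈ᵢ.δ-comm i i<4
    (comm-sym (ζ-central z s g 4≤s s+z≤ i (i<w i i<4)))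
    (comm-sym (ζ-central z s g 4≤s s+z≤ (i + (m + m)) (m+m<w+ i i<4))) d)

  ζζ-comm : ∀ s s′ g g′ → 4 ≤ s → s + z ≤ m + m → 4 ≤ s′ → s′ + z ≤ m + m → Comm (ζ z s g) (ζ z s′ g′)
  ζζ-comm s s′ g g′ 4≤s s+z≤ 4≤s′ s′+z≤ = ζ-comm z s′ (λ i s′≤i i< → comm-sym
    (ζ-central z s g 4≤s s+z≤ i (ℕ.≤-trans i< (ℕ.≤-trans s′+z≤ (ℕ.m≤n+m (m + m) 4))))) g′

  θ₀ θ₁ : Group.Carrier (D₈ ^ᴳ 2 ×ᴳ ℤ₂ ^ᴳ z) → Carrier
  θ₀ (d , g) = δ₀.δ (d 0F) ∙ (δ₁.δ (d 1F) ∙ ζ z 4 g)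
  θ₁ (d , g) = δ₂.δ (d 0F) ∙ (δ₃.δ (d 1F) ∙ ζ z (4 + m) g)

  θ : H.Carrier → Carrier
  θ f = θ₀ (f 0F) ∙ θ₁ (f 1F)

  θ-cong : ∀ {f f′} → f H.≈ f′ → θ f ≈ θ f′
  θ-cong {f} {f′} p = ∙-cong
    (∙-cong (δ₀.δ-cong (proj₁ (f 0F) 0F) (proj₁ (f′ 0F) 0F) (proj₁ (p 0F) 0F)) (∙-cong (δ₁.δ-cong (proj₁ (f 0F) 1F) (proj₁ (f′ 0F) 1F) (proj₁ (p 0F) 1F)) (ζ-cong z 4 (proj₂ (p 0F)))))
    (∙-cong (δ₂.δ-cong (proj₁ (f 1F) 0F) (proj₁ (f′ 1F) 0F) (proj₁ (p 1F) 0F)) (∙-cong (δ₃.δ-cong (proj₁ (f 1F) 1F) (proj₁ (f′ 1F) 1F) (proj₁ (p 1F) 1F)) (ζ-cong z (4 + m) (proj₂ (p 1F)))))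

  private
    4+m+z≤ : (4 + m) + z ≤ m + m
    4+m+z≤ = ℕ.≤-reflexive 4+m+z

  θ-∙ : ∀ f f′ → θ (f H.∙ f′) ≈ θ f ∙ θ f′
  θ-∙ f f′ = ≈-trans (∙-cong half₀ half₁) (interchange (comm-sym swap-halves))
    where
    d₀ = proj₁ (f 0F) ; d₀′ = proj₁ (f′ 0F) ; g₀ = proj₂ (f 0F) ; g₀′ = proj₂ (f′ 0F)
    d₁ = proj₁ (f 1F) ; d₁′ = proj₁ (f′ 1F) ; g₁ = proj₂ (f 1F) ; g₁′ = proj₂ (f′ 1F)
    half₀ : θ₀ ((f H.∙ f′) 0F) ≈ θ₀ (f 0F) ∙ θ₀ (f′ 0F)
    half₀ = ≈-trans (∙-cong (δ₀.δ-∙ (d₀ 0F) (d₀′ 0F)) (≈-trans (∙-cong (δ₁.δ-∙ (d₀ 1F) (d₀′ 1F)) (ζ-∙ z 4 g₀ g₀′ ℕ.≤-refl 4+z≤))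
        (interchange (δζ-comm 1 1<4 (d₀′ 1F) 4 g₀ ℕ.≤-refl 4+z≤))))
      (interchange (comm-∙ (δδ-comm 0 1 0<4 1<4 (λ ()) (d₀′ 0F) (d₀ 1F)) (δζ-comm 0 0<4 (d₀′ 0F) 4 g₀ ℕ.≤-refl 4+z≤)))
    half₁ : θ₁ ((f H.∙ f′) 1F) ≈ θ₁ (f 1F) ∙ θ₁ (f′ 1F)
    half₁ = ≈-trans (∙-cong (δ₂.δ-∙ (d₁ 0F) (d₁′ 0F)) (≈-trans (∙-cong (δ₃.δ-∙ (d₁ 1F) (d₁′ 1F)) (ζ-∙ z (4 + m) g₁ g₁′ 4≤4+m 4+m+z≤))
        (interchange (δζ-comm 3 3<4 (d₁′ 1F) (4 + m) g₁ 4≤4+m 4+m+z≤))))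
      (interchange (comm-∙ (δδ-comm 2 3 2<4 3<4 (λ ()) (d₁′ 0F) (d₁ 1F)) (δζ-comm 2 2<4 (d₁′ 0F) (4 + m) g₁ 4≤4+m 4+m+z≤)))
    with-half : ∀ {u} → Comm u (δ₀.δ (d₀′ 0F)) → Comm u (δ₁.δ (d₀′ 1F)) → Comm u (ζ z 4 g₀′) → Comm u (θ₀ (f′ 0F))
    with-half p q r = comm-∙ p (comm-∙ q r)
    swap-halves : Comm (θ₁ (f 1F)) (θ₀ (f′ 0F))
    swap-halves = comm-sym (comm-∙
      (comm-sym (with-half (δδ-comm 2 0 2<4 0<4 (λ ()) (d₁ 0F) (d₀′ 0F)) (δδ-comm 2 1 2<4 1<4 (λ ()) (d₁ 0F) (d₀′ 1F)) (δζ-comm 2 2<4 (d₁ 0F) 4 g₀′ ℕ.≤-refl 4+z≤)))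
      (comm-∙
        (comm-sym (with-half (δδ-comm 3 0 3<4 0<4 (λ ()) (d₁ 1F) (d₀′ 0F)) (δδ-comm 3 1 3<4 1<4 (λ ()) (d₁ 1F) (d₀′ 1F)) (δζ-comm 3 3<4 (d₁ 1F) 4 g₀′ ℕ.≤-refl 4+z≤)))
        (comm-sym (with-half (comm-sym (δζ-comm 0 0<4 (d₀′ 0F) (4 + m) g₁ 4≤4+m 4+m+z≤)) (comm-sym (δζ-comm 1 1<4 (d₀′ 1F) (4 + m) g₁ 4≤4+m 4+m+z≤))
          (ζζ-comm (4 + m) 4 g₁ g₀′ 4≤4+m 4+m+z≤ ℕ.≤-refl 4+z≤)))))

  K-ζ : ∀ k s g → s + k ≤ w → K (ζ k s g)
  K-ζ zero    s g _ = W-ε 0 w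
  K-ζ (suc k) s g s+k≤ = K-∙ (K-pw (bit (g zero)) s (ℕ.≤-trans (ℕ.m≤m+n (suc s) k) 1+s+k≤)) (K-ζ k (suc s) _ 1+s+k≤)
    where
    1+s+k≤ : suc s + k ≤ w
    1+s+k≤ = ≡.subst (_≤ w) (ℕ.+-suc s k) s+k≤

  θ-K : ∀ f → K (θ f)
  θ-K f = K-∙ (K-∙ (δ₀.K-δ (proj₁ (f 0F) 0F)) (K-∙ (δ₁.K-δ (proj₁ (f 0F) 1F)) (K-ζ z 4 _ (ℕ.≤-trans 4+z≤ (ℕ.m≤n+m (m + m) 4)))))
              (K-∙ (δ₂.K-δ (proj₁ (f 1F) 0F)) (K-∙ (δ₃.K-δ (proj₁ (f 1F) 1F)) (K-ζ z (4 + m) _ (ℕ.≤-trans 4+m+z≤ (ℕ.m≤n+m (m + m) 4)))))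

  Image : Carrier → Set
  Image u = ∃ λ f → θ f ≈ u

  private
    at : Group.Carrier (D₈ ^ᴳ 2) → (Fin z → Parity) → Group.Carrier (D₈ ^ᴳ 2) → (Fin z → Parity) → H.Carrier
    at d g d′ g′ 0F = d , g
    at d g d′ g′ 1F = d′ , g′
    1ᴰ = Group.ε D₈
    none : Fin z → Parity
    none _ = 0ℙ
    just₀ just₁ : Group.Carrier D₈ → Group.Carrier (D₈ ^ᴳ 2)
    just₀ d 0F = d
    just₀ d 1F = 1ᴰ
    just₁ d 0F = 1ᴰ
    just₁ d 1F = d

    only : ∀ {a b′ c d e g h} → a ≈ h → b′ ≈ ε → c ≈ ε → d ≈ ε → e ≈ ε → g ≈ ε → (a ∙ (b′ ∙ c)) ∙ (d ∙ (e ∙ g)) ≈ h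
    only {h = h} p₁′ p₂′ p₃′ p₄′ p₅′ p₆′ = ≈-trans (∙-cong (∙-cong p₁′ (∙-cong p₂′ p₃′)) (∙-cong p₄′ (∙-cong p₅′ p₆′)))
      (solve (h ∷ []) (p₀ ⊙ (one ⊙ one) ⊙ (one ⊙ (one ⊙ one))) p₀ refl)

    e₀ : ε ∙ ε ≈ ε
    e₀ = identityˡ ε
    ζ₀ = ζ-ε z 4
    ζ₁ = ζ-ε z (4 + m)

  image-δ : ∀ i (i<4 : i < 4) d → Image (D₈ᵢ.δ i i<4 d)
  image-δ 0 (s≤s z≤n) d = at (just₀ d) none (just₀ 1ᴰ) none , only ≈-refl e₀ ζ₀ e₀ e₀ ζ₁
  image-δ 1 (s≤s (s≤s z≤n)) d = at (just₁ d) none (just₀ 1ᴰ) none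
    , ≈-trans (∙-cong (∙-cong e₀ (∙-congˡ ζ₀)) (∙-cong e₀ (∙-cong e₀ ζ₁))) (solve (δ₁.δ d ∷ []) (one ⊙ (p₀ ⊙ one) ⊙ (one ⊙ (one ⊙ one))) p₀ refl)
  image-δ 2 (s≤s (s≤s (s≤s z≤n))) d = at (just₀ 1ᴰ) none (just₀ d) none
    , ≈-trans (∙-cong (∙-cong e₀ (∙-cong e₀ ζ₀)) (∙-congˡ (∙-cong e₀ ζ₁))) (solve (δ₂.δ d ∷ []) (one ⊙ (one ⊙ one) ⊙ (p₀ ⊙ (one ⊙ one))) p₀ refl)
  image-δ 3 (s≤s (s≤s (s≤s (s≤s z≤n)))) d = at (just₀ 1ᴰ) none (just₁ d) none
    , ≈-trans (∙-cong (∙-cong e₀ (∙-cong e₀ ζ₀)) (∙-cong e₀ (∙-congˡ ζ₁))) (solve (δ₃.δ d ∷ []) (one ⊙ (one ⊙ one) ⊙ (one ⊙ (p₀ ⊙ one))) p₀ refl)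
  image-δ (suc (suc (suc (suc _)))) (s≤s (s≤s (s≤s (s≤s ())))) d

  image-resp : ∀ {u v} → u ≈ v → Image u → Image v
  image-resp p (f , q) = f , ≈-trans q p

  image-bi : ∀ j → j < w → Image (bi j)
  image-bi j j<w = go (j ℕ.<? 4) (j ℕ.<? m) (j ℕ.<? 4 + m) (j ℕ.<? m + m)
    where
    reflect : ∀ i (i<4 : i < 4) → Image (bi i)
    reflect i i<4 = image-resp (identityˡ _) (image-δ i i<4 (ℤ.+ 0 , 1ℙ))
    centre : ∀ i (i<4 : i < 4) → Image (bi (i + m))
    centre i i<4 = image-resp (≈-trans (identityʳ _) (D₈ᵢ.pow2 i i<4)) (image-δ i i<4 (ℤ.+ 2 , 0ℙ))
    -- bᵢ₊₂ₘ is the reflection r⁻¹ bᵢ.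
    reflect′ : ∀ i (i<4 : i < 4) → Image (bi (i + (m + m)))
    reflect′ i i<4 = image-resp (begin
      (D₈ᵢ.r i i<4 ∙ ε) ⁻¹ ∙ bi i      ≈⟨ ∙-congʳ (≈-trans (⁻¹-cong (identityʳ _)) (D₈ᵢ.r⁻¹ i i<4)) ⟩
      bi (i + (m + m)) ∙ bi i ∙ bi i   ≈⟨ assoc _ _ _ ⟩
      bi (i + (m + m)) ∙ (bi i ∙ bi i) ≈⟨ ∙-congˡ (bi² i) ⟩
      bi (i + (m + m)) ∙ ε             ≈⟨ identityʳ _ ⟩
      bi (i + (m + m))                 ∎) (image-δ i i<4 (ℤ.-[1+ 0 ] , 1ℙ))
    at-offset : ∀ s → s ≤ j → ∀ {k} → j < s + k → (∀ t → t < k → Image (bi (s + t))) → Image (bi j)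
    at-offset s s≤j {k} j< h = ≡.subst (λ i → Image (bi i)) (ℕ.m+[n∸m]≡n s≤j)
      (h (j ∸ s) (ℕ.+-cancelˡ-< s (j ∸ s) k (≡.subst (_< s + k) (≡.sym (ℕ.m+[n∸m]≡n s≤j)) j<)))
    flip-+ : ∀ s → (∀ t → t < 4 → Image (bi (t + s))) → ∀ t → t < 4 → Image (bi (s + t))
    flip-+ s h t t<4 = ≡.subst (λ i → Image (bi i)) (ℕ.+-comm t s) (h t t<4)
    go : Dec (j < 4) → Dec (j < m) → Dec (j < 4 + m) → Dec (j < m + m) → Image (bi j)
    go (yes p) _ _ _ = reflect j p
    go (no ¬p) (yes q) _ _ = at-offset 4 (ℕ.≮⇒≥ ¬p) (≡.subst (j <_) (≡.sym 4+z) q) λ t t<z →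
      let g , r = ζ-unit z 4 t t<z in at (just₀ 1ᴰ) g (just₀ 1ᴰ) none
      , ≈-trans (∙-cong (∙-cong e₀ (∙-cong e₀ r)) (∙-cong e₀ (∙-cong e₀ ζ₁))) (solve (bi (4 + t) ∷ []) (one ⊙ (one ⊙ p₀) ⊙ (one ⊙ (one ⊙ one))) p₀ refl)
    go (no _) (no ¬q) (yes r) _ = at-offset m (ℕ.≮⇒≥ ¬q) (≡.subst (j <_) (ℕ.+-comm 4 m) r) (flip-+ m centre)
    go (no _) (no _) (no ¬r) (yes s) = at-offset (4 + m) (ℕ.≮⇒≥ ¬r) (≡.subst (j <_) (≡.sym 4+m+z) s) λ t t<z →
      let g , r = ζ-unit z (4 + m) t t<z in at (just₀ 1ᴰ) none (just₀ 1ᴰ) g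
      , ≈-trans (∙-cong (∙-cong e₀ (∙-cong e₀ ζ₀)) (∙-cong e₀ (∙-cong e₀ r))) (solve (bi ((4 + m) + t) ∷ []) (one ⊙ (one ⊙ one) ⊙ (one ⊙ (one ⊙ p₀))) p₀ refl)
    go (no _) (no _) (no _) (no ¬s) = at-offset (m + m) (ℕ.≮⇒≥ ¬s) (≡.subst (j <_) (ℕ.+-comm 4 (m + m)) j<w) (flip-+ (m + m) reflect′)

  K-image : ∀ {k} → K k → Image k
  K-image = go 0 w ℕ.≤-refl
    where
    go : ∀ i k {u} → i + k ≤ w → W i k u → Image u
    go i zero    _ p = H.ε , ≈-trans (only e₀ e₀ ζ₀ e₀ e₀ ζ₁) (≈-sym p)
    go i (suc k) i+k≤ (inj₁ p) = go (suc i) k (≡.subst (_≤ w) (ℕ.+-suc i k) i+k≤) p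
    go i (suc k) {u} i+k≤ (inj₂ p) =
      let 1+i+k≤ = ≡.subst (_≤ w) (ℕ.+-suc i k) i+k≤
          f , q = image-bi i (ℕ.≤-trans (ℕ.m≤m+n (suc i) k) 1+i+k≤)
          f′ , q′ = go (suc i) k 1+i+k≤ p
      in f H.∙ f′ , ≈-trans (θ-∙ f f′) (≈-trans (∙-cong q q′) (bi-cancel i u))

  -- Injectivity of `θ`

  Up : ℕ → Carrier → Set
  Up s = W s (w ∸ s)

  Up-mul : ∀ s {u v} → Up s u → Up s v → Up s (u ∙ v)
  Up-mul s = W-mul s (w ∸ s) (ℕ.≤-trans (ℕ.m∸n≤m w s) w≤1+w)

  Up-bi : ∀ s j → s ≤ j → j < w → Up s (bi j)
  Up-bi s j s≤j j<w = ≡.subst (λ z → Up s (bi z)) (ℕ.m+[n∸m]≡n s≤j)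
    (W-bi s (w ∸ s) (j ∸ s) (ℕ.≤-trans (ℕ.m∸n≤m w s) w≤1+w) (ℕ.∸-monoˡ-< j<w s≤j))

  Up-ζ : ∀ r k s g → r ≤ s → s + k ≤ w → Up r (ζ k s g)
  Up-ζ r zero    s g _ _ = W-ε r (w ∸ r)
  Up-ζ r (suc k) s g r≤s s+k≤ = Up-mul r (head (bit (g zero))) (Up-ζ r k (suc s) _ (ℕ.m≤n⇒m≤1+n r≤s) 1+s+k≤)
    where
    1+s+k≤ : suc s + k ≤ w
    1+s+k≤ = ≡.subst (_≤ w) (ℕ.+-suc s k) s+k≤
    head : ∀ e → Up r (pw e (bi s))
    head true  = Up-bi r s r≤s (ℕ.≤-trans (ℕ.m≤m+n (suc s) k) 1+s+k≤)
    head false = W-ε r (w ∸ r)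

  ∙-rotate : ∀ {u v} → u ∙ v ≈ ε → v ∙ u ≈ ε
  ∙-rotate {u} {v} p = ≈-trans (∙-congʳ (inverseʳ-unique u v p)) (inverseˡ u)

  -- With exponent 1 the equation would give b_s = v⁻¹, a product of later shifts.
  strip : ∀ s {α v} → s < w → pw α (bi s) ∙ v ≈ ε → Up (suc s) v → α ≡ false × v ≈ ε
  strip s {false} _   p _ = refl , ≈-trans (≈-sym (identityˡ _)) p
  strip s {true} {v} s<w p q = ⊥-elim (bi∉W s (w ∸ suc s) k≤ (W-resp (suc s) (w ∸ suc s)
      (≈-sym (inverseˡ-unique _ _ p)) (W-inv (suc s) (w ∸ suc s) k≤ q)))
    where
    k≤ : w ∸ suc s ≤ suc w
    k≤ = ℕ.≤-trans (ℕ.m∸n≤m w (suc s)) w≤1+w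

  bit-false : ∀ p → bit p ≡ false → p ≡ 0ℙ
  bit-false 0ℙ _ = refl

  ζ-strip : ∀ k s g {v} → s + k ≤ w → ζ k s g ∙ v ≈ ε → (∀ r → r ≤ s + k → Up r v) →
            (∀ t → g t ≡ 0ℙ) × v ≈ ε
  ζ-strip zero    s g s+k≤ p _ = (λ ()) , ≈-trans (≈-sym (identityˡ _)) p
  ζ-strip (suc k) s g {v} s+k≤ p h =
    let e , p′ = strip s (ℕ.≤-trans (ℕ.m≤m+n (suc s) k) 1+s+k≤) (≈-trans (≈-sym (assoc _ _ _)) p)
                   (Up-mul (suc s) (Up-ζ (suc s) k (suc s) _ ℕ.≤-refl 1+s+k≤) (h (suc s) (≡.subst (suc s ≤_) (≡.sym (ℕ.+-suc s k)) (ℕ.m≤m+n (suc s) k))))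
        a , p″ = ζ-strip k (suc s) _ 1+s+k≤ p′ (λ r r≤ → h r (≡.subst (r ≤_) (≡.sym (ℕ.+-suc s k)) r≤))
    in (λ { zero → bit-false _ e ; (suc t) → a t }) , p″
    where
    1+s+k≤ : suc s + k ≤ w
    1+s+k≤ = ≡.subst (_≤ w) (ℕ.+-suc s k) s+k≤

  -- An element of H has 14 blocks of coordinates; in increasing order of the
  -- indices of the bᵢ involved they are numbered 0, …, 13.
  module Blocks (start len : ℕ → ℕ) (inside : ∀ r → start r + len r ≤ w)
                (sorted : ∀ r → start r + len r ≤ start (suc r))
                (g : ∀ r → Fin (len r) → Parity) where

    B : ℕ → Carrier
    B r = ζ (len r) (start r) (g r)

    product : List ℕ → Carrier
    product []       = ε
    product (r ∷ rs) = B r ∙ product rs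

    product-++ : ∀ rs qs → product (rs ++ qs) ≈ product rs ∙ product qs
    product-++ []       qs = ≈-sym (identityˡ _)
    product-++ (r ∷ rs) qs = ≈-trans (∙-congˡ (product-++ rs qs)) (≈-sym (assoc _ _ _))

    start-mono : ∀ r k → start r ≤ start (r + k)
    start-mono r zero    = ℕ.≤-reflexive (≡.cong start (≡.sym (ℕ.+-identityʳ r)))
    start-mono r (suc k) = ℕ.≤-trans (ℕ.≤-trans (ℕ.m≤m+n (start r) (len r)) (sorted r))
      (ℕ.≤-trans (start-mono (suc r) k) (ℕ.≤-reflexive (≡.cong start (≡.sym (ℕ.+-suc r k)))))

    after : ∀ r q → r < q → start r + len r ≤ start q
    after r q r<q = ℕ.≤-trans (sorted r) (ℕ.≤-trans (start-mono (suc r) (q ∸ suc r)) (ℕ.≤-reflexive (≡.cong start (ℕ.m+[n∸m]≡n r<q))))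

    product-Up : ∀ r qs → All (r <_) qs → ∀ s → s ≤ start r + len r → Up s (product qs)
    product-Up r []       _ s _ = W-ε s (w ∸ s)
    product-Up r (q ∷ qs) (r<q ∷ a) s s≤ = Up-mul s
      (Up-ζ s (len q) (start q) (g q) (ℕ.≤-trans s≤ (after r q r<q)) (inside q)) (product-Up r qs a s s≤)

    -- A product equal to 1 may be rotated cyclically. This brings the block with the lowest indices
    -- to the front without any commutation; there its exponents vanish and the block drops out.
    extract : ∀ rs r qs → All (r <_) (qs ++ rs) → product (rs ++ r ∷ qs) ≈ ε →
              (∀ t → g r t ≡ 0ℙ) × product (qs ++ rs) ≈ ε
    extract rs r qs a p = ζ-strip (len r) (start r) (g r) (inside r) (begin
        B r ∙ product (qs ++ rs)          ≈⟨ ∙-congˡ (product-++ qs rs) ⟩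
        B r ∙ (product qs ∙ product rs)   ≈⟨ assoc _ _ _ ⟨
        product (r ∷ qs) ∙ product rs     ≈⟨ ∙-rotate (≈-trans (≈-sym (product-++ rs (r ∷ qs))) p) ⟩
        ε                                 ∎)
      (product-Up r (qs ++ rs) a)

  private
    start′ len′ : ℕ → ℕ
    start′ 0 = 0
    start′ 1 = 1
    start′ 2 = 2
    start′ 3 = 3
    start′ 4 = 4
    start′ 5 = 0 + m
    start′ 6 = 1 + m
    start′ 7 = 2 + m
    start′ 8 = 3 + m
    start′ 9 = 4 + m
    start′ 10 = 0 + (m + m)
    start′ 11 = 1 + (m + m)
    start′ 12 = 2 + (m + m)
    start′ 13 = 3 + (m + m)
    start′ _  = w
    len′ 4 = z
    len′ 9 = z
    len′ 0 = 1
    len′ 1 = 1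
    len′ 2 = 1
    len′ 3 = 1
    len′ 5 = 1
    len′ 6 = 1
    len′ 7 = 1
    len′ 8 = 1
    len′ 10 = 1
    len′ 11 = 1
    len′ 12 = 1
    len′ 13 = 1
    len′ _ = 0

    sorted : ∀ r → start′ r + len′ r ≤ start′ (suc r)
    sorted 0 = ℕ.≤-refl
    sorted 1 = ℕ.≤-refl
    sorted 2 = ℕ.≤-refl
    sorted 3 = ℕ.≤-refl
    sorted 4 = ℕ.≤-reflexive 4+z
    sorted 5 = ℕ.≤-reflexive (ℕ.+-comm m 1)
    sorted 6 = ℕ.≤-reflexive (ℕ.+-comm (1 + m) 1)
    sorted 7 = ℕ.≤-reflexive (ℕ.+-comm (2 + m) 1)
    sorted 8 = ℕ.≤-reflexive (ℕ.+-comm (3 + m) 1)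
    sorted 9 = ℕ.≤-reflexive 4+m+z
    sorted 10 = ℕ.≤-reflexive (ℕ.+-comm (m + m) 1)
    sorted 11 = ℕ.≤-reflexive (ℕ.+-comm (1 + (m + m)) 1)
    sorted 12 = ℕ.≤-reflexive (ℕ.+-comm (2 + (m + m)) 1)
    sorted 13 = ℕ.≤-reflexive (ℕ.+-comm (3 + (m + m)) 1)
    sorted (suc (suc (suc (suc (suc (suc (suc (suc (suc (suc (suc (suc (suc (suc _)))))))))))))) = ℕ.≤-reflexive (ℕ.+-identityʳ w)

    4+m≤w : 4 + m ≤ w
    4+m≤w = ℕ.+-monoʳ-≤ 4 (ℕ.m≤m+n m m)

    inside : ∀ r → start′ (suc r) ≤ w
    inside 0 = ℕ.m≤m+n 1 (3 + (m + m))
    inside 1 = ℕ.m≤m+n 2 (2 + (m + m))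
    inside 2 = ℕ.m≤m+n 3 (1 + (m + m))
    inside 3 = ℕ.m≤m+n 4 (m + m)
    inside 4 = ℕ.≤-trans (ℕ.m≤n+m m 4) 4+m≤w
    inside 5 = ℕ.≤-trans (ℕ.m≤n+m (1 + m) 3) 4+m≤w
    inside 6 = ℕ.≤-trans (ℕ.m≤n+m (2 + m) 2) 4+m≤w
    inside 7 = ℕ.≤-trans (ℕ.m≤n+m (3 + m) 1) 4+m≤w
    inside 8 = 4+m≤w
    inside 9 = ℕ.m≤n+m (m + m) 4
    inside 10 = ℕ.m≤n+m (1 + (m + m)) 3
    inside 11 = ℕ.m≤n+m (2 + (m + m)) 2
    inside 12 = ℕ.m≤n+m (3 + (m + m)) 1
    inside (suc (suc (suc (suc (suc (suc (suc (suc (suc (suc (suc (suc (suc _))))))))))))) = ℕ.≤-refl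

    toParity : Bool → Parity
    toParity false = 0ℙ
    toParity true  = 1ℙ

    parity-false : ∀ α → toParity α ≡ 0ℙ → α ≡ false
    parity-false false _ = refl

    parity-bit : ∀ α {s} → pw (bit (toParity α)) (bi s) ∙ ε ≈ pw α (bi s)
    parity-bit false = identityʳ ε
    parity-bit true  = identityʳ _

  θ-kernel : ∀ f → θ f ≈ ε → f H.≈ H.ε
  θ-kernel f θf = λ { 0F → (λ { 0F → trivial₀ (bits≡ (z0 0F) (z5 0F) (z10 0F)) ; 1F → trivial₁ (bits≡ (z1 0F) (z6 0F) (z11 0F)) }) , z4
                    ; 1F → (λ { 0F → trivial₂ (bits≡ (z2 0F) (z7 0F) (z12 0F)) ; 1F → trivial₃ (bits≡ (z3 0F) (z8 0F) (z13 0F)) }) , z9 }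
    where
    F₀ = δ₀.δ-form (proj₁ (f 0F) 0F)
    F₁ = δ₁.δ-form (proj₁ (f 0F) 1F)
    F₂ = δ₂.δ-form (proj₁ (f 1F) 0F)
    F₃ = δ₃.δ-form (proj₁ (f 1F) 1F)
    trivial₀ = proj₂ (proj₂ F₀)
    trivial₁ = proj₂ (proj₂ F₁)
    trivial₂ = proj₂ (proj₂ F₂)
    trivial₃ = proj₂ (proj₂ F₃)
    α β γ : Bool × Bool × Bool → Bool
    α (a , _ , _) = a
    β (_ , a , _) = a
    γ (_ , _ , a) = a
    coords : ∀ r → Fin (len′ r) → Parity
    coords 0 _ = toParity (α (proj₁ F₀))
    coords 1 _ = toParity (α (proj₁ F₁))
    coords 2 _ = toParity (α (proj₁ F₂))
    coords 3 _ = toParity (α (proj₁ F₃))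
    coords 4   = proj₂ (f 0F)
    coords 5 _ = toParity (β (proj₁ F₀))
    coords 6 _ = toParity (β (proj₁ F₁))
    coords 7 _ = toParity (β (proj₁ F₂))
    coords 8 _ = toParity (β (proj₁ F₃))
    coords 9   = proj₂ (f 1F)
    coords 10 _ = toParity (γ (proj₁ F₀))
    coords 11 _ = toParity (γ (proj₁ F₁))
    coords 12 _ = toParity (γ (proj₁ F₂))
    coords 13 _ = toParity (γ (proj₁ F₃))
    coords (suc (suc (suc (suc (suc (suc (suc (suc (suc (suc (suc (suc (suc (suc _)))))))))))))) ()
    open Blocks start′ len′ (λ r → ℕ.≤-trans (sorted r) (inside r)) sorted coords
    bits≡ : ∀ {αβγ : Bool × Bool × Bool} → toParity (α αβγ) ≡ 0ℙ → toParity (β αβγ) ≡ 0ℙ → toParity (γ αβγ) ≡ 0ℙ → αβγ ≡ (false , false , false)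
    bits≡ {a , c , e} p q r = ≡.cong₂ _,_ (parity-false a p) (≡.cong₂ _,_ (parity-false c q) (parity-false e r))
    glue : ∀ αβγ s t r {u v} → u ≈ pw (α αβγ) (bi s) ∙ (pw (β αβγ) (bi t) ∙ pw (γ αβγ) (bi r)) →
      (pw (bit (toParity (α αβγ))) (bi s) ∙ ε) ∙ ((pw (bit (toParity (β αβγ))) (bi t) ∙ ε) ∙ ((pw (bit (toParity (γ αβγ))) (bi r) ∙ ε) ∙ v)) ≈ u ∙ v
    glue (a , c , e) s t r {u} {v} p = ≈-trans (∙-cong (parity-bit a {s}) (∙-cong (parity-bit c {t}) (∙-congʳ (parity-bit e {r}))))
      (≈-trans (solve (pw a (bi s) ∷ pw c (bi t) ∷ pw e (bi r) ∷ v ∷ []) (p₀ ⊙ (p₁ ⊙ (p₂ ⊙ p₃))) (p₀ ⊙ (p₁ ⊙ p₂) ⊙ p₃) refl) (∙-congʳ (≈-sym p)))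
    -- The order in which the blocks occur in `θ f`: three for each dihedral factor, and 4 and 9 for
    -- the central involutions of the two halves.
    p : product (0 ∷ 5 ∷ 10 ∷ 1 ∷ 6 ∷ 11 ∷ 4 ∷ 2 ∷ 7 ∷ 12 ∷ 3 ∷ 8 ∷ 13 ∷ 9 ∷ []) ≈ ε
    p = ≈-trans (≈-trans (glue (proj₁ F₀) 0 (0 + m) (0 + (m + m)) (proj₁ (proj₂ F₀))) (∙-congˡ (≈-trans (glue (proj₁ F₁) 1 (1 + m) (1 + (m + m)) (proj₁ (proj₂ F₁))) (∙-congˡ (∙-congˡ
          (≈-trans (glue (proj₁ F₂) 2 (2 + m) (2 + (m + m)) (proj₁ (proj₂ F₂))) (∙-congˡ (glue (proj₁ F₃) 3 (3 + m) (3 + (m + m)) (proj₁ (proj₂ F₃))))))))))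
        (≈-trans (solve (δ₀.δ (proj₁ (f 0F) 0F) ∷ δ₁.δ (proj₁ (f 0F) 1F) ∷ ζ z 4 (proj₂ (f 0F)) ∷ δ₂.δ (proj₁ (f 1F) 0F) ∷ δ₃.δ (proj₁ (f 1F) 1F) ∷ ζ z (4 + m) (proj₂ (f 1F)) ∷ [])
          (p₀ ⊙ (p₁ ⊙ (p₂ ⊙ (p₃ ⊙ (p₄ ⊙ (p₅ ⊙ one)))))) (p₀ ⊙ (p₁ ⊙ p₂) ⊙ (p₃ ⊙ (p₄ ⊙ p₅))) refl) θf)
    -- The blocks are removed in the order 0, ..., 13; each removal leaves the list rotated to start
    -- behind the removed block.
    step0 = extract [] 0 (5 ∷ 10 ∷ 1 ∷ 6 ∷ 11 ∷ 4 ∷ 2 ∷ 7 ∷ 12 ∷ 3 ∷ 8 ∷ 13 ∷ 9 ∷ []) (from-yes (all? (0 ℕ.<?_) (5 ∷ 10 ∷ 1 ∷ 6 ∷ 11 ∷ 4 ∷ 2 ∷ 7 ∷ 12 ∷ 3 ∷ 8 ∷ 13 ∷ 9 ∷ []))) p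
    z0 = proj₁ step0
    step1 = extract (5 ∷ 10 ∷ []) 1 (6 ∷ 11 ∷ 4 ∷ 2 ∷ 7 ∷ 12 ∷ 3 ∷ 8 ∷ 13 ∷ 9 ∷ []) (from-yes (all? (1 ℕ.<?_) (6 ∷ 11 ∷ 4 ∷ 2 ∷ 7 ∷ 12 ∷ 3 ∷ 8 ∷ 13 ∷ 9 ∷ 5 ∷ 10 ∷ []))) (proj₂ step0)
    z1 = proj₁ step1
    step2 = extract (6 ∷ 11 ∷ 4 ∷ []) 2 (7 ∷ 12 ∷ 3 ∷ 8 ∷ 13 ∷ 9 ∷ 5 ∷ 10 ∷ []) (from-yes (all? (2 ℕ.<?_) (7 ∷ 12 ∷ 3 ∷ 8 ∷ 13 ∷ 9 ∷ 5 ∷ 10 ∷ 6 ∷ 11 ∷ 4 ∷ []))) (proj₂ step1)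
    z2 = proj₁ step2
    step3 = extract (7 ∷ 12 ∷ []) 3 (8 ∷ 13 ∷ 9 ∷ 5 ∷ 10 ∷ 6 ∷ 11 ∷ 4 ∷ []) (from-yes (all? (3 ℕ.<?_) (8 ∷ 13 ∷ 9 ∷ 5 ∷ 10 ∷ 6 ∷ 11 ∷ 4 ∷ 7 ∷ 12 ∷ []))) (proj₂ step2)
    z3 = proj₁ step3
    step4 = extract (8 ∷ 13 ∷ 9 ∷ 5 ∷ 10 ∷ 6 ∷ 11 ∷ []) 4 (7 ∷ 12 ∷ []) (from-yes (all? (4 ℕ.<?_) (7 ∷ 12 ∷ 8 ∷ 13 ∷ 9 ∷ 5 ∷ 10 ∷ 6 ∷ 11 ∷ []))) (proj₂ step3)
    z4 = proj₁ step4
    step5 = extract (7 ∷ 12 ∷ 8 ∷ 13 ∷ 9 ∷ []) 5 (10 ∷ 6 ∷ 11 ∷ []) (from-yes (all? (5 ℕ.<?_) (10 ∷ 6 ∷ 11 ∷ 7 ∷ 12 ∷ 8 ∷ 13 ∷ 9 ∷ []))) (proj₂ step4)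
    z5 = proj₁ step5
    step6 = extract (10 ∷ []) 6 (11 ∷ 7 ∷ 12 ∷ 8 ∷ 13 ∷ 9 ∷ []) (from-yes (all? (6 ℕ.<?_) (11 ∷ 7 ∷ 12 ∷ 8 ∷ 13 ∷ 9 ∷ 10 ∷ []))) (proj₂ step5)
    z6 = proj₁ step6
    step7 = extract (11 ∷ []) 7 (12 ∷ 8 ∷ 13 ∷ 9 ∷ 10 ∷ []) (from-yes (all? (7 ℕ.<?_) (12 ∷ 8 ∷ 13 ∷ 9 ∷ 10 ∷ 11 ∷ []))) (proj₂ step6)
    z7 = proj₁ step7
    step8 = extract (12 ∷ []) 8 (13 ∷ 9 ∷ 10 ∷ 11 ∷ []) (from-yes (all? (8 ℕ.<?_) (13 ∷ 9 ∷ 10 ∷ 11 ∷ 12 ∷ []))) (proj₂ step7)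
    z8 = proj₁ step8
    step9 = extract (13 ∷ []) 9 (10 ∷ 11 ∷ 12 ∷ []) (from-yes (all? (9 ℕ.<?_) (10 ∷ 11 ∷ 12 ∷ 13 ∷ []))) (proj₂ step8)
    z9 = proj₁ step9
    step10 = extract [] 10 (11 ∷ 12 ∷ 13 ∷ []) (from-yes (all? (10 ℕ.<?_) (11 ∷ 12 ∷ 13 ∷ []))) (proj₂ step9)
    z10 = proj₁ step10
    step11 = extract [] 11 (12 ∷ 13 ∷ []) (from-yes (all? (11 ℕ.<?_) (12 ∷ 13 ∷ []))) (proj₂ step10)
    z11 = proj₁ step11
    step12 = extract [] 12 (13 ∷ []) (from-yes (all? (12 ℕ.<?_) (13 ∷ []))) (proj₂ step11)
    z12 = proj₁ step12
    step13 = extract [] 13 [] (from-yes (all? (13 ℕ.<?_) [])) (proj₂ step12)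
    z13 = proj₁ step13

  θ-inj : ∀ {f f′} → θ f ≈ θ f′ → f H.≈ f′
  θ-inj {f} {f′} p = HP.x∙y⁻¹≈ε⇒x≈y f f′ (θ-kernel (f H.∙ f′ H.⁻¹) (identityˡ-unique _ (θ f′) (begin
    θ (f H.∙ f′ H.⁻¹) ∙ θ f′        ≈⟨ θ-∙ (f H.∙ f′ H.⁻¹) f′ ⟨
    θ ((f H.∙ f′ H.⁻¹) H.∙ f′)      ≈⟨ θ-cong {(f H.∙ f′ H.⁻¹) H.∙ f′} {f} (HP.//-rightDividesˡ f′ f) ⟩
    θ f                             ≈⟨ p ⟩
    θ f′                            ∎)))
    where
    module HP = GroupProperties H

-- Permutation groups containing 3-cycles

≢⇒≡⁻¹ : ∀ c d → c ≢ d → c ≡ d ℙ.⁻¹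
≢⇒≡⁻¹ 0ℙ 0ℙ p = ⊥-elim (p refl)
≢⇒≡⁻¹ 0ℙ 1ℙ _ = refl
≢⇒≡⁻¹ 1ℙ 0ℙ _ = refl
≢⇒≡⁻¹ 1ℙ 1ℙ p = ⊥-elim (p refl)

module ActionLaws (X : Grp) {T : Set} (_▸_ : Group.Carrier X → T → T)
  (▸-cong : ∀ {u v} → Group._≈_ X u v → ∀ t → u ▸ t ≡ v ▸ t)
  (▸-∙ : ∀ u v t → Group._∙_ X u v ▸ t ≡ u ▸ (v ▸ t)) (▸-ε : ∀ t → Group.ε X ▸ t ≡ t) where

  open Group X using (_⁻¹)

  ▸-⁻¹ˡ : ∀ u t → (u ⁻¹) ▸ (u ▸ t) ≡ t
  ▸-⁻¹ˡ u t = ≡.trans (≡.sym (▸-∙ (u ⁻¹) u t)) (≡.trans (▸-cong (Group.inverseˡ X u) t) (▸-ε t))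

  ▸-⁻¹ʳ : ∀ u t → u ▸ ((u ⁻¹) ▸ t) ≡ t
  ▸-⁻¹ʳ u t = ≡.trans (≡.sym (▸-∙ u (u ⁻¹) t)) (≡.trans (▸-cong (Group.inverseʳ X u) t) (▸-ε t))

  ▸-inj : ∀ u {s t} → u ▸ s ≡ u ▸ t → s ≡ t
  ▸-inj u {s} {t} p = ≡.trans (≡.sym (▸-⁻¹ˡ u s)) (≡.trans (≡.cong ((u ⁻¹) ▸_) p) (▸-⁻¹ˡ u t))

module Cycles (X : Grp) {T : Set} (_▸_ : Group.Carrier X → T → T)
  (▸-cong : ∀ {u v} → Group._≈_ X u v → ∀ t → u ▸ t ≡ v ▸ t)
  (▸-∙ : ∀ u v t → Group._∙_ X u v ▸ t ≡ u ▸ (v ▸ t)) (▸-ε : ∀ t → Group.ε X ▸ t ≡ t)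
  (_≟ᵀ_ : DecidableEquality T)
  (colour : T → Parity) (colour-▸ : ∀ u {s t} → colour s ≡ colour t → colour (u ▸ s) ≡ colour (u ▸ t))
  where

  open Group X using (Carrier; _≈_; _∙_; ε; _⁻¹)

  open ActionLaws X _▸_ ▸-cong ▸-∙ ▸-ε

  record Is3Cycle (u : Carrier) (a b c : T) : Set where
    constructor mk3
    field
      a≢b : a ≢ b
      b≢c : b ≢ c
      c≢a : c ≢ a
      a↦b : u ▸ a ≡ b
      b↦c : u ▸ b ≡ c
      c↦a : u ▸ c ≡ a
      else : ∀ t → t ≢ a → t ≢ b → t ≢ c → u ▸ t ≡ t

  rotate₃ : ∀ {u a b c} → Is3Cycle u a b c → Is3Cycle u b c a
  rotate₃ (mk3 p q r x y z e) = mk3 q r p y z x (λ t tb tc ta → e t ta tb tc)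

  inverse₃ : ∀ {u a b c} → Is3Cycle u a b c → Is3Cycle (u ⁻¹) a c b
  inverse₃ {u} {a} {b} {c} (mk3 p q r x y z e) = mk3 (r ∘ ≡.sym) (q ∘ ≡.sym) (p ∘ ≡.sym)
    (back z) (back y) (back x) (λ t ta tc tb → back (e t ta tb tc))
    where
    back : ∀ {s t} → (u ▸ s) ≡ t → (u ⁻¹) ▸ t ≡ s
    back {s} p = ≡.trans (≡.cong ((u ⁻¹) ▸_) (≡.sym p)) (▸-⁻¹ˡ u s)

  conj₃ : ∀ g {u a b c} → Is3Cycle u a b c → Is3Cycle (g ∙ u ∙ g ⁻¹) (g ▸ a) (g ▸ b) (g ▸ c)
  conj₃ g {u} {a} {b} {c} (mk3 p q r x y z e) = mk3 (p ∘ ▸-inj g) (q ∘ ▸-inj g) (r ∘ ▸-inj g)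
    (at x) (at y) (at z)
    (λ t ta tb tc → ≡.trans (≡.cong ((g ∙ u ∙ g ⁻¹) ▸_) (≡.sym (▸-⁻¹ʳ g t)))
      (≡.trans (at (e ((g ⁻¹) ▸ t) (ne ta) (ne tb) (ne tc))) (▸-⁻¹ʳ g t)))
    where
    at : ∀ {s t} → (u ▸ s) ≡ t → (g ∙ u ∙ g ⁻¹) ▸ (g ▸ s) ≡ g ▸ t
    at {s} {t} p = ≡.trans (▸-∙ (g ∙ u) (g ⁻¹) _) (≡.trans (▸-∙ g u _)
      (≡.cong (g ▸_) (≡.trans (≡.cong (u ▸_) (▸-⁻¹ˡ g s)) p)))
    ne : ∀ {s t} → t ≢ (g ▸ s) → (g ⁻¹) ▸ t ≢ s
    ne {s} {t} h eq = h (≡.trans (≡.sym (▸-⁻¹ʳ g t)) (≡.cong (g ▸_) eq))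

  subst₃ : ∀ {u a b c a′ b′ c′} → a ≡ a′ → b ≡ b′ → c ≡ c′ → Is3Cycle u a b c → Is3Cycle u a′ b′ c′
  subst₃ refl refl refl t = t

  module Closed (P : Carrier → Set) (P-resp : ∀ {u v} → u ≈ v → P u → P v)
                (P-ε : P ε) (P-∙ : ∀ {u v} → P u → P v → P (u ∙ v)) (P-⁻¹ : ∀ {u} → P u → P (u ⁻¹)) where

    Has₃ : T → T → T → Set
    Has₃ a b c = ∃ λ u → P u × Is3Cycle u a b c

    has-rotate : ∀ {a b c} → Has₃ a b c → Has₃ b c a
    has-rotate (u , p , h) = u , p , rotate₃ h

    has-inverse : ∀ {a b c} → Has₃ a b c → Has₃ a c b
    has-inverse (u , p , h) = u ⁻¹ , P-⁻¹ p , inverse₃ h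

    has-conj : ∀ {g a b c a′ b′ c′} → P g → g ▸ a ≡ a′ → g ▸ b ≡ b′ → g ▸ c ≡ c′ → Has₃ a b c → Has₃ a′ b′ c′
    has-conj {g} Pg p q r (u , Pu , h) = g ∙ u ∙ g ⁻¹ , P-∙ (P-∙ Pg Pu) (P-⁻¹ Pg) , subst₃ p q r (conj₃ g h)

    -- Leaving the third point open makes the relation transitive on distinct points, so that
    -- connectedness suffices to obtain all 3-cycles.
    Link : T → T → Set
    Link a b = ∃ λ c → Has₃ a b c

    link-sym : ∀ {a b} → Link a b → Link b a
    link-sym (c , h) = c , has-rotate (has-rotate (has-inverse h))

    -- Conjugating (a b x) by v = (b c y) turns b into c and keeps a, unless a = y. The cases are
    -- the coincidences among a, c, x, y.
    link-trans : ∀ {a b c} → a ≢ c → Link a b → Link b c → Link a c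
    link-trans {a} {b} {c} a≢c (x , Hu@(u , Pu , hu)) (y , Hv@(v , Pv , hv)) with a ≟ᵀ y
    ... | yes refl = b , has-rotate (has-inverse Hv)
    ... | no a≢y with c ≟ᵀ x
    ...   | yes refl = b , has-inverse Hu
    ...   | no c≢x with x ≟ᵀ y
    ...     | yes refl = b , has-conj Pv (V.else a U.a≢b a≢c a≢y) V.a↦b V.c↦a Hu
      where
      module U = Is3Cycle hu
      module V = Is3Cycle hv
    ...     | no x≢y = x , has-conj Pv (V.else a U.a≢b a≢c a≢y) V.a↦b (V.else x (U.b≢c ∘ ≡.sym) (c≢x ∘ ≡.sym) x≢y) Hu
      where
      module U = Is3Cycle hu
      module V = Is3Cycle hv

    -- A 3-cycle x → c → z conjugates a → b → x into a → b → c. If z is a or b, its inverse is used;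
    -- this yields the inverse of the 3-cycle wanted.
    all-3-cycles : ∀ {a b c} → a ≢ b → b ≢ c → c ≢ a → colour a ≡ colour b → Link a b →
                   (∀ x → x ≢ c → colour x ≡ colour b → Link x c) → Has₃ a b c
    all-3-cycles {a} {b} {c} a≢b b≢c c≢a a~b (x , Hu@(u , Pu , hu)) link with x ≟ᵀ c
    ... | yes refl = Hu
    ... | no x≢c with link x x≢c (≡.trans (≡.sym (≡.cong colour (Is3Cycle.b↦c hu))) (≡.trans (colour-▸ u (≡.sym a~b)) (≡.cong colour (Is3Cycle.a↦b hu))))
    ...   | z , Hv@(v , Pv , hv) with z ≟ᵀ a
    ...     | yes refl = has-rotate (has-rotate (has-rotate (has-rotate (has-inverse
                (has-conj (P-⁻¹ Pv) (V.b↦c) (V.else b (U.b≢c) a≢b′ b≢c) (V.a↦b) Hu)))))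
      where
      module U = Is3Cycle hu
      module V = Is3Cycle (inverse₃ hv)
      a≢b′ = a≢b ∘ ≡.sym
    ...     | no z≢a with z ≟ᵀ b
    ...       | yes refl = has-inverse (has-conj (P-⁻¹ Pv) (V.else a (U.c≢a ∘ ≡.sym) a≢b (c≢a ∘ ≡.sym)) V.b↦c V.a↦b Hu)
      where
      module U = Is3Cycle hu
      module V = Is3Cycle (inverse₃ hv)
    ...       | no z≢b = has-conj Pv (V.else a (U.c≢a ∘ ≡.sym) (c≢a ∘ ≡.sym) (z≢a ∘ ≡.sym)) (V.else b U.b≢c b≢c (z≢b ∘ ≡.sym)) V.a↦b Hu
      where
      module U = Is3Cycle hu
      module V = Is3Cycle hv

  Avoids : T → List T → Set
  Avoids t []       = ⊤
  Avoids t (s ∷ ts) = t ≢ s × Avoids t ts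

  -- The two standard commutator tricks: a nontrivial u gives [u , c] of small
  -- support, and then [[u , c] , e] is a 3-cycle for a suitable 3-cycle e.
  module Normal
    (three-cycle : ∀ {a b c} → a ≢ b → b ≢ c → c ≢ a → colour a ≡ colour b → colour b ≡ colour c → ∃ λ u → Is3Cycle u a b c)
    (fresh : ∀ c ts → length ts < 8 → ∃ λ t → colour t ≡ c × Avoids t ts)
    (P : Carrier → Set) (P-resp : ∀ {u v} → u ≈ v → P u → P v)
    (P-∙ : ∀ {u v} → P u → P v → P (u ∙ v)) (P-⁻¹ : ∀ {u} → P u → P (u ⁻¹))
    (P-conj : ∀ g {u} → P u → P (g ∙ u ∙ g ⁻¹)) {u₀ : Carrier} (Pu₀ : P u₀) where

    P-ε : P ε
    P-ε = P-resp (Group.inverseʳ X u₀) (P-∙ Pu₀ (P-⁻¹ Pu₀))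

    open Closed P P-resp P-ε P-∙ P-⁻¹ public

    commutator : Carrier → Carrier → Carrier
    commutator u g = u ∙ (g ∙ u ⁻¹ ∙ g ⁻¹)

    P-commutator : ∀ {u} g → P u → P (commutator u g)
    P-commutator g Pu = P-∙ Pu (P-conj g (P-⁻¹ Pu))

    commutator-▸ : ∀ u g {r s t} → (g ⁻¹) ▸ r ≡ s → (u ∙ g ∙ u ⁻¹) ▸ s ≡ t → commutator u g ▸ r ≡ t
    commutator-▸ u g {r} p q = ≡.trans (▸-cong (solve (u ∷ g ∷ []) (p₀ ⊙ (p₁ ⊙ ⊖ p₀ ⊙ ⊖ p₁)) (p₀ ⊙ p₁ ⊙ ⊖ p₀ ⊙ ⊖ p₁) refl) r)
      (≡.trans (▸-∙ (u ∙ g ∙ u ⁻¹) (g ⁻¹) r) (≡.trans (≡.cong ((u ∙ g ∙ u ⁻¹) ▸_) p) q))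
      where open GroupSolver X

    -- [u , c] = (u c u⁻¹) c⁻¹ is a product of two 3-cycles, so it moves at most six points.
    small-support : ∀ u {c i k l} → Is3Cycle c i k l → u ▸ i ≢ i → k ≢ u ▸ i → l ≢ u ▸ i →
      (commutator u c ▸ (u ▸ i) ≡ u ▸ k) ×
      (∀ t → Avoids t (i ∷ k ∷ l ∷ (u ▸ i) ∷ (u ▸ k) ∷ (u ▸ l) ∷ []) → commutator u c ▸ t ≡ t)
    small-support u {c} {i} {k} {l} hc j≢i k≢j l≢j =
      commutator-▸ u c (C.else _ j≢i (l≢j ∘ ≡.sym) (k≢j ∘ ≡.sym)) D.a↦b
      , λ t (ti , tk , tl , tj , tuk , tul , _) → commutator-▸ u c (C.else t ti tl tk) (D.else t tj tuk tul)
      where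
      module C = Is3Cycle (inverse₃ hc)
      module D = Is3Cycle (conj₃ u hc)

    -- The 3-cycles e⁻¹ and ρ e ρ⁻¹ have y and z in common; in their product z becomes fixed and a,
    -- a′, y are permuted cyclically.
    commutator-3-cycle : ∀ {ρ e a a′ y z} → P ρ → Is3Cycle e a y z → ρ ▸ a ≡ a′ → ρ ▸ y ≡ y → ρ ▸ z ≡ z →
      a′ ≢ a → y ≢ a′ → z ≢ a′ → Has₃ a a′ y
    commutator-3-cycle {ρ} {e} {a} {a′} {y} {z} Pρ he ρa ρy ρz a′≢a y≢a′ z≢a′ =
      commutator ρ e , P-commutator e Pρ , mk3 (a′≢a ∘ ≡.sym) (y≢a′ ∘ ≡.sym) (H.a≢b ∘ ≡.sym)
        (commutator-▸ ρ e E.a↦b F.c↦a)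
        (commutator-▸ ρ e (E.else a′ a′≢a (z≢a′ ∘ ≡.sym) (y≢a′ ∘ ≡.sym)) F.a↦b)
        (commutator-▸ ρ e E.c↦a (F.else a (a′≢a ∘ ≡.sym) H.a≢b (H.c≢a ∘ ≡.sym)))
        (λ t ta ta′ ty → rest t ta ta′ ty (t ≟ᵀ z))
      where
      hf : Is3Cycle (ρ ∙ e ∙ ρ ⁻¹) a′ y z
      hf = subst₃ ρa ρy ρz (conj₃ ρ he)
      module H = Is3Cycle he
      module E = Is3Cycle (inverse₃ he)
      module F = Is3Cycle hf
      rest : ∀ t → t ≢ a → t ≢ a′ → t ≢ y → Dec (t ≡ z) → commutator ρ e ▸ t ≡ t
      rest t ta ta′ ty (yes refl) = commutator-▸ ρ e E.b↦c F.b↦c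
      rest t ta ta′ ty (no tz)    = commutator-▸ ρ e (E.else t ta tz ty) (F.else t ta′ ty tz)

    -- The auxiliary y and z are chosen in the colour of j = u₀ i, outside the six points of the
    -- first commutator. For z seven points are excluded, whence the 8 in `fresh`.
    some-3-cycle : ∀ {i} → u₀ ▸ i ≢ i → ∃ λ a → ∃ λ b → ∃ λ c → colour a ≡ colour b × Has₃ a b c
    some-3-cycle {i} j≢i = step₁ (fresh (colour i) (i ∷ (u₀ ▸ i) ∷ []) (s≤s (s≤s (s≤s z≤n))))
      where
      j = u₀ ▸ i
      step₃ : ∀ {k l c} → colour k ≡ colour i → k ≢ i → Is3Cycle c i k l → k ≢ j → l ≢ j →
        (∃ λ y → colour y ≡ colour j × Avoids y (i ∷ k ∷ l ∷ j ∷ (u₀ ▸ k) ∷ (u₀ ▸ l) ∷ [])) →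
        ∃ λ a → ∃ λ b → ∃ λ c → colour a ≡ colour b × Has₃ a b c
      step₃ {k} {l} {c} ck k≢i hc k≢j l≢j (y , cy , yi , yk , yl , yj , yuk , yul , _) =
        let z , cz , zy , zi , zk , zl , zj , zuk , zul , _ = fresh (colour j) (y ∷ i ∷ k ∷ l ∷ j ∷ (u₀ ▸ k) ∷ (u₀ ▸ l) ∷ []) ℕ.≤-refl
            ρj , ρ-fix = small-support u₀ hc j≢i k≢j l≢j
            e , he = three-cycle (yj ∘ ≡.sym) (zy ∘ ≡.sym) zj (≡.sym cy) (≡.trans cy (≡.sym cz))
        in j , u₀ ▸ k , y , colour-▸ u₀ (≡.sym ck) ,
           commutator-3-cycle (P-commutator c Pu₀) he ρj (ρ-fix y (yi , yk , yl , yj , yuk , yul , tt)) (ρ-fix z (zi , zk , zl , zj , zuk , zul , tt))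
             (k≢i ∘ ▸-inj u₀) yuk zuk
      step₂ : ∀ {k} → colour k ≡ colour i → k ≢ i → k ≢ j → (∃ λ l → colour l ≡ colour i × Avoids l (i ∷ j ∷ k ∷ [])) →
        ∃ λ a → ∃ λ b → ∃ λ c → colour a ≡ colour b × Has₃ a b c
      step₂ {k} ck k≢i k≢j (l , cl , li , lj , lk , _) =
        let c , hc = three-cycle (k≢i ∘ ≡.sym) (lk ∘ ≡.sym) li (≡.sym ck) (≡.trans ck (≡.sym cl))
        in step₃ ck k≢i hc k≢j lj (fresh (colour j) _ (s≤s (s≤s (s≤s (s≤s (s≤s (s≤s (s≤s z≤n))))))))
      step₁ : (∃ λ k → colour k ≡ colour i × Avoids k (i ∷ j ∷ [])) →
        ∃ λ a → ∃ λ b → ∃ λ c → colour a ≡ colour b × Has₃ a b c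
      step₁ (k , ck , ki , kj , _) = step₂ ck ki kj (fresh (colour i) (i ∷ j ∷ k ∷ []) (s≤s (s≤s (s≤s (s≤s z≤n)))))

    normal-conj : ∀ g {a b c a′ b′ c′} → g ▸ a ≡ a′ → g ▸ b ≡ b′ → g ▸ c ≡ c′ → Has₃ a b c → Has₃ a′ b′ c′
    normal-conj g p q r (u , Pu , h) = g ∙ u ∙ g ⁻¹ , P-conj g Pu , subst₃ p q r (conj₃ g h)

    -- In general the 3-cycle a → s → z with a fresh z fixes b and c; by normality it turns (a b c)
    -- into (s b c).
    link-all : ∀ {a b c} → colour a ≡ colour b → Has₃ a b c → ∀ s → colour s ≡ colour b → s ≢ b → Link s b
    link-all {a} {b} {c} a~b H@(_ , _ , h) s s~b s≢b with s ≟ᵀ a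
    ... | yes refl = c , H
    ... | no s≢a with s ≟ᵀ c
    ...   | yes refl = a , has-inverse (has-rotate (has-rotate H))
    ...   | no s≢c =
      let z , cz , za , zb , zc , zs , _ = fresh (colour b) (a ∷ b ∷ c ∷ s ∷ []) (s≤s (s≤s (s≤s (s≤s (s≤s z≤n)))))
          g , hg = three-cycle (s≢a ∘ ≡.sym) (zs ∘ ≡.sym) za (≡.trans a~b (≡.sym s~b)) (≡.trans s~b (≡.sym cz))
          module G = Is3Cycle hg
          module H = Is3Cycle h
      in c , normal-conj g G.a↦b (G.else b (H.a≢b ∘ ≡.sym) (s≢b ∘ ≡.sym) (zb ∘ ≡.sym))
               (G.else c H.c≢a (s≢c ∘ ≡.sym) (zc ∘ ≡.sym)) H

    links : ∀ {a b c} → colour a ≡ colour b → Has₃ a b c → ∀ s t → colour s ≡ colour b → colour t ≡ colour b → s ≢ t → Link s t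
    links {a} {b} a~b H s t s~b t~b s≢t with t ≟ᵀ b
    ... | yes refl = link-all a~b H s s~b s≢t
    ... | no t≢b with s ≟ᵀ b
    ...   | yes refl = link-sym (link-all a~b H t t~b t≢b)
    ...   | no s≢b = link-trans s≢t (link-all a~b H s s~b s≢b) (link-sym (link-all a~b H t t~b t≢b))

    all-of-colour : ∀ {a b c} → colour a ≡ colour b → Has₃ a b c → ∀ {r s t} → r ≢ s → s ≢ t → t ≢ r →
      colour r ≡ colour b → colour s ≡ colour b → colour t ≡ colour b → Has₃ r s t
    all-of-colour a~b H {r} {s} {t} r≢s s≢t t≢r r~ s~ t~ = all-3-cycles r≢s s≢t t≢r (≡.trans r~ (≡.sym s~))
      (links a~b H r s r~ s~ r≢s) (λ x x≢t x~s → links a~b H x t (≡.trans x~s s~) t~ x≢t)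

    -- The first 3-cycle may have the wrong colour; conjugation by the colour-exchanging g repairs
    -- this.
    all-colours : ∀ g → (∀ t → colour (g ▸ t) ≡ colour t ℙ.⁻¹) → ∀ {i} → u₀ ▸ i ≢ i →
      ∀ {r s t} → r ≢ s → s ≢ t → t ≢ r → colour r ≡ colour s → colour s ≡ colour t → Has₃ r s t
    all-colours g flips {i} ui≢i {r} {s} {t} r≢s s≢t t≢r r~s s~t = finish (some-3-cycle ui≢i)
      where
      cases : ∀ {a b c} → colour a ≡ colour b → Has₃ a b c → Dec (colour s ≡ colour b) → Has₃ r s t
      cases a~b H (yes eq) = all-of-colour a~b H r≢s s≢t t≢r (≡.trans r~s eq) eq (≡.trans (≡.sym s~t) eq)
      cases {a} {b} a~b H (no ≢) = all-of-colour (colour-▸ g a~b) (normal-conj g refl refl refl H) r≢s s≢t t≢r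
        (≡.trans r~s eq) eq (≡.trans (≡.sym s~t) eq)
        where
        eq : colour s ≡ colour (g ▸ b)
        eq = ≡.trans (≢⇒≡⁻¹ (colour s) (colour b) ≢) (≡.sym (flips b))
      finish : (∃ λ a → ∃ λ b → ∃ λ c → colour a ≡ colour b × Has₃ a b c) → Has₃ r s t
      finish (a , b , c , a~b , H) = cases a~b H (colour s ℙ.≟ colour b)

-- The wreath product

⁻¹-≢ : ∀ c → c ℙ.⁻¹ ≢ c
⁻¹-≢ 0ℙ ()
⁻¹-≢ 1ℙ ()

transpose-left : ∀ {N} (i j : Fin N) → PC.transpose i j i ≡ j
transpose-left i j rewrite dec-true (i Fin.≟ i) refl = refl

transpose-right : ∀ {N} (i j : Fin N) → PC.transpose i j j ≡ i
transpose-right i j with j Fin.≟ i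
... | yes p = p
... | no _ rewrite dec-true (j Fin.≟ j) refl = refl

transpose-other : ∀ {N} {i j k : Fin N} → k ≢ i → k ≢ j → PC.transpose i j k ≡ k
transpose-other {i = i} {j} {k} p q rewrite dec-false (k Fin.≟ i) p | dec-false (k Fin.≟ j) q = refl

module Wreath (N : ℕ) (base : Fin N) where

  X : Grp
  X = Alt N ≀ℤ₂

  open Group X using (Carrier; _≈_; _∙_; ε; _⁻¹) public

  Token : Set
  Token = Fin N × Parity

  component : Parity → Carrier → Fin N → Fin N
  component 0ℙ (((f , _) , _) , _) = f ⟨$⟩ʳ_
  component 1ℙ ((_ , (f , _)) , _) = f ⟨$⟩ʳ_

  infixr 6 _▸_
  -- The colour is changed first and the component of the new colour is applied, matching
  -- `semidirect`, where the left factor's ℤ₂-part acts on the right factor's base part.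
  _▸_ : Carrier → Token → Token
  u ▸ (i , c) = component (proj₂ u ℙ.+ c) u i , proj₂ u ℙ.+ c

  ▸-cong : ∀ {u v} → u ≈ v → ∀ t → u ▸ t ≡ v ▸ t
  ▸-cong {_ , 0ℙ} ((p , q) , refl) (i , 0ℙ) = ≡.cong (_, 0ℙ) (p i)
  ▸-cong {_ , 0ℙ} ((p , q) , refl) (i , 1ℙ) = ≡.cong (_, 1ℙ) (q i)
  ▸-cong {_ , 1ℙ} ((p , q) , refl) (i , 0ℙ) = ≡.cong (_, 1ℙ) (q i)
  ▸-cong {_ , 1ℙ} ((p , q) , refl) (i , 1ℙ) = ≡.cong (_, 0ℙ) (p i)

  ▸-∙ : ∀ u v t → (u ∙ v) ▸ t ≡ u ▸ (v ▸ t)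
  ▸-∙ (_ , 0ℙ) (_ , 0ℙ) (i , 0ℙ) = refl
  ▸-∙ (_ , 0ℙ) (_ , 0ℙ) (i , 1ℙ) = refl
  ▸-∙ (_ , 0ℙ) (_ , 1ℙ) (i , 0ℙ) = refl
  ▸-∙ (_ , 0ℙ) (_ , 1ℙ) (i , 1ℙ) = refl
  ▸-∙ (_ , 1ℙ) (_ , 0ℙ) (i , 0ℙ) = refl
  ▸-∙ (_ , 1ℙ) (_ , 0ℙ) (i , 1ℙ) = refl
  ▸-∙ (_ , 1ℙ) (_ , 1ℙ) (i , 0ℙ) = refl
  ▸-∙ (_ , 1ℙ) (_ , 1ℙ) (i , 1ℙ) = refl

  ▸-ε : ∀ t → ε ▸ t ≡ t
  ▸-ε (i , 0ℙ) = refl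
  ▸-ε (i , 1ℙ) = refl

  -- `base` supplies a token, whose image tells elements that exchange the colours from those that
  -- do not.
  faithful : ∀ u v → (∀ t → u ▸ t ≡ v ▸ t) → u ≈ v
  faithful (_ , 0ℙ) (_ , 0ℙ) p = ((λ i → ≡.cong proj₁ (p (i , 0ℙ))) , (λ i → ≡.cong proj₁ (p (i , 1ℙ)))) , refl
  faithful (_ , 1ℙ) (_ , 1ℙ) p = ((λ i → ≡.cong proj₁ (p (i , 1ℙ))) , (λ i → ≡.cong proj₁ (p (i , 0ℙ)))) , refl
  faithful (_ , 0ℙ) (_ , 1ℙ) p with () ← ≡.cong proj₂ (p (base , 0ℙ))
  faithful (_ , 1ℙ) (_ , 0ℙ) p with () ← ≡.cong proj₂ (p (base , 0ℙ))

  _≟ᵀ_ : DecidableEquality Token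
  _≟ᵀ_ = Product.≡-dec Fin._≟_ ℙ._≟_

  all-tokens? : {P : Token → Set} → (∀ t → Dec (P t)) → Dec (∀ t → P t)
  all-tokens? {P} P? = map′ (λ { (p , q) (i , 0ℙ) → p i ; (p , q) (i , 1ℙ) → q i })
    (λ p → (λ i → p (i , 0ℙ)) , (λ i → p (i , 1ℙ)))
    (Fin.all? (λ i → P? (i , 0ℙ)) ×-dec Fin.all? (λ i → P? (i , 1ℙ)))

  _≟_ : Decidable _≈_
  u ≟ v = map′ (faithful u v) (▸-cong {u} {v}) (all-tokens? (λ t → (u ▸ t) ≟ᵀ (v ▸ t)))

  moved : ∀ u → ¬ u ≈ ε → ∃ λ t → u ▸ t ≢ t
  moved u u≉ε with Fin.any? (λ i → ¬? ((u ▸ (i , 0ℙ)) ≟ᵀ (i , 0ℙ))) | Fin.any? (λ i → ¬? ((u ▸ (i , 1ℙ)) ≟ᵀ (i , 1ℙ)))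
  ... | yes (i , p) | _ = (i , 0ℙ) , p
  ... | no _ | yes (i , p) = (i , 1ℙ) , p
  ... | no ¬p | no ¬q = ⊥-elim (u≉ε (faithful u ε λ
    { (i , 0ℙ) → decidable-stable ((u ▸ (i , 0ℙ)) ≟ᵀ (i , 0ℙ)) (λ r → ¬p (i , r))
    ; (i , 1ℙ) → decidable-stable ((u ▸ (i , 1ℙ)) ≟ᵀ (i , 1ℙ)) (λ r → ¬q (i , r)) }))

  private
    toFin : Token → Fin (N * 2)
    toFin (i , 0ℙ) = combine i 0F
    toFin (i , 1ℙ) = combine i 1F

    token : Fin N × Fin 2 → Token
    token (i , 0F) = i , 0ℙ
    token (i , 1F) = i , 1ℙ

    fromFin : Fin (N * 2) → Token
    fromFin k = token (remQuot 2 k)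

    from-to : ∀ t → fromFin (toFin t) ≡ t
    from-to (i , 0ℙ) = ≡.cong token (Fin.remQuot-combine {N} {2} i 0F)
    from-to (i , 1ℙ) = ≡.cong token (Fin.remQuot-combine {N} {2} i 1F)

  code : Carrier → Fin ((N * 2) ^ (N * 2))
  code u = funToFin (λ k → toFin (u ▸ fromFin k))

  code-inj : ∀ {u v} → code u ≡ code v → u ≈ v
  code-inj {u} {v} p = faithful u v λ t → begin
    u ▸ t                                             ≡⟨ ≡.cong (u ▸_) (from-to t) ⟨
    u ▸ fromFin (toFin t)                             ≡⟨ from-to _ ⟨
    fromFin (toFin (u ▸ fromFin (toFin t)))           ≡⟨ ≡.cong fromFin (Fin.finToFun-funToFin (λ k → toFin (u ▸ fromFin k)) (toFin t)) ⟨
    fromFin (finToFun (code u) (toFin t))             ≡⟨ ≡.cong (λ c → fromFin (finToFun c (toFin t))) p ⟩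
    fromFin (finToFun (code v) (toFin t))             ≡⟨ ≡.cong fromFin (Fin.finToFun-funToFin (λ k → toFin (v ▸ fromFin k)) (toFin t)) ⟩
    fromFin (toFin (v ▸ fromFin (toFin t)))           ≡⟨ from-to _ ⟩
    v ▸ fromFin (toFin t)                             ≡⟨ ≡.cong (v ▸_) (from-to t) ⟩
    v ▸ t                                             ∎
    where open ≡.≡-Reasoning

  idᴬ : Group.Carrier (Alt N)
  idᴬ = Group.ε (Alt N)

  private
    double : ∀ i j k l → i ≢ j → k ≢ l → Group.Carrier (Alt N)
    double i j k l p q = eval ((i , j) ∷ (k , l) ∷ []) , ((i , j) ∷ (k , l) ∷ []) , p ∷ q ∷ [] , ∣-refl , λ _ → refl

  -- The double transposition (k l)(i j), with (i j) applied first, on one colour.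
  pair : Parity → ∀ i j k l → i ≢ j → k ≢ l → Carrier
  pair 0ℙ i j k l p q = (double i j k l p q , idᴬ) , 0ℙ
  pair 1ℙ i j k l p q = (idᴬ , double i j k l p q) , 0ℙ

  pair-same : ∀ c i j k l p q s → pair c i j k l p q ▸ (s , c) ≡ (PC.transpose k l (PC.transpose i j s) , c)
  pair-same 0ℙ i j k l p q s = refl
  pair-same 1ℙ i j k l p q s = refl

  pair-other : ∀ c i j k l p q s → pair c i j k l p q ▸ (s , c ℙ.⁻¹) ≡ (s , c ℙ.⁻¹)
  pair-other 0ℙ i j k l p q s = refl
  pair-other 1ℙ i j k l p q s = refl

  colour-▸ : ∀ u {s t : Token} → proj₂ s ≡ proj₂ t → proj₂ (u ▸ s) ≡ proj₂ (u ▸ t)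
  colour-▸ u p = ≡.cong (proj₂ u ℙ.+_) p

  open Cycles X _▸_ (λ {u} {v} → ▸-cong {u} {v}) ▸-∙ ▸-ε _≟ᵀ_ proj₂ colour-▸ public

  three-cycle : ∀ col {i j k} → i ≢ j → j ≢ k → k ≢ i → ∃ λ u → Is3Cycle u (i , col) (j , col) (k , col)
  three-cycle col {i} {j} {k} i≢j j≢k k≢i = u , mk3 (i≢j ∘ ≡.cong proj₁) (j≢k ∘ ≡.cong proj₁) (k≢i ∘ ≡.cong proj₁)
    (≡.trans (at i) (≡.cong (_, col) (≡.trans (≡.cong (PC.transpose i j) (transpose-other i≢j (k≢i ∘ ≡.sym))) (transpose-left i j))))
    (≡.trans (at j) (≡.cong (_, col) (≡.trans (≡.cong (PC.transpose i j) (transpose-left j k)) (transpose-other k≢i (j≢k ∘ ≡.sym)))))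
    (≡.trans (at k) (≡.cong (_, col) (≡.trans (≡.cong (PC.transpose i j) (transpose-right j k)) (transpose-right i j))))
    fixed
    where
    u = pair col j k i j j≢k i≢j
    at : ∀ s → u ▸ (s , col) ≡ (PC.transpose i j (PC.transpose j k s) , col)
    at = pair-same col j k i j j≢k i≢j
    fixed : ∀ t → t ≢ (i , col) → t ≢ (j , col) → t ≢ (k , col) → u ▸ t ≡ t
    fixed (s , c) si sj sk with c ℙ.≟ col
    ... | yes refl = ≡.trans (at s) (≡.cong (_, col) (≡.trans (≡.cong (PC.transpose i j) (transpose-other (sj ∘ ≡.cong (_, col)) (sk ∘ ≡.cong (_, col))))
                       (transpose-other (si ∘ ≡.cong (_, col)) (sj ∘ ≡.cong (_, col)))))
    ... | no c≢col with refl ← ≢⇒≡⁻¹ c col c≢col = pair-other col j k i j j≢k i≢j s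

  fresh : ∀ (is : List (Fin N)) → length is < N → ∃ λ j → ¬ (j List.∈ is)
  fresh is l<N with Fin.any? (λ j → ¬? (Any.any? (j Fin.≟_) is))
  ... | yes p = p
  ... | no ¬p = ⊥-elim (let i , j , i<j , eq = Fin.pigeonhole l<N (λ j → index (mem j))
                        in Fin.<⇒≢ i<j (≡.trans (Any.lookup-index (mem i)) (≡.trans (≡.cong (Data.List.Base.lookup is) eq) (≡.sym (Any.lookup-index (mem j))))))
    where
    mem : ∀ j → j List.∈ is
    mem j = decidable-stable (Any.any? (j Fin.≟_) is) (λ r → ¬p (j , r))

  module Contains (P : Carrier → Set) (P-resp : ∀ {u v} → u ≈ v → P u → P v)
                  (P-ε : P ε) (P-∙ : ∀ {u v} → P u → P v → P (u ∙ v)) (P-⁻¹ : ∀ {u} → P u → P (u ⁻¹)) where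
    open Closed P (λ {u} {v} → P-resp {u} {v}) P-ε (λ {u} {v} → P-∙ {u} {v}) (λ {u} → P-⁻¹ {u}) public

    module Colour (col : Parity)
      (has₃ : ∀ {i j k} → i ≢ j → j ≢ k → k ≢ i → Has₃ (i , col) (j , col) (k , col)) where

      Realises : (Fin N → Fin N) → Set
      Realises f = ∃ λ u → P u × (∀ s → u ▸ (s , col) ≡ (f s , col)) × (∀ s → u ▸ (s , col ℙ.⁻¹) ≡ (s , col ℙ.⁻¹))

      realises-resp : ∀ {f g} → (∀ s → f s ≡ g s) → Realises f → Realises g
      realises-resp p (u , Pu , q , r) = u , Pu , (λ s → ≡.trans (q s) (≡.cong (_, col) (p s))) , r

      realises-∘ : ∀ {f g} → Realises f → Realises g → Realises (f ∘ g)
      realises-∘ {f} {g} (u , Pu , p , q) (v , Pv , p′ , q′) = u ∙ v , P-∙ Pu Pv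
        , (λ s → ≡.trans (▸-∙ u v _) (≡.trans (≡.cong (u ▸_) (p′ s)) (p (g s))))
        , (λ s → ≡.trans (▸-∙ u v _) (≡.trans (≡.cong (u ▸_) (q′ s)) (q s)))

      realises-id : Realises (λ s → s)
      realises-id = ε , P-ε , (λ s → ▸-ε _) , (λ s → ▸-ε _)

      -- Two transpositions with a common point give the 3-cycle i → k → j, or the identity if k =
      -- i.
      adjacent : ∀ i j k → i ≢ j → j ≢ k → Realises (PC.transpose j k ∘ PC.transpose i j)
      adjacent i j k i≢j j≢k with k Fin.≟ i
      ... | yes refl = realises-resp (λ s → ≡.sym (PC.transpose-inverse j i)) realises-id
      ... | no k≢i with has₃ (k≢i ∘ ≡.sym) (j≢k ∘ ≡.sym) (i≢j ∘ ≡.sym)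
      ...   | u , Pu , mk3 _ _ _ i↦k k↦j j↦i fix = u , Pu , same , λ s → fix _ (diff s i) (diff s k) (diff s j)
        where
        diff : ∀ s i → (s , col ℙ.⁻¹) ≢ (i , col)
        diff s i eq = ⁻¹-≢ col (≡.cong proj₂ eq)
        cases : ∀ s → Dec (s ≡ i) → Dec (s ≡ j) → Dec (s ≡ k) → u ▸ (s , col) ≡ (PC.transpose j k (PC.transpose i j s) , col)
        cases s (yes refl) _ _ = ≡.trans i↦k (≡.cong (_, col) (≡.sym (≡.trans (≡.cong (PC.transpose j k) (transpose-left s j)) (transpose-left j k))))
        cases s (no s≢i) (yes refl) _ = ≡.trans j↦i (≡.cong (_, col) (≡.sym (≡.trans (≡.cong (PC.transpose s k) (transpose-right i s)) (transpose-other i≢j (k≢i ∘ ≡.sym)))))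
        cases s (no s≢i) (no s≢j) (yes refl) = ≡.trans k↦j (≡.cong (_, col) (≡.sym (≡.trans (≡.cong (PC.transpose j s) (transpose-other s≢i s≢j)) (transpose-right j s))))
        cases s (no s≢i) (no s≢j) (no s≢k) = ≡.trans (fix _ (s≢i ∘ ≡.cong proj₁) (s≢k ∘ ≡.cong proj₁) (s≢j ∘ ≡.cong proj₁))
          (≡.cong (_, col) (≡.sym (≡.trans (≡.cong (PC.transpose j k) (transpose-other s≢i s≢j)) (transpose-other s≢j s≢k))))
        same : ∀ s → u ▸ (s , col) ≡ (PC.transpose j k (PC.transpose i j s) , col)
        same s = cases s (s Fin.≟ i) (s Fin.≟ j) (s Fin.≟ k)

      -- Inserting (j k) twice splits the product into two pairs with a common point.
      two-transpositions : ∀ i j k l → i ≢ j → k ≢ l → Realises (PC.transpose k l ∘ PC.transpose i j)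
      two-transpositions i j k l i≢j k≢l with j Fin.≟ k
      ... | yes refl = adjacent i j l i≢j k≢l
      ... | no j≢k = realises-resp (λ s → ≡.cong (PC.transpose k l) (≡.trans (≡.cong (PC.transpose j k) (comm (PC.transpose i j s))) (PC.transpose-inverse j k {PC.transpose i j s})))
                       (realises-∘ (adjacent j k l j≢k k≢l) (adjacent i j k i≢j j≢k))
        where
        cases : ∀ s → Dec (s ≡ j) → Dec (s ≡ k) → PC.transpose j k s ≡ PC.transpose k j s
        cases s (yes refl) _ = ≡.trans (transpose-left s k) (≡.sym (transpose-right k s))
        cases s (no _) (yes refl) = ≡.trans (transpose-right j s) (≡.sym (transpose-left s j))
        cases s (no s≢j) (no s≢k) = ≡.trans (transpose-other s≢j s≢k) (≡.sym (transpose-other s≢k s≢j))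
        comm : ∀ s → PC.transpose j k s ≡ PC.transpose k j s
        comm s = cases s (s Fin.≟ j) (s Fin.≟ k)

      even : ∀ (ts : TranspositionList N) → All (λ (i , j) → i ≢ j) ts → 2 ∣ length ts → Realises (eval ts ⟨$⟩ʳ_)
      even [] _ _ = realises-id
      even (_ ∷ []) _ 2∣1 with () ← ∣1⇒≡1 2∣1
      even ((i , j) ∷ (k , l) ∷ ts) (p ∷ q ∷ ps) 2∣ =
        realises-∘ (even ts ps (∣m+n∣m⇒∣n 2∣ ∣-refl)) (two-transpositions i j k l p q)

    contains-Alt² : (∀ col {i j k} → i ≢ j → j ≢ k → k ≢ i → Has₃ (i , col) (j , col) (k , col)) →
                    ∀ u → proj₂ u ≡ 0ℙ → P u
    contains-Alt² has₃ u@(((f , ts , d , e , p) , (g , ts′ , d′ , e′ , p′)) , 0ℙ) refl =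
      let u₀ , P₀ , s₀ , o₀ = Colour.even 0ℙ (has₃ 0ℙ) ts d e
          u₁ , P₁ , s₁ , o₁ = Colour.even 1ℙ (has₃ 1ℙ) ts′ d′ e′
      in P-resp {u₀ ∙ u₁} {u} (faithful (u₀ ∙ u₁) u λ
        { (i , 0ℙ) → ≡.trans (▸-∙ u₀ u₁ _) (≡.trans (≡.cong (u₀ ▸_) (o₁ i)) (≡.trans (s₀ i) (≡.cong (_, 0ℙ) (p i))))
        ; (i , 1ℙ) → ≡.trans (▸-∙ u₀ u₁ _) (≡.trans (≡.cong (u₀ ▸_) (s₁ i)) (≡.trans (o₀ _) (≡.cong (_, 1ℙ) (p′ i)))) })
        (P-∙ P₀ P₁)

    contains-all : ∀ x → proj₂ x ≡ 1ℙ → (∀ {u} → P u → P (u ∙ x)) → (∀ u → proj₂ u ≡ 0ℙ → P u) → ∀ u → P u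
    contains-all x x-odd P-x P-even u = by-parity (proj₂ u) refl
      where
      by-parity : ∀ z → proj₂ u ≡ z → P u
      by-parity 0ℙ = P-even u
      by-parity 1ℙ e = P-resp {u ∙ x ⁻¹ ∙ x} {u} (GroupProperties.//-rightDividesˡ X x u)
        (P-x {u ∙ x ⁻¹} (P-even (u ∙ x ⁻¹) (≡.cong₂ ℙ._+_ e x-odd)))

  three-cycle′ : ∀ {a b c : Token} → a ≢ b → b ≢ c → c ≢ a → proj₂ a ≡ proj₂ b → proj₂ b ≡ proj₂ c → ∃ λ u → Is3Cycle u a b c
  three-cycle′ {i , col} {j , _} {k , _} a≢b b≢c c≢a refl refl =
    three-cycle col (a≢b ∘ ≡.cong (_, col)) (b≢c ∘ ≡.cong (_, col)) (c≢a ∘ ≡.cong (_, col))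

  fresh-token : 8 ≤ N → ∀ c ts → length ts < 8 → ∃ λ (t : Token) → proj₂ t ≡ c × Avoids t ts
  fresh-token 8≤N c ts l<8 = let i , p = fresh (map proj₁ ts) (≡.subst (_< N) (≡.sym (length-map proj₁ ts)) (ℕ.≤-trans l<8 8≤N))
                             in (i , c) , refl , avoid ts p
    where
    avoid : ∀ {i} ts → ¬ (i List.∈ map proj₁ ts) → Avoids (i , c) ts
    avoid [] _ = tt
    avoid (t ∷ ts) p = (λ { refl → p (here refl) }) , avoid ts (p ∘ there)

  flip : Carrier
  flip = Group.ε (Alt N ×ᴳ Alt N) , 1ℙ

  flip-▸ : ∀ i c → flip ▸ (i , c) ≡ (i , c ℙ.⁻¹)
  flip-▸ i 0ℙ = refl
  flip-▸ i 1ℙ = refl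

  normal-subgroups : 8 ≤ N → (P : Carrier → Set) → (∀ {u v} → u ≈ v → P u → P v) →
    (∀ {u v} → P u → P v → P (u ∙ v)) → (∀ {u} → P u → P (u ⁻¹)) → (∀ g {u} → P u → P (g ∙ u ∙ g ⁻¹)) →
    ∀ {u} → P u → ¬ u ≈ ε → ∀ v → proj₂ v ≡ 0ℙ → P v
  normal-subgroups 8≤N P P-resp P-∙ P-⁻¹ P-conj {u} Pu u≉ε =
    contains-Alt² λ col p q r → all-colours flip (λ (i , c) → ≡.cong proj₂ (flip-▸ i c)) (proj₂ (moved u u≉ε))
      (p ∘ ≡.cong proj₁) (q ∘ ≡.cong proj₁) (r ∘ ≡.cong proj₁) refl refl
    where
    open Normal three-cycle′ (fresh-token 8≤N) P (λ {u} {v} → P-resp {u} {v}) (λ {u} {v} → P-∙ {u} {v}) (λ {u} → P-⁻¹ {u}) (λ g {u} → P-conj g {u}) Pu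
    open Contains P (λ {u} {v} → P-resp {u} {v}) P-ε (λ {u} {v} → P-∙ {u} {v}) (λ {u} → P-⁻¹ {u}) using (contains-Alt²)

-- The involution b

-- (c , k , r) names the position r + k m on cycle c.
Name : Set
Name = Fin 2 × ℕ × ℕ

-- The transpositions of b.  The first four are one copy of the basic system, the
-- last four a second copy lying entirely on cycle 1.
table : List (Name × Name)
table = ((1F , 0 , 0) , (0F , 0 , 0))
      ∷ ((1F , 1 , 0) , (1F , 3 , 0))
      ∷ ((1F , 2 , 0) , (1F , 4 , 0))
      ∷ ((1F , 5 , 0) , (0F , 1 , 0))
      ∷ ((1F , 8 , 1) , (1F , 16 , 3))
      ∷ ((1F , 9 , 1) , (1F , 11 , 1))
      ∷ ((1F , 10 , 1) , (1F , 12 , 1))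
      ∷ ((1F , 13 , 1) , (1F , 17 , 3))
      ∷ []

shift : ℕ × ℕ → Name → Name
shift (k , r) (c , k′ , r′) = c , k + k′ , r + r′

-- Sufficient for r + k m < r′ + k′ m for every m ≥ 5. It is not necessary: an undecided comparison
-- merely makes a check fail.
below : ℕ × ℕ → ℕ × ℕ → Bool
below (k , r) (k′ , r′) = (k <ᵇ k′) ∧ (r <ᵇ r′ + 5 * (k′ ∸ k)) ∨ (k ≡ᵇ k′) ∧ (r <ᵇ r′)

cycle≠ : Fin 2 → Fin 2 → Bool
cycle≠ 0F 1F = true
cycle≠ 1F 0F = true
cycle≠ _  _  = false

cycle≠-irrefl : ∀ c → ¬ T (cycle≠ c c)
cycle≠-irrefl 0F ()
cycle≠-irrefl 1F ()

apart : Name → Name → Bool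
apart (c , p) (c′ , p′) = cycle≠ c c′ ∨ below p p′ ∨ below p′ p

-- With 5 ≤ m and 25m + 3 ≤ Q these bounds keep r + k m below Q, so distinct numbers are distinct
-- positions.
inRange : Name → Bool
inRange (_ , k , r) = (k <ᵇ 25) ∧ (r <ᵇ 8)

_≟ˢ_ : (s s′ : Name) → Dec (s ≡ s′)
_≟ˢ_ = Product.≡-dec Fin._≟_ (Product.≡-dec ℕ._≟_ ℕ._≟_)

-- The image of s under bᵢ, or nothing if it cannot be told whether bᵢ moves s.
move : List (Name × Name) → ℕ × ℕ → Name → Maybe Name
move []             i s = if inRange s then just s else nothing
move ((p , q) ∷ ps) i s with s ≟ˢ shift i p | s ≟ˢ shift i q
... | yes _ | _     = just (shift i q)
... | no _  | yes _ = just (shift i p)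
... | no _  | no _  = if apart s (shift i p) ∧ apart s (shift i q) ∧ inRange (shift i p) ∧ inRange (shift i q)
                      then move ps i s else nothing

-- Letters are applied from the last to the first.
run : List (ℕ × ℕ) → Name → Maybe Name
run []       s = just s
run (i ∷ is) s = run is s >>= move table i

support : ℕ × ℕ → List Name
support i = concatMap (λ (p , q) → shift i p ∷ shift i q ∷ []) table

_==_ : Maybe Name → Maybe Name → Bool
just s == just s′ = does (s ≟ˢ s′)
_      == _       = false

every : ∀ {A : Set} → (A → Bool) → List A → Bool
every f []       = true
every f (y ∷ ys) = f y ∧ every f ys

every-sound : ∀ {A : Set} (f : A → Bool) ys → T (every f ys) → All (λ y → T (f y)) ys
every-sound f []       _ = []
every-sound f (y ∷ ys) h = let h₁ , h₂ = Equivalence.to (T-∧ {f y}) h in h₁ ∷ every-sound f ys h₂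

-- Tokens outside the supports of all letters are fixed by both words, so finitely many names decide
-- the equation for all m at once.
agree : List (ℕ × ℕ) → List (ℕ × ℕ) → Bool
agree is js = every (λ s → run is s == run js s) (concatMap support (is ++ js))

every-pair : (f : Name → Bool) → Name × Name → Bool
every-pair f (p , q) = f p ∧ f q

small : Name → Bool
small (_ , k , r) = (k ≤ᵇ 17) ∧ (r ≤ᵇ 3)

-- Positions as linear forms in m

module Values (m : ℕ) (5≤m : 5 ≤ m) (Q : ℕ) (Q-large : 25 * m + 3 ≤ Q) where

  val : ℕ × ℕ → ℕ
  val (k , r) = r + k * m

  T-∧⁻ : ∀ {a b} → T (a ∧ b) → T a × T b
  T-∧⁻ = Equivalence.to T-∧

  T-∨⁻ : ∀ {a b} → T (a ∨ b) → T a ⊎ T b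
  T-∨⁻ {true}  _ = inj₁ tt
  T-∨⁻ {false} p = inj₂ p

  below⇒< : ∀ p q → T (below p q) → val p < val q
  below⇒< (k , r) (k′ , r′) h with T-∨⁻ {(k <ᵇ k′) ∧ (r <ᵇ r′ + 5 * (k′ ∸ k))} h
  ... | inj₁ h₁ = begin-strict
      r + k * m                           <⟨ ℕ.+-monoˡ-< (k * m) (ℕ.<ᵇ⇒< r _ r<) ⟩
      r′ + 5 * (k′ ∸ k) + k * m           ≤⟨ ℕ.+-monoˡ-≤ (k * m) (ℕ.+-monoʳ-≤ r′ (ℕ.*-monoˡ-≤ (k′ ∸ k) 5≤m)) ⟩
      r′ + m * (k′ ∸ k) + k * m           ≡⟨ ℕ.+-assoc r′ _ _ ⟩
      r′ + (m * (k′ ∸ k) + k * m)         ≡⟨ ≡.cong (λ z → r′ + (z + k * m)) (ℕ.*-comm m (k′ ∸ k)) ⟩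
      r′ + ((k′ ∸ k) * m + k * m)         ≡⟨ ≡.cong (r′ +_) (≡.sym (ℕ.*-distribʳ-+ m (k′ ∸ k) k)) ⟩
      r′ + ((k′ ∸ k) + k) * m             ≡⟨ ≡.cong (λ z → r′ + z * m) (ℕ.m∸n+n≡m (ℕ.<⇒≤ (ℕ.<ᵇ⇒< k k′ k<))) ⟩
      r′ + k′ * m                         ∎
    where
    open ℕ.≤-Reasoning
    k< = proj₁ (T-∧⁻ h₁)
    r< = proj₂ (T-∧⁻ {k <ᵇ k′} h₁)
  ... | inj₂ h₂ with refl ← ℕ.≡ᵇ⇒≡ k k′ (proj₁ (T-∧⁻ h₂)) = ℕ.+-monoˡ-< (k * m) (ℕ.<ᵇ⇒< r r′ (proj₂ (T-∧⁻ {k ≡ᵇ k} h₂)))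

  inRange⇒< : ∀ {s} → T (inRange s) → val (proj₂ s) < Q
  inRange⇒< {c , k , r} h = begin-strict
      r + k * m        <⟨ ℕ.+-mono-<-≤ (ℕ.<ᵇ⇒< r 8 (proj₂ (T-∧⁻ {k <ᵇ 25} h))) (ℕ.*-monoˡ-≤ m (ℕ.≤-pred (ℕ.<ᵇ⇒< k 25 (proj₁ (T-∧⁻ h))))) ⟩
      8 + 24 * m       ≤⟨ ℕ.+-monoʳ-≤ 3 (ℕ.+-monoˡ-≤ (24 * m) 5≤m) ⟩
      3 + 25 * m       ≡⟨ ℕ.+-comm 3 (25 * m) ⟩
      25 * m + 3       ≤⟨ Q-large ⟩
      Q                ∎
    where open ℕ.≤-Reasoning

  val-shift : ∀ i p → val (proj₁ i + proj₁ p , proj₂ i + proj₂ p) ≡ val i + val p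
  val-shift (k , r) (k′ , r′) = ≡.trans (≡.cong (r + r′ +_) (ℕ.*-distribʳ-+ m k k′))
    (≡.trans (ℕ.+-assoc r r′ _) (≡.trans (≡.cong (r +_) (≡.trans (≡.sym (ℕ.+-assoc r′ _ _)) (≡.trans (≡.cong (_+ k′ * m) (ℕ.+-comm r′ _)) (ℕ.+-assoc (k * m) r′ _))))
      (≡.sym (ℕ.+-assoc r _ _))))

module Places (m : ℕ) (5≤m : 5 ≤ m) (Q : ℕ) (Q-large : 25 * m + 3 ≤ Q) {Tok : Set} (pos : Fin 2 → ℕ → Tok)
  (pos-inj : ∀ {c c′ p p′} → p < Q → p′ < Q → pos c p ≡ pos c′ p′ → c ≡ c′ × p ≡ p′) where

  open Values m 5≤m Q Q-large public

  ⟦_⟧ⁿ : Name → Tok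
  ⟦ c , p ⟧ⁿ = pos c (val p)

  apart⇒≢ : ∀ {s s′} → T (apart s s′) → T (inRange s) → T (inRange s′) → ⟦ s ⟧ⁿ ≢ ⟦ s′ ⟧ⁿ
  apart⇒≢ {c , p} {c′ , p′} a r r′ eq with pos-inj (inRange⇒< {c , p} r) (inRange⇒< {c′ , p′} r′) eq
  ... | refl , v≡v′ with T-∨⁻ {cycle≠ c c} a
  ...   | inj₁ h = cycle≠-irrefl c h
  ...   | inj₂ h with T-∨⁻ {below p p′} h
  ...     | inj₁ h′ = ℕ.<⇒≢ (below⇒< p p′ h′) v≡v′
  ...     | inj₂ h′ = ℕ.<⇒≢ (below⇒< p′ p h′) (≡.sym v≡v′)

record TokenSystem (X : Grp) : Set₁ where
  open Group X using (Carrier; _≈_; _∙_; ε)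
  field
    {Tok}        : Set
    _≟ᵀ_         : DecidableEquality Tok
    _▸_          : Carrier → Tok → Tok
    ▸-cong       : ∀ {u v} → u ≈ v → ∀ t → u ▸ t ≡ v ▸ t
    ▸-∙          : ∀ u v t → (u ∙ v) ▸ t ≡ u ▸ (v ▸ t)
    ▸-ε          : ∀ t → ε ▸ t ≡ t
    faithful     : ∀ u v → (∀ t → u ▸ t ≡ v ▸ t) → u ≈ v
    m            : ℕ
    5≤m          : 5 ≤ m
    Q            : ℕ
    Q-large      : 25 * m + 3 ≤ Q
    pos          : Fin 2 → ℕ → Tok
    pos-inj      : ∀ {c c′ p p′} → p < Q → p′ < Q → pos c p ≡ pos c′ p′ → c ≡ c′ × p ≡ p′
    pos-periodic : ∀ c p → pos c (Q + p) ≡ pos c p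
    pos-sur      : ∀ t → ∃ λ c → ∃ λ p → t ≡ pos c p
    b x          : Carrier
    x-pos        : ∀ c p → x ▸ pos c p ≡ pos c (suc p)

  open Places m 5≤m Q Q-large pos (λ {c} {c′} {p} {p′} → pos-inj {c} {c′} {p} {p′}) public

  field
    b-table : All (λ (p , q) → b ▸ ⟦ p ⟧ⁿ ≡ ⟦ q ⟧ⁿ × b ▸ ⟦ q ⟧ⁿ ≡ ⟦ p ⟧ⁿ) table
    b-fix   : ∀ t → All (λ (p , q) → t ≢ ⟦ p ⟧ⁿ × t ≢ ⟦ q ⟧ⁿ) table → b ▸ t ≡ t

module TokenGroup {X : Grp} (S : TokenSystem X) where

  open Group X using (Carrier; _≈_; _∙_; ε; _⁻¹)
  open TokenSystem S public
  open Shifts X b x public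
  open GroupSolver X using (solve; one; _⊙_; ⊖_; p₀; p₁; p₂)

  open ActionLaws X _▸_ ▸-cong ▸-∙ ▸-ε public

  xp-pos : ∀ i c p → xp i ▸ pos c p ≡ pos c (i + p)
  xp-pos zero    c p = ▸-ε _
  xp-pos (suc i) c p = ≡.trans (▸-∙ x (xp i) _) (≡.trans (≡.cong (x ▸_) (xp-pos i c p)) (x-pos c (i + p)))

  bi-conj : ∀ i t → bi i ▸ (xp i ▸ t) ≡ xp i ▸ (b ▸ t)
  bi-conj zero    t = ≡.trans (≡.cong (b ▸_) (▸-ε t)) (≡.sym (▸-ε _))
  bi-conj (suc i) t = ≡.trans (≡.sym (▸-∙ _ _ t)) (≡.trans
    (▸-cong (solve (x ∷ bi i ∷ xp i ∷ []) (p₀ ⊙ p₁ ⊙ ⊖ p₀ ⊙ (p₀ ⊙ p₂)) (p₀ ⊙ (p₁ ⊙ p₂)) refl) t)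
    (≡.trans (▸-∙ x _ t) (≡.trans (≡.cong (x ▸_) (≡.trans (▸-∙ (bi i) (xp i) t) (bi-conj i t))) (≡.sym (▸-∙ x (xp i) _)))))

  at : ℕ → Name → Tok
  at i (c , p) = pos c (i + val p)

  bi-move : ∀ i p q → b ▸ ⟦ p ⟧ⁿ ≡ ⟦ q ⟧ⁿ → bi i ▸ at i p ≡ at i q
  bi-move i (c , p) (c′ , q) eq = ≡.trans (≡.cong (bi i ▸_) (≡.sym (xp-pos i c (val p))))
    (≡.trans (bi-conj i _) (≡.trans (≡.cong (xp i ▸_) eq) (xp-pos i c′ (val q))))

  bi-table : ∀ i → All (λ (p , q) → bi i ▸ at i p ≡ at i q × bi i ▸ at i q ≡ at i p) table
  bi-table i = All.map (λ { {p , q} (e , e′) → bi-move i p q e , bi-move i q p e′ }) b-table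

  bi-fix : ∀ i t → All (λ (p , q) → t ≢ at i p × t ≢ at i q) table → bi i ▸ t ≡ t
  bi-fix i t a = ≡.trans (≡.cong (bi i ▸_) (≡.sym (▸-⁻¹ʳ (xp i) t))) (≡.trans (bi-conj i _)
    (≡.trans (≡.cong (xp i ▸_) (b-fix _ (All.map (λ { {p , q} (n , n′) → pull p n , pull q n′ }) a))) (▸-⁻¹ʳ (xp i) t)))
    where
    pull : ∀ p → t ≢ at i p → (xp i ⁻¹) ▸ t ≢ ⟦ p ⟧ⁿ
    pull (c , p) n eq = n (≡.trans (≡.sym (▸-⁻¹ʳ (xp i) t)) (≡.trans (≡.cong (xp i ▸_) eq) (xp-pos i c (val p))))

  at-shift : ∀ i p → at (val i) p ≡ ⟦ shift i p ⟧ⁿ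
  at-shift i (c , p) = ≡.cong (pos c) (≡.sym (val-shift i p))

  Moves : List (Name × Name) → ℕ × ℕ → Name → Name → Set
  Moves ps i s s′ = Any (λ (p , q) → (s ≡ shift i p × s′ ≡ shift i q) ⊎ (s ≡ shift i q × s′ ≡ shift i p)) ps
                  ⊎ (s′ ≡ s × All (λ (p , q) → ⟦ s ⟧ⁿ ≢ ⟦ shift i p ⟧ⁿ × ⟦ s ⟧ⁿ ≢ ⟦ shift i q ⟧ⁿ) ps × T (inRange s))

  just-if : ∀ {A : Set} (c : Bool) {y : Maybe A} {z} → (if c then y else nothing) ≡ just z → T c × y ≡ just z
  just-if true p = tt , p

  move-sound : ∀ ps i s {s′} → move ps i s ≡ just s′ → Moves ps i s s′
  move-sound [] i s eq with just-if (inRange s) eq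
  ... | r , refl = inj₂ (refl , [] , r)
  move-sound ((p , q) ∷ ps) i s eq with s ≟ˢ shift i p | s ≟ˢ shift i q
  move-sound ((p , q) ∷ ps) i s refl | yes e | _     = inj₁ (here (inj₁ (e , refl)))
  move-sound ((p , q) ∷ ps) i s refl | no _  | yes e = inj₁ (here (inj₂ (e , refl)))
  ... | no _  | no _ with just-if (apart s (shift i p) ∧ apart s (shift i q) ∧ inRange (shift i p) ∧ inRange (shift i q)) eq
  ...   | h , eq′ with move-sound ps i s eq′
  ...     | inj₁ a = inj₁ (there a)
  ...     | inj₂ (e , a , r) =
    let h₁ , h′ = T-∧⁻ {apart s (shift i p)} h
        h₂ , h″ = T-∧⁻ {apart s (shift i q)} h′
        h₃ , h₄ = T-∧⁻ {inRange (shift i p)} h″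
    in inj₂ (e , (apart⇒≢ {s} {shift i p} h₁ r h₃ , apart⇒≢ {s} {shift i q} h₂ r h₄) ∷ a , r)

  move-▸ : ∀ i s {s′} → move table i s ≡ just s′ → bi (val i) ▸ ⟦ s ⟧ⁿ ≡ ⟦ s′ ⟧ⁿ
  move-▸ i s {s′} eq with move-sound table i s eq
  ... | inj₁ a = find table a (bi-table (val i))
    where
    find : ∀ ps → Any (λ (p , q) → (s ≡ shift i p × s′ ≡ shift i q) ⊎ (s ≡ shift i q × s′ ≡ shift i p)) ps →
           All (λ (p , q) → bi (val i) ▸ at (val i) p ≡ at (val i) q × bi (val i) ▸ at (val i) q ≡ at (val i) p) ps →
           bi (val i) ▸ ⟦ s ⟧ⁿ ≡ ⟦ s′ ⟧ⁿ
    find ((p , q) ∷ ps) (here (inj₁ (refl , refl))) ((e , _) ∷ _) =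
      ≡.trans (≡.cong (bi (val i) ▸_) (≡.sym (at-shift i p))) (≡.trans e (at-shift i q))
    find ((p , q) ∷ ps) (here (inj₂ (refl , refl))) ((_ , e) ∷ _) =
      ≡.trans (≡.cong (bi (val i) ▸_) (≡.sym (at-shift i q))) (≡.trans e (at-shift i p))
    find (_ ∷ ps) (there a) (_ ∷ es) = find ps a es
  ... | inj₂ (refl , a , _) = bi-fix (val i) ⟦ s ⟧ⁿ
    (All.map (λ { {p , q} (n , n′) → (λ e → n (≡.trans e (at-shift i p))) , (λ e → n′ (≡.trans e (at-shift i q))) }) a)

  word : List (ℕ × ℕ) → Carrier
  word []       = ε
  word (i ∷ is) = bi (val i) ∙ word is

  run-▸ : ∀ is s {s′} → run is s ≡ just s′ → word is ▸ ⟦ s ⟧ⁿ ≡ ⟦ s′ ⟧ⁿ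
  run-▸ [] s refl = ▸-ε _
  run-▸ (i ∷ is) s {s′} eq with run is s in e
  ... | just s″ = ≡.trans (▸-∙ _ _ _) (≡.trans (≡.cong (bi (val i) ▸_) (run-▸ is s e)) (move-▸ i s″ eq))

  Named : Tok → List Name → Set
  Named t = Any (λ s → t ≡ ⟦ s ⟧ⁿ)

  word-fix : ∀ is t → ¬ Named t (concatMap support is) → word is ▸ t ≡ t
  word-fix []       t _ = ▸-ε t
  word-fix (i ∷ is) t n = ≡.trans (▸-∙ _ _ _) (≡.trans
    (≡.cong (bi (val i) ▸_) (word-fix is t (λ a → n (Any.++⁺ʳ (support i) a))))
    (bi-fix (val i) t (spread table (λ a → n (Any.++⁺ˡ a)))))
    where
    spread : ∀ ps → ¬ Named t (concatMap (λ (p , q) → shift i p ∷ shift i q ∷ []) ps) →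
             All (λ (p , q) → t ≢ at (val i) p × t ≢ at (val i) q) ps
    spread [] _ = []
    spread ((p , q) ∷ ps) n = ((λ e → n (here (≡.trans e (at-shift i p)))) , (λ e → n (there (here (≡.trans e (at-shift i q))))))
                            ∷ spread ps (λ a → n (there (there a)))

  named? : ∀ t ss → Dec (Named t ss)
  named? t = Any.any? (λ s → t ≟ᵀ ⟦ s ⟧ⁿ)

  ==-sound : ∀ a b → T (a == b) → ∃ λ s → a ≡ just s × b ≡ just s
  ==-sound (just s) (just s′) h with s ≟ˢ s′
  ... | yes refl = s , refl , refl

  agree-sound : ∀ is js → T (agree is js) → word is ≈ word js
  agree-sound is js h = faithful _ _ λ t → cases t (named? t (concatMap support (is ++ js)))
    where
    split : concatMap support (is ++ js) ≡ concatMap support is ++ concatMap support js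
    split = List.concatMap-++ support is js
    checked : All (λ s → T (run is s == run js s)) (concatMap support (is ++ js))
    checked = every-sound (λ s → run is s == run js s) _ h
    find : ∀ t ss → Named t ss → All (λ s → T (run is s == run js s)) ss → word is ▸ t ≡ word js ▸ t
    find t (s ∷ ss) (here refl) (c ∷ _) = let s′ , e , e′ = ==-sound (run is s) (run js s) c
                                          in ≡.trans (run-▸ is s e) (≡.sym (run-▸ js s e′))
    find t (s ∷ ss) (there a) (_ ∷ cs) = find t ss a cs
    cases : ∀ t → Dec (Named t (concatMap support (is ++ js))) → word is ▸ t ≡ word js ▸ t
    cases t (yes a) = find t _ a checked
    cases t (no n)  = ≡.trans (word-fix is t (λ a → n (≡.subst (Named t) (≡.sym split) (Any.++⁺ˡ a))))
                       (≡.sym (word-fix js t (λ a → n (≡.subst (Named t) (≡.sym split) (Any.++⁺ʳ (concatMap support is) a)))))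

  fix-by : ∀ i t (f : Name → Bool) → T (every (every-pair f) table) → (∀ s → T (f s) → t ≢ at i s) → bi i ▸ t ≡ t
  fix-by i t f h n = bi-fix i t (All.map (λ { {p , q} h → n p (proj₁ (T-∧⁻ {f p} h)) , n q (proj₂ (T-∧⁻ {f p} h)) })
    (every-sound (every-pair f) table h))

  small⇒≤ : ∀ s → T (small s) → val (proj₂ s) ≤ 3 + 17 * m
  small⇒≤ (_ , k , r) h = ℕ.+-mono-≤ (ℕ.≤ᵇ⇒≤ r 3 (proj₂ (T-∧⁻ {k ≤ᵇ 17} h))) (ℕ.*-monoˡ-≤ m (ℕ.≤ᵇ⇒≤ k 17 (proj₁ (T-∧⁻ h))))

  -- From 5 ≤ m and r ≤ 5 (7 - k) follows r + k m ≤ 7m; adding 17m + 3, an upper bound for the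
  -- positions in `table`, stays below 25m + 3.
  room : ∀ k r → k ≤ 7 → r ≤ 35 ∸ 5 * k → (r + k * m) + (3 + 17 * m) < Q
  room k r k≤7 r≤ = begin-strict
    (r + k * m) + (3 + 17 * m)               ≤⟨ ℕ.+-monoˡ-≤ (3 + 17 * m) (ℕ.+-monoˡ-≤ (k * m) (ℕ.≤-trans r≤ (ℕ.≤-reflexive (≡.sym (ℕ.*-distribˡ-∸ 5 7 k))))) ⟩
    (5 * (7 ∸ k) + k * m) + (3 + 17 * m)     ≤⟨ ℕ.+-monoˡ-≤ (3 + 17 * m) (ℕ.+-monoˡ-≤ (k * m) (ℕ.*-monoˡ-≤ (7 ∸ k) 5≤m)) ⟩
    (m * (7 ∸ k) + k * m) + (3 + 17 * m)     ≡⟨ ≡.cong (λ z → z + (3 + 17 * m)) (≡.trans (≡.cong (_+ k * m) (ℕ.*-comm m (7 ∸ k))) (≡.trans (≡.sym (ℕ.*-distribʳ-+ m (7 ∸ k) k)) (≡.cong (_* m) (ℕ.m∸n+n≡m k≤7)))) ⟩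
    7 * m + (3 + 17 * m)                     <⟨ ℕ.n<1+n _ ⟩
    1 + (7 * m + (3 + 17 * m))               ≤⟨ ℕ.+-monoˡ-≤ (7 * m + (3 + 17 * m)) (ℕ.≤-trans (s≤s z≤n) 5≤m) ⟩
    m + (7 * m + (3 + 17 * m))               ≡⟨ +-*-Solver.solve 1 (λ y → y :+ (con 7 :* y :+ (con 3 :+ con 17 :* y)) := con 25 :* y :+ con 3) refl m ⟩
    25 * m + 3                               ≤⟨ Q-large ⟩
    Q                                        ∎
    where
    open ℕ.≤-Reasoning

  bound₁₇ : 3 + 17 * m < Q
  bound₁₇ = room 0 0 z≤n z≤n

  b² : b ∙ b ≈ ε
  b² = Group.trans X (Group.∙-congˡ X (Group.sym X (Group.identityʳ X b))) (agree-sound ((0 , 0) ∷ (0 , 0) ∷ []) [] tt)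

  2*≡ : 2 * m ≡ m + m
  2*≡ = ≡.cong (m +_) (ℕ.+-identityʳ m)

  bi-2 : bi (2 * m) ≈ bi (m + m)
  bi-2 = Group.reflexive X (≡.cong bi 2*≡)

  bi-1 : bi (1 * m) ≈ bi m
  bi-1 = Group.reflexive X (≡.cong bi (ℕ.+-identityʳ m))

  dihedral-rel : b ∙ bi (m + m) ≈ bi m ∙ (bi (m + m) ∙ b)
  dihedral-rel = begin
    b ∙ bi (m + m)                        ≈⟨ ∙-congˡ (trans (sym bi-2) (sym (identityʳ _))) ⟩
    b ∙ (bi (2 * m) ∙ ε)                  ≈⟨ agree-sound ((0 , 0) ∷ (2 , 0) ∷ []) ((1 , 0) ∷ (2 , 0) ∷ (0 , 0) ∷ []) tt ⟩
    bi (1 * m) ∙ (bi (2 * m) ∙ (b ∙ ε))   ≈⟨ ∙-cong bi-1 (∙-cong bi-2 (identityʳ b)) ⟩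
    bi m ∙ (bi (m + m) ∙ b)               ∎
    where
    open Group X using (∙-cong; ∙-congˡ; identityʳ; trans; sym; setoid)
    open SetoidReasoning setoid

  commute-m : b ∙ bi m ≈ bi m ∙ b
  commute-m = begin
    b ∙ bi m                  ≈⟨ ∙-congˡ (trans (sym bi-1) (sym (identityʳ _))) ⟩
    b ∙ (bi (1 * m) ∙ ε)      ≈⟨ agree-sound ((0 , 0) ∷ (1 , 0) ∷ []) ((1 , 0) ∷ (0 , 0) ∷ []) tt ⟩
    bi (1 * m) ∙ (b ∙ ε)      ≈⟨ ∙-cong bi-1 (identityʳ b) ⟩
    bi m ∙ b                  ∎
    where
    open Group X using (∙-cong; ∙-congˡ; identityʳ; trans; sym; setoid)
    open SetoidReasoning setoid

-- Relations by disjoint supports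

gap : Name → Name → Bool
gap (c , k , r) (c′ , k′ , r′) = cycle≠ c c′ ∨ (3 + k′ ≤ᵇ k) ∧ (r′ ≤ᵇ r) ∨ (k ≤ᵇ k′) ∧ (r ≤ᵇ r′)
  ∨ (k ≡ᵇ 1 + k′) ∧ (r ≡ᵇ r′) ∨ (k ≡ᵇ 2 + k′) ∧ (r ≡ᵇ r′)

record Clear (s : Name) : Set where
  constructor clear
  field
    is-small : T (small s)
    gaps     : T (every (every-pair (λ s′ → small s′ ∧ gap s s′)) table)

table-clear : All (λ (p , q) → Clear p × Clear q) table
table-clear = (clear tt tt , clear tt tt) ∷ (clear tt tt , clear tt tt) ∷ (clear tt tt , clear tt tt) ∷ (clear tt tt , clear tt tt)
            ∷ (clear tt tt , clear tt tt) ∷ (clear tt tt , clear tt tt) ∷ (clear tt tt , clear tt tt) ∷ (clear tt tt , clear tt tt) ∷ []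

module Relations {X : Grp} (S : TokenSystem X) where

  open Group X using (Carrier; _≈_; _∙_; ε; _⁻¹)
  open TokenGroup S
  open GroupSolver X using (solve; one; _⊙_; ⊖_; p₀; p₁; p₂)

  w₀ : ℕ
  w₀ = 4 + (m + m)

  4+2m≡ : 4 + (m + m) ≡ 4 + 2 * m
  4+2m≡ = ≡.cong (4 +_) (≡.sym 2*≡)

  -- `gap` lists the ways in which s - s′ can avoid d: different cycles, at least 3m > w (by 5 ≤ m),
  -- at most 0, or exactly one of the excluded values m and 2m.
  gap⇒≢ : ∀ s s′ d → T (gap s s′) → 1 ≤ d → d ≤ w₀ → d ≢ m → d ≢ m + m → proj₁ s ≡ proj₁ s′ → val (proj₂ s) ≢ d + val (proj₂ s′)
  gap⇒≢ (c , k , r) (c , k′ , r′) d h 1≤d d≤w d≢m d≢2m refl eq with T-∨⁻ {cycle≠ c c} h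
  ... | inj₁ h₀ = cycle≠-irrefl c h₀
  ... | inj₂ h₁ with T-∨⁻ {(3 + k′ ≤ᵇ k) ∧ (r′ ≤ᵇ r)} h₁
  ...   | inj₁ g = ℕ.<⇒≢ (begin-strict
            d + (r′ + k′ * m)            ≤⟨ ℕ.+-monoˡ-≤ (r′ + k′ * m) (ℕ.≤-trans d≤w (ℕ.≤-reflexive 4+2m≡)) ⟩
            4 + 2 * m + (r′ + k′ * m)    <⟨ ℕ.+-monoˡ-< (r′ + k′ * m) (ℕ.+-monoˡ-≤ (2 * m) 5≤m) ⟩
            3 * m + (r′ + k′ * m)        ≡⟨ +-*-Solver.solve 3 (λ y r k → con 3 :* y :+ (r :+ k :* y) := r :+ (con 3 :+ k) :* y) refl m r′ k′ ⟩
            r′ + (3 + k′) * m            ≤⟨ ℕ.+-mono-≤ (ℕ.≤ᵇ⇒≤ r′ r (proj₂ (T-∧⁻ {3 + k′ ≤ᵇ k} g))) (ℕ.*-monoˡ-≤ m (ℕ.≤ᵇ⇒≤ (3 + k′) k (proj₁ (T-∧⁻ g)))) ⟩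
            r + k * m                    ∎) (≡.sym eq)
    where
    open ℕ.≤-Reasoning
  ...   | inj₂ h₂ with T-∨⁻ {(k ≤ᵇ k′) ∧ (r ≤ᵇ r′)} h₂
  ...     | inj₁ g = ℕ.<⇒≢ (ℕ.≤-<-trans (ℕ.+-mono-≤ (ℕ.≤ᵇ⇒≤ r r′ (proj₂ (T-∧⁻ {k ≤ᵇ k′} g))) (ℕ.*-monoˡ-≤ m (ℕ.≤ᵇ⇒≤ k k′ (proj₁ (T-∧⁻ g)))))
                        (ℕ.m<n+m (r′ + k′ * m) 1≤d)) eq
  ...     | inj₂ h₃ with T-∨⁻ {(k ≡ᵇ 1 + k′) ∧ (r ≡ᵇ r′)} h₃
  ...       | inj₁ g with refl ← ℕ.≡ᵇ⇒≡ k (1 + k′) (proj₁ (T-∧⁻ g)) | refl ← ℕ.≡ᵇ⇒≡ r r′ (proj₂ (T-∧⁻ {k ≡ᵇ 1 + k′} g)) =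
    d≢m (ℕ.+-cancelʳ-≡ (r + k′ * m) d m (≡.trans (≡.sym eq)
      (+-*-Solver.solve 3 (λ y r k → r :+ (con 1 :+ k) :* y := y :+ (r :+ k :* y)) refl m r k′)))
  ...       | inj₂ g with refl ← ℕ.≡ᵇ⇒≡ k (2 + k′) (proj₁ (T-∧⁻ g)) | refl ← ℕ.≡ᵇ⇒≡ r r′ (proj₂ (T-∧⁻ {k ≡ᵇ 2 + k′} g)) =
    d≢2m (ℕ.+-cancelʳ-≡ (r + k′ * m) d (m + m) (≡.trans (≡.sym eq)
      (+-*-Solver.solve 3 (λ y r k → r :+ (con 2 :+ k) :* y := (y :+ y) :+ (r :+ k :* y)) refl m r k′)))

  room-w : ∀ s → T (small s) → ∀ d → d ≤ suc w₀ → d + val (proj₂ s) < Q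
  room-w s h d d≤ = ℕ.≤-<-trans (ℕ.+-mono-≤ (ℕ.≤-trans d≤ (ℕ.≤-reflexive (≡.cong suc 4+2m≡))) (small⇒≤ s h))
    (room 2 5 (s≤s (s≤s z≤n)) (ℕ.m≤m+n 5 20))

  -- All pairs of positions in `table` pass `gap`, so b and b_d have disjoint supports. For d = m
  -- the supports overlap and the relation is evaluated instead.
  commute-other : ∀ d → 1 ≤ d → d ≤ w₀ → d ≢ m → d ≢ m + m → b ∙ bi d ≈ bi d ∙ b
  commute-other d 1≤d d≤w d≢m d≢2m = faithful _ _ λ t → ≡.trans (▸-∙ b (bi d) t) (≡.trans (cases t (search t table b-table b-fixed (b-fix t))) (≡.sym (▸-∙ (bi d) b t)))
    where
    fixed : ∀ s → Clear s → bi d ▸ ⟦ s ⟧ⁿ ≡ ⟦ s ⟧ⁿ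
    fixed s (clear h g) = fix-by d ⟦ s ⟧ⁿ (λ s′ → small s′ ∧ gap s s′) g λ s′ h′ eq →
      let c≡ , v≡ = pos-inj (ℕ.≤-<-trans (small⇒≤ s h) bound₁₇)
                      (room-w s′ (proj₁ (T-∧⁻ h′)) d (ℕ.m≤n⇒m≤1+n d≤w)) eq
      in gap⇒≢ s s′ d (proj₂ (T-∧⁻ {small s′} h′)) 1≤d d≤w d≢m d≢2m c≡ v≡
    b-fixed : All (λ (p , q) → bi d ▸ ⟦ p ⟧ⁿ ≡ ⟦ p ⟧ⁿ × bi d ▸ ⟦ q ⟧ⁿ ≡ ⟦ q ⟧ⁿ) table
    b-fixed = All.map (λ { {p , q} (h , h′) → fixed p h , fixed q h′ }) table-clear
    Touched : Tok → Set
    Touched t = bi d ▸ t ≡ t × bi d ▸ (b ▸ t) ≡ b ▸ t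
    search : ∀ t ps → All (λ (p , q) → b ▸ ⟦ p ⟧ⁿ ≡ ⟦ q ⟧ⁿ × b ▸ ⟦ q ⟧ⁿ ≡ ⟦ p ⟧ⁿ) ps →
      All (λ (p , q) → bi d ▸ ⟦ p ⟧ⁿ ≡ ⟦ p ⟧ⁿ × bi d ▸ ⟦ q ⟧ⁿ ≡ ⟦ q ⟧ⁿ) ps →
      (All (λ (p , q) → t ≢ ⟦ p ⟧ⁿ × t ≢ ⟦ q ⟧ⁿ) ps → b ▸ t ≡ t) → Touched t ⊎ b ▸ t ≡ t
    search t [] [] [] k = inj₂ (k [])
    search t ((p , q) ∷ ps) ((e , e′) ∷ es) ((f , f′) ∷ fs) k = pick (t ≟ᵀ ⟦ p ⟧ⁿ) (t ≟ᵀ ⟦ q ⟧ⁿ)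
      where
      pick : Dec (t ≡ ⟦ p ⟧ⁿ) → Dec (t ≡ ⟦ q ⟧ⁿ) → Touched t ⊎ b ▸ t ≡ t
      pick (yes refl) _        = inj₁ (f , ≡.trans (≡.cong (bi d ▸_) e) (≡.trans f′ (≡.sym e)))
      pick (no _) (yes refl)   = inj₁ (f′ , ≡.trans (≡.cong (bi d ▸_) e′) (≡.trans f (≡.sym e′)))
      pick (no n) (no n′)      = search t ps es fs (λ a → k ((n , n′) ∷ a))
    both : ∀ t → Touched (bi d ▸ t) ⊎ b ▸ (bi d ▸ t) ≡ bi d ▸ t → b ▸ t ≡ t → b ▸ (bi d ▸ t) ≡ bi d ▸ (b ▸ t)
    both t (inj₁ (f , _)) bt = ≡.trans (≡.cong (b ▸_) dt) (≡.trans bt (≡.trans (≡.sym dt) (≡.cong (bi d ▸_) (≡.sym bt))))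
      where
      dt : bi d ▸ t ≡ t
      dt = ▸-inj (bi d) f
    both t (inj₂ bdt) bt = ≡.trans bdt (≡.cong (bi d ▸_) (≡.sym bt))
    cases : ∀ t → Touched t ⊎ b ▸ t ≡ t → b ▸ (bi d ▸ t) ≡ bi d ▸ (b ▸ t)
    cases t (inj₁ (f , f′)) = ≡.trans (≡.cong (b ▸_) f) (≡.sym f′)
    cases t (inj₂ bt) = both t (search (bi d ▸ t) table b-table b-fixed (b-fix (bi d ▸ t))) bt

  commute : ∀ d → 1 ≤ d → d ≤ w₀ → d ≢ m + m → b ∙ bi d ≈ bi d ∙ b
  commute d 1≤d d≤w d≢2m with d ℕ.≟ m
  ... | yes refl = commute-m
  ... | no d≢m = commute-other d 1≤d d≤w d≢m d≢2m

  0<Q : 0 < Q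
  0<Q = ℕ.≤-<-trans z≤n bound₁₇

  lead-moved : b ▸ pos 1F 0 ≢ pos 1F 0
  lead-moved eq = 0≢1 (proj₁ (pos-inj {0F} {1F} 0<Q 0<Q (≡.trans (≡.sym (proj₁ (All.head b-table))) eq)))
    where
    0≢1 : 0F ≢ 1F
    0≢1 ()

  -- Position 0 is the lowest on cycle 1, and shifts by at most w + 1 do not wrap around to it.
  lead-fixed : ∀ j → bi (suc j) ▸ pos 1F 0 ≡ pos 1F 0 ⊎ w₀ < j
  lead-fixed j with j ℕ.≤? w₀
  ... | no ¬p = inj₂ (ℕ.≰⇒> ¬p)
  ... | yes p = inj₁ (fix-by (suc j) (pos 1F 0) small tt λ s h eq → ℕ.0≢1+n (proj₂ (pos-inj 0<Q (room-w s h (suc j) (s≤s p)) eq)))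

  -- On cycle 0 `table` has only 0 and m, so the bⱼ with j < w reach at most position 3m + 3 there,
  -- which is below 4m.
  far : ℕ → Tok
  far i = pos 0F (i + 4 * m)

  far-bound : ∀ i → i ≤ 8 → i + 4 * m < Q
  far-bound i i≤8 = ℕ.≤-<-trans (ℕ.m≤m+n (i + 4 * m) (3 + 17 * m)) (room 4 i (ℕ.m≤m+n 4 3) (ℕ.≤-trans i≤8 (ℕ.m≤m+n 8 7)))

  first-cycle : Name → Bool
  first-cycle (c , k , r) = cycle≠ 0F c ∨ (k ≤ᵇ 1) ∧ (r ≤ᵇ 0)

  first-cycle⇒≤ : ∀ k r → T (first-cycle (0F , k , r)) → val (k , r) ≤ m
  first-cycle⇒≤ k r h = ≡.subst (val (k , r) ≤_) (ℕ.+-identityʳ m) (ℕ.+-mono-≤ (ℕ.≤ᵇ⇒≤ r 0 (proj₂ (T-∧⁻ {k ≤ᵇ 1} h))) (ℕ.*-monoˡ-≤ m (ℕ.≤ᵇ⇒≤ k 1 (proj₁ (T-∧⁻ h)))))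

  far-fixed : ∀ i j → i ≤ 8 → j < w₀ → bi j ▸ far i ≡ far i
  far-fixed i j i≤8 j<w = fix-by j (far i) (λ s → small s ∧ first-cycle s) tt λ { s@(c , k , r) h eq →
    let c≡ , v≡ = pos-inj (far-bound i i≤8) (room-w s (proj₁ (T-∧⁻ h)) j (ℕ.m≤n⇒m≤1+n (ℕ.<⇒≤ j<w))) eq
    in contra k r (≡.subst (λ c → T (first-cycle (c , k , r))) (≡.sym c≡) (proj₂ (T-∧⁻ {small s} h))) v≡ }
    where
    open ℕ.≤-Reasoning
    contra : ∀ k r → T (first-cycle (0F , k , r)) → i + 4 * m ≢ j + val (k , r)
    contra k r h eq = ℕ.<⇒≢ (begin-strict
      j + val (k , r)       ≤⟨ ℕ.+-monoʳ-≤ j (first-cycle⇒≤ k r h) ⟩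
      j + m                 <⟨ ℕ.+-monoˡ-< m j<w ⟩
      4 + (m + m) + m       ≡⟨ ≡.cong (_+ m) 4+2m≡ ⟩
      4 + 2 * m + m         ≤⟨ ℕ.+-monoˡ-≤ m (ℕ.+-monoˡ-≤ (2 * m) (ℕ.≤-trans (ℕ.n≤1+n 4) 5≤m)) ⟩
      3 * m + m             ≡⟨ ℕ.+-comm (3 * m) m ⟩
      4 * m                 ≤⟨ ℕ.m≤n+m (4 * m) i ⟩
      i + 4 * m             ∎) (≡.sym eq)

  far-inj : ∀ i j → i ≤ 8 → j ≤ 8 → far i ≡ far j → i ≡ j
  far-inj i j i≤8 j≤8 eq = ℕ.+-cancelʳ-≡ (4 * m) i j (proj₂ (pos-inj (far-bound i i≤8) (far-bound j j≤8) eq))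

  w<Q : w₀ < Q
  w<Q = ℕ.≤-<-trans (ℕ.≤-trans (ℕ.≤-reflexive 4+2m≡) (ℕ.m≤m+n _ (3 + 17 * m))) (room 2 4 (s≤s (s≤s z≤n)) (ℕ.m≤m+n 4 21))

  x^Q : xp Q ≈ ε
  x^Q = faithful _ _ λ t → let c , p , e = pos-sur t in
    ≡.trans (≡.cong (xp Q ▸_) e) (≡.trans (xp-pos Q c p) (≡.trans (pos-periodic c p) (≡.trans (≡.sym e) (≡.sym (▸-ε t)))))

  -- (b₁ b₃ₘ₊₂)² is a commutator of involutions at distance 3m + 1, a 3-cycle on position 4m + 2 of
  -- cycle 0 and 8m + 2, 16m + 4 of cycle 1, all fixed by b. In the mirror image the 3-cycle
  -- contains 16m + 3 of cycle 1, which b₃ₘ₊₂ sends to 20m + 5.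
  ℓ₀ : ℕ
  ℓ₀ = 1 + 3 * m

  chiral : bi 1 ∙ bi (suc ℓ₀) ∙ (bi 1 ∙ bi (suc ℓ₀)) ∙ b ≈ b ∙ (bi 1 ∙ bi (suc ℓ₀) ∙ (bi 1 ∙ bi (suc ℓ₀)))
  chiral = Group.trans X (solve (bi 1 ∷ bi (suc ℓ₀) ∷ b ∷ []) (p₀ ⊙ p₁ ⊙ (p₀ ⊙ p₁) ⊙ p₂) (p₀ ⊙ (p₁ ⊙ (p₀ ⊙ (p₁ ⊙ (p₂ ⊙ one))))) refl)
    (Group.trans X (agree-sound ((0 , 1) ∷ (3 , 2) ∷ (0 , 1) ∷ (3 , 2) ∷ (0 , 0) ∷ []) ((0 , 0) ∷ (0 , 1) ∷ (3 , 2) ∷ (0 , 1) ∷ (3 , 2) ∷ []) tt)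
    (solve (bi 1 ∷ bi (suc ℓ₀) ∷ b ∷ []) (p₂ ⊙ (p₀ ⊙ (p₁ ⊙ (p₀ ⊙ (p₁ ⊙ one))))) (p₂ ⊙ (p₀ ⊙ p₁ ⊙ (p₀ ⊙ p₁))) refl))

  chiral-not : ¬ (bi ℓ₀ ∙ b ∙ (bi ℓ₀ ∙ b) ∙ bi (suc ℓ₀) ≈ bi (suc ℓ₀) ∙ (bi ℓ₀ ∙ b ∙ (bi ℓ₀ ∙ b)))
  chiral-not h = apart⇒≢ {1F , 20 , 5} {1F , 8 , 1} tt tt tt (≡.trans (≡.sym (run-▸ left s refl))
    (≡.trans (▸-cong left≈right ⟦ s ⟧ⁿ) (run-▸ right s refl)))
    where
    s : Name
    s = 1F , 16 , 3
    left right : List (ℕ × ℕ)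
    left  = (3 , 1) ∷ (0 , 0) ∷ (3 , 1) ∷ (0 , 0) ∷ (3 , 2) ∷ []
    right = (3 , 2) ∷ (3 , 1) ∷ (0 , 0) ∷ (3 , 1) ∷ (0 , 0) ∷ []
    left≈right : word left ≈ word right
    left≈right = Group.trans X (solve (bi ℓ₀ ∷ b ∷ bi (suc ℓ₀) ∷ []) (p₀ ⊙ (p₁ ⊙ (p₀ ⊙ (p₁ ⊙ (p₂ ⊙ one))))) (p₀ ⊙ p₁ ⊙ (p₀ ⊙ p₁) ⊙ p₂) refl)
      (Group.trans X h (solve (bi ℓ₀ ∷ b ∷ bi (suc ℓ₀) ∷ []) (p₂ ⊙ (p₀ ⊙ p₁ ⊙ (p₀ ⊙ p₁))) (p₂ ⊙ (p₀ ⊙ (p₁ ⊙ (p₀ ⊙ (p₁ ⊙ one))))) refl))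

-- Independence of the shifts of b

on-axis : Name → Bool
on-axis (c , k , r) = small (c , k , r) ∧ (cycle≠ 0F c ∨ (r ≡ᵇ 0) ∧ ((k ≡ᵇ 0) ∨ (k ≡ᵇ 1)))

-- On cycle 1 the entries that are not multiples of m have k ≥ 5, too high to interfere with the
-- token tracked below.
on-grid : Name → Bool
on-grid (c , k , r) = small (c , k , r) ∧ (cycle≠ 1F c ∨ (r ≡ᵇ 0) ∨ (5 ≤ᵇ k))

table-on-axis : T (every (every-pair on-axis) table)
table-on-axis = tt

table-on-grid : T (every (every-pair on-grid) table)
table-on-grid = tt

module Sweeps {X : Grp} (S : TokenSystem X) where

  open Group X using (Carrier; _≈_; _∙_; ε; _⁻¹)
  open TokenGroup S

  wrap : ∀ c q → q < Q + Q → ∃ λ z → z < Q × pos c q ≡ pos c z × (q ≡ z ⊎ q ≡ Q + z)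
  wrap c q q<2Q = split (q ℕ.<? Q)
    where
    split : Dec (q < Q) → ∃ λ z → z < Q × pos c q ≡ pos c z × (q ≡ z ⊎ q ≡ Q + z)
    split (yes q<Q) = q , q<Q , refl , inj₁ refl
    split (no q≮Q)  = q ∸ Q , ℕ.+-cancelˡ-< Q _ _ (≡.subst (_< Q + Q) (≡.sym Q+) q<2Q)
      , ≡.trans (≡.cong (pos c) (≡.sym Q+)) (pos-periodic c _) , inj₂ (≡.sym Q+)
      where
      Q+ : Q + (q ∸ Q) ≡ q
      Q+ = ℕ.m+[n∸m]≡n (ℕ.≮⇒≥ q≮Q)

  -- m ≤ p excludes wrap-around: i + m = Q + p with i < Q would force p < m.
  axis-fixed : ∀ p i → m ≤ p → p < Q → i < Q → i ≢ p → m + i ≢ p → bi i ▸ pos 0F p ≡ pos 0F p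
  axis-fixed p i m≤p p<Q i<Q i≢p m+i≢p = fix-by i (pos 0F p) on-axis table-on-axis off
    where
    same-cycle : ∀ k r → T ((r ≡ᵇ 0) ∧ ((k ≡ᵇ 0) ∨ (k ≡ᵇ 1))) → ∀ z → p ≡ z →
                 i + val (k , r) ≡ z ⊎ i + val (k , r) ≡ Q + z → ⊥
    same-cycle 0 0 _ z refl (inj₁ e) = i≢p (≡.trans (≡.sym (ℕ.+-identityʳ i)) e)
    same-cycle 0 0 _ z refl (inj₂ e) = ℕ.<⇒≱ i<Q (ℕ.≤-trans (ℕ.m≤m+n Q z) (ℕ.≤-reflexive (≡.trans (≡.sym e) (ℕ.+-identityʳ i))))
    same-cycle 1 0 _ z refl (inj₁ e) = m+i≢p (≡.trans (ℕ.+-comm m i) (≡.trans (≡.cong (i +_) (≡.sym (ℕ.+-identityʳ m))) e))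
    same-cycle 1 0 _ z refl (inj₂ e) = ℕ.<⇒≢ (ℕ.+-mono-<-≤ i<Q (ℕ.≤-trans (ℕ.≤-reflexive (ℕ.+-identityʳ m)) m≤p)) e
    off : ∀ s → T (on-axis s) → pos 0F p ≢ at i s
    off s@(c , k , r) h eq = finish c (wrap c (i + val (k , r)) (ℕ.+-mono-< i<Q (ℕ.≤-<-trans (small⇒≤ s (proj₁ (T-∧⁻ {small s} h))) bound₁₇)))
                               eq (proj₂ (T-∧⁻ {small s} h))
      where
      finish : ∀ c → (∃ λ z → z < Q × pos c (i + val (k , r)) ≡ pos c z × (i + val (k , r) ≡ z ⊎ i + val (k , r) ≡ Q + z)) →
               pos 0F p ≡ pos c (i + val (k , r)) → T (cycle≠ 0F c ∨ (r ≡ᵇ 0) ∧ ((k ≡ᵇ 0) ∨ (k ≡ᵇ 1))) → ⊥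
      finish 0F (z , z<Q , e , zz) eq h = same-cycle k r h z (proj₂ (pos-inj p<Q z<Q (≡.trans eq e))) zz
      finish 1F (z , z<Q , e , zz) eq h with () ← proj₁ (pos-inj p<Q z<Q (≡.trans eq e))

  letter : (ℕ → Bool) → ℕ → Carrier
  letter e i = if e i then bi i else ε

  letter-fixed : ∀ e i {t} → bi i ▸ t ≡ t → letter e i ▸ t ≡ t
  letter-fixed e i p with e i
  ... | true  = p
  ... | false = ▸-ε _

  module _ (e : ℕ → Bool) (t : Tok) (j : ℕ) (others : ∀ i → i < Q → i ≢ j → letter e i ▸ t ≡ t) where

    after : ∀ i k → i + k ≡ Q → j < i → sweep e i k ▸ t ≡ t
    after i zero    _ _ = ▸-ε t
    after i (suc k) i+k j<i = ≡.trans (▸-∙ _ _ t) (≡.trans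
      (≡.cong (letter e i ▸_) (after (suc i) k (≡.trans (≡.sym (ℕ.+-suc i k)) i+k) (ℕ.m≤n⇒m≤1+n j<i)))
      (others i (≡.subst (i <_) i+k (ℕ.m<m+n i (s≤s z≤n))) (ℕ.>⇒≢ j<i)))

    -- The factors to the right of the j-th leave t in place, the j-th moves it, and those to the
    -- left fix t and so cannot bring another token there.
    moved-once : ∀ i k → i + k ≡ Q → i ≤ j → j < Q → letter e j ▸ t ≢ t → sweep e i k ▸ t ≢ t
    moved-once i zero    i+k i≤j j<Q _ _ = ℕ.<⇒≱ j<Q (ℕ.≤-trans (ℕ.≤-reflexive (≡.trans (≡.sym i+k) (ℕ.+-identityʳ i))) i≤j)
    moved-once i (suc k) i+k i≤j j<Q moved eq = split (ℕ.m≤n⇒m<n∨m≡n i≤j)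
      where
      i+k′ : suc i + k ≡ Q
      i+k′ = ≡.trans (≡.sym (ℕ.+-suc i k)) i+k
      eq′ : letter e i ▸ (sweep e (suc i) k ▸ t) ≡ t
      eq′ = ≡.trans (≡.sym (▸-∙ _ _ t)) eq
      split : i < j ⊎ i ≡ j → ⊥
      split (inj₁ i<j)  = moved-once (suc i) k i+k′ i<j j<Q moved
        (▸-inj (letter e i) (≡.trans eq′ (≡.sym (others i (ℕ.<-trans i<j j<Q) (ℕ.<⇒≢ i<j)))))
      split (inj₂ refl) = moved (≡.trans (≡.cong (letter e i ▸_) (≡.sym (after (suc i) k i+k′ ℕ.≤-refl))) eq′)

  bi-swap : ∀ i → All (λ (p , q) → bi (val i) ▸ ⟦ shift i p ⟧ⁿ ≡ ⟦ shift i q ⟧ⁿ × bi (val i) ▸ ⟦ shift i q ⟧ⁿ ≡ ⟦ shift i p ⟧ⁿ) table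
  bi-swap i = All.map (λ { {p , q} (e , e′) → name p q e , name q p e′ }) (bi-table (val i))
    where
    name : ∀ p q → bi (val i) ▸ at (val i) p ≡ at (val i) q → bi (val i) ▸ ⟦ shift i p ⟧ⁿ ≡ ⟦ shift i q ⟧ⁿ
    name p q e = ≡.trans (≡.cong (bi (val i) ▸_) (≡.sym (at-shift i p))) (≡.trans e (at-shift i q))

  -- On cycle 0 the position p ≥ m is met only by b_p and b_{p−m}.
  module _ (e : ℕ → Bool) (trivial : sweep e 0 Q ≈ ε) where

    sweep-fixes : ∀ t → sweep e 0 Q ▸ t ≡ t
    sweep-fixes t = ≡.trans (▸-cong trivial t) (▸-ε t)

    -- Were only one of the two exponents set, position m + q of cycle 0 would be moved exactly
    -- once.
    periodic : ∀ q → m + q < Q → e (m + q) ≡ e q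
    periodic q m+q<Q = compare (e (m + q)) (e q) refl refl
      where
      p : ℕ
      p = m + q
      q<Q : q < Q
      q<Q = ℕ.≤-<-trans (ℕ.m≤n+m q m) m+q<Q
      elsewhere : ∀ i → i < Q → i ≢ p → i ≢ q → letter e i ▸ pos 0F p ≡ pos 0F p
      elsewhere i i<Q i≢p i≢q = letter-fixed e i (axis-fixed p i (ℕ.m≤m+n m q) m+q<Q i<Q i≢p (λ eq → i≢q (ℕ.+-cancelˡ-≡ m i q eq)))
      idle : ∀ i → e i ≡ false → letter e i ▸ pos 0F p ≡ pos 0F p
      idle i eq = ≡.trans (≡.cong (λ z → (if z then bi i else ε) ▸ pos 0F p) eq) (▸-ε _)
      active : ∀ i {s} → e i ≡ true → bi i ▸ pos 0F p ≡ s → letter e i ▸ pos 0F p ≡ s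
      active i eq r = ≡.trans (≡.cong (λ z → (if z then bi i else ε) ▸ pos 0F p) eq) r
      other-cycle : ∀ {y} → y < Q + Q → pos 1F y ≢ pos 0F p
      other-cycle {y} y<2Q eq with wrap 1F y y<2Q
      ... | z , z<Q , e , _ with () ← proj₁ (pos-inj {1F} {0F} z<Q m+q<Q (≡.trans (≡.sym e) eq))
      p-moved : bi p ▸ pos 0F p ≡ pos 1F (p + 0)
      p-moved = ≡.trans (≡.cong (λ z → bi p ▸ pos 0F z) (≡.sym (ℕ.+-identityʳ p))) (proj₂ (All.head (bi-table p)))
      q-moved : bi q ▸ pos 0F p ≡ pos 1F (q + 5 * m)
      q-moved = ≡.trans (≡.cong (λ z → bi q ▸ pos 0F z) (≡.trans (ℕ.+-comm m q) (≡.cong (q +_) (≡.sym (ℕ.+-identityʳ m)))))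
        (proj₂ (All.head (All.tail (All.tail (All.tail (bi-table q))))))
      compare : ∀ y z → e p ≡ y → e q ≡ z → e p ≡ e q
      compare true  true  ep eq = ≡.trans ep (≡.sym eq)
      compare false false ep eq = ≡.trans ep (≡.sym eq)
      compare true  false ep eq = ⊥-elim (moved-once e (pos 0F p) p
        (λ i i<Q i≢p → [i≟q] i i<Q i≢p (i ℕ.≟ q)) 0 Q refl z≤n m+q<Q
        (λ r → other-cycle {p + 0} (≡.subst (_< Q + Q) (≡.sym (ℕ.+-identityʳ p)) (ℕ.<-≤-trans m+q<Q (ℕ.m≤m+n Q Q)))
                 (≡.trans (≡.sym (active p ep p-moved)) r))
        (sweep-fixes _))
        where
        [i≟q] : ∀ i → i < Q → i ≢ p → Dec (i ≡ q) → letter e i ▸ pos 0F p ≡ pos 0F p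
        [i≟q] i i<Q i≢p (yes refl) = idle i eq
        [i≟q] i i<Q i≢p (no i≢q)   = elsewhere i i<Q i≢p i≢q
      compare false true ep eq = ⊥-elim (moved-once e (pos 0F p) q
        (λ i i<Q i≢q → [i≟p] i i<Q i≢q (i ℕ.≟ p)) 0 Q refl z≤n q<Q
        (λ r → other-cycle {q + 5 * m} (ℕ.+-mono-< q<Q 5m<Q)
                 (≡.trans (≡.sym (active q eq q-moved)) r))
        (sweep-fixes _))
        where
        5m<Q : 5 * m < Q
        5m<Q = ℕ.≤-<-trans (ℕ.m≤m+n (5 * m) (3 + 17 * m)) (room 5 0 (ℕ.m≤m+n 5 2) z≤n)
        [i≟p] : ∀ i → i < Q → i ≢ q → Dec (i ≡ p) → letter e i ▸ pos 0F p ≡ pos 0F p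
        [i≟p] i i<Q i≢q (yes refl) = idle i ep
        [i≟p] i i<Q i≢q (no i≢p)   = elsewhere i i<Q i≢p i≢q

    -- The factors of highest index act first, so a token is tracked with i descending from Q to 0.
    Reaches : Tok → ℕ → Tok → Set
    Reaches t i y = ∀ k → i + k ≡ Q → sweep e i k ▸ t ≡ y

    glide : ∀ {t y} d i → (∀ i′ → i ≤ i′ → i′ < i + d → bi i′ ▸ y ≡ y) → i + d ≤ Q → Reaches t (i + d) y → Reaches t i y
    glide {t} {y} zero    i _ _ r = ≡.subst (λ i → Reaches t i y) (ℕ.+-identityʳ i) r
    glide {t} {y} (suc d) i f i+d≤Q r zero i+k = ⊥-elim (ℕ.m+1+n≰m i (≡.subst (i + suc d ≤_) (≡.trans (≡.sym i+k) (ℕ.+-identityʳ i)) i+d≤Q))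
    glide {t} {y} (suc d) i f i+d≤Q r (suc k) i+k = ≡.trans (▸-∙ _ _ t) (≡.trans
      (≡.cong (letter e i ▸_) (glide d (suc i)
        (λ i′ i<i′ i′< → f i′ (ℕ.<⇒≤ i<i′) (≡.subst (i′ <_) (≡.sym (ℕ.+-suc i d)) i′<)) (≡.subst (_≤ Q) (ℕ.+-suc i d) i+d≤Q)
        (≡.subst (λ i → Reaches t i y) (ℕ.+-suc i d) r) k (≡.trans (≡.sym (ℕ.+-suc i k)) i+k)))
      (letter-fixed e i (f i ℕ.≤-refl (ℕ.m<m+n i (s≤s z≤n)))))

    glide-to : ∀ {t y} i j → i ≤ j → j ≤ Q → (∀ i′ → i ≤ i′ → i′ < j → bi i′ ▸ y ≡ y) → Reaches t j y → Reaches t i y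
    glide-to {t} {y} i j i≤j j≤Q f r = glide (j ∸ i) i (λ i′ p q → f i′ p (≡.subst (i′ <_) i+ q)) (≡.subst (_≤ Q) (≡.sym i+) j≤Q)
      (≡.subst (λ i → Reaches t i y) (≡.sym i+) r)
      where
      i+ : i + (j ∸ i) ≡ j
      i+ = ℕ.m+[n∸m]≡n i≤j

    hop : ∀ {t y y′} i → e i ≡ true → i < Q → bi i ▸ y ≡ y′ → Reaches t (suc i) y → Reaches t i y′
    hop i ei i<Q m r zero    i+k = ⊥-elim (ℕ.<⇒≢ i<Q (≡.trans (≡.sym (ℕ.+-identityʳ i)) i+k))
    hop {t} {y} i ei i<Q m r (suc k) i+k = ≡.trans (▸-∙ _ _ t) (≡.trans
      (≡.cong (letter e i ▸_) (r k (≡.trans (≡.sym (ℕ.+-suc i k)) i+k)))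
      (≡.trans (≡.cong (λ z → (if z then bi i else ε) ▸ y) ei) m))

    -- If e holds on the residue class of q, the sweep carries position q + 5 m of
    -- cycle 0 through cycle 1 to position q + m of cycle 0.
    module _ (q : ℕ) (q<m : q < m) (eq : e q ≡ true) where

      site : Fin 2 → ℕ → Tok
      site c k = ⟦ c , k , q + 0 ⟧ⁿ

      idx : ℕ → ℕ
      idx k = val (k , q)

      idx-suc : ∀ k → idx (suc k) ≡ m + idx k
      idx-suc k = ≡.trans (≡.sym (ℕ.+-assoc q m (k * m))) (≡.trans (≡.cong (_+ k * m) (ℕ.+-comm q m)) (ℕ.+-assoc m q (k * m)))

      idx-room : ∀ k → k ≤ 6 → idx k + (3 + 17 * m) < Q
      idx-room k k≤6 = ℕ.≤-<-trans (ℕ.+-monoˡ-≤ (3 + 17 * m) idx≤) (room 7 0 ℕ.≤-refl z≤n)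
        where
        idx≤ : idx k ≤ 7 * m
        idx≤ = ℕ.+-mono-≤ (ℕ.<⇒≤ q<m) (ℕ.*-monoˡ-≤ m k≤6)

      idx<Q : ∀ k → k ≤ 6 → idx k < Q
      idx<Q k k≤6 = ℕ.≤-<-trans (ℕ.m≤m+n (idx k) (3 + 17 * m)) (idx-room k k≤6)

      on : ∀ k → k ≤ 6 → e (idx k) ≡ true
      on zero    _   = ≡.trans (≡.cong e (ℕ.+-identityʳ q)) eq
      on (suc k) k≤6 = ≡.trans (≡.cong e (idx-suc k)) (≡.trans (periodic (idx k) (≡.subst (_< Q) (idx-suc k) (idx<Q (suc k) k≤6)))
        (on k (ℕ.<⇒≤ k≤6)))

      site-bound : ∀ k → k ≤ 17 → val (k , q + 0) < Q
      site-bound k k≤17 = begin-strict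
        q + 0 + k * m           ≡⟨ ≡.cong (_+ k * m) (ℕ.+-identityʳ q) ⟩
        q + k * m               ≤⟨ ℕ.+-mono-≤ (ℕ.<⇒≤ q<m) (ℕ.*-monoˡ-≤ m k≤17) ⟩
        m + 17 * m              ≤⟨ ℕ.+-mono-≤ (ℕ.≤-reflexive (≡.sym (ℕ.+-identityʳ m))) (ℕ.m≤n+m (17 * m) 3) ⟩
        1 * m + (3 + 17 * m)    <⟨ room 1 0 (s≤s z≤n) z≤n ⟩
        Q                       ∎
        where open ℕ.≤-Reasoning

      -- As i is strictly between `idx k` and `idx (suc k)`, an entry k′ m of bᵢ falls short of the
      -- site if k′ ≤ j and beyond it if k′ > j.
      between-fixed : ∀ k j → k ≤ 4 → j ≤ 4 → ∀ i → idx k < i → i < idx (suc k) → bi i ▸ site 1F (suc k + j) ≡ site 1F (suc k + j)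
      between-fixed k j k≤4 j≤4 i lo hi = fix-by i (site 1F (suc k + j)) on-grid table-on-grid λ { s@(c , k′ , r) h eq →
          let hs , hg = T-∧⁻ {small s} h
              c≡ , v≡ = pos-inj (site-bound (suc k + j) (s≤s (ℕ.≤-trans (ℕ.+-mono-≤ k≤4 j≤4) (ℕ.m≤m+n 8 8))))
                          (ℕ.<-trans (ℕ.+-mono-<-≤ hi (small⇒≤ s hs)) (idx-room (suc k) (s≤s (ℕ.m≤n⇒m≤1+n k≤4)))) eq
          in contra k′ r (≡.subst (λ c → T (cycle≠ 1F c ∨ (r ≡ᵇ 0) ∨ (5 ≤ᵇ k′))) (≡.sym c≡) hg) v≡ (k′ ℕ.≤? j) }
        where
        open ℕ.≤-Reasoning
        contra : ∀ k′ r → T ((r ≡ᵇ 0) ∨ (5 ≤ᵇ k′)) → val (suc k + j , q + 0) ≡ i + val (k′ , r) → Dec (k′ ≤ j) → ⊥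
        contra k′ r h eq (no k′≰j) = ℕ.<⇒≢ (begin-strict
          q + 0 + (suc k + j) * m     ≡⟨ +-*-Solver.solve 4 (λ q k j m → q :+ con 0 :+ (con 1 :+ k :+ j) :* m := q :+ k :* m :+ (con 1 :+ j) :* m) refl q k j m ⟩
          idx k + suc j * m           <⟨ ℕ.+-mono-<-≤ lo (ℕ.≤-trans (ℕ.*-monoˡ-≤ m (ℕ.≰⇒> k′≰j)) (ℕ.m≤n+m (k′ * m) r)) ⟩
          i + (r + k′ * m)            ∎) eq
        contra k′ zero h eq (yes k′≤j) = ℕ.<⇒≢ (begin-strict
          i + k′ * m                  <⟨ ℕ.+-mono-<-≤ hi (ℕ.*-monoˡ-≤ m k′≤j) ⟩
          idx (suc k) + j * m         ≡⟨ +-*-Solver.solve 4 (λ q k j m → q :+ (con 1 :+ k) :* m :+ j :* m := q :+ con 0 :+ (con 1 :+ k :+ j) :* m) refl q k j m ⟩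
          q + 0 + (suc k + j) * m     ∎) (≡.sym eq)
        contra k′ (suc r) h eq (yes k′≤j) = ℕ.<⇒≱ (ℕ.≤ᵇ⇒≤ 5 k′ h) (ℕ.≤-trans k′≤j j≤4)

      leg : ∀ {t y y′} k → k ≤ 5 → (∀ i → idx k < i → i < idx (suc k) → bi i ▸ y ≡ y) → bi (idx k) ▸ y ≡ y′ →
            Reaches t (idx (suc k)) y → Reaches t (idx k) y′
      leg k k≤5 f m r = hop (idx k) (on k (ℕ.m≤n⇒m≤1+n k≤5)) (idx<Q k (ℕ.m≤n⇒m≤1+n k≤5)) m
        (glide-to (suc (idx k)) (idx (suc k)) idx-mono (ℕ.<⇒≤ (idx<Q (suc k) (s≤s k≤5))) f r)
        where
        idx-mono : idx k < idx (suc k)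
        idx-mono = ≡.subst (idx k <_) (≡.sym (idx-suc k)) (ℕ.m<n+m (idx k) (ℕ.≤-trans (s≤s z≤n) 5≤m))

      start : Tok
      start = site 0F 5

      site≡idx : ∀ k → val (k , q + 0) ≡ idx k
      site≡idx k = ≡.cong (_+ k * m) (ℕ.+-identityʳ q)

      site-fixed : ∀ k → k ≤ 5 → ∀ i → i < Q → i ≢ idx (suc k) → i ≢ idx k → bi i ▸ site 0F (suc k) ≡ site 0F (suc k)
      site-fixed k k≤5 i i<Q i≢ i≢′ = axis-fixed (val (suc k , q + 0)) i
        (ℕ.≤-trans (ℕ.m≤m+n m (k * m)) (ℕ.m≤n+m _ (q + 0))) (site-bound (suc k) (s≤s (ℕ.≤-trans k≤5 (ℕ.m≤m+n 5 11)))) i<Q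
        (λ e → i≢ (≡.trans e (site≡idx (suc k))))
        (λ e → i≢′ (ℕ.+-cancelˡ-≡ m i (idx k) (≡.trans e (≡.trans (site≡idx (suc k)) (idx-suc k)))))

      swap₀ : ∀ k → bi (idx k) ▸ site 0F (k + 0) ≡ site 1F (k + 0)
      swap₀ k = proj₂ (All.head (bi-swap (k , q)))

      swap₁₃ : ∀ k → bi (idx k) ▸ site 1F (k + 1) ≡ site 1F (k + 3) × bi (idx k) ▸ site 1F (k + 3) ≡ site 1F (k + 1)
      swap₁₃ k = All.head (All.tail (bi-swap (k , q)))

      swap₂₄ : ∀ k → bi (idx k) ▸ site 1F (k + 2) ≡ site 1F (k + 4) × bi (idx k) ▸ site 1F (k + 4) ≡ site 1F (k + 2)
      swap₂₄ k = All.head (All.tail (All.tail (bi-swap (k , q))))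

      swap₅ : ∀ k → bi (idx k) ▸ site 1F (k + 5) ≡ site 0F (k + 1)
      swap₅ k = proj₁ (All.head (All.tail (All.tail (All.tail (bi-swap (k , q))))))

      above : Reaches start (suc (idx 5)) start
      above = glide-to (suc (idx 5)) Q (idx<Q 5 (ℕ.n≤1+n 5)) ℕ.≤-refl
        (λ i lo i<Q → site-fixed 4 (ℕ.n≤1+n 4) i i<Q (ℕ.>⇒≢ lo) (ℕ.>⇒≢ (ℕ.≤-<-trans idx-mono lo)))
        λ { zero _ → ▸-ε _ ; (suc k) Q+ → ⊥-elim (ℕ.m+1+n≢m Q Q+) }
        where
        idx-mono : idx 4 ≤ idx 5
        idx-mono = ≡.subst (idx 4 ≤_) (≡.sym (idx-suc 4)) (ℕ.m≤n+m (idx 4) m)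

      at₅ : Reaches start (idx 5) (site 1F 5)
      at₅ = hop (idx 5) (on 5 (ℕ.n≤1+n 5)) (idx<Q 5 (ℕ.n≤1+n 5)) (swap₀ 5) above

      at₀ : Reaches start (idx 0) (site 0F 1)
      -- Read from the inside: relative to q and in units of m, the token on cycle 1 runs 5 → 7 → 5
      -- → 3 → 5 under the shifts with k = 4, 3, 2, 1, and k = 0 sends it to 1 on cycle 0.
      at₀ = leg 0 z≤n (between-fixed 0 4 z≤n ℕ.≤-refl) (swap₅ 0)
           (leg 1 (s≤s z≤n) (between-fixed 1 1 (s≤s z≤n) (s≤s z≤n)) (proj₁ (swap₂₄ 1))
           (leg 2 (ℕ.m≤m+n 2 3) (between-fixed 2 2 (ℕ.m≤m+n 2 2) (ℕ.m≤m+n 2 2)) (proj₂ (swap₁₃ 2))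
           (leg 3 (ℕ.m≤m+n 3 2) (between-fixed 3 3 (ℕ.m≤m+n 3 1) (ℕ.m≤m+n 3 1)) (proj₂ (swap₂₄ 3))
           (leg 4 (ℕ.m≤m+n 4 1) (between-fixed 4 0 ℕ.≤-refl z≤n) (proj₁ (swap₁₃ 4)) at₅))))

      at-end : Reaches start 0 (site 0F 1)
      at-end = glide-to 0 (idx 0) z≤n (ℕ.<⇒≤ (idx<Q 0 z≤n))
        (λ i _ hi → site-fixed 0 z≤n i (ℕ.<-trans hi (idx<Q 0 z≤n))
           (ℕ.<⇒≢ (ℕ.<-≤-trans hi (≡.subst (idx 0 ≤_) (≡.sym (idx-suc 0)) (ℕ.m≤n+m (idx 0) m)))) (ℕ.<⇒≢ hi)) at₀

      impossible : ⊥
      impossible = ℕ.<⇒≢ (ℕ.+-monoʳ-< (q + 0) (ℕ.*-monoˡ-< m {{>-nonZero (ℕ.≤-trans (s≤s z≤n) 5≤m)}} {1} {5} (s≤s (s≤s z≤n))))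
        (proj₂ (pos-inj {0F} {0F} {val (1 , q + 0)} {val (5 , q + 0)} (site-bound 1 (s≤s z≤n)) (site-bound 5 (ℕ.m≤m+n 5 12)) (≡.trans (≡.sym (at-end Q refl)) (sweep-fixes start))))

    all-false : ∀ n i → i ≤ n → i < Q → e i ≡ false
    all-false n i i≤n i<Q = split (i ℕ.<? m)
      where
      not-true : ∀ z → e i ≡ z → i < m → e i ≡ false
      not-true true  ei i<m = ⊥-elim (impossible i i<m ei)
      not-true false ei _   = ei
      split : Dec (i < m) → e i ≡ false
      split (yes i<m) = not-true (e i) refl i<m
      split (no i≮m)  = descend n i≤n
        where
        m+ : m + (i ∸ m) ≡ i
        m+ = ℕ.m+[n∸m]≡n (ℕ.≮⇒≥ i≮m)
        i∸m< : i ∸ m < i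
        i∸m< = ≡.subst (i ∸ m <_) m+ (ℕ.m<n+m (i ∸ m) (ℕ.≤-trans (s≤s z≤n) 5≤m))
        descend : ∀ n → i ≤ n → e i ≡ false
        descend zero    z≤n = ⊥-elim (i≮m (ℕ.≤-trans (s≤s z≤n) 5≤m))
        descend (suc n) i≤n = ≡.trans (≡.cong e (≡.sym m+)) (≡.trans (periodic (i ∸ m) (≡.subst (_< Q) (≡.sym m+) i<Q))
          (all-false n (i ∸ m) (ℕ.≤-pred (ℕ.<-≤-trans i∸m< i≤n)) (ℕ.<-trans i∸m< i<Q)))

  sweep-injective : ∀ e → sweep e 0 Q ≈ ε → ∀ i → i < Q → e i ≡ false
  sweep-injective e h i = all-false e h i i ℕ.≤-refl

-- Generation

is-3-cycle : List (ℕ × ℕ) → Name → Name → Name → Bool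
is-3-cycle is s₁ s₂ s₃ = every (λ s → does (s ≟ˢ s₁) ∨ does (s ≟ˢ s₂) ∨ does (s ≟ˢ s₃) ∨ run is s == just s) (concatMap support is)

-- The commutators [b₀ , b₃ₘ₊₁] and [b₀ , b₃ₘ₊₂]. The supports meet only in 8m + 1, respectively 16m
-- + 3, of cycle 1, and involutions whose supports meet in one point have a 3-cycle as commutator.
first-word second-word : List (ℕ × ℕ)
first-word  = (0 , 0) ∷ (3 , 1) ∷ (0 , 0) ∷ (3 , 1) ∷ []
second-word = (0 , 0) ∷ (3 , 2) ∷ (0 , 0) ∷ (3 , 2) ∷ []

first-check : T (is-3-cycle first-word (0F , 4 , 1) (1F , 8 , 1) (1F , 16 , 3))
first-check = tt

second-check : T (is-3-cycle second-word (1F , 8 , 1) (1F , 20 , 5) (1F , 16 , 3))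
second-check = tt

module Generation {X : Grp} (S : TokenSystem X) (colour : TokenSystem.Tok S → Parity)
  (colour-▸ : ∀ u {s t} → colour s ≡ colour t → colour (TokenSystem._▸_ S u s) ≡ colour (TokenSystem._▸_ S u t))
  (colour-pos : ∀ c p → colour (TokenSystem.pos S c p) ≡ parity p) where

  open TokenGroup S
  open Relations S using (x^Q)
  open Group X using (Carrier; _≈_; _∙_; ε; _⁻¹; sym; trans; assoc; identityˡ; identityʳ; ∙-congˡ; ∙-congʳ; ⁻¹-cong)
  open GroupProperties X using (⁻¹-anti-homo-∙; inverseʳ-unique; ε⁻¹≈ε)

  gen-∙ : ∀ {u v} → Generated u → Generated v → Generated (u ∙ v)
  gen-∙ p gen-ε       = gen-≈ (sym (identityʳ _)) p
  gen-∙ p (gen-b q)   = gen-≈ (assoc _ _ _) (gen-b (gen-∙ p q))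
  gen-∙ p (gen-x q)   = gen-≈ (assoc _ _ _) (gen-x (gen-∙ p q))
  gen-∙ p (gen-≈ e q) = gen-≈ (∙-congˡ e) (gen-∙ p q)

  generated-b : Generated b
  generated-b = gen-≈ (identityˡ b) (gen-b gen-ε)

  generated-x : Generated x
  generated-x = gen-≈ (identityˡ x) (gen-x gen-ε)

  generated-xp : ∀ i → Generated (xp i)
  generated-xp zero    = gen-ε
  generated-xp (suc i) = gen-∙ generated-x (generated-xp i)

  generated-x⁻¹ : Generated (x ⁻¹)
  generated-x⁻¹ = gen-≈ (inverseʳ-unique x (xp (Q ∸ 1)) (trans (Group.reflexive X (≡.cong xp (ℕ.m+[n∸m]≡n 1≤Q))) x^Q)) (generated-xp (Q ∸ 1))
    where
    1≤Q : 1 ≤ Q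
    1≤Q = ℕ.≤-<-trans z≤n bound₁₇

  gen-⁻¹ : ∀ {u} → Generated u → Generated (u ⁻¹)
  gen-⁻¹ gen-ε           = gen-≈ (sym ε⁻¹≈ε) gen-ε
  gen-⁻¹ (gen-b {u} p)   = gen-≈ (trans (∙-congʳ (inverseʳ-unique b b b²)) (sym (⁻¹-anti-homo-∙ u b))) (gen-∙ generated-b (gen-⁻¹ p))
  gen-⁻¹ (gen-x {u} p)   = gen-≈ (sym (⁻¹-anti-homo-∙ u x)) (gen-∙ generated-x⁻¹ (gen-⁻¹ p))
  gen-⁻¹ (gen-≈ e p)     = gen-≈ (⁻¹-cong e) (gen-⁻¹ p)

  generated-bi : ∀ i → Generated (bi i)
  generated-bi zero    = generated-b
  generated-bi (suc i) = gen-∙ (gen-∙ generated-x (generated-bi i)) generated-x⁻¹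

  generated-word : ∀ is → Generated (word is)
  generated-word []       = gen-ε
  generated-word (i ∷ is) = gen-∙ (generated-bi (val i)) (generated-word is)

  open Cycles X _▸_ ▸-cong ▸-∙ ▸-ε _≟ᵀ_ colour colour-▸ public
  open Closed Generated gen-≈ gen-ε gen-∙ gen-⁻¹ public

  word-3-cycle : ∀ is s₁ s₂ s₃ → ⟦ s₁ ⟧ⁿ ≢ ⟦ s₂ ⟧ⁿ → ⟦ s₂ ⟧ⁿ ≢ ⟦ s₃ ⟧ⁿ → ⟦ s₃ ⟧ⁿ ≢ ⟦ s₁ ⟧ⁿ →
    run is s₁ ≡ just s₂ → run is s₂ ≡ just s₃ → run is s₃ ≡ just s₁ → T (is-3-cycle is s₁ s₂ s₃) → Is3Cycle (word is) ⟦ s₁ ⟧ⁿ ⟦ s₂ ⟧ⁿ ⟦ s₃ ⟧ⁿ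
  word-3-cycle is s₁ s₂ s₃ n₁ n₂ n₃ e₁ e₂ e₃ h = mk3 n₁ n₂ n₃ (run-▸ is s₁ e₁) (run-▸ is s₂ e₂) (run-▸ is s₃ e₃)
    λ t t₁ t₂ t₃ → rest t t₁ t₂ t₃ (named? t (concatMap support is))
    where
    f : Name → Bool
    f s = does (s ≟ˢ s₁) ∨ does (s ≟ˢ s₂) ∨ does (s ≟ˢ s₃) ∨ run is s == just s
    does⇒ : ∀ s s′ → T (does (s ≟ˢ s′)) → s ≡ s′
    does⇒ s s′ h with s ≟ˢ s′
    ... | yes e = e
    pick : ∀ s → T (f s) → ⟦ s ⟧ⁿ ≢ ⟦ s₁ ⟧ⁿ → ⟦ s ⟧ⁿ ≢ ⟦ s₂ ⟧ⁿ → ⟦ s ⟧ⁿ ≢ ⟦ s₃ ⟧ⁿ → word is ▸ ⟦ s ⟧ⁿ ≡ ⟦ s ⟧ⁿ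
    pick s c t₁ t₂ t₃ = by₁ (T-∨⁻ {does (s ≟ˢ s₁)} c)
      where
      by₃ : T (does (s ≟ˢ s₃)) ⊎ T (run is s == just s) → word is ▸ ⟦ s ⟧ⁿ ≡ ⟦ s ⟧ⁿ
      by₃ (inj₁ c) = ⊥-elim (t₃ (≡.cong ⟦_⟧ⁿ (does⇒ s s₃ c)))
      by₃ (inj₂ c) = let _ , e , e′ = ==-sound (run is s) (just s) c in run-▸ is s (≡.trans e (≡.sym e′))
      by₂ : T (does (s ≟ˢ s₂)) ⊎ T (does (s ≟ˢ s₃) ∨ run is s == just s) → word is ▸ ⟦ s ⟧ⁿ ≡ ⟦ s ⟧ⁿ
      by₂ (inj₁ c) = ⊥-elim (t₂ (≡.cong ⟦_⟧ⁿ (does⇒ s s₂ c)))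
      by₂ (inj₂ c) = by₃ (T-∨⁻ {does (s ≟ˢ s₃)} c)
      by₁ : T (does (s ≟ˢ s₁)) ⊎ T (does (s ≟ˢ s₂) ∨ does (s ≟ˢ s₃) ∨ run is s == just s) → word is ▸ ⟦ s ⟧ⁿ ≡ ⟦ s ⟧ⁿ
      by₁ (inj₁ c) = ⊥-elim (t₁ (≡.cong ⟦_⟧ⁿ (does⇒ s s₁ c)))
      by₁ (inj₂ c) = by₂ (T-∨⁻ {does (s ≟ˢ s₂)} c)
    find : ∀ t ss → Named t ss → All (λ s → T (f s)) ss → t ≢ ⟦ s₁ ⟧ⁿ → t ≢ ⟦ s₂ ⟧ⁿ → t ≢ ⟦ s₃ ⟧ⁿ → word is ▸ t ≡ t
    find t (s ∷ ss) (here ≡.refl) (c ∷ _) t₁ t₂ t₃ = pick s c t₁ t₂ t₃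
    find t (s ∷ ss) (there a) (_ ∷ cs) t₁ t₂ t₃ = find t ss a cs t₁ t₂ t₃
    rest : ∀ t → t ≢ ⟦ s₁ ⟧ⁿ → t ≢ ⟦ s₂ ⟧ⁿ → t ≢ ⟦ s₃ ⟧ⁿ → Dec (Named t (concatMap support is)) → word is ▸ t ≡ t
    rest t t₁ t₂ t₃ (yes a) = find t _ a (every-sound f _ h) t₁ t₂ t₃
    rest t t₁ t₂ t₃ (no n)  = word-fix is t n

  first-3-cycle : Has₃ ⟦ 0F , 4 , 1 ⟧ⁿ ⟦ 1F , 8 , 1 ⟧ⁿ ⟦ 1F , 16 , 3 ⟧ⁿ
  first-3-cycle = word first-word , generated-word first-word ,
    word-3-cycle first-word (0F , 4 , 1) (1F , 8 , 1) (1F , 16 , 3) (apart⇒≢ {0F , 4 , 1} {1F , 8 , 1} tt tt tt)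
      (apart⇒≢ {1F , 8 , 1} {1F , 16 , 3} tt tt tt) (apart⇒≢ {1F , 16 , 3} {0F , 4 , 1} tt tt tt) ≡.refl ≡.refl ≡.refl first-check

  second-3-cycle : Has₃ ⟦ 1F , 8 , 1 ⟧ⁿ ⟦ 1F , 20 , 5 ⟧ⁿ ⟦ 1F , 16 , 3 ⟧ⁿ
  second-3-cycle = word second-word , generated-word second-word ,
    word-3-cycle second-word (1F , 8 , 1) (1F , 20 , 5) (1F , 16 , 3) (apart⇒≢ {1F , 8 , 1} {1F , 20 , 5} tt tt tt)
      (apart⇒≢ {1F , 20 , 5} {1F , 16 , 3} tt tt tt) (apart⇒≢ {1F , 16 , 3} {1F , 8 , 1} tt tt tt) ≡.refl ≡.refl ≡.refl second-check

  Joined : Tok → Tok → Set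
  Joined s t = s ≡ t ⊎ Link s t

  joined-sym : ∀ {s t} → Joined s t → Joined t s
  joined-sym (inj₁ e) = inj₁ (≡.sym e)
  joined-sym (inj₂ l) = inj₂ (link-sym l)

  joined-trans : ∀ {r s t} → Joined r s → Joined s t → Joined r t
  joined-trans (inj₁ ≡.refl) l = l
  joined-trans l (inj₁ ≡.refl) = l
  joined-trans {r} {s} {t} (inj₂ k) (inj₂ l) = split (r ≟ᵀ t)
    where
    split : Dec (r ≡ t) → Joined r t
    split (yes e) = inj₁ e
    split (no n)  = inj₂ (link-trans n k l)

  link-conj : ∀ {g s t s′ t′} → Generated g → g ▸ s ≡ s′ → g ▸ t ≡ t′ → Link s t → Link s′ t′
  link-conj {g} Gg p q (r , h) = g ▸ r , has-conj Gg p q ≡.refl h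

  pos-cong : ∀ c {p q} → p ≡ q → pos c p ≡ pos c q
  pos-cong c = ≡.cong (pos c)

  translate : ∀ {c c′ a d a′} → a ≤ Q → a′ ≡ d + a → Link (pos c a) (pos c′ a′) → ∀ y → Link (pos c y) (pos c′ (d + y))
  translate {c} {c′} {a} {d} a≤Q ≡.refl l y = link-conj (generated-xp v)
    (≡.trans (xp-pos v c a) (≡.trans (pos-cong c v+a) (pos-periodic c y)))
    (≡.trans (xp-pos v c′ (d + a)) (≡.trans (pos-cong c′ v+d+a) (pos-periodic c′ (d + y)))) l
    where
    v : ℕ
    -- The exponent y - a modulo Q.
    v = y + (Q ∸ a)
    v+a : v + a ≡ Q + y
    v+a = ≡.trans (ℕ.+-assoc y (Q ∸ a) a) (≡.trans (≡.cong (y +_) (ℕ.m∸n+n≡m a≤Q)) (ℕ.+-comm y Q))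
    v+d+a : v + (d + a) ≡ Q + (d + y)
    v+d+a = ≡.trans (≡.cong (v +_) (ℕ.+-comm d a)) (≡.trans (≡.sym (ℕ.+-assoc v a d)) (≡.trans (≡.cong (_+ d) v+a)
      (≡.trans (ℕ.+-assoc Q y d) (≡.cong (Q +_) (ℕ.+-comm y d)))))

  range : ∀ k r → T (inRange (0F , k , r)) → r + k * m ≤ Q
  range k r h = ℕ.<⇒≤ (inRange⇒< {0F , k , r} h)

  long : ∀ y → Link (pos 1F y) (pos 1F (2 + 8 * m + y))
  long = translate (range 8 1 tt) (+-*-Solver.solve 1 (λ m → con 3 :+ con 16 :* m := con 2 :+ con 8 :* m :+ (con 1 :+ con 8 :* m)) ≡.refl m)
    (link-sym (⟦ 1F , 20 , 5 ⟧ⁿ , has-rotate (has-rotate second-3-cycle)))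

  short : ∀ y → Link (pos 1F y) (pos 1F (2 + 4 * m + y))
  short = translate (range 16 3 tt) (+-*-Solver.solve 1 (λ m → con 5 :+ con 20 :* m := con 2 :+ con 4 :* m :+ (con 3 :+ con 16 :* m)) ≡.refl m)
    (link-sym (⟦ 1F , 8 , 1 ⟧ⁿ , has-rotate second-3-cycle))

  across : ∀ y → Link (pos 0F y) (pos 1F (4 * m + y))
  across = translate (range 4 1 tt) (+-*-Solver.solve 1 (λ m → con 1 :+ con 8 :* m := con 4 :* m :+ (con 1 :+ con 4 :* m)) ≡.refl m)
    (⟦ 1F , 16 , 3 ⟧ⁿ , first-3-cycle)

  -- 8 m + 2 and 2 (4 m + 2) differ by 2.
  by-two : ∀ y → Joined (pos 1F y) (pos 1F (2 + y))
  by-two y = joined-trans (inj₁ (≡.trans (≡.sym (pos-periodic 1F y)) (pos-cong 1F (≡.sym eq₁))))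
    (joined-trans (joined-sym (inj₂ (long z))) (joined-trans (inj₂ (short z)) (joined-trans (inj₂ (short _))
      (inj₁ (≡.trans (pos-cong 1F eq₂) (pos-periodic 1F (2 + y)))))))
    where
    z : ℕ
    z = Q ∸ (2 + 8 * m) + y
    2+8m≤Q : 2 + 8 * m ≤ Q
    2+8m≤Q = range 8 2 tt
    eq₁ : 2 + 8 * m + z ≡ Q + y
    eq₁ = ≡.trans (≡.sym (ℕ.+-assoc (2 + 8 * m) _ y)) (≡.cong (_+ y) (ℕ.m+[n∸m]≡n 2+8m≤Q))
    eq₂ : 2 + 4 * m + (2 + 4 * m + z) ≡ Q + (2 + y)
    eq₂ = ≡.trans (+-*-Solver.solve 2 (λ m z → con 2 :+ con 4 :* m :+ (con 2 :+ con 4 :* m :+ z) := con 2 :+ (con 2 :+ con 8 :* m :+ z)) ≡.refl m z)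
      (≡.trans (≡.cong (2 +_) eq₁) (≡.trans (≡.sym (ℕ.+-assoc 2 Q y)) (≡.trans (≡.cong (_+ y) (ℕ.+-comm 2 Q)) (ℕ.+-assoc Q 2 y))))

  root : Parity → Tok
  root 0ℙ = pos 1F 0
  root 1ℙ = pos 1F 1

  joined-root₁ : ∀ p → Joined (pos 1F p) (root (parity p))
  joined-root₁ 0 = inj₁ ≡.refl
  joined-root₁ 1 = inj₁ ≡.refl
  joined-root₁ (suc (suc p)) = joined-trans (joined-sym (by-two p)) (joined-root₁ p)

  parity-4* : ∀ p → parity (4 * m + p) ≡ parity p
  parity-4* p = ≡.trans (ℙ.+-homo-+ (4 * m) p) (≡.cong (ℙ._+ parity p) (ℙ.*-homo-* 4 m))

  -- Steps of 2 leave one class per colour on cycle 1, and `across` attaches cycle 0 with the even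
  -- displacement 4m.
  joined-root : ∀ t → Joined t (root (colour t))
  joined-root t = by-cycle (pos-sur t)
    where
    by-cycle : (∃ λ c → ∃ λ p → t ≡ pos c p) → Joined t (root (colour t))
    by-cycle (1F , p , ≡.refl) = ≡.subst (λ z → Joined (pos 1F p) (root z)) (≡.sym (colour-pos 1F p)) (joined-root₁ p)
    by-cycle (0F , p , ≡.refl) = ≡.subst (λ z → Joined (pos 0F p) (root z)) (≡.sym (≡.trans (colour-pos 0F p) (≡.sym (parity-4* p))))
      (joined-trans (inj₂ (across p)) (joined-root₁ (4 * m + p)))

  link : ∀ s t → s ≢ t → colour s ≡ colour t → Link s t
  link s t s≢t s~t = conclude (joined-trans (joined-root s) (≡.subst (λ c → Joined (root c) t) (≡.sym s~t) (joined-sym (joined-root t))))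
    where
    conclude : Joined s t → Link s t
    conclude (inj₁ e) = ⊥-elim (s≢t e)
    conclude (inj₂ l) = l

  has₃ : ∀ {r s t} → r ≢ s → s ≢ t → t ≢ r → colour r ≡ colour s → colour s ≡ colour t → Has₃ r s t
  has₃ {r} {s} {t} r≢s s≢t t≢r r~s s~t = all-3-cycles r≢s s≢t t≢r r~s (link r s r≢s r~s) λ y y≢t y~s → link y t y≢t (≡.trans y~s s~t)

module Configuration {X : Grp} (S : TokenSystem X) where

  open Group X using (_≈_)
  open TokenGroup S
  open Relations S

  config : Decidable _≈_ → (∀ u → Generated u) → Config X
  config _≟_ generates = record
    { Token = Tok ; _▸_ = _▸_ ; ▸-cong = ▸-cong ; ▸-∙ = ▸-∙ ; ▸-ε = ▸-ε
    ; b = b ; x = x ; b² = b² ; m = m ; 5≤m = 5≤m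
    ; commute      = commute
    ; dihedral-rel = dihedral-rel
    ; lead         = pos 1F 0
    ; lead-moved   = lead-moved
    ; lead-fixed   = lead-fixed
    ; far          = far
    ; far-x        = λ i → x-pos 0F (i + 4 * m)
    ; far-fixed    = far-fixed
    ; far-inj      = far-inj
    ; Q            = Q
    ; w<Q          = w<Q
    ; x^Q          = x^Q
    ; sweep-inj    = Sweeps.sweep-injective S
    ; generates    = generates
    ; ℓ            = ℓ₀
    ; chiral       = chiral
    ; chiral-not   = chiral-not
    ; _≟_          = _≟_
    }

-- The rotation x

transpose-same : ∀ {N} (i k : Fin N) → PC.transpose i i k ≡ k
transpose-same i k = split (k Fin.≟ i)
  where
  split : Dec (k ≡ i) → PC.transpose i i k ≡ k
  split (yes refl) = transpose-left i i
  split (no k≢i)   = transpose-other k≢i k≢i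

-- `Even` asks for distinct entries, whereas `decompose` may list trivial transpositions.
strip : ∀ {N} → TranspositionList N → TranspositionList N
strip [] = []
strip ((i , j) ∷ ts) with i Fin.≟ j
... | yes _ = strip ts
... | no _  = (i , j) ∷ strip ts

strip-distinct : ∀ {N} (ts : TranspositionList N) → All (λ (i , j) → i ≢ j) (strip ts)
strip-distinct [] = []
strip-distinct ((i , j) ∷ ts) with i Fin.≟ j
... | yes _   = strip-distinct ts
... | no i≢j  = i≢j ∷ strip-distinct ts

eval-strip : ∀ {N} (ts : TranspositionList N) k → eval (strip ts) ⟨$⟩ʳ k ≡ eval ts ⟨$⟩ʳ k
eval-strip [] k = refl
eval-strip ((i , j) ∷ ts) k with i Fin.≟ j
... | yes refl = ≡.trans (eval-strip ts k) (≡.cong (eval ts ⟨$⟩ʳ_) (≡.sym (transpose-same i k)))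
... | no _     = eval-strip ts (PC.transpose i j k)

half-double : ∀ k p → ⌊ k + k + p /2⌋ ≡ k + ⌊ p /2⌋
half-double zero    p = refl
half-double (suc k) p = ≡.trans (≡.cong (λ z → ⌊ suc (z + p) /2⌋) (ℕ.+-suc k k)) (≡.cong suc (half-double k p))

parity-double : ∀ k p → parity (k + k + p) ≡ parity p
parity-double zero    p = refl
parity-double (suc k) p = ≡.trans (≡.cong (λ z → parity (suc (z + p))) (ℕ.+-suc k k)) (parity-double k p)

half-parity-injective : ∀ p q → ⌊ p /2⌋ ≡ ⌊ q /2⌋ → parity p ≡ parity q → p ≡ q
half-parity-injective 0 0 _ _ = refl
half-parity-injective 1 1 _ _ = refl
half-parity-injective 0 1 _ ()
half-parity-injective 1 0 _ ()
half-parity-injective (suc (suc p)) (suc (suc q)) h e = ≡.cong (2 +_) (half-parity-injective p q (ℕ.suc-injective h) e)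

half-< : ∀ k p → p < k + k → ⌊ p /2⌋ < k
half-< (suc k) 0             _ = s≤s z≤n
half-< (suc k) 1             _ = s≤s z≤n
half-< (suc k) (suc (suc p)) h = s≤s (half-< k p (ℕ.≤-pred (ℕ.≤-pred (≡.subst (suc (suc p) <_) (≡.cong suc (ℕ.+-suc k k)) h))))

module Rotation (L : ℕ) {{L≢0 : NonZero L}} where

  toℕ-mod : ∀ k → toℕ (k mod L) ≡ k % L
  toℕ-mod k = Fin.toℕ-fromℕ< (m%n<n k L)

  mod-cong : ∀ {j k} → j % L ≡ k % L → j mod L ≡ k mod L
  mod-cong {j} {k} e = Fin.toℕ-injective (≡.trans (toℕ-mod j) (≡.trans e (≡.sym (toℕ-mod k))))

  mod-toℕ : ∀ h → toℕ h mod L ≡ h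
  mod-toℕ h = Fin.toℕ-injective (≡.trans (toℕ-mod (toℕ h)) (m<n⇒m%n≡m (Fin.toℕ<n h)))

  +-mod : ∀ a k → (a + toℕ (k mod L)) mod L ≡ (a + k) mod L
  +-mod a k = mod-cong (begin
    (a + toℕ (k mod L)) % L        ≡⟨ ≡.cong (λ z → (a + z) % L) (toℕ-mod k) ⟩
    (a + k % L) % L                ≡⟨ %-distribˡ-+ a (k % L) L ⟩
    (a % L + k % L % L) % L        ≡⟨ ≡.cong (λ z → (a % L + z) % L) (m%n%n≡m%n k L) ⟩
    (a % L + k % L) % L            ≡⟨ %-distribˡ-+ a k L ⟨
    (a + k) % L                    ∎)
    where open ≡.≡-Reasoning

  L+-mod : ∀ k → (L + k) mod L ≡ k mod L
  L+-mod k = mod-cong (≡.trans (≡.cong (_% L) (ℕ.+-comm L k)) ([m+n]%n≡m%n k L))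

  next : Fin L → Fin L
  next h = (1 + toℕ h) mod L

  previous : Fin L → Fin L
  previous h = ((L ∸ 1) + toℕ h) mod L

  1+[L∸1] : 1 + (L ∸ 1) ≡ L
  1+[L∸1] = ℕ.m+[n∸m]≡n (>-nonZero⁻¹ L)

  full-turn : ∀ a b → a + b ≡ L → ∀ h → (a + toℕ ((b + toℕ h) mod L)) mod L ≡ h
  full-turn a b a+b h = ≡.trans (+-mod a (b + toℕ h)) (≡.trans (≡.cong (_mod L) (≡.trans (≡.sym (ℕ.+-assoc a b (toℕ h))) (≡.cong (_+ toℕ h) a+b)))
    (≡.trans (L+-mod (toℕ h)) (mod-toℕ h)))

  rotation : Permutation′ L
  rotation = permutation next previous
    (full-turn 1 (L ∸ 1) 1+[L∸1]) (full-turn (L ∸ 1) 1 (≡.trans (ℕ.+-comm (L ∸ 1) 1) 1+[L∸1]))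

  swaps : TranspositionList L
  swaps = strip (decompose rotation)

  eval-swaps : ∀ h → eval swaps ⟨$⟩ʳ h ≡ next h
  eval-swaps h = ≡.trans (eval-strip (decompose rotation) h) (eval-decompose rotation h)

  on-half : Fin 2 → TranspositionList L → TranspositionList (2 * L)
  on-half c = map (λ (i , j) → combine c i , combine c j)

  combine-injʳ : ∀ (c : Fin 2) {h h′ : Fin L} → combine c h ≡ combine c h′ → h ≡ h′
  combine-injʳ c {h} {h′} = Fin.combine-injectiveʳ c h c h′

  on-half-distinct : ∀ c {ts} → All (λ (i , j) → i ≢ j) ts → All (λ (i , j) → i ≢ j) (on-half c ts)
  on-half-distinct c = All.map⁺ ∘ All.map (λ i≢j e → i≢j (combine-injʳ c e))

  transpose-combine : ∀ (c : Fin 2) (i j h : Fin L) → PC.transpose (combine c i) (combine c j) (combine c h) ≡ combine c (PC.transpose i j h)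
  transpose-combine c i j h = split (h Fin.≟ i) (h Fin.≟ j)
    where
    split : Dec (h ≡ i) → Dec (h ≡ j) → PC.transpose (combine c i) (combine c j) (combine c h) ≡ combine c (PC.transpose i j h)
    split (yes refl) _        = ≡.trans (transpose-left (combine c i) (combine c j)) (≡.cong (combine c) (≡.sym (transpose-left i j)))
    split (no _) (yes refl)   = ≡.trans (transpose-right (combine c i) (combine c j)) (≡.cong (combine c) (≡.sym (transpose-right i j)))
    split (no h≢i) (no h≢j)   = ≡.trans (transpose-other (h≢i ∘ combine-injʳ c) (h≢j ∘ combine-injʳ c)) (≡.cong (combine c) (≡.sym (transpose-other h≢i h≢j)))

  on-half-same : ∀ c ts h → eval (on-half c ts) ⟨$⟩ʳ combine c h ≡ combine c (eval ts ⟨$⟩ʳ h)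
  on-half-same c [] h = refl
  on-half-same c ((i , j) ∷ ts) h = ≡.trans (≡.cong (eval (on-half c ts) ⟨$⟩ʳ_) (transpose-combine c i j h)) (on-half-same c ts (PC.transpose i j h))

  on-half-other : ∀ c d → d ≢ c → ∀ ts (h : Fin L) → eval (on-half c ts) ⟨$⟩ʳ combine d h ≡ combine d h
  on-half-other c d d≢c [] h = refl
  on-half-other c d d≢c ((i , j) ∷ ts) h = ≡.trans (≡.cong (eval (on-half c ts) ⟨$⟩ʳ_) (transpose-other (ne i) (ne j))) (on-half-other c d d≢c ts h)
    where
    ne : ∀ i → combine d h ≢ combine c i
    ne i e = d≢c (Fin.combine-injectiveˡ d h c i e)

  -- The same rotation is performed on two halves, so the number of transpositions is even whatever
  -- it is on one of them.
  both-halves : TranspositionList (2 * L)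
  both-halves = on-half 0F swaps ++ on-half 1F swaps

  both-halves-▸ : ∀ c h → eval both-halves ⟨$⟩ʳ combine c h ≡ combine c (next h)
  both-halves-▸ c h = ≡.trans (eval-++ (on-half 0F swaps) (on-half 1F swaps) (combine c h)) (by-half c)
    where
    by-half : ∀ (c : Fin 2) → eval (on-half 1F swaps) ⟨$⟩ʳ (eval (on-half 0F swaps) ⟨$⟩ʳ combine c h) ≡ combine c (next h)
    by-half 0F = ≡.trans (≡.cong (eval (on-half 1F swaps) ⟨$⟩ʳ_) (on-half-same 0F swaps h))
      (≡.trans (on-half-other 1F 0F (λ ()) swaps (eval swaps ⟨$⟩ʳ h)) (≡.cong (combine {2} 0F) (eval-swaps h)))
    by-half 1F = ≡.trans (≡.cong (eval (on-half 1F swaps) ⟨$⟩ʳ_) (on-half-other 0F 1F (λ ()) swaps h))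
      (≡.trans (on-half-same 1F swaps h) (≡.cong (combine {2} 1F) (eval-swaps h)))

  both-halves-even : 2 ∣ length both-halves
  both-halves-even = divides (length swaps) (≡.trans (length-++ (on-half 0F swaps))
    (≡.trans (≡.cong₂ _+_ (length-map _ swaps) (length-map _ swaps))
      (≡.trans (≡.cong (length swaps +_) (≡.sym (ℕ.+-identityʳ (length swaps)))) (ℕ.*-comm 2 (length swaps)))))

  turn : Group.Carrier (Alt (2 * L))
  turn = eval both-halves , both-halves , All.++⁺ (on-half-distinct 0F distinct) (on-half-distinct 1F distinct)
       , both-halves-even , λ _ → refl
    where
    distinct : All (λ (i , j) → i ≢ j) swaps
    distinct = strip-distinct (decompose rotation)

  base : Fin (2 * L)
  base = combine {2} 0F (0 mod L)

  open Wreath (2 * L) base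

  -- Position 2h + z of cycle c is the token with index h in half c and colour z; colours are thus
  -- parities of positions.
  pos : Fin 2 → ℕ → Token
  pos c p = combine c (⌊ p /2⌋ mod L) , parity p

  abstract
    -- A step from an even to an odd position changes only the colour; from odd to even `turn` also
    -- advances the index.
    x : Carrier
    x = (turn , idᴬ) , 1ℙ

    x-odd : proj₂ x ≡ 1ℙ
    x-odd = refl

    x-pos : ∀ c p → x ▸ pos c p ≡ pos c (suc p)
    x-pos c p = step (parity p) p refl
      where
      halves : ∀ q → parity q ≡ 0ℙ → ⌊ suc q /2⌋ ≡ ⌊ q /2⌋ × parity (suc q) ≡ 1ℙ
      halves 0 _ = refl , refl
      halves (suc (suc q)) e = let h , e′ = halves q e in ≡.cong suc h , e′
      halves′ : ∀ q → parity q ≡ 1ℙ → ⌊ suc q /2⌋ ≡ suc ⌊ q /2⌋ × parity (suc q) ≡ 0ℙ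
      halves′ 1 _ = refl , refl
      halves′ (suc (suc q)) e = let h , e′ = halves′ q e in ≡.cong suc h , e′
      step : ∀ z p → parity p ≡ z → x ▸ pos c p ≡ pos c (suc p)
      step 0ℙ p e = let h , e′ = halves p e in ≡.trans (≡.cong (λ z → x ▸ (combine c (⌊ p /2⌋ mod L) , z)) e)
        (≡.cong₂ _,_ (≡.cong (λ k → combine c (k mod L)) (≡.sym h)) (≡.sym e′))
      step 1ℙ p e = let h , e′ = halves′ p e in ≡.trans (≡.cong (λ z → x ▸ (combine c (⌊ p /2⌋ mod L) , z)) e)
        (≡.cong₂ _,_ (≡.trans (both-halves-▸ c _) (≡.cong (combine c) (≡.trans (+-mod 1 ⌊ p /2⌋) (≡.cong (_mod L) (≡.sym h))))) (≡.sym e′))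

  Q : ℕ
  Q = L + L

  pos-periodic : ∀ c p → pos c (Q + p) ≡ pos c p
  pos-periodic c p = ≡.cong₂ _,_ (≡.cong (combine c) (≡.trans (≡.cong (_mod L) (half-double L p)) (L+-mod ⌊ p /2⌋))) (parity-double L p)

  pos-inj : ∀ {c c′ p p′} → p < Q → p′ < Q → pos c p ≡ pos c′ p′ → c ≡ c′ × p ≡ p′
  pos-inj {c} {c′} {p} {p′} p<Q p′<Q e = Fin.combine-injectiveˡ c _ c′ _ (≡.cong proj₁ e)
    , half-parity-injective p p′ (≡.trans (≡.sym (unreduced p p<Q)) (≡.trans (≡.cong toℕ (Fin.combine-injectiveʳ c _ c′ _ (≡.cong proj₁ e))) (unreduced p′ p′<Q)))
        (≡.cong proj₂ e)
    where
    unreduced : ∀ p → p < Q → toℕ (⌊ p /2⌋ mod L) ≡ ⌊ p /2⌋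
    unreduced p p<Q = ≡.trans (toℕ-mod _) (m<n⇒m%n≡m (half-< L p p<Q))

  pos-sur : ∀ t → ∃ λ c → ∃ λ p → t ≡ pos c p
  pos-sur (i , col) = let c , h = remQuot {2} L i in c , toℕ h + toℕ h + odd col
    , ≡.cong₂ _,_ (≡.trans (≡.sym (Fin.combine-remQuot {2} L i)) (≡.cong (combine c) (≡.trans (≡.sym (mod-toℕ h)) (≡.cong (_mod L)
        (≡.sym (≡.trans (half-double (toℕ h) (odd col)) (≡.trans (≡.cong (toℕ h +_) (half-odd col)) (ℕ.+-identityʳ _))))))))
      (≡.sym (≡.trans (parity-double (toℕ h) (odd col)) (parity-odd col)))
    where
    odd : Parity → ℕ
    odd 0ℙ = 0
    odd 1ℙ = 1
    half-odd : ∀ z → ⌊ odd z /2⌋ ≡ 0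
    half-odd 0ℙ = refl
    half-odd 1ℙ = refl
    parity-odd : ∀ z → parity (odd z) ≡ z
    parity-odd 0ℙ = refl
    parity-odd 1ℙ = refl

-- b and x as elements of the wreath product

off-list : List (Name × Name) → Name → Bool
off-list qs s = inRange s ∧ every (every-pair (λ s′ → inRange s′ ∧ apart s s′)) qs

separate : List (Name × Name) → List (Name × Name) → Bool
separate ps qs = every (every-pair (off-list qs)) ps

-- Equal parities of k and of r give equal colours of r + k m whatever the parity of m.
classes : Name → Parity × Parity
classes (_ , k , r) = parity k , parity r

module Concrete (L : ℕ) {{L≢0 : NonZero L}} (m : ℕ) (5≤m : 5 ≤ m) (large : 25 * m + 3 ≤ L + L) where

  open Rotation L
  open Wreath (2 * L) base
  open Places m 5≤m Q large pos (λ {c} {c′} {p} {p′} → pos-inj {c} {c′} {p} {p′}) using (val; T-∧⁻; ⟦_⟧ⁿ; apart⇒≢)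

  class-colour : ∀ {s s′} → classes s ≡ classes s′ → proj₂ ⟦ s ⟧ⁿ ≡ proj₂ ⟦ s′ ⟧ⁿ
  class-colour {_ , k , r} {_ , k′ , r′} e = ≡.trans (colours k r) (≡.trans (≡.cong (λ (z , y) → y ℙ.+ (z ℙ.* parity m)) e) (≡.sym (colours k′ r′)))
    where
    colours : ∀ k r → parity (r + k * m) ≡ parity r ℙ.+ (parity k ℙ.* parity m)
    colours k r = ≡.trans (ℙ.+-homo-+ r (k * m)) (≡.cong (parity r ℙ.+_) (ℙ.*-homo-* k m))

  double-swap : ∀ (s t s′ t′ : Token) → proj₂ s ≡ proj₂ t → proj₂ s ≡ proj₂ s′ → proj₂ s ≡ proj₂ t′ →
    s ≢ t → s ≢ s′ → s ≢ t′ → t ≢ s′ → t ≢ t′ → s′ ≢ t′ →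
    ∃ λ u → (u ▸ s ≡ t × u ▸ t ≡ s) × (u ▸ s′ ≡ t′ × u ▸ t′ ≡ s′) × (∀ r → r ≢ s → r ≢ t → r ≢ s′ → r ≢ t′ → u ▸ r ≡ r)
  double-swap (i , c) (j , _) (k , _) (l , _) refl refl refl st ss′ st′ ts′ tt′ s′t′ =
    u , (by (≡.trans (≡.cong (PC.transpose k l) (transpose-left i j)) (transpose-other (ne ts′) (ne tt′)))
        , by (≡.trans (≡.cong (PC.transpose k l) (transpose-right i j)) (transpose-other (ne ss′) (ne st′))))
      , (by (≡.trans (≡.cong (PC.transpose k l) (transpose-other (ne ss′ ∘ ≡.sym) (ne ts′ ∘ ≡.sym))) (transpose-left k l))
        , by (≡.trans (≡.cong (PC.transpose k l) (transpose-other (ne st′ ∘ ≡.sym) (ne tt′ ∘ ≡.sym))) (transpose-right k l)))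
      , λ (r , d) rs rt rs′ rt′ → fixed r d rs rt rs′ rt′ (d ℙ.≟ c)
    where
    ne : ∀ {i j} → (i , c) ≢ (j , c) → i ≢ j
    ne n refl = n refl
    u : Carrier
    u = pair c i j k l (ne st) (ne s′t′)
    by : ∀ {r r′} → PC.transpose k l (PC.transpose i j r) ≡ r′ → u ▸ (r , c) ≡ (r′ , c)
    by {r} e = ≡.trans (pair-same c i j k l _ _ r) (≡.cong (_, c) e)
    fixed : ∀ r d → (r , d) ≢ (i , c) → (r , d) ≢ (j , c) → (r , d) ≢ (k , c) → (r , d) ≢ (l , c) → Dec (d ≡ c) → u ▸ (r , d) ≡ (r , d)
    fixed r d rs rt rs′ rt′ (yes refl) = by (≡.trans (≡.cong (PC.transpose k l) (transpose-other (ne rs) (ne rt))) (transpose-other (ne rs′) (ne rt′)))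
    fixed r d rs rt rs′ rt′ (no d≢c) = ≡.subst (λ d → u ▸ (r , d) ≡ (r , d)) (≡.sym (≢⇒≡⁻¹ d c d≢c)) (pair-other c i j k l _ _ r)

  Off : Token → List (Name × Name) → Set
  Off t = All (λ (p , q) → t ≢ ⟦ p ⟧ⁿ × t ≢ ⟦ q ⟧ⁿ)

  record Swaps (u : Carrier) (ps : List (Name × Name)) : Set where
    constructor mkSwaps
    field
      swapped : All (λ (p , q) → u ▸ ⟦ p ⟧ⁿ ≡ ⟦ q ⟧ⁿ × u ▸ ⟦ q ⟧ⁿ ≡ ⟦ p ⟧ⁿ) ps
      fixed   : ∀ t → Off t ps → u ▸ t ≡ t

  off-sound : ∀ s qs → T (off-list qs s) → Off ⟦ s ⟧ⁿ qs
  off-sound s qs h = All.map (λ { {p , q} h′ → ne p (proj₁ (T-∧⁻ {f p} h′)) , ne q (proj₂ (T-∧⁻ {f p} h′)) })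
    (every-sound (every-pair f) qs (proj₂ (T-∧⁻ {inRange s} h)))
    where
    f : Name → Bool
    f s′ = inRange s′ ∧ apart s s′
    ne : ∀ s′ → T (f s′) → ⟦ s ⟧ⁿ ≢ ⟦ s′ ⟧ⁿ
    ne s′ h′ = apart⇒≢ {s} {s′} (proj₂ (T-∧⁻ {inRange s′} h′)) (proj₁ (T-∧⁻ {inRange s} h)) (proj₁ (T-∧⁻ {inRange s′} h′))

  separate-sound : ∀ ps qs → T (separate ps qs) → All (λ (p , q) → Off ⟦ p ⟧ⁿ qs × Off ⟦ q ⟧ⁿ qs) ps
  separate-sound ps qs h = All.map (λ { {p , q} h′ → off-sound p qs (proj₁ (T-∧⁻ {off-list qs p} h′)) , off-sound q qs (proj₂ (T-∧⁻ {off-list qs p} h′)) })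
    (every-sound (every-pair (off-list qs)) ps h)

  swaps-∙ : ∀ {u v} ps qs → T (separate ps qs) → T (separate qs ps) → Swaps u ps → Swaps v qs → Swaps (u ∙ v) (ps ++ qs)
  swaps-∙ {u} {v} ps qs h h′ (mkSwaps us uf) (mkSwaps vs vf) = mkSwaps
    (All.++⁺ (All.zipWith (λ { {p , q} ((e , e′) , (o , o′)) → u-part p o e , u-part q o′ e′ }) (us , separate-sound ps qs h))
             (All.zipWith (λ { {p , q} ((e , e′) , (o , o′)) → v-part q o′ e , v-part p o e′ }) (vs , separate-sound qs ps h′)))
    λ t o → ≡.trans (▸-∙ u v t) (≡.trans (≡.cong (u ▸_) (vf t (All.++⁻ʳ ps o))) (uf t (All.++⁻ˡ ps o)))
    where
    u-part : ∀ p {r} → Off ⟦ p ⟧ⁿ qs → u ▸ ⟦ p ⟧ⁿ ≡ r → (u ∙ v) ▸ ⟦ p ⟧ⁿ ≡ r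
    u-part p o e = ≡.trans (▸-∙ u v _) (≡.trans (≡.cong (u ▸_) (vf _ o)) e)
    v-part : ∀ q {r} → Off ⟦ q ⟧ⁿ ps → v ▸ r ≡ ⟦ q ⟧ⁿ → (u ∙ v) ▸ r ≡ ⟦ q ⟧ⁿ
    v-part q o e = ≡.trans (▸-∙ u v _) (≡.trans (≡.cong (u ▸_) e) (uf _ o))

  -- `off-list` works with pairs; the repeated q′ only completes the last pair. The hypotheses on
  -- `classes` put all four tokens in one colour class, where the two swaps form an even
  -- permutation.
  two-swaps : ∀ p q p′ q′ → classes p ≡ classes q → classes p ≡ classes p′ → classes p ≡ classes q′ →
    T (off-list ((q , p′) ∷ (q′ , q′) ∷ []) p) → T (off-list ((p′ , q′) ∷ []) q) → T (off-list ((q′ , q′) ∷ []) p′) →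
    ∃ λ u → Swaps u ((p , q) ∷ (p′ , q′) ∷ [])
  two-swaps p q p′ q′ e e′ e″ h h′ h″ = assemble (off-sound p _ h) (off-sound q _ h′) (off-sound p′ _ h″)
    where
    assemble : Off ⟦ p ⟧ⁿ ((q , p′) ∷ (q′ , q′) ∷ []) → Off ⟦ q ⟧ⁿ ((p′ , q′) ∷ []) → Off ⟦ p′ ⟧ⁿ ((q′ , q′) ∷ []) →
               ∃ λ u → Swaps u ((p , q) ∷ (p′ , q′) ∷ [])
    assemble ((pq , pp′) ∷ (pq′ , _) ∷ []) ((qp′ , qq′) ∷ []) ((p′q′ , _) ∷ []) =
      let u , s , s′ , f = double-swap ⟦ p ⟧ⁿ ⟦ q ⟧ⁿ ⟦ p′ ⟧ⁿ ⟦ q′ ⟧ⁿ (class-colour {p} {q} e) (class-colour {p} {p′} e′) (class-colour {p} {q′} e″)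
                             pq pp′ pq′ qp′ qq′ p′q′
      in u , mkSwaps (s ∷ s′ ∷ []) λ { t ((tp , tq) ∷ (tp′ , tq′) ∷ []) → f t tp tq tp′ tq′ }

  ps₁ ps₂ ps₃ ps₄ : List (Name × Name)
  ps₁ = ((1F , 0 , 0) , (0F , 0 , 0)) ∷ ((1F , 2 , 0) , (1F , 4 , 0)) ∷ []
  ps₂ = ((1F , 1 , 0) , (1F , 3 , 0)) ∷ ((1F , 5 , 0) , (0F , 1 , 0)) ∷ []
  ps₃ = ((1F , 8 , 1) , (1F , 16 , 3)) ∷ ((1F , 10 , 1) , (1F , 12 , 1)) ∷ []
  ps₄ = ((1F , 9 , 1) , (1F , 11 , 1)) ∷ ((1F , 13 , 1) , (1F , 17 , 3)) ∷ []

  abstract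
    -- Swaps in the table are paired up by colour, so that each factor is even on each colour class.
    b-swaps : ∃ λ u → Swaps u (ps₁ ++ ps₂ ++ ps₃ ++ ps₄)
    b-swaps =
      let u₁ , s₁ = two-swaps (1F , 0 , 0) (0F , 0 , 0) (1F , 2 , 0) (1F , 4 , 0) refl refl refl tt tt tt
          u₂ , s₂ = two-swaps (1F , 1 , 0) (1F , 3 , 0) (1F , 5 , 0) (0F , 1 , 0) refl refl refl tt tt tt
          u₃ , s₃ = two-swaps (1F , 8 , 1) (1F , 16 , 3) (1F , 10 , 1) (1F , 12 , 1) refl refl refl tt tt tt
          u₄ , s₄ = two-swaps (1F , 9 , 1) (1F , 11 , 1) (1F , 13 , 1) (1F , 17 , 3) refl refl refl tt tt tt
      in u₁ ∙ (u₂ ∙ (u₃ ∙ u₄)) , swaps-∙ ps₁ (ps₂ ++ ps₃ ++ ps₄) tt tt s₁ (swaps-∙ ps₂ (ps₃ ++ ps₄) tt tt s₂ (swaps-∙ ps₃ ps₄ tt tt s₃ s₄))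

  b : Carrier
  b = proj₁ b-swaps

  reorder : ∀ {P : Name × Name → Set} → All P (ps₁ ++ ps₂ ++ ps₃ ++ ps₄) → All P table
  reorder (p₁ ∷ p₃ ∷ p₂ ∷ p₄ ∷ p₅ ∷ p₇ ∷ p₆ ∷ p₈ ∷ []) = p₁ ∷ p₂ ∷ p₃ ∷ p₄ ∷ p₅ ∷ p₆ ∷ p₇ ∷ p₈ ∷ []

  reorder⁻¹ : ∀ {P : Name × Name → Set} → All P table → All P (ps₁ ++ ps₂ ++ ps₃ ++ ps₄)
  reorder⁻¹ (p₁ ∷ p₂ ∷ p₃ ∷ p₄ ∷ p₅ ∷ p₆ ∷ p₇ ∷ p₈ ∷ []) = p₁ ∷ p₃ ∷ p₂ ∷ p₄ ∷ p₅ ∷ p₇ ∷ p₆ ∷ p₈ ∷ []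

  system : TokenSystem X
  system = record
    { _≟ᵀ_         = _≟ᵀ_
    ; _▸_          = _▸_
    ; ▸-cong       = λ {u} {v} → ▸-cong {u} {v}
    ; ▸-∙          = ▸-∙
    ; ▸-ε          = ▸-ε
    ; faithful     = faithful
    ; m            = m
    ; 5≤m          = 5≤m
    ; Q            = Q
    ; Q-large      = large
    ; pos          = pos
    ; pos-inj      = λ {c} {c′} {p} {p′} → pos-inj {c} {c′} {p} {p′}
    ; pos-periodic = pos-periodic
    ; pos-sur      = pos-sur
    ; b            = b
    ; x            = x
    ; x-pos        = x-pos
    ; b-table      = reorder (Swaps.swapped (proj₂ b-swaps))
    ; b-fix        = λ t o → Swaps.fixed (proj₂ b-swaps) t (reorder⁻¹ o)
    }

  module G = Generation system proj₂ colour-▸ (λ _ _ → refl)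
  open Shifts X b x

  open Contains Generated (λ {u} {v} → gen-≈ {u} {v}) gen-ε (λ {u} {v} → G.gen-∙ {u} {v}) (λ {u} → G.gen-⁻¹ {u}) using (contains-Alt²; contains-all; Has₃)

  three-generated : ∀ col {i j k} → i ≢ j → j ≢ k → k ≢ i → Has₃ (i , col) (j , col) (k , col)
  three-generated col {i} {j} {k} i≢j j≢k k≢i = G.has₃ {i , col} {j , col} {k , col} (i≢j ∘ ≡.cong proj₁) (j≢k ∘ ≡.cong proj₁) (k≢i ∘ ≡.cong proj₁) refl refl

  even-generated : ∀ u → proj₂ u ≡ 0ℙ → Generated u
  even-generated = contains-Alt² three-generated

  generates : ∀ u → Generated u
  generates = contains-all x x-odd (λ {u} → gen-x {u}) even-generated

  config : Config X
  config = Configuration.config system _≟_ generates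

-- The graph of the theorem

coset-graph : ∀ {X : Grp} (C : Config X) (let open Group X) (par : Carrier → Parity) →
  ((P : Carrier → Set) → (∀ {u v} → u ≈ v → P u → P v) →
    (∀ {u v} → P u → P v → P (u ∙ v)) → (∀ {u} → P u → P (u ⁻¹)) → (∀ g {u} → P u → P (g ∙ u ∙ g ⁻¹)) →
    ∀ {u} → P u → ¬ u ≈ ε → ∀ g h → par g ≡ par h → P (h ∙ g ⁻¹)) →
  ∀ {F} (code : Carrier → Fin F) → (∀ {u v} → code u ≡ code v → u ≈ v) →
  ∃ λ (Γ : Graph) → Finite Γ × Connected Γ × Tetravalent Γ × HalfArcTransitive Γ × Basic Γ ×
    Aut Γ ≅ X × (∀ v → ⟦ Stabilizer Γ v ⟧ ≅ (D₈ ^ᴳ 2 ×ᴳ ℤ₂ ^ᴳ (Config.m C ∸ 4)) ^ᴳ 2)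
coset-graph C par simple code code-inj = Γ , finite code code-inj , connected , tetravalent , half-arc-transitive
  , basic par simple , Aut≅X , stabilizer {H} θ (λ {f} {g} → θ-cong {f} {g}) θ-∙ (λ {f} {g} → θ-inj {f} {g}) θ-K K-image
  where
  open GraphProps C using (Γ; finite; connected; tetravalent; half-arc-transitive; basic; Aut≅X; stabilizer)
  open StabGroup C using (H; θ; θ-cong; θ-∙; θ-inj; θ-K; K-image)

module Assembly (L : ℕ) {{L≢0 : NonZero L}} (m : ℕ) (5≤m : 5 ≤ m) (large : 25 * m + 3 ≤ L + L) where

  open Rotation L using (base)
  open Wreath (2 * L) base using (X; Carrier; _≈_; _∙_; ε; _⁻¹; code; code-inj; normal-subgroups)
  open Concrete L m 5≤m large using (config)

  8≤2L : 8 ≤ 2 * L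
  8≤2L = ℕ.≤-trans (ℕ.≤-trans (ℕ.≤-trans (ℕ.m≤m+n 8 120) (ℕ.+-monoˡ-≤ 3 (ℕ.*-monoʳ-≤ 25 5≤m))) large)
    (ℕ.≤-reflexive (≡.cong (L +_) (≡.sym (ℕ.+-identityʳ L))))

  simple : (P : Carrier → Set) → (∀ {u v} → u ≈ v → P u → P v) →
    (∀ {u v} → P u → P v → P (u ∙ v)) → (∀ {u} → P u → P (u ⁻¹)) → (∀ g {u} → P u → P (g ∙ u ∙ g ⁻¹)) →
    ∀ {u} → P u → ¬ u ≈ ε → ∀ g h → proj₂ g ≡ proj₂ h → P (h ∙ g ⁻¹)
  simple P P-resp P-∙ P-⁻¹ P-conj {u} Pu u≉ε g h e =
    normal-subgroups 8≤2L P (λ {u} {v} → P-resp {u} {v}) (λ {u} {v} → P-∙ {u} {v}) (λ {u} → P-⁻¹ {u}) (λ g {u} → P-conj g {u}) {u} Pu u≉ε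
      (h ∙ g ⁻¹) (≡.trans (≡.cong (proj₂ h ℙ.+_) e) (ℙ.p+p≡0ℙ (proj₂ h)))

  Γ-exists : ∃ λ (Γ : Graph) → Finite Γ × Connected Γ × Tetravalent Γ × HalfArcTransitive Γ × Basic Γ ×
    Aut Γ ≅ (Alt (2 * L)) ≀ℤ₂ × (∀ v → ⟦ Stabilizer Γ v ⟧ ≅ (D₈ ^ᴳ 2 ×ᴳ ℤ₂ ^ᴳ (m ∸ 4)) ^ᴳ 2)
  Γ-exists = coset-graph config proj₂ simple code (λ {u} {v} → code-inj {u} {v})

large-power : ∀ k → 25 * (5 + k) + 3 ≤ 2 ^ (6 + k) + 2 ^ (6 + k)
-- An equality: 25 · 5 + 3 = 128 = 2⁷.
large-power zero    = ℕ.≤-refl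
large-power (suc k) = begin
  25 * (6 + k) + 3                                  ≡⟨ ≡.cong (_+ 3) (ℕ.*-distribˡ-+ 25 1 (5 + k)) ⟩
  25 + 25 * (5 + k) + 3                             ≤⟨ ℕ.+-monoˡ-≤ 3 (ℕ.+-monoˡ-≤ (25 * (5 + k)) (ℕ.m≤m*n 25 (5 + k))) ⟩
  25 * (5 + k) + 25 * (5 + k) + 3                   ≡⟨ ℕ.+-assoc (25 * (5 + k)) (25 * (5 + k)) 3 ⟩
  25 * (5 + k) + (25 * (5 + k) + 3)                 ≤⟨ ℕ.+-mono-≤ (ℕ.≤-trans (ℕ.m≤m+n (25 * (5 + k)) 3) (large-power k)) (large-power k) ⟩
  2 ^ (6 + k) + 2 ^ (6 + k) + (2 ^ (6 + k) + 2 ^ (6 + k)) ≡⟨ ≡.cong₂ _+_ double double ⟩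
  2 ^ (7 + k) + 2 ^ (7 + k)                         ∎
  where
  open ℕ.≤-Reasoning
  double : 2 ^ (6 + k) + 2 ^ (6 + k) ≡ 2 ^ (7 + k)
  double = ≡.cong (2 ^ (6 + k) +_) (≡.sym (ℕ.+-identityʳ (2 ^ (6 + k))))

theorem1p3 : ∀ (n : ℕ) → n ≥ 7 → ∃ λ (Γ : Graph) →
    Finite Γ × Connected Γ × Tetravalent Γ × HalfArcTransitive Γ × Basic Γ ×
    Aut Γ ≅ (Alt (2 ^ n)) ≀ℤ₂ ×
    (∀ v → ⟦ Stabilizer Γ v ⟧ ≅ (D₈ ^ᴳ 2 ×ᴳ ℤ₂ ^ᴳ (n ∸ 6)) ^ᴳ 2)
theorem1p3 n 7≤n with k , refl ← ℕ.m≤n⇒∃[o]m+o≡n 7≤n =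
  -- With n = 7 + k this is L = 2ⁿ⁻¹, so that 2L is 2ⁿ by computation, and m = n - 2, so that m ∸ 4
  -- is n ∸ 6.
  Assembly.Γ-exists (2 ^ (6 + k)) {{ℕ.m^n≢0 2 (6 + k)}} (5 + k) (ℕ.m≤m+n 5 k) (large-power k)
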